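{- The $\mathbf c\mathbf d$-index of a near-Gorenstein* poset has non-negative integer coefficients.
   Context: Conventions: all posets are finite and graded, have a minimum $\hat0$ of rank $0$, and need not have a maximum; in a poset of rank $n$ all maximal elements have rank $n$. $\rho$ is rank, $\rho(x,y)=\rho(y)-\rho(x)$, and $\hat1$ is a formally adjoined maximum of rank $n+1$. Order complex: $\mathcal O(\Pi)$ is the simplicial complex whose faces are the chains in $\Pi\setminus\{\hat0\}$. A simplicial complex $\Delta$ of dimension $n-1$ is Gorenstein if for every face $x$ (including the empty face, of dimension $-1$, with link $\Delta$) $\tilde H_i(\mathrm{Link}_\Delta(x);\mathbb R)$ is $\mathbb R$ for $i=n-2-\dim x$ and $0$ otherwise. A pair $(\Delta,\partial\Delta)$ with $\partial\Delta$ a subcomplex of dimension $n-2$ is near-Gorenstein if $\partial\Delta$ is Gorenstein of dimension $n-2$ and for every face $x$ of $\Delta$ (including the empty face) $\tilde H_i(\mathrm{Link}_\Delta(x);\mathbb R)$ is $\mathbb R$ if $i=n-2-\dim x$ and $x\notin\partial\Delta$, and $0$ otherwise. A poset is Gorenstein* if its order complex is Gorenstein. A pair $(P,\partial P)$, $P$ of rank $n$, $\partial P\subset P$ a down-closed subposet of rank $n-1$, is near-Gorenstein* if $(\mathcal O(P),\mathcal O(\partial P))$ is near-Gorenstein. $\mathbf{a}\mathbf{b}$-index: for a chain $x=\{\hat0=\sigma_0<\cdots<\sigma_k\}$ in a poset $P$ of rank $m$, $\mathrm{wt}(x)=(\mathbf a-\mathbf b)^{\rho(\sigma_0,\sigma_1)-1}\mathbf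 b\cdots\mathbf b(\mathbf a-\mathbf b)^{\rho(\sigma_k,\hat1)-1}$ (noncommuting variables, $\rho(\hat1)=m+1$) and $\Psi_P=\sum_x\mathrm{wt}(x)$. For Gorenstein* $P$ it is a polynomial in $\mathbf c=\mathbf a+\mathbf b$, $\mathbf d=\mathbf a\mathbf b+\mathbf b\mathbf a$. For a near-Gorenstein* $(P,\partial P)$ of rank $n$, $\Psi_P(\mathbf a,\mathbf b)=\Phi_P(\mathbf a,\mathbf b)+\Psi_{\partial P}(\mathbf a,\mathbf b)\,\mathbf a$ where $\Phi_P$ is homogeneous of degree $n$ and can be written in $\mathbf c,\mathbf d$; the $\mathbf c\mathbf d$-index of $P$ is defined as $\Psi_P(\mathbf c,\mathbf d):=\Phi_P(\mathbf c,\mathbf d)+\Psi_{\partial P}(\mathbf c,\mathbf d)$. -}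

module Defs where

open import Data.Bool using (Bool; true; false; _∧_; _∨_; not; if_then_else_)
open import Data.Nat using (ℕ; zero; suc; _∸_; _≡ᵇ_; _<ᵇ_) renaming (_+_ to _+ℕ_)
open import Data.Fin using (Fin; zero; suc; toℕ; punchIn)
open import Data.Vec using (Vec; []; _∷_; lookup; zipWith)
open import Data.List using (List; []; _∷_; _++_; map; filterᵇ; length; concatMap; foldr)
import Data.List as L
open import Data.Integer using (ℤ; 0ℤ; 1ℤ; -1ℤ; -_; +_) renaming (_+_ to _+ℤ_; _*_ to _*ℤ_)
open import Data.Product using (Σ; _×_; _,_)
open import Relation.Binary.PropositionalEquality using (_≡_; _≢_)
open import Relation.Nullary.Decidable using (⌊_⌋)

sumFin : ∀ {n} → (Fin n → ℤ) → ℤ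
sumFin {zero}  f = 0ℤ
sumFin {suc n} f = f zero +ℤ sumFin (λ i → f (suc i))

allFin : ∀ {n} → (Fin n → Bool) → Bool
allFin {zero}  p = true
allFin {suc n} p = p zero ∧ allFin (λ i → p (suc i))

anyFin : ∀ {n} → (Fin n → Bool) → Bool
anyFin {zero}  p = false
anyFin {suc n} p = p zero ∨ anyFin (λ i → p (suc i))

countFin : ∀ {n} → (Fin n → Bool) → ℕ
countFin {zero}  p = zero
countFin {suc n} p = (if p zero then 1 else 0) +ℕ countFin (λ i → p (suc i))

sgn : ℕ → ℤ
sgn zero    = 1ℤ
sgn (suc k) = - sgn k

boolℤ : Bool → ℤ
boolℤ true  = 1ℤ
boolℤ false = 0ℤ

VSet : ℕ → Set
VSet N = Vec Bool N

allSubsets : ∀ N → List (VSet N)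
allSubsets zero    = [] ∷ []
allSubsets (suc N) = map (true ∷_) (allSubsets N) ++ map (false ∷_) (allSubsets N)

card : ∀ {N} → VSet N → ℕ
card S = countFin (λ u → lookup S u)

_∪ˢ_ : ∀ {N} → VSet N → VSet N → VSet N
_∪ˢ_ = zipWith _∨_

disjoint : ∀ {N} → VSet N → VSet N → Bool
disjoint x y = allFin (λ u → not (lookup x u ∧ lookup y u))

subsetᵇ : ∀ {N} → VSet N → VSet N → Bool
subsetᵇ x y = allFin (λ u → not (lookup x u) ∨ lookup y u)

-- Abstract simplicial complexes on vertex set Fin N, given by a
-- (decidable) face predicate. The empty set is the face of dim -1.

Complex : ℕ → Set
Complex N = VSet N → Bool

Link : ∀ {N} → Complex N → VSet N → Complex N
Link K x y = disjoint x y ∧ K (x ∪ˢ y)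

-- faces with exactly s vertices (i.e. of dimension s - 1)
facesOfSize : ∀ {N} → Complex N → ℕ → List (VSet N)
facesOfSize {N} K s = filterᵇ (λ S → K S ∧ (card S ≡ᵇ s)) (allSubsets N)

-- Integer matrices, determinants, rank (= determinantal rank, which over
-- ℤ ⊂ ℚ equals the rank over ℚ, hence over ℝ).

Matrix : ℕ → ℕ → Set
Matrix m k = Fin m → Fin k → ℤ

det : ∀ r → Matrix r r → ℤ
det zero    M = 1ℤ
det (suc r) M =
  sumFin (λ j → sgn (toℕ j) *ℤ (M zero j *ℤ det r (λ i k → M (suc i) (punchIn j k))))

RankIs : ∀ {m k} → Matrix m k → ℕ → Set
RankIs {m} {k} M r =
  (Σ (Fin r → Fin m) λ f → Σ (Fin r → Fin k) λ g → det r (λ i j → M (f i) (g j)) ≢ 0ℤ)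
  × ((f : Fin (suc r) → Fin m) (g : Fin (suc r) → Fin k) → det (suc r) (λ i j → M (f i) (g j)) ≡ 0ℤ)

-- Simplicial (augmented) boundary maps, vertices oriented by the order
-- of Fin N.

-- coefficient of τ in ∂σ (|σ| = |τ| + 1)
incidence : ∀ {N} → VSet N → VSet N → ℤ
incidence τ σ =
  boolℤ (subsetᵇ τ σ) *ℤ
  sumFin (λ u → boolℤ (lookup σ u ∧ not (lookup τ u))
                *ℤ sgn (countFin (λ w → lookup σ w ∧ (toℕ w <ᵇ toℕ u))))

bdMat : ∀ {N} (K : Complex N) (s : ℕ) →
        Matrix (length (facesOfSize K s)) (length (facesOfSize K (suc s)))
bdMat K s i j = incidence (L.lookup (facesOfSize K s) i) (L.lookup (facesOfSize K (suc s)) j)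

-- rank of the boundary map out of faces of size s (zero map when s = 0)
RankOut : ∀ {N} → Complex N → ℕ → ℕ → Set
RankOut K zero    r = r ≡ 0
RankOut K (suc s) r = RankIs (bdMat K s) r

-- dim of reduced homology H̃_{s-1}(K; ℝ) equals b
-- (degree s - 1, so s = 0 is degree -1)
BettiIs : ∀ {N} → Complex N → ℕ → ℕ → Set
BettiIs K s b =
  Σ ℕ λ r₁ → Σ ℕ λ r₂ →
    RankOut K s r₁ × RankIs (bdMat K s) r₂ × (b +ℕ r₁ +ℕ r₂ ≡ length (facesOfSize K s))

-- Gorenstein complex of dimension d - 1: for every face x (incl. ∅),
-- H̃_i(Link x) = ℝ for i = d - 2 - dim x, i.e. i+1 = d - |x|, and 0 otherwise
IsGorenstein : ∀ {N} → Complex N → ℕ → Set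
IsGorenstein {N} K d =
  (x : VSet N) → K x ≡ true → (s : ℕ) →
    BettiIs (Link K x) s (if s ≡ᵇ (d ∸ card x) then 1 else 0)

-- near-Gorenstein pair (Δ, ∂Δ) with dim Δ = d - 1
IsNearGorenstein : ∀ {N} → Complex N → Complex N → ℕ → Set
IsNearGorenstein {N} K B d =
  IsGorenstein B (d ∸ 1) ×
  ((x : VSet N) → K x ≡ true → (s : ℕ) →
    BettiIs (Link K x) s (if (s ≡ᵇ (d ∸ card x)) ∧ not (B x) then 1 else 0))

record PosetData (N : ℕ) : Set where
  field
    _≤ᵇ_ : Fin N → Fin N → Bool
    ρ    : Fin N → ℕ
    𝟎    : Fin N

module _ {N : ℕ} (P : PosetData N) where
  open PosetData P

  _<ᵇ'_ : Fin N → Fin N → Bool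
  x <ᵇ' y = (x ≤ᵇ y) ∧ not ⌊ x Data.Fin.≟ y ⌋

  Covers : Fin N → Fin N → Set
  Covers x y = (x <ᵇ' y ≡ true) × ((z : Fin N) → (x <ᵇ' z) ∧ (z <ᵇ' y) ≡ false)

  IsGradedPoset : ℕ → Set
  IsGradedPoset n =
    ((x : Fin N) → x ≤ᵇ x ≡ true) ×
    ((x y : Fin N) → x ≤ᵇ y ≡ true → y ≤ᵇ x ≡ true → x ≡ y) ×
    ((x y z : Fin N) → x ≤ᵇ y ≡ true → y ≤ᵇ z ≡ true → x ≤ᵇ z ≡ true) ×
    ((x : Fin N) → 𝟎 ≤ᵇ x ≡ true) ×
    (ρ 𝟎 ≡ 0) ×
    ((x y : Fin N) → Covers x y → ρ y ≡ suc (ρ x)) ×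
    ((x : Fin N) → ((y : Fin N) → x ≤ᵇ y ≡ true → y ≡ x) → ρ x ≡ n)

  IsDownClosedOfRank : (Fin N → Bool) → ℕ → Set
  IsDownClosedOfRank B n =
    (B 𝟎 ≡ true) ×
    ((x y : Fin N) → x ≤ᵇ y ≡ true → B y ≡ true → B x ≡ true) ×
    ((x : Fin N) → B x ≡ true →
       ((y : Fin N) → B y ≡ true → x ≤ᵇ y ≡ true → y ≡ x) → ρ x ≡ n)

  OrderComplex : (Fin N → Bool) → Complex N
  OrderComplex B S =
    not (lookup S 𝟎) ∧
    allFin (λ u → not (lookup S u) ∨ B u) ∧
    allFin (λ u → allFin (λ v → not (lookup S u ∧ lookup S v) ∨ ((u ≤ᵇ v) ∨ (v ≤ᵇ u))))

  fullSet : Fin N → Bool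
  fullSet _ = true

data AB : Set where
  𝐚 𝐛 : AB

data CD : Set where
  𝐜 𝐝 : CD

eqAB : AB → AB → Bool
eqAB 𝐚 𝐚 = true
eqAB 𝐛 𝐛 = true
eqAB _ _ = false

eqCD : CD → CD → Bool
eqCD 𝐜 𝐜 = true
eqCD 𝐝 𝐝 = true
eqCD _ _ = false

eqWord : ∀ {A : Set} → (A → A → Bool) → List A → List A → Bool
eqWord e []       []       = true
eqWord e (x ∷ xs) (y ∷ ys) = e x y ∧ eqWord e xs ys
eqWord e _        _        = false

NCPoly : Set → Set
NCPoly A = List (ℤ × List A)

coeffOf : ∀ {A : Set} → (A → A → Bool) → NCPoly A → List A → ℤ
coeffOf e p w = foldr (λ { (c , v) acc → (if eqWord e v w then c else 0ℤ) +ℤ acc }) 0ℤ p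

ABPoly CDPoly : Set
ABPoly = NCPoly AB
CDPoly = NCPoly CD

coeffAB : ABPoly → List AB → ℤ
coeffAB = coeffOf eqAB

coeffCD : CDPoly → List CD → ℤ
coeffCD = coeffOf eqCD

_≈ₚ_ : ABPoly → ABPoly → Set
p ≈ₚ q = (w : List AB) → coeffAB p w ≡ coeffAB q w

_⊕_ : ABPoly → ABPoly → ABPoly
_⊕_ = _++_

⊖_ : ABPoly → ABPoly
⊖ p = map (λ { (c , w) → (- c , w) }) p

_⊗_ : ABPoly → ABPoly → ABPoly
p ⊗ q = concatMap (λ { (c , v) → map (λ { (c' , w) → (c *ℤ c' , v ++ w) }) q }) p

onePoly : ABPoly
onePoly = (1ℤ , []) ∷ []

aPoly bPoly : ABPoly
aPoly = (1ℤ , 𝐚 ∷ []) ∷ []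
bPoly = (1ℤ , 𝐛 ∷ []) ∷ []

a-b : ABPoly
a-b = aPoly ⊕ (⊖ bPoly)

cPoly dPoly : ABPoly
cPoly = aPoly ⊕ bPoly
dPoly = (aPoly ⊗ bPoly) ⊕ (bPoly ⊗ aPoly)

expandCD : CDPoly → ABPoly
expandCD f = concatMap (λ { (k , w) → ((k , []) ∷ []) ⊗ foldr (λ x acc → letter x ⊗ acc) onePoly w }) f
  where
    letter : CD → ABPoly
    letter 𝐜 = cPoly
    letter 𝐝 = dPoly

prodPos : ℕ → (ℕ → ABPoly) → ABPoly
prodPos m g = go 1 m
  where
    go : ℕ → ℕ → ABPoly
    go i zero    = onePoly
    go i (suc k) = g i ⊗ go (suc i) k

module _ {N : ℕ} (P : PosetData N) where
  open PosetData P

  -- weight of the chain 𝟎 < σ₁ < ⋯ < σₖ (S = {σ₁,…,σₖ}) in a poset of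
  -- rank m: (a-b)^{ρ(σ₀,σ₁)-1} b ⋯ b (a-b)^{ρ(σₖ,1̂)-1}, i.e. the product
  -- over positions i = 1..m of b if i = ρ(σⱼ) for some j, else (a-b)
  wt : ℕ → VSet N → ABPoly
  wt m S = prodPos m (λ i → if anyFin (λ u → lookup S u ∧ (ρ u ≡ᵇ i)) then bPoly else a-b)

  abIndex : (Fin N → Bool) → ℕ → ABPoly
  abIndex B m = concatMap (wt m) (filterᵇ (OrderComplex P B) (allSubsets N))

{-# OPTIONS --safe #-}
module Submission where

-- Since the open intervals of P are homology spheres, the covers of P carry incidence numbers ε that turn P into a
-- cell complex, so a sheaf of vector spaces on P has a cellular cochain complex above every x ∈ P. Call a sheaf F
-- Cohen–Macaulay up to rank k if all these complexes are exact in ranks < k; the constant sheaves on ∂P (k = m) and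
-- on P ∖ ∂P (k = m + 1) are. For i < k the cycles of rank i above x form a sheaf Z, a generic choice of forms
-- Σ ε t RᵗR embeds F into Z, and E = Z / F is Cohen–Macaulay up to rank i − 1. Its dimension is D_i f = ω_i f − f,
-- where f = dim F and ω_i f (x) = Σ_{y ≥ x, ρ(y) ≤ i} (−1)^{i−ρ(y)} f(y).
-- On the other hand, counting flags weighted by the value of f at their largest element gives a cd-polynomial with
-- cd_{k+2}(f) = cd_{k+1}(f) c + cd_k(D_{k+1} f) d, because ω_i is an involution by the Euler relation for intervals.
-- So the coefficients of cd_k(f) are dimensions of stalks of iterated derived sheaves at 0̂. The two summands of the
-- cd-index are obtained from f = 1 on P ∖ ∂P, where D_{m+1} f = 1 on ∂P, and from f = 1 on ∂P, where D_m f = 0.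

open import Defs
open import Algebra.Bundles using (CommutativeRing)
import Algebra.Properties.Group
import Algebra.Solver.Ring
import Algebra.Solver.Ring.AlmostCommutativeRing as ACR
open import Algebra.Structures using (IsCommutativeRing)
open import Data.Bool using (Bool; true; false; _∧_; _∨_; not; if_then_else_)
import Data.Bool.Properties as Boolₚ
open import Data.Empty using (⊥; ⊥-elim)
open import Data.Fin using (Fin; zero; suc; toℕ; punchIn; punchOut; inject₁)
open import Data.Fin.Induction using (spo-wellFounded; spo-noetherian)
import Data.Fin.Properties as Finₚ
open import Data.Integer using (ℤ; 0ℤ; 1ℤ; -1ℤ) renaming (_≤_ to _≤ℤ_)
import Data.Integer as ℤ
import Data.Integer.Properties as ℤₚ
open import Data.List using (List; []; _∷_; _++_; map; concatMap; filterᵇ; foldr; length; reverse)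
import Data.List as L
open import Data.List.Membership.Propositional using (_∈_)
open import Data.List.Membership.Propositional.Properties using (∈-++⁺ˡ; ∈-++⁺ʳ; ∈-map⁺)
import Data.List.Properties as Listₚ
open import Data.List.Relation.Unary.All using (All; []; _∷_)
import Data.List.Relation.Unary.All.Properties as Allₚ
import Data.List.Relation.Unary.Any as Any
open import Data.Maybe using (Maybe; just; nothing)
open import Data.Nat using (ℕ; zero; suc; _≡ᵇ_; _<ᵇ_; _∸_; _<_; _≤_; z≤n; s≤s; _≤?_)
import Data.Nat as ℕ
import Data.Nat.Coprimality as Coprime
import Data.Nat.Properties as ℕₚ
open import Data.Product using (Σ; _×_; _,_; proj₁; proj₂)
import Data.Rational as ℚ
import Data.Rational.Properties as ℚₚ
import Data.Rational.Unnormalised as ℚᵘ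
import Data.Rational.Unnormalised.Properties as ℚᵘₚ
open import Data.Sum using (_⊎_; inj₁; inj₂; swap)
open import Data.Vec using ([]; _∷_; lookup; replicate; _[_]≔_)
import Data.Vec.Properties as Vecₚ
open import Function using (flip)
open import Induction.WellFounded using (Acc; acc; WellFounded)
open import Level using (0ℓ)
open import Relation.Binary.Definitions using (DecidableEquality; tri<; tri≈; tri>)
open import Relation.Binary.PropositionalEquality hiding ([_])
open import Relation.Binary.Structures using (IsStrictPartialOrder)
open import Relation.Nullary using (¬_; Dec; yes; no; does)
open import Relation.Nullary.Decidable using (⌊_⌋; _×-dec_; ¬?; dec-true; dec-false)

-- Finite sums in commutative rings

-- The obstacle is to embed F into Z naturally. Cycles take values in the dual stalks, so each y
-- needs a form Q_y on its stalk. With Q_y = Σ ε(y,z) t_z RᵗR over the covers z of y, the family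
-- (Q_y R s) over the y of rank i above x is a cycle for every t, by functoriality and Σ ε ε = 0.
-- But the signs of ε make Q_y indefinite, so it may degenerate, and one family t has to serve all
-- y. Each t_z is therefore chosen small against the forms built before it, which is where an
-- ordering of the field enters. Then ker Q_y consists of the vectors killed by all restrictions to
-- covers, and these vanish because F is Cohen-Macaulay at y. Exactness of E in rank j uses that of
-- Z in rank j, that of F in rank j + 1 and the embedding in rank j + 2 ≤ i. For i = k + 1 and F
-- good up to k + 2 this leaves E good up to k: two ranks are lost, just as the letter d costs two
-- degrees, so the recursion never runs out of exactness. The rational numbers suffice, since the
-- Betti numbers of the hypothesis are expressed by integer minors.

record Ring≡ : Set₁ where
  infixl 7 _*_
  infixl 6 _+_ _-_
  infix  8 -_
  field
    K       : Set
    _+_ _*_ : K → K → K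
    -_      : K → K
    0# 1#   : K
    isCommutativeRing : IsCommutativeRing _≡_ _+_ _*_ -_ 0# 1#
    fromℤ   : ℤ → K
    +-homo  : ∀ i j → fromℤ (i ℤ.+ j) ≡ fromℤ i + fromℤ j
    *-homo  : ∀ i j → fromℤ (i ℤ.* j) ≡ fromℤ i * fromℤ j
    -‿homo  : ∀ i → fromℤ (ℤ.- i) ≡ - fromℤ i
    0-homo  : fromℤ 0ℤ ≡ 0#
    1-homo  : fromℤ 1ℤ ≡ 1#

  _-_ : K → K → K
  x - y = x + - y

  commutativeRing : CommutativeRing 0ℓ 0ℓ
  commutativeRing = record { isCommutativeRing = isCommutativeRing }

ℤring : Ring≡
ℤring = record
  { K = ℤ ; _+_ = ℤ._+_ ; _*_ = ℤ._*_ ; -_ = ℤ.-_ ; 0# = 0ℤ ; 1# = 1ℤ ; isCommutativeRing = ℤₚ.+-*-isCommutativeRing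
  ; fromℤ = λ i → i ; +-homo = λ _ _ → refl ; *-homo = λ _ _ → refl ; -‿homo = λ _ → refl ; 0-homo = refl ; 1-homo = refl }

module Solver (R : Ring≡) where
  open Ring≡ R

  private
    morphism : ℤ.+-*-rawRing ACR.-Raw-AlmostCommutative⟶ ACR.fromCommutativeRing commutativeRing
    morphism = record
      { ⟦_⟧ = fromℤ ; +-homo = +-homo ; *-homo = *-homo ; -‿homo = -‿homo
      ; 0-homo = 0-homo ; 1-homo = 1-homo }

    coeff≟ : ∀ x y → Maybe (fromℤ x ≡ fromℤ y)
    coeff≟ x y with x ℤₚ.≟ y
    ... | yes e = just (cong fromℤ e)
    ... | no _  = nothing

  open Algebra.Solver.Ring ℤ.+-*-rawRing (ACR.fromCommutativeRing commutativeRing)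
    morphism coeff≟ public using (solve; _:=_; _:+_; _:*_; _:-_; :-_; con)

module Sums (R : Ring≡) where
  open Ring≡ R
  open Solver R
  open IsCommutativeRing isCommutativeRing public
    using (+-comm; +-assoc; *-comm; *-assoc; +-identityˡ; +-identityʳ; *-identityˡ; *-identityʳ; zeroˡ; zeroʳ; distribˡ; distribʳ; -‿inverseˡ; -‿inverseʳ)

  module _ {J : Set} where
    sumL : List J → (J → K) → K
    sumL []       f = 0#
    sumL (x ∷ xs) f = f x + sumL xs f

    sumL-cong : ∀ xs {f g} → (∀ j → f j ≡ g j) → sumL xs f ≡ sumL xs g
    sumL-cong []       e = refl
    sumL-cong (x ∷ xs) e = cong₂ _+_ (e x) (sumL-cong xs e)

    sumL-0 : ∀ xs → sumL xs (λ _ → 0#) ≡ 0#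
    sumL-0 []       = refl
    sumL-0 (x ∷ xs) = trans (+-identityˡ _) (sumL-0 xs)

    sumL-+ : ∀ xs f g → sumL xs (λ j → f j + g j) ≡ sumL xs f + sumL xs g
    sumL-+ []       f g = sym (+-identityˡ 0#)
    sumL-+ (x ∷ xs) f g rewrite sumL-+ xs f g =
      solve 4 (λ a b c d → (a :+ b) :+ (c :+ d) := (a :+ c) :+ (b :+ d)) refl (f x) (g x) (sumL xs f) (sumL xs g)

    sumL-*ˡ : ∀ xs c f → sumL xs (λ j → c * f j) ≡ c * sumL xs f
    sumL-*ˡ []       c f = sym (zeroʳ c)
    sumL-*ˡ (x ∷ xs) c f = trans (cong ((c * f x) +_) (sumL-*ˡ xs c f)) (sym (distribˡ c (f x) (sumL xs f)))

    sumL-++ : ∀ xs ys f → sumL (xs ++ ys) f ≡ sumL xs f + sumL ys f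
    sumL-++ []       ys f = sym (+-identityˡ _)
    sumL-++ (x ∷ xs) ys f = trans (cong (f x +_) (sumL-++ xs ys f)) (sym (+-assoc _ _ _))

  sumL-map : ∀ {I J : Set} (h : I → J) xs f → sumL (map h xs) f ≡ sumL xs (λ i → f (h i))
  sumL-map h []       f = refl
  sumL-map h (x ∷ xs) f = cong (f (h x) +_) (sumL-map h xs f)

  sumL-concatMap : ∀ {I J : Set} (h : I → List J) xs f → sumL (concatMap h xs) f ≡ sumL xs (λ i → sumL (h i) f)
  sumL-concatMap h []       f = refl
  sumL-concatMap h (x ∷ xs) f = trans (sumL-++ (h x) _ f) (cong (sumL (h x) f +_) (sumL-concatMap h xs f))

  sumL-swap : ∀ {I J : Set} (xs : List I) (ys : List J) (f : I → J → K) →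
    sumL xs (λ i → sumL ys (f i)) ≡ sumL ys (λ j → sumL xs (λ i → f i j))
  sumL-swap []       ys f = sym (sumL-0 ys)
  sumL-swap (x ∷ xs) ys f = trans (cong (sumL ys (f x) +_) (sumL-swap xs ys f)) (sym (sumL-+ ys _ _))

  [_] : Bool → K
  [ true ]  = 1#
  [ false ] = 0#

  []-∧ : ∀ a b → [ a ∧ b ] ≡ [ a ] * [ b ]
  []-∧ true  b = sym (*-identityˡ _)
  []-∧ false b = sym (zeroˡ _)

  -- In characteristic zero `pick` says that `enum` lists every element exactly once. It is stated
  -- as a sum against a Kronecker delta because matrix identities use it in that form.
  record Finite (J : Set) : Set where
    field
      enum : List J
      _≟_  : DecidableEquality J
      pick : ∀ j (f : J → K) → sumL enum (λ i → [ does (j ≟ i) ] * f i) ≡ f j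

  open Finite {{...}} public

  opaque
    ∑ : {J : Set} {{_ : Finite J}} → (J → K) → K
    ∑ f = sumL enum f

    ∑-def : {J : Set} {{F : Finite J}} (f : J → K) → ∑ f ≡ sumL (Finite.enum F) f
    ∑-def f = refl

  infixr 5 ∑
  syntax ∑ (λ j → e) = ∑[ j ] e

  δ : {J : Set} {{_ : Finite J}} → J → J → K
  δ i j = [ does (i ≟ j) ]

  opaque
    unfolding ∑

    ∑-cong : {J : Set} {{_ : Finite J}} {f g : J → K} → (∀ j → f j ≡ g j) → ∑ f ≡ ∑ g
    ∑-cong = sumL-cong enum

    ∑-0 : {J : Set} {{_ : Finite J}} {f : J → K} → (∀ j → f j ≡ 0#) → ∑ f ≡ 0#
    ∑-0 {J} e = trans (∑-cong e) (sumL-0 (enum {J}))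

    ∑-+ : {J : Set} {{_ : Finite J}} (f g : J → K) → ∑ (λ j → f j + g j) ≡ ∑ f + ∑ g
    ∑-+ = sumL-+ enum

    ∑-*ˡ : {J : Set} {{_ : Finite J}} (c : K) (f : J → K) → ∑ (λ j → c * f j) ≡ c * ∑ f
    ∑-*ˡ = sumL-*ˡ enum

    ∑-δ : {J : Set} {{_ : Finite J}} (j : J) (f : J → K) → ∑ (λ i → δ j i * f i) ≡ f j
    ∑-δ = pick

    ∑-swap : {I J : Set} {{_ : Finite I}} {{_ : Finite J}} (f : I → J → K) →
      ∑ (λ i → ∑ (f i)) ≡ ∑ (λ j → ∑ (λ i → f i j))
    ∑-swap = sumL-swap enum enum

  module _ {J : Set} {{_ : Finite J}} where

    ∑-*ʳ : ∀ c (f : J → K) → ∑ (λ j → f j * c) ≡ ∑ f * c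
    ∑-*ʳ c f = trans (∑-cong (λ j → *-comm (f j) c)) (trans (∑-*ˡ c f) (*-comm c _))

    ∑-neg : (f : J → K) → ∑ (λ j → - f j) ≡ - ∑ f
    ∑-neg f = trans (∑-cong (λ j → solve 1 (λ x → :- x := con (ℤ.- 1ℤ) :* x) refl (f j)))
                    (trans (∑-*ˡ _ f) (solve 1 (λ x → con (ℤ.- 1ℤ) :* x := :- x) refl (∑ f)))

    ∑-sub : (f g : J → K) → ∑ (λ j → f j - g j) ≡ ∑ f - ∑ g
    ∑-sub f g = trans (∑-+ f (λ j → - g j)) (cong (∑ f +_) (∑-neg g))

    δ-refl : ∀ (j : J) → δ j j ≡ 1#
    δ-refl j = cong [_] (dec-true (j ≟ j) refl)

    δ-≢ : ∀ {i j : J} → i ≢ j → δ i j ≡ 0#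
    δ-≢ {i} {j} n = cong [_] (dec-false (i ≟ j) n)

    δ-sym : ∀ (i j : J) → δ i j ≡ δ j i
    δ-sym i j with i ≟ j
    ... | yes refl = sym (δ-refl j)
    ... | no n     = sym (δ-≢ (λ e → n (sym e)))

    ∑-δʳ : ∀ j (f : J → K) → ∑ (λ i → f i * δ i j) ≡ f j
    ∑-δʳ j f = trans (∑-cong (λ i → trans (*-comm _ _) (cong (_* f i) (δ-sym i j)))) (∑-δ j f)

    ∑-one : ∀ j (f : J → K) → (∀ i → i ≢ j → f i ≡ 0#) → ∑ f ≡ f j
    ∑-one j f z = trans (∑-cong h) (∑-δ j f)
      where
      h : ∀ i → f i ≡ δ j i * f i
      h i with j ≟ i
      ... | yes _ = sym (*-identityˡ _)
      ... | no n  = trans (z i (λ e → n (sym e))) (sym (zeroˡ _))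

  enumFin : ∀ n → List (Fin n)
  enumFin zero    = []
  enumFin (suc n) = zero ∷ map suc (enumFin n)

  private
    []-irr : ∀ {A B : Set} (p : Dec A) (q : Dec B) → (A → B) → (B → A) → [ does p ] ≡ [ does q ]
    []-irr (yes _) (yes _) f g = refl
    []-irr (no _)  (no _)  f g = refl
    []-irr (yes a) (no nb) f g = ⊥-elim (nb (f a))
    []-irr (no na) (yes b) f g = ⊥-elim (na (g b))

    pickFin : ∀ {n} j (f : Fin n → K) → sumL (enumFin n) (λ i → [ does (j Finₚ.≟ i) ] * f i) ≡ f j
    pickFin {suc n} zero f =
      trans (cong₂ _+_ (*-identityˡ _)
              (trans (sumL-map suc (enumFin n) _) (trans (sumL-cong (enumFin n) (λ i → zeroˡ _)) (sumL-0 (enumFin n)))))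
            (+-identityʳ _)
    pickFin {suc n} (suc j) f =
      trans (cong₂ _+_ (zeroˡ _) (trans (sumL-map suc (enumFin n) _)
              (trans (sumL-cong (enumFin n) (λ i → cong (_* f (suc i))
                 ([]-irr (suc j Finₚ.≟ suc i) (j Finₚ.≟ i) Finₚ.suc-injective (cong suc))))
                 (pickFin j (λ i → f (suc i))))))
            (+-identityˡ _)

  instance
    finFin : ∀ {n} → Finite (Fin n)
    finFin {n} = record { enum = enumFin n ; _≟_ = Finₚ._≟_ ; pick = pickFin }

  opaque
    unfolding ∑

    ∑Fin-zero : (f : Fin 0 → K) → ∑ f ≡ 0#
    ∑Fin-zero f = refl

    ∑Fin-suc : ∀ {n} (f : Fin (suc n) → K) → ∑ f ≡ f zero + ∑ (λ i → f (suc i))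
    ∑Fin-suc {n} f = cong (f zero +_) (sumL-map suc (enumFin n) f)

  module _ {n : ℕ} {f : Fin n → ℕ} where
    private
      T = Σ (Fin n) (λ x → Fin (f x))

      enumΣ : List T
      enumΣ = concatMap (λ x → map (x ,_) (enumFin (f x))) (enumFin n)

      _≟Σ_ : DecidableEquality T
      (x , a) ≟Σ (y , b) with x Finₚ.≟ y
      ... | no n = no λ { refl → n refl }
      ... | yes refl with a Finₚ.≟ b
      ...   | yes refl = yes refl
      ...   | no n     = no λ { refl → n refl }

      split : ∀ x a y b → [ does ((x , a) ≟Σ (y , b)) ] ≡ [ does (x Finₚ.≟ y) ] * [ does ((x , a) ≟Σ (y , b)) ]
      split x a y b with x Finₚ.≟ y
      ... | no _ = sym (zeroˡ _)
      ... | yes refl = sym (*-identityˡ _)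

    private
     ∑Σ′ : ∀ (g : T → K) → sumL enumΣ g ≡ sumL (enumFin n) (λ x → sumL (enumFin (f x)) (λ a → g (x , a)))
     ∑Σ′ g = trans (sumL-concatMap _ (enumFin n) g) (sumL-cong (enumFin n) (λ x → sumL-map (x ,_) (enumFin (f x)) g))

    private
      pickΣ : ∀ t (g : T → K) → sumL enumΣ (λ s → [ does (t ≟Σ s) ] * g s) ≡ g t
      pickΣ (x , a) g =
        trans (∑Σ′ _) (trans
          (sumL-cong (enumFin n) (λ y → trans
            (sumL-cong (enumFin (f y)) (λ b → trans (cong (_* g (y , b)) (split x a y b)) (*-assoc _ _ _)))
            (sumL-*ˡ (enumFin (f y)) _ _)))
          (trans (pickFin x _) (trans (sumL-cong (enumFin (f x)) (λ b → cong (_* g (x , b)) (h b))) (pickFin a _))))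
        where
        h : ∀ b → [ does ((x , a) ≟Σ (x , b)) ] ≡ [ does (a Finₚ.≟ b) ]
        h b = []-irr ((x , a) ≟Σ (x , b)) (a Finₚ.≟ b) (λ { refl → refl }) (λ { refl → refl })

    instance
      finΣ : Finite T
      finΣ = record { enum = enumΣ ; _≟_ = _≟Σ_ ; pick = pickΣ }

    opaque
      unfolding ∑

      ∑Σ : (g : T → K) → ∑ g ≡ ∑ (λ x → ∑ (λ a → g (x , a)))
      ∑Σ = ∑Σ′

-- Ranks and homology over an ordered field

record OrderedField : Set₁ where
  field
    ring : Ring≡
  open Ring≡ ring public
  field
    _≟K_      : DecidableEquality K
    inv       : K → K
    inverse   : ∀ x → x ≢ 0# → x * inv x ≡ 1#
    -- Characteristic zero: dimensions are computed as traces in the field and read back as natural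
    -- numbers.
    fromℤ-inj : ∀ {i j} → fromℤ i ≡ fromℤ j → i ≡ j
    NN        : K → Set
    NN-sq     : ∀ x → NN (x * x)
    NN-+      : ∀ {x y} → NN x → NN y → NN (x + y)
    NN-*      : ∀ {x y} → NN x → NN y → NN (x * y)
    NN-total  : ∀ x → NN x ⊎ NN (- x)
    NN-anti   : ∀ {x} → NN x → NN (- x) → x ≡ 0#

module LinAlg (F : OrderedField) where
  open OrderedField F
  open Solver ring
  open Sums ring

  1≢0 : 1# ≢ 0#
  1≢0 e with fromℤ-inj (trans 1-homo (trans e (sym 0-homo)))
  ... | ()

  *-≢0 : ∀ {x y} → x ≢ 0# → y ≢ 0# → x * y ≢ 0#
  *-≢0 {x} {y} nx ny e = ny (begin
    y               ≡⟨ solve 1 (λ y → y := con 1ℤ :* y) refl y ⟩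
    fromℤ 1ℤ * y    ≡⟨ cong (_* y) (trans 1-homo (sym (inverse x nx))) ⟩
    x * inv x * y   ≡⟨ solve 3 (λ x i y → x :* i :* y := i :* (x :* y)) refl x (inv x) y ⟩
    inv x * (x * y) ≡⟨ cong (inv x *_) e ⟩
    inv x * 0#      ≡⟨ zeroʳ _ ⟩
    0#              ∎)
    where open ≡-Reasoning

  *-cancel0 : ∀ {x y} → x * y ≡ 0# → x ≢ 0# → y ≡ 0#
  *-cancel0 {x} {y} e nx with y ≟K 0#
  ... | yes z = z
  ... | no ny = ⊥-elim (*-≢0 nx ny e)

  vanish : ∀ {x y} → (x ≢ 0# → y ≢ 0# → ⊥) → x * y ≡ 0#
  vanish {x} {y} h with x ≟K 0# | y ≟K 0#
  ... | yes p | _     = trans (cong (_* y) p) (zeroˡ _)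
  ... | no _  | yes q = trans (cong (x *_) q) (zeroʳ _)
  ... | no p  | no q  = ⊥-elim (h p q)

  *-on : ∀ {x y y'} → (x ≢ 0# → y ≡ y') → x * y ≡ x * y'
  *-on {x} {y} {y'} h with x ≟K 0#
  ... | yes p = trans (cong (_* y) p) (trans (zeroˡ _) (sym (trans (cong (_* y') p) (zeroˡ _))))
  ... | no p  = cong (x *_) (h p)

  0-or : ∀ {x} → (x ≢ 0# → ⊥) → x ≡ 0#
  0-or {x} h with x ≟K 0#
  ... | yes p = p
  ... | no q  = ⊥-elim (h q)

  neg-0 : - 0# ≡ 0#
  neg-0 = trans (sym (+-identityˡ _)) (-‿inverseʳ 0#)

  x-y≡0 : ∀ {x y} → x - y ≡ 0# → x ≡ y
  x-y≡0 {x} {y} e = trans (solve 2 (λ x y → x := (x :- y) :+ y) refl x y) (trans (cong (_+ y) e) (+-identityˡ y))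

  x-x : ∀ x → x - x ≡ 0#
  x-x = -‿inverseʳ

  fromℕ : ℕ → K
  fromℕ n = fromℤ (ℤ.+ n)

  fromℕ-suc : ∀ n → fromℕ (suc n) ≡ 1# + fromℕ n
  fromℕ-suc n = trans (+-homo 1ℤ (ℤ.+ n)) (cong (_+ fromℕ n) 1-homo)

  fromℕ-+ : ∀ m n → fromℕ (m ℕ.+ n) ≡ fromℕ m + fromℕ n
  fromℕ-+ m n = +-homo (ℤ.+ m) (ℤ.+ n)

  fromℕ-inj : ∀ {m n} → fromℕ m ≡ fromℕ n → m ≡ n
  fromℕ-inj e = ℤₚ.+-injective (fromℤ-inj e)

  Mat : Set → Set → Set
  Mat I J = I → J → K

  infix 4 _≋_
  _≋_ : ∀ {I J} → Mat I J → Mat I J → Set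
  A ≋ B = ∀ i j → A i j ≡ B i j

  Id : ∀ {I} {{_ : Finite I}} → Mat I I
  Id = δ

  infixl 7 _∙_ _·_
  _∙_ : ∀ {I J L} {{_ : Finite J}} → Mat I J → Mat J L → Mat I L
  (A ∙ B) i l = ∑[ j ] A i j * B j l

  _·_ : ∀ {I J} {{_ : Finite J}} → Mat I J → (J → K) → I → K
  (A · v) i = ∑[ j ] A i j * v j

  tr : ∀ {I} {{_ : Finite I}} → Mat I I → K
  tr A = ∑[ i ] A i i

  module _ {I J L : Set} {{_ : Finite J}} where
    ∙-cong : {A A' : Mat I J} {B B' : Mat J L} → A ≋ A' → B ≋ B' → A ∙ B ≋ A' ∙ B'
    ∙-cong e e' i l = ∑-cong (λ j → cong₂ _*_ (e i j) (e' j l))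

    ∙-0ˡ : {A : Mat I J} {B : Mat J L} → (∀ i j → A i j ≡ 0#) → ∀ i l → (A ∙ B) i l ≡ 0#
    ∙-0ˡ {A} {B} e i l = ∑-0 (λ j → trans (cong (_* B j l) (e i j)) (zeroˡ _))

    ∙-0ʳ : {A : Mat I J} {B : Mat J L} → (∀ j l → B j l ≡ 0#) → ∀ i l → (A ∙ B) i l ≡ 0#
    ∙-0ʳ {A} {B} e i l = ∑-0 (λ j → trans (cong (A i j *_) (e j l)) (zeroʳ _))

    ∙-subˡ : (A A' : Mat I J) (B : Mat J L) → ∀ i l → ((λ i j → A i j - A' i j) ∙ B) i l ≡ (A ∙ B) i l - (A' ∙ B) i l
    ∙-subˡ A A' B i l = trans (∑-cong (λ j → solve 3 (λ a b c → (a :- b) :* c := a :* c :- b :* c) refl (A i j) (A' i j) (B j l)))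
                              (∑-sub _ _)

    ∙-subʳ : (A : Mat I J) (B B' : Mat J L) → ∀ i l → (A ∙ (λ j l → B j l - B' j l)) i l ≡ (A ∙ B) i l - (A ∙ B') i l
    ∙-subʳ A B B' i l = trans (∑-cong (λ j → solve 3 (λ a b c → a :* (b :- c) := a :* b :- a :* c) refl (A i j) (B j l) (B' j l)))
                              (∑-sub _ _)

  ·-cong : ∀ {I J} {{_ : Finite J}} (A : Mat I J) {v w : J → K} → (∀ j → v j ≡ w j) → ∀ i → (A · v) i ≡ (A · w) i
  ·-cong A e i = ∑-cong (λ j → cong (A i j *_) (e j))

  ∙-assoc : ∀ {I J L M} {{_ : Finite J}} {{_ : Finite L}} (A : Mat I J) (B : Mat J L) (C : Mat L M) →
    (A ∙ B) ∙ C ≋ A ∙ (B ∙ C)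
  ∙-assoc A B C i m = begin
    ∑[ l ] (∑[ j ] A i j * B j l) * C l m   ≡⟨ ∑-cong (λ l → sym (∑-*ʳ (C l m) _)) ⟩
    ∑[ l ] ∑[ j ] A i j * B j l * C l m     ≡⟨ ∑-swap _ ⟩
    ∑[ j ] ∑[ l ] A i j * B j l * C l m     ≡⟨ ∑-cong (λ j → trans (∑-cong (λ l → *-assoc _ _ _)) (∑-*ˡ (A i j) _)) ⟩
    ∑[ j ] A i j * (∑[ l ] B j l * C l m)   ∎
    where open ≡-Reasoning

  ·-assoc : ∀ {I J L} {{_ : Finite J}} {{_ : Finite L}} (A : Mat I J) (B : Mat J L) (v : L → K) →
    ∀ i → ((A ∙ B) · v) i ≡ (A · (B · v)) i
  ·-assoc A B v i = ∙-assoc A B (λ l (_ : Fin 1) → v l) i zero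

  ∙-idˡ : ∀ {I J} {{_ : Finite I}} (A : Mat I J) → Id ∙ A ≋ A
  ∙-idˡ A i j = ∑-δ i (λ i → A i j)

  ∙-idʳ : ∀ {I J} {{_ : Finite J}} (A : Mat I J) → A ∙ Id ≋ A
  ∙-idʳ A i j = ∑-δʳ j (A i)

  tr-comm : ∀ {I J} {{_ : Finite I}} {{_ : Finite J}} (A : Mat I J) (B : Mat J I) → tr (A ∙ B) ≡ tr (B ∙ A)
  tr-comm A B = trans (∑-swap _) (∑-cong (λ j → ∑-cong (λ i → *-comm _ _)))

  tr-cong : ∀ {I} {{_ : Finite I}} {A B : Mat I I} → A ≋ B → tr A ≡ tr B
  tr-cong e = ∑-cong (λ i → e i i)

  ∑-1 : ∀ n → ∑ {Fin n} (λ _ → 1#) ≡ fromℕ n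
  ∑-1 zero    = trans (∑Fin-zero _) (sym 0-homo)
  ∑-1 (suc n) = trans (∑Fin-suc {n} (λ _ → 1#)) (trans (cong (1# +_) (∑-1 n)) (sym (fromℕ-suc n)))

  tr-Id : ∀ n → tr (Id {Fin n}) ≡ fromℕ n
  tr-Id n = trans (∑-cong (λ i → δ-refl i)) (∑-1 n)

  -- The rows of B form a basis of the row space of A: `rows` and `span` say that both span the same
  -- space, and the right inverse B⁺ stands for independence. Then G = B⁺ C is a generalised
  -- inverse, A G is a projection onto the column space, and its trace is the rank. All dimension
  -- counts below are traces of projections, so bases never have to be exchanged or compared.
  record RankFactorization {I J : Set} {{_ : Finite I}} {{_ : Finite J}} (A : Mat I J) : Set where
    field
      rank : ℕ
      B    : Mat (Fin rank) J
      B⁺   : Mat J (Fin rank)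
      C    : Mat (Fin rank) I
      BB⁺  : B ∙ B⁺ ≋ Id
      rows : B ≋ C ∙ A
      span : A ≋ (A ∙ B⁺) ∙ B

    G : Mat J I
    G = B⁺ ∙ C

    AGA : (A ∙ G) ∙ A ≋ A
    AGA i j = begin
      ((A ∙ (B⁺ ∙ C)) ∙ A) i j   ≡⟨ ∙-cong {B = A} (λ i j → sym (∙-assoc A B⁺ C i j)) (λ _ _ → refl) i j ⟩
      (((A ∙ B⁺) ∙ C) ∙ A) i j   ≡⟨ ∙-assoc (A ∙ B⁺) C A i j ⟩
      ((A ∙ B⁺) ∙ (C ∙ A)) i j   ≡⟨ ∙-cong {A = A ∙ B⁺} (λ _ _ → refl) (λ i j → sym (rows i j)) i j ⟩
      ((A ∙ B⁺) ∙ B) i j         ≡⟨ sym (span i j) ⟩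
      A i j ∎
      where open ≡-Reasoning

    trace : tr (A ∙ G) ≡ fromℕ rank
    trace = begin
      tr (A ∙ (B⁺ ∙ C))   ≡⟨ tr-cong (λ i j → sym (∙-assoc A B⁺ C i j)) ⟩
      tr ((A ∙ B⁺) ∙ C)   ≡⟨ tr-comm (A ∙ B⁺) C ⟩
      tr (C ∙ (A ∙ B⁺))   ≡⟨ tr-cong (λ i j → sym (∙-assoc C A B⁺ i j)) ⟩
      tr ((C ∙ A) ∙ B⁺)   ≡⟨ tr-cong (∙-cong (λ i j → sym (rows i j)) (λ _ _ → refl)) ⟩
      tr (B ∙ B⁺)         ≡⟨ tr-cong BB⁺ ⟩
      tr (Id {Fin rank})  ≡⟨ tr-Id rank ⟩
      fromℕ rank ∎
      where open ≡-Reasoning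

  zero? : ∀ {J} {{_ : Finite J}} (v : J → K) → (∀ j → v j ≡ 0#) ⊎ Σ J (λ j → v j ≢ 0#)
  zero? {J} v = conclude (search enum)
    where
    search : (xs : List J) → (∀ {j} → j ∈ xs → v j ≡ 0#) ⊎ Σ J (λ j → v j ≢ 0#)
    search [] = inj₁ λ ()
    search (x ∷ xs) with v x ≟K 0#
    ... | no n = inj₂ (x , n)
    ... | yes z with search xs
    ...   | inj₂ w = inj₂ w
    ...   | inj₁ a = inj₁ λ { (Any.here refl) → z ; (Any.there m) → a m }

    sumL-0∈ : (xs : List J) {f : J → K} → (∀ {j} → j ∈ xs → f j ≡ 0#) → sumL xs f ≡ 0#
    sumL-0∈ [] e = refl
    sumL-0∈ (x ∷ xs) e = trans (cong₂ _+_ (e (Any.here refl)) (sumL-0∈ xs (λ m → e (Any.there m)))) (+-identityˡ 0#)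

    conclude : (∀ {j} → j ∈ enum → v j ≡ 0#) ⊎ Σ J (λ j → v j ≢ 0#) → (∀ j → v j ≡ 0#) ⊎ Σ J (λ j → v j ≢ 0#)
    conclude (inj₂ w) = inj₂ w
    conclude (inj₁ a) = inj₁ λ j → trans (sym (∑-δ j v)) (trans (∑-def _) (sumL-0∈ enum (λ {i} m → trans (cong (δ j i *_) (a m)) (zeroʳ _))))

  module _ {I J : Set} {{_ : Finite I}} {{_ : Finite J}} (A : Mat I J) where
    private
      record Partial (xs : List I) : Set where
        field
          rank : ℕ
          B    : Mat (Fin rank) J
          B⁺   : Mat J (Fin rank)
          C    : Mat (Fin rank) I
          BB⁺  : B ∙ B⁺ ≋ Id
          rows : B ≋ C ∙ A
          span : ∀ {i} → i ∈ xs → ∀ j → A i j ≡ ((A ∙ B⁺) ∙ B) i j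

      -- Gaussian elimination one row at a time. The residue `a` of the new row modulo the old basis
      -- satisfies a B⁺ = 0, so the old dual columns stay valid. If some entry a j₀ is non-zero, `a`
      -- joins the basis; its dual column `c` is the j₀-th unit vector divided by a j₀, corrected
      -- through B⁺ so that B c = 0.
      extend : ∀ x {xs} → Partial xs → Partial (x ∷ xs)
      extend x {xs} p = go (zero? a)
        where
        open Partial p
        open ≡-Reasoning
        a : J → K
        a j = A x j - ((A ∙ B⁺) ∙ B) x j

        aB⁺ : ∀ k → (∑[ j ] a j * B⁺ j k) ≡ 0#
        aB⁺ k = begin
          (∑[ j ] a j * B⁺ j k)                          ≡⟨ ∙-subˡ A ((A ∙ B⁺) ∙ B) B⁺ x k ⟩
          (A ∙ B⁺) x k - (((A ∙ B⁺) ∙ B) ∙ B⁺) x k       ≡⟨ cong (λ z → (A ∙ B⁺) x k - z) (begin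
            (((A ∙ B⁺) ∙ B) ∙ B⁺) x k    ≡⟨ ∙-assoc (A ∙ B⁺) B B⁺ x k ⟩
            ((A ∙ B⁺) ∙ (B ∙ B⁺)) x k    ≡⟨ ∙-cong {A = A ∙ B⁺} (λ _ _ → refl) BB⁺ x k ⟩
            ((A ∙ B⁺) ∙ Id) x k          ≡⟨ ∙-idʳ (A ∙ B⁺) x k ⟩
            (A ∙ B⁺) x k ∎) ⟩
          (A ∙ B⁺) x k - (A ∙ B⁺) x k                    ≡⟨ x-x _ ⟩
          0# ∎

        go : (∀ j → a j ≡ 0#) ⊎ Σ J (λ j → a j ≢ 0#) → Partial (x ∷ xs)
        go (inj₁ z) = record { rank = rank ; B = B ; B⁺ = B⁺ ; C = C ; BB⁺ = BB⁺ ; rows = rows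
                             ; span = λ { (Any.here refl) j → x-y≡0 (z j) ; (Any.there m) → span m } }
        go (inj₂ (j₀ , nz)) = record
          { rank = suc rank ; B = B' ; B⁺ = B⁺' ; C = C' ; BB⁺ = BB' ; rows = rows' ; span = span' }
          where
          w : Mat (Fin rank) (Fin 1)
          w k _ = B k j₀ * inv (a j₀)

          c : J → K
          c j = δ j j₀ * inv (a j₀) - (∑[ k ] B⁺ j k * (B k j₀ * inv (a j₀)))

          Bc : ∀ k → (∑[ j ] B k j * c j) ≡ 0#
          Bc k = begin
            (∑[ j ] B k j * c j)
              ≡⟨ ∙-subʳ B (λ j (_ : Fin 1) → δ j j₀ * inv (a j₀)) (B⁺ ∙ w) k zero ⟩
            (∑[ j ] B k j * (δ j j₀ * inv (a j₀))) - (B ∙ (B⁺ ∙ w)) k zero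
              ≡⟨ cong₂ _-_ (trans (∑-cong (λ j → sym (*-assoc _ _ _))) (trans (∑-*ʳ _ _) (cong (_* inv (a j₀)) (∑-δʳ j₀ (B k)))))
                           (trans (sym (∙-assoc B B⁺ w k zero)) (trans (∙-cong {B = w} BB⁺ (λ _ _ → refl) k zero) (∙-idˡ w k zero))) ⟩
            B k j₀ * inv (a j₀) - B k j₀ * inv (a j₀)  ≡⟨ x-x _ ⟩
            0# ∎

          ac : (∑[ j ] a j * c j) ≡ 1#
          ac = begin
            (∑[ j ] a j * c j)
              ≡⟨ ∙-subʳ (λ (_ : Fin 1) → a) (λ j (_ : Fin 1) → δ j j₀ * inv (a j₀)) (B⁺ ∙ w) zero zero ⟩
            (∑[ j ] a j * (δ j j₀ * inv (a j₀))) - ((λ (_ : Fin 1) → a) ∙ (B⁺ ∙ w)) zero zero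
              ≡⟨ cong₂ _-_ (trans (∑-cong (λ j → sym (*-assoc _ _ _))) (trans (∑-*ʳ _ _) (cong (_* inv (a j₀)) (∑-δʳ j₀ a))))
                           (trans (sym (∙-assoc (λ (_ : Fin 1) → a) B⁺ w zero zero)) (∙-0ˡ {B = w} (λ (_ : Fin 1) k → aB⁺ k) zero zero)) ⟩
            a j₀ * inv (a j₀) - 0#  ≡⟨ trans (cong₂ _-_ (inverse _ nz) refl) (trans (cong (1# +_) neg-0) (+-identityʳ _)) ⟩
            1# ∎

          B' : Mat (Fin (suc rank)) J
          B' zero    = a
          B' (suc k) = B k

          B⁺' : Mat J (Fin (suc rank))
          B⁺' j zero    = c j
          B⁺' j (suc k) = B⁺ j k

          C' : Mat (Fin (suc rank)) I
          C' zero i    = δ i x - (∑[ k ] (A ∙ B⁺) x k * C k i)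
          C' (suc k) i = C k i

          BB' : B' ∙ B⁺' ≋ Id
          BB' zero    zero    = ac
          BB' zero    (suc k) = aB⁺ k
          BB' (suc k) zero    = Bc k
          BB' (suc k) (suc l) = trans (BB⁺ k l) refl

          rows' : B' ≋ C' ∙ A
          rows' zero j = sym (begin
            (∑[ i ] (δ i x - ((A ∙ B⁺) ∙ C) x i) * A i j)
              ≡⟨ ∙-subˡ (λ (_ : Fin 1) i → δ i x) (λ _ → ((A ∙ B⁺) ∙ C) x) A zero j ⟩
            (∑[ i ] δ i x * A i j) - (((A ∙ B⁺) ∙ C) ∙ A) x j
              ≡⟨ cong₂ _-_ (trans (∑-cong (λ i → cong (_* A i j) (δ-sym i x))) (∑-δ x (λ i → A i j)))
                           (trans (∙-assoc (A ∙ B⁺) C A x j) (∙-cong {A = A ∙ B⁺} (λ _ _ → refl) (λ i j → sym (rows i j)) x j)) ⟩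
            a j ∎)
          rows' (suc k) j = rows k j

          expand : ∀ i j → ((A ∙ B⁺') ∙ B') i j ≡ (∑[ j ] A i j * c j) * a j + ((A ∙ B⁺) ∙ B) i j
          expand i j = ∑Fin-suc {rank} (λ k → (A ∙ B⁺') i k * B' k j)

          span' : ∀ {i} → i ∈ (x ∷ xs) → ∀ j → A i j ≡ ((A ∙ B⁺') ∙ B') i j
          span' (Any.here refl) j = sym (begin
            ((A ∙ B⁺') ∙ B') x j        ≡⟨ expand x j ⟩
            (∑[ j ] A x j * c j) * a j + ((A ∙ B⁺) ∙ B) x j ≡⟨ cong (λ z → z * a j + ((A ∙ B⁺) ∙ B) x j) Axc ⟩
            1# * a j + ((A ∙ B⁺) ∙ B) x j ≡⟨ cong (_+ ((A ∙ B⁺) ∙ B) x j) (*-identityˡ _) ⟩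
            a j + ((A ∙ B⁺) ∙ B) x j ≡⟨ solve 2 (λ p q → (p :- q) :+ q := p) refl (A x j) (((A ∙ B⁺) ∙ B) x j) ⟩
            A x j ∎)
            where
            Axc : (∑[ j ] A x j * c j) ≡ 1#
            Axc = begin
              (∑[ j ] A x j * c j) ≡⟨ ∑-cong (λ j → cong (_* c j) (solve 2 (λ p q → p := (p :- q) :+ q) refl (A x j) (((A ∙ B⁺) ∙ B) x j))) ⟩
              (∑[ j ] (a j + ((A ∙ B⁺) ∙ B) x j) * c j) ≡⟨ trans (∑-cong (λ j → distribʳ (c j) _ _)) (∑-+ _ _) ⟩
              (∑[ j ] a j * c j) + (((A ∙ B⁺) ∙ B) · c) x ≡⟨ cong₂ _+_ ac (trans (·-assoc (A ∙ B⁺) B c x) (∑-0 (λ k → trans (cong ((A ∙ B⁺) x k *_) (Bc k)) (zeroʳ _)))) ⟩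
              1# + 0# ≡⟨ +-identityʳ _ ⟩
              1# ∎
          span' {i} (Any.there m) j = sym (begin
            ((A ∙ B⁺') ∙ B') i j        ≡⟨ expand i j ⟩
            (∑[ j ] A i j * c j) * a j + ((A ∙ B⁺) ∙ B) i j ≡⟨ cong (λ z → z * a j + ((A ∙ B⁺) ∙ B) i j) Aic ⟩
            0# * a j + ((A ∙ B⁺) ∙ B) i j ≡⟨ trans (cong (_+ ((A ∙ B⁺) ∙ B) i j) (zeroˡ _)) (+-identityˡ _) ⟩
            ((A ∙ B⁺) ∙ B) i j ≡⟨ sym (span m j) ⟩
            A i j ∎)
            where
            Aic : (∑[ j ] A i j * c j) ≡ 0#
            Aic = trans (∑-cong (λ j → cong (_* c j) (span m j))) (trans (·-assoc (A ∙ B⁺) B c i) (∑-0 (λ k → trans (cong ((A ∙ B⁺) i k *_) (Bc k)) (zeroʳ _))))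

      build : ∀ xs → Partial xs
      build []       = record { rank = 0 ; B = λ () ; B⁺ = λ _ () ; C = λ () ; BB⁺ = λ () ; rows = λ () ; span = λ () }
      build (x ∷ xs) = extend x (build xs)

      sum-∈ : ∀ (f g : I → K) xs → (∀ {i} → i ∈ xs → f i ≡ g i) → sumL xs f ≡ sumL xs g
      sum-∈ f g []       e = refl
      sum-∈ f g (x ∷ xs) e = cong₂ _+_ (e (Any.here refl)) (sum-∈ f g xs (λ m → e (Any.there m)))

    abstract
      factorize : RankFactorization A
      factorize = record { rank = rank ; B = B ; B⁺ = B⁺ ; C = C ; BB⁺ = BB⁺ ; rows = rows
        ; span = λ i j → trans (sym (∑-δ i (λ i → A i j)))
                   (trans (trans (∑-def _) (trans (sum-∈ _ _ enum (λ {k} m → cong (δ i k *_) (span m j))) (sym (∑-def _)))) (∑-δ i (λ i → ((A ∙ B⁺) ∙ B) i j))) }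
        where open Partial (build enum)

    rk : ℕ
    rk = RankFactorization.rank factorize

  ∙-congˡ : ∀ {I J L} {{_ : Finite J}} {A A' : Mat I J} (B : Mat J L) → A ≋ A' → A ∙ B ≋ A' ∙ B
  ∙-congˡ B e = ∙-cong {B = B} e (λ _ _ → refl)

  ∙-congʳ : ∀ {I J L} {{_ : Finite J}} (A : Mat I J) {B B' : Mat J L} → B ≋ B' → A ∙ B ≋ A ∙ B'
  ∙-congʳ A e = ∙-cong {A = A} (λ _ _ → refl) e

  infixl 6 _⊝_
  _⊝_ : ∀ {I J} → Mat I J → Mat I J → Mat I J
  (A ⊝ B) i j = A i j - B i j

  tr-sub : ∀ {I} {{_ : Finite I}} (A B : Mat I I) → tr (A ⊝ B) ≡ tr A - tr B
  tr-sub A B = ∑-sub (λ i → A i i) (λ i → B i i)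

  record Splitting {J : Set} {{_ : Finite J}} (P : Mat J J) : Set where
    field
      dim : ℕ
      σ   : Mat J (Fin dim)
      π   : Mat (Fin dim) J
      σπ  : σ ∙ π ≋ P
      πσ  : π ∙ σ ≋ Id
      tr-dim : fromℕ dim ≡ tr P

  split : ∀ {J : Set} {{_ : Finite J}} (P : Mat J J) → P ∙ P ≋ P → Splitting P
  split P PP = record
    { dim = rank ; σ = P ∙ B⁺ ; π = B ; σπ = λ i j → sym (span i j) ; πσ = πσ
    ; tr-dim = trans (sym (tr-Id rank)) (trans (tr-cong (λ i j → sym (πσ i j))) (trans (tr-comm B (P ∙ B⁺)) (tr-cong (λ i j → sym (span i j))))) }
    where
    open RankFactorization (factorize P)
    open ≡-Reasoning
    πσ : B ∙ (P ∙ B⁺) ≋ Id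
    πσ i j = begin
      (B ∙ (P ∙ B⁺)) i j         ≡⟨ ∙-congˡ (P ∙ B⁺) rows i j ⟩
      ((C ∙ P) ∙ (P ∙ B⁺)) i j   ≡⟨ ∙-assoc C P (P ∙ B⁺) i j ⟩
      (C ∙ (P ∙ (P ∙ B⁺))) i j   ≡⟨ ∙-congʳ C (λ i j → trans (sym (∙-assoc P P B⁺ i j)) (∙-congˡ B⁺ PP i j)) i j ⟩
      (C ∙ (P ∙ B⁺)) i j         ≡⟨ sym (∙-assoc C P B⁺ i j) ⟩
      ((C ∙ P) ∙ B⁺) i j         ≡⟨ ∙-congˡ B⁺ (λ i j → sym (rows i j)) i j ⟩
      (B ∙ B⁺) i j               ≡⟨ BB⁺ i j ⟩
      Id i j ∎

  diag : ∀ {J : Set} {{_ : Finite J}} → (J → Bool) → Mat J J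
  diag m i j = [ m i ] * δ i j

  diag-· : ∀ {J L : Set} {{_ : Finite J}} (m : J → Bool) (A : Mat J L) → ∀ i l → (diag m ∙ A) i l ≡ [ m i ] * A i l
  diag-· m A i l = trans (∑-cong (λ j → *-assoc _ _ _)) (trans (∑-*ˡ [ m i ] _) (cong ([ m i ] *_) (∑-δ i (λ j → A j l))))

  ·-diag : ∀ {J L : Set} {{_ : Finite J}} (m : J → Bool) (A : Mat L J) → ∀ l j → (A ∙ diag m) l j ≡ A l j * [ m j ]
  ·-diag m A l j = trans (∑-cong (λ i → sym (*-assoc _ _ _))) (∑-δʳ j (λ i → A l i * [ m i ]))

  []-idem : ∀ b → [ b ] * [ b ] ≡ [ b ]
  []-idem true  = *-identityˡ 1#
  []-idem false = zeroˡ 0#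

  -- The homology of  U --A--> V --B--> W  at V, where V is cut down to the coordinates selected by m.
  module Homology {U V W : Set} {{_ : Finite U}} {{_ : Finite V}} {{_ : Finite W}}
    (m : V → Bool) (A : Mat V U) (B : Mat W V)
    (mA : ∀ v u → [ m v ] * A v u ≡ A v u) (Bm : ∀ w v → B w v * [ m v ] ≡ B w v)
    (BA : ∀ w u → (B ∙ A) w u ≡ 0#) where

    private
      module FA = RankFactorization (factorize A)
      module FB = RankFactorization (factorize B)
      M = diag m
      MA : M ∙ A ≋ A
      MA v u = trans (diag-· m A v u) (mA v u)
      BM : B ∙ M ≋ B
      BM w v = trans (·-diag m B w v) (Bm w v)
      MM : M ∙ M ≋ M
      MM i j = trans (diag-· m M i j) (trans (sym (*-assoc _ _ _)) (cong (_* δ i j) ([]-idem (m i))))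

      -- `e₁` = M - M G B projects onto the cycles and `e₂` = A G onto the boundaries. Because e₁ e₂
      -- = e₂, the difference `h` = e₁ - e₂ e₁ is again idempotent; its image is a complement of the
      -- boundaries among the cycles, and its trace is the Betti number.
      N = M ∙ (FB.G ∙ B)
      e₁ = M ⊝ N
      e₂ = A ∙ FA.G

      MN : M ∙ N ≋ N
      MN i j = trans (sym (∙-assoc M M (FB.G ∙ B) i j)) (∙-congˡ (FB.G ∙ B) MM i j)

      BN : B ∙ N ≋ B
      BN i j = trans (sym (∙-assoc B M (FB.G ∙ B) i j)) (trans (∙-congˡ (FB.G ∙ B) BM i j) (trans (sym (∙-assoc B FB.G B i j)) (FB.AGA i j)))

      Me₁ : M ∙ e₁ ≋ e₁
      Me₁ i j = trans (∙-subʳ M M N i j) (cong₂ _-_ (MM i j) (MN i j))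

      Be₁ : ∀ i j → (B ∙ e₁) i j ≡ 0#
      Be₁ i j = trans (∙-subʳ B M N i j) (trans (cong₂ _-_ (BM i j) (BN i j)) (x-x _))

      fix : ∀ {L : Set} (X : Mat V L) → M ∙ X ≋ X → (∀ i j → (B ∙ X) i j ≡ 0#) → e₁ ∙ X ≋ X
      fix X MX BX i j = trans (∙-subˡ M N X i j) (trans (cong₂ _-_ (MX i j)
        (trans (∙-assoc M (FB.G ∙ B) X i j) (∙-0ʳ {A = M} (λ i j → trans (∙-assoc FB.G B X i j) (∙-0ʳ {A = FB.G} BX i j)) i j)))
        (trans (cong (X i j +_) neg-0) (+-identityʳ _)))

      e₁e₁ : e₁ ∙ e₁ ≋ e₁
      e₁e₁ = fix e₁ Me₁ Be₁

      e₁e₂ : e₁ ∙ e₂ ≋ e₂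
      e₁e₂ = fix e₂ (λ i j → trans (sym (∙-assoc M A FA.G i j)) (∙-congˡ FA.G MA i j))
                    (λ i j → trans (sym (∙-assoc B A FA.G i j)) (∙-0ˡ {B = FA.G} BA i j))

      e₂e₂ : e₂ ∙ e₂ ≋ e₂
      e₂e₂ i j = trans (sym (∙-assoc (A ∙ FA.G) A FA.G i j)) (∙-congˡ FA.G FA.AGA i j)

      h = e₁ ⊝ (e₂ ∙ e₁)

      e₁h : e₁ ∙ h ≋ h
      e₁h i j = trans (∙-subʳ e₁ e₁ (e₂ ∙ e₁) i j) (cong₂ _-_ (e₁e₁ i j) (trans (sym (∙-assoc e₁ e₂ e₁ i j)) (∙-congˡ e₁ e₁e₂ i j)))

      e₂h : ∀ i j → (e₂ ∙ h) i j ≡ 0#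
      e₂h i j = trans (∙-subʳ e₂ e₁ (e₂ ∙ e₁) i j)
        (trans (cong (λ z → (e₂ ∙ e₁) i j - z) (trans (sym (∙-assoc e₂ e₂ e₁ i j)) (∙-congˡ e₁ e₂e₂ i j))) (x-x _))

      hh : h ∙ h ≋ h
      hh i j = trans (∙-subˡ e₁ (e₂ ∙ e₁) h i j) (trans (cong₂ _-_ (e₁h i j)
        (trans (∙-assoc e₂ e₁ h i j) (trans (∙-congʳ e₂ e₁h i j) (e₂h i j)))) (trans (cong (h i j +_) neg-0) (+-identityʳ _)))

      tr-h : tr h ≡ tr M - fromℕ (rk B) - fromℕ (rk A)
      tr-h = begin
        tr h                        ≡⟨ tr-sub e₁ (e₂ ∙ e₁) ⟩
        tr e₁ - tr (e₂ ∙ e₁)        ≡⟨ cong₂ _-_ (trans (tr-sub M N) (cong (λ z → tr M - z) trN)) (trans (tr-comm e₂ e₁) (trans (tr-cong e₁e₂) FA.trace)) ⟩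
        tr M - fromℕ (rk B) - fromℕ (rk A) ∎
        where
        open ≡-Reasoning
        trN : tr N ≡ fromℕ (rk B)
        trN = trans (tr-cong (λ i j → sym (∙-assoc M FB.G B i j))) (trans (tr-comm (M ∙ FB.G) B)
          (trans (tr-cong (λ i j → trans (sym (∙-assoc B M FB.G i j)) (∙-congˡ FB.G BM i j))) FB.trace))

      module S = Splitting (split h hh)

      via : ∀ {L : Set} (X : Mat L V) → (∀ i j → (X ∙ h) i j ≡ 0#) → ∀ i j → (X ∙ S.σ) i j ≡ 0#
      via X e i j = trans (sym (∙-idʳ (X ∙ S.σ) i j)) (trans (∙-congʳ (X ∙ S.σ) (λ i j → sym (S.πσ i j)) i j)
        (trans (sym (∙-assoc (X ∙ S.σ) S.π S.σ i j)) (∙-0ˡ {B = S.σ} (λ i j → trans (∙-assoc X S.σ S.π i j) (trans (∙-congʳ X S.σπ i j) (e i j))) i j)))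

    dim : ℕ
    dim = S.dim

    σ : Mat V (Fin dim)
    σ = S.σ

    π : Mat (Fin dim) V
    π = S.π

    πσ : π ∙ σ ≋ Id
    πσ = S.πσ

    dim-formula : fromℕ dim + fromℕ (rk A) + fromℕ (rk B) ≡ (∑[ v ] [ m v ])
    dim-formula = trans (cong (λ z → z + fromℕ (rk A) + fromℕ (rk B)) (trans S.tr-dim tr-h))
      (trans (solve 3 (λ t a b → t :- b :- a :+ a :+ b := t) refl (tr M) (fromℕ (rk A)) (fromℕ (rk B)))
        (∑-cong (λ v → trans (cong ([ m v ] *_) (δ-refl v)) (*-identityʳ _))))

    Bσ : ∀ w k → (B ∙ σ) w k ≡ 0#
    Bσ = via B (λ i j → trans (∙-subʳ B e₁ (e₂ ∙ e₁) i j) (trans (cong₂ _-_ (Be₁ i j)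
      (trans (sym (∙-assoc B e₂ e₁ i j)) (∙-0ˡ {B = e₁} (λ i j → trans (sym (∙-assoc B A FA.G i j)) (∙-0ˡ {B = FA.G} BA i j)) i j)))
      (x-x 0#)))

    mσ : ∀ v k → [ m v ] * σ v k ≡ σ v k
    mσ v k = trans (sym (diag-· m σ v k)) (trans (sym (x-y≡0 (trans (sym (∙-subˡ Id M σ v k)) (via (Id ⊝ M) Ih v k)))) (∙-idˡ σ v k))
      where
      Mh : M ∙ h ≋ h
      Mh i j = trans (∙-congʳ M (λ i j → sym (e₁h i j)) i j) (trans (sym (∙-assoc M e₁ h i j)) (trans (∙-congˡ h Me₁ i j) (e₁h i j)))
      Ih : ∀ i j → ((Id ⊝ M) ∙ h) i j ≡ 0#
      Ih i j = trans (∙-subˡ Id M h i j) (trans (cong₂ _-_ (∙-idˡ h i j) (Mh i j)) (x-x _))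

    πA : ∀ k u → (π ∙ A) k u ≡ 0#
    πA k u = trans (sym (∙-idˡ (π ∙ A) k u)) (trans (∙-congˡ (π ∙ A) (λ i j → sym (πσ i j)) k u)
      (trans (∙-assoc π σ (π ∙ A) k u) (∙-0ʳ {A = π} (λ i j → trans (sym (∙-assoc σ π A i j)) (trans (∙-congˡ A S.σπ i j) (hA i j))) k u)))
      where
      e₁A : e₁ ∙ A ≋ A
      e₁A = fix A MA BA
      hA : ∀ i j → (h ∙ A) i j ≡ 0#
      hA i j = trans (∙-subˡ e₁ (e₂ ∙ e₁) A i j) (trans (cong₂ _-_ (e₁A i j)
        (trans (∙-assoc e₂ e₁ A i j) (trans (∙-congʳ e₂ e₁A i j) (FA.AGA i j)))) (x-x _))

    decompose : ∀ c → (∀ v → [ m v ] * c v ≡ c v) → (∀ w → (B · c) w ≡ 0#) →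
      Σ (U → K) λ u → ∀ v → c v ≡ (A · u) v + (σ · (π · c)) v
    decompose c mc Bc = FA.G · c , λ v → begin
      c v                                       ≡⟨ solve 2 (λ p q → p := q :+ (p :- q)) refl (c v) ((e₂ · c) v) ⟩
      (e₂ · c) v + (c v - (e₂ · c) v)           ≡⟨ cong₂ _+_ (·-assoc A FA.G c v) (sym (hc v)) ⟩
      (A · (FA.G · c)) v + (h · c) v            ≡⟨ cong ((A · (FA.G · c)) v +_) (trans (sym (∙-congˡ (λ v (_ : Fin 1) → c v) S.σπ v zero)) (·-assoc σ π c v)) ⟩
      (A · (FA.G · c)) v + (σ · (π · c)) v ∎
      where
      open ≡-Reasoning
      c' : Mat V (Fin 1)
      c' v _ = c v
      e₁c : e₁ ∙ c' ≋ c'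
      e₁c = fix c' (λ v j → trans (diag-· m c' v j) (mc v)) (λ w _ → Bc w)
      hc : ∀ v → (h · c) v ≡ c v - (e₂ · c) v
      hc v = trans (∙-subˡ e₁ (e₂ ∙ e₁) c' v zero) (cong₂ _-_ (e₁c v zero) (trans (∙-assoc e₂ e₁ c' v zero) (∙-congʳ e₂ e₁c v zero)))

    -- A representing cycle that bounds would be killed by π, since π A = 0, whereas π σ = Id.
    exact⇒dim≡0 : (∀ c → (∀ v → [ m v ] * c v ≡ c v) → (∀ w → (B · c) w ≡ 0#) → Σ (U → K) λ u → ∀ v → c v ≡ (A · u) v) → dim ≡ 0
    exact⇒dim≡0 ex with dim in eq
    ... | zero  = refl
    ... | suc d = ⊥-elim (1≢0 (trans (sym (δ-refl k₀)) (trans (sym (πσ k₀ k₀)) (begin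
        (π ∙ σ) k₀ k₀   ≡⟨ ·-cong π (proj₂ lift) k₀ ⟩
        (π · (A · proj₁ lift)) k₀ ≡⟨ sym (·-assoc π A (proj₁ lift) k₀) ⟩
        ((π ∙ A) · proj₁ lift) k₀ ≡⟨ ∙-0ˡ {B = λ u (_ : Fin 1) → proj₁ lift u} πA k₀ zero ⟩
        0# ∎))))
      where
      open ≡-Reasoning
      k₀ : Fin dim
      k₀ = subst Fin (sym eq) zero
      lift = ex (λ v → σ v k₀) (λ v → mσ v k₀) (λ w → Bσ w k₀)

  abstract
    -- The rows of Id - A G annihilate A because A G A = A. Orthogonality of u to these rows says u
    -- = A G u, which exhibits the preimage G u.
    fredholm : ∀ {I J : Set} {{_ : Finite I}} {{_ : Finite J}} (A : Mat I J) (u : I → K) →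
      (∀ (w : I → K) → (∀ j → (∑[ i ] w i * A i j) ≡ 0#) → (∑[ i ] w i * u i) ≡ 0#) → Σ (J → K) λ v → ∀ i → u i ≡ (A · v) i
    fredholm {I} A u orth = G · u , λ i → trans (x-y≡0 (trans (cong (_- ((A ∙ G) · u) i) (sym (∙-idˡ u' i zero)))
        (trans (sym (∙-subˡ Id (A ∙ G) u' i zero)) (orth (λ k → (Id ⊝ (A ∙ G)) i k)
          (λ j → trans (∙-subˡ Id (A ∙ G) A i j) (trans (cong₂ _-_ (∙-idˡ A i j) (AGA i j)) (x-x _)))))))
        (·-assoc A G u i)
      where
      open RankFactorization (factorize A)
      u' : Mat I (Fin 1)
      u' i _ = u i

  left-inverse : ∀ {I J : Set} {{_ : Finite I}} {{_ : Finite J}} (A : Mat I J) →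
    (∀ v → (∀ i → (A · v) i ≡ 0#) → ∀ j → v j ≡ 0#) → RankFactorization.G (factorize A) ∙ A ≋ Id
  left-inverse A inj i j = sym (x-y≡0 (inj (λ i → (Id ⊝ (G ∙ A)) i j)
      (λ k → trans (∙-subʳ A Id (G ∙ A) k j) (trans (cong₂ _-_ (∙-idʳ A k j) (trans (sym (∙-assoc A G A k j)) (AGA k j))) (x-x _))) i))
    where open RankFactorization (factorize A)

  injective⇒rk : ∀ {I : Set} {n} {{_ : Finite I}} (A : Mat I (Fin n)) →
    (∀ v → (∀ i → (A · v) i ≡ 0#) → ∀ j → v j ≡ 0#) → rk A ≡ n
  injective⇒rk {n = n} A inj = fromℕ-inj (trans (sym trace) (trans (tr-comm A G) (trans (tr-cong (left-inverse A inj)) (tr-Id n))))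
    where open RankFactorization (factorize A)

-- Generic combinations of positive semidefinite forms

module Generic (F : OrderedField) where
  open OrderedField F
  open Solver ring
  open Sums ring
  open LinAlg F

  two : K
  two = 1# + 1#

  NN-0 : NN 0#
  NN-0 = subst NN (zeroˡ 0#) (NN-sq 0#)

  NN-1 : NN 1#
  NN-1 = subst NN (*-identityˡ 1#) (NN-sq 1#)

  NN-∑ : ∀ {J : Set} {{_ : Finite J}} {f : J → K} → (∀ j → NN (f j)) → NN (∑ f)
  NN-∑ {J} {f} p = subst NN (sym (∑-def f)) (go enum)
    where
    go : (xs : List J) → NN (sumL xs f)
    go []       = NN-0
    go (x ∷ xs) = NN-+ (p x) (go xs)

  NN-sum0 : ∀ {x y} → NN x → NN y → x + y ≡ 0# → x ≡ 0#
  NN-sum0 {x} {y} nx ny e = NN-anti nx (subst NN (trans (solve 2 (λ x y → y := (x :+ y) :- x) refl x y) (trans (cong (_- x) e) (+-identityˡ _))) ny)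

  NN-rest : ∀ {J : Set} {{_ : Finite J}} {f : J → K} → (∀ j → NN (f j)) → ∀ j → NN (∑ f - f j)
  NN-rest {J} {f} p j = subst NN (trans (∑-cong (λ i → refl)) (trans (∑-sub f (λ i → δ j i * f i)) (cong (λ z → ∑ f - z) (∑-δ j f))))
    (NN-∑ {f = λ i → f i - δ j i * f i} term)
    where
    term : ∀ i → NN (f i - δ j i * f i)
    term i with j ≟ i
    ... | yes _ = subst NN (sym (trans (cong (λ z → f i - z) (*-identityˡ _)) (x-x _))) NN-0
    ... | no _  = subst NN (sym (trans (cong (λ z → f i - z) (zeroˡ _)) (trans (cong (f i +_) neg-0) (+-identityʳ _)))) (p i)

  dot : ∀ {J : Set} {{_ : Finite J}} → (J → K) → (J → K) → K
  dot v w = ∑[ j ] v j * w j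

  dot≡0 : ∀ {J : Set} {{_ : Finite J}} (v : J → K) → dot v v ≡ 0# → ∀ j → v j ≡ 0#
  dot≡0 v e j with v j ≟K 0#
  ... | yes z = z
  ... | no n  = ⊥-elim (*-≢0 n n (NN-sum0 (NN-sq (v j)) (NN-rest (λ j → NN-sq (v j)) j)
                  (trans (solve 2 (λ p q → p :+ (q :- p) := q) refl (v j * v j) (dot v v)) e)))

  quad : ∀ {J : Set} {{_ : Finite J}} → Mat J J → (J → K) → K
  quad S r = ∑[ i ] ∑[ j ] S i j * (r i * r j)

  private
    -- `c` is |s|, and the property is |s| x + s p ≥ 0 for |p| ≤ x.
    absolute : ∀ (s : K) → Σ K λ c → NN c × (∀ {x p} → NN (x + p) → NN (x - p) → NN (c * x + s * p))
    absolute s with NN-total s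
    ... | inj₁ n = s , n , λ {x} {p} a b → subst NN (solve 3 (λ s x p → s :* (x :+ p) := s :* x :+ s :* p) refl s x p) (NN-* n a)
    ... | inj₂ n = - s , n , λ {x} {p} a b → subst NN (solve 3 (λ s x p → (:- s) :* (x :- p) := (:- s) :* x :+ s :* p) refl s x p) (NN-* n b)

    -- The bound |r i · r j| ≤ r·r comes from (r i ± r j)² ≥ 0 and from each of (r i)² and (r j)²
    -- being at most r·r. Bounding the two squares separately covers the case i = j, and the factor
    -- 2 avoids halving.
    NN-2dot : ∀ {J : Set} {{_ : Finite J}} (r : J → K) i j →
      NN (two * dot r r + two * (r i * r j)) × NN (two * dot r r - two * (r i * r j))
    NN-2dot r i j =
      subst NN (solve 4 (λ d a b o → (d :- a :* a) :+ ((d :- b :* b) :+ (a :+ b) :* (a :+ b)) := (con 1ℤ :+ con 1ℤ) :* d :+ (con 1ℤ :+ con 1ℤ) :* (a :* b)) refl (dot r r) (r i) (r j) 1# ∙≡ two≡)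
        (NN-+ (NN-rest (λ j → NN-sq (r j)) i) (NN-+ (NN-rest (λ j → NN-sq (r j)) j) (NN-sq (r i + r j)))) ,
      subst NN (solve 4 (λ d a b o → (d :- a :* a) :+ ((d :- b :* b) :+ (a :- b) :* (a :- b)) := (con 1ℤ :+ con 1ℤ) :* d :- (con 1ℤ :+ con 1ℤ) :* (a :* b)) refl (dot r r) (r i) (r j) 1# ∙≡ two≡')
        (NN-+ (NN-rest (λ j → NN-sq (r j)) i) (NN-+ (NN-rest (λ j → NN-sq (r j)) j) (NN-sq (r i - r j))))
      where
      infixl 5 _∙≡_
      _∙≡_ : ∀ {x y z : K} → x ≡ y → y ≡ z → x ≡ z
      _∙≡_ = trans
      two≡ : (fromℤ 1ℤ + fromℤ 1ℤ) * dot r r + (fromℤ 1ℤ + fromℤ 1ℤ) * (r i * r j) ≡ two * dot r r + two * (r i * r j)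
      two≡ rewrite 1-homo = refl
      two≡' : (fromℤ 1ℤ + fromℤ 1ℤ) * dot r r - (fromℤ 1ℤ + fromℤ 1ℤ) * (r i * r j) ≡ two * dot r r - two * (r i * r j)
      two≡' rewrite 1-homo = refl

    bound : ∀ {J : Set} {{_ : Finite J}} (S : Mat J J) →
      Σ K λ C → NN C × (∀ r → NN (C * dot r r + two * quad S r))
    bound S = (∑[ i ] ∑[ j ] two * c i j) , NN-∑ (λ i → NN-∑ (λ j → NN-* (NN-+ NN-1 NN-1) (proj₁ (proj₂ (absolute (S i j)))))) ,
      λ r → subst NN (eq r) (NN-∑ (λ i → NN-∑ (λ j → proj₂ (proj₂ (absolute (S i j))) (proj₁ (NN-2dot r i j)) (proj₂ (NN-2dot r i j)))))
      where
      c : Mat _ _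
      c i j = proj₁ (absolute (S i j))
      open ≡-Reasoning
      eq : ∀ r → (∑[ i ] ∑[ j ] c i j * (two * dot r r) + S i j * (two * (r i * r j))) ≡ (∑[ i ] ∑[ j ] two * c i j) * dot r r + two * quad S r
      eq r = begin
        (∑[ i ] ∑[ j ] c i j * (two * dot r r) + S i j * (two * (r i * r j)))
          ≡⟨ ∑-cong (λ i → trans (∑-cong (λ j → solve 5 (λ c t d s p → c :* (t :* d) :+ s :* (t :* p) := t :* c :* d :+ t :* (s :* p)) refl (c i j) two (dot r r) (S i j) (r i * r j)))
                     (trans (∑-+ _ _) (cong₂ _+_ (∑-*ʳ (dot r r) _) (∑-*ˡ two _)))) ⟩
        (∑[ i ] (∑[ j ] two * c i j) * dot r r + two * (∑[ j ] S i j * (r i * r j)))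
          ≡⟨ trans (∑-+ _ _) (cong₂ _+_ (∑-*ʳ (dot r r) _) (∑-*ˡ two _)) ⟩
        (∑[ i ] ∑[ j ] two * c i j) * dot r r + two * quad S r ∎

  -- With C the sum of the constants from `bound` over all y, take t = 2 / (1 + C). For the value q
  -- of any of the forms at r this gives (1 + C)(r·r + t q) = r·r + (C r·r + 2 q), where the bracket
  -- is non-negative. So r·r + t q = 0 forces r·r = 0, for all the finitely many forms with the same
  -- t.
  small : ∀ {N} (n : Fin N → ℕ) (S : ∀ y → Mat (Fin (n y)) (Fin (n y))) →
    Σ K λ t → t ≢ 0# × (∀ y r → dot r r + t * quad (S y) r ≡ 0# → ∀ j → r j ≡ 0#)
  small n S = two * inv D , *-≢0 two≢0 inv≢0 , go
    where
    Cy : ∀ y → K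
    Cy y = proj₁ (bound (S y))
    NC : ∀ y → NN (Cy y)
    NC y = proj₁ (proj₂ (bound (S y)))
    C = ∑ Cy
    D = 1# + C
    two≢0 : two ≢ 0#
    two≢0 e = 1≢0 (NN-sum0 NN-1 NN-1 e)
    D≢0 : D ≢ 0#
    D≢0 e = 1≢0 (NN-sum0 NN-1 (NN-∑ NC) e)
    inv≢0 : inv D ≢ 0#
    inv≢0 e = 1≢0 (trans (sym (inverse D D≢0)) (trans (cong (D *_) e) (zeroʳ _)))
    go : ∀ y r → dot r r + (two * inv D) * quad (S y) r ≡ 0# → ∀ j → r j ≡ 0#
    go y r e = dot≡0 r (NN-sum0 (NN-∑ (λ j → NN-sq (r j)))
        (NN-+ (proj₂ (proj₂ (bound (S y))) r) (NN-* (NN-rest NC y) (NN-∑ (λ j → NN-sq (r j))))) (begin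
        d + (Cy y * d + two * q + (C - Cy y) * d)  ≡⟨ solve 5 (λ d cy t q c → d :+ (cy :* d :+ t :* q :+ (c :- cy) :* d) := d :+ c :* d :+ t :* q) refl d (Cy y) two q C ⟩
        d + C * d + two * q                        ≡⟨ cong (λ z → z + C * d + two * q) (sym (*-identityˡ d)) ⟩
        1# * d + C * d + two * q                   ≡⟨ cong₂ _+_ (sym (distribʳ d 1# C)) (trans (cong (_* (two * q)) (sym (inverse D D≢0)) ∙≡) refl) ⟩
        D * d + D * inv D * (two * q)              ≡⟨ solve 5 (λ D d i t q → D :* d :+ D :* i :* (t :* q) := D :* (d :+ (t :* i) :* q)) refl D d (inv D) two q ⟩
        D * (d + two * inv D * q)                  ≡⟨ trans (cong (D *_) e) (zeroʳ _) ⟩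
        0# ∎))
      where
      open ≡-Reasoning
      d = dot r r
      q = quad (S y) r
      _∙≡ : ∀ {z} → 1# * (two * q) ≡ z → two * q ≡ z
      p ∙≡ = trans (sym (*-identityˡ _)) p

  module _ {f g : ℕ} (A : Mat (Fin f) (Fin f)) (A-sym : ∀ i j → A i j ≡ A j i) (R : Mat (Fin g) (Fin f)) (s : K) where
    private
      open RankFactorization (factorize A) using (G; AGA)
      Rᵗ : Mat (Fin f) (Fin g)
      Rᵗ i j = R j i
      H : Mat (Fin g) (Fin g)
      H = R ∙ (G ∙ Rᵗ)

    pencilForm : Mat (Fin g) (Fin g)
    pencilForm i j = s * H i j

    -- If (A + t s RᵗR) v = 0 and n = v - GAv then An = 0, so Rn is orthogonal to r = Rv, while Rn = r + t s (R G Rᵗ) r.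
    pencil : ∀ t → t ≢ 0# → (∀ r → dot r r + t * quad pencilForm r ≡ 0# → ∀ j → r j ≡ 0#) →
      ∀ v → (∀ i → (A · v) i + s * t * (Rᵗ · (R · v)) i ≡ 0#) →
      (∀ i → (A · v) i ≡ 0#) × (s ≢ 0# → ∀ j → (R · v) j ≡ 0#)
    pencil t t≢0 sm v e = Av≡0 , λ s≢0 → r≡0 s≢0
      where
      open ≡-Reasoning
      r = R · v
      n : Fin f → K
      n i = v i - (G · (A · v)) i
      Av : ∀ i → (A · v) i ≡ - (s * t) * (Rᵗ · r) i
      Av i = x-y≡0 (trans (solve 3 (λ a c b → a :- (:- c) :* b := a :+ c :* b) refl ((A · v) i) (s * t) ((Rᵗ · r) i)) (e i))
      An : ∀ i → (A · n) i ≡ 0#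
      An i = trans (∙-subʳ A (λ j (_ : Fin 1) → v j) (λ j _ → (G · (A · v)) j) i zero)
        (trans (cong (λ z → (A · v) i - z) (trans (sym (·-assoc A G (A · v) i)) (trans (sym (·-assoc (A ∙ G) A v i)) (∑-cong (λ j → cong (_* v j) (AGA i j)))))) (x-x _))
      nAv : dot n (A · v) ≡ 0#
      nAv = begin
        (∑[ i ] n i * (∑[ j ] A i j * v j))    ≡⟨ ∑-cong (λ i → sym (∑-*ˡ (n i) _)) ⟩
        (∑[ i ] ∑[ j ] n i * (A i j * v j))    ≡⟨ ∑-swap _ ⟩
        (∑[ j ] ∑[ i ] n i * (A i j * v j))    ≡⟨ ∑-cong (λ j → trans (∑-cong (λ i → trans (cong (λ z → n i * (z * v j)) (A-sym i j)) (solve 3 (λ n a v → n :* (a :* v) := v :* (a :* n)) refl (n i) (A j i) (v j)))) (∑-*ˡ (v j) _)) ⟩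
        (∑[ j ] v j * (A · n) j)               ≡⟨ ∑-0 (λ j → trans (cong (v j *_) (An j)) (zeroʳ _)) ⟩
        0# ∎
      adj : ∀ (x : Fin f → K) (y : Fin g → K) → dot x (Rᵗ · y) ≡ dot (R · x) y
      adj x y = begin
        (∑[ i ] x i * (∑[ j ] R j i * y j))    ≡⟨ ∑-cong (λ i → sym (∑-*ˡ (x i) _)) ⟩
        (∑[ i ] ∑[ j ] x i * (R j i * y j))    ≡⟨ ∑-swap _ ⟩
        (∑[ j ] ∑[ i ] x i * (R j i * y j))    ≡⟨ ∑-cong (λ j → trans (∑-cong (λ i → solve 3 (λ n a v → n :* (a :* v) := a :* n :* v) refl (x i) (R j i) (y j))) (∑-*ʳ (y j) _)) ⟩
        (∑[ j ] (R · x) j * y j) ∎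
      Rn : ∀ j → (R · n) j ≡ r j + s * t * (H · r) j
      Rn j = begin
        (R · n) j ≡⟨ ∙-subʳ R (λ j (_ : Fin 1) → v j) (λ j _ → (G · (A · v)) j) j zero ⟩
        r j - (R · (G · (A · v))) j ≡⟨ cong (λ z → r j - z) (begin
          (R · (G · (A · v))) j                        ≡⟨ ·-cong R (·-cong G Av) j ⟩
          (R · (G · (λ i → - (s * t) * (Rᵗ · r) i))) j ≡⟨ ·-cong R (λ i → trans (∑-cong (λ k → solve 3 (λ a b c → a :* (b :* c) := b :* (a :* c)) refl (G i k) (- (s * t)) ((Rᵗ · r) k))) (∑-*ˡ _ _)) j ⟩
          (R · (λ i → - (s * t) * (G · (Rᵗ · r)) i)) j ≡⟨ trans (∑-cong (λ k → solve 3 (λ a b c → a :* (b :* c) := b :* (a :* c)) refl (R j k) (- (s * t)) ((G · (Rᵗ · r)) k))) (∑-*ˡ _ _) ⟩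
          - (s * t) * (R · (G · (Rᵗ · r))) j           ≡⟨ cong (- (s * t) *_) (trans (·-cong R (λ i → sym (·-assoc G Rᵗ r i)) j) (sym (·-assoc R (G ∙ Rᵗ) r j))) ⟩
          - (s * t) * (H · r) j ∎) ⟩
        r j - - (s * t) * (H · r) j ≡⟨ solve 3 (λ r c h → r :- (:- c) :* h := r :+ c :* h) refl (r j) (s * t) ((H · r) j) ⟩
        r j + s * t * (H · r) j ∎
      Rn·r : s ≢ 0# → dot (R · n) r ≡ 0#
      Rn·r s≢0 = *-cancel0 {s * t} (begin
        s * t * dot (R · n) r                        ≡⟨ cong (s * t *_) (sym (adj n r)) ⟩
        s * t * dot n (Rᵗ · r)                       ≡⟨ sym (∑-*ˡ _ _) ⟩
        (∑[ i ] s * t * (n i * (Rᵗ · r) i))          ≡⟨ ∑-cong (λ i → solve 4 (λ s t n x → s :* t :* (n :* x) := :- (n :* ((:- (s :* t)) :* x))) refl s t (n i) ((Rᵗ · r) i)) ⟩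
        (∑[ i ] - (n i * (- (s * t) * (Rᵗ · r) i)))  ≡⟨ ∑-neg _ ⟩
        - (∑[ i ] n i * (- (s * t) * (Rᵗ · r) i))    ≡⟨ cong -_ (trans (∑-cong (λ i → cong (n i *_) (sym (Av i)))) nAv) ⟩
        - 0#                                         ≡⟨ neg-0 ⟩
        0# ∎) (*-≢0 s≢0 t≢0)
      r≡0 : s ≢ 0# → ∀ j → r j ≡ 0#
      r≡0 s≢0 = sm r (begin
        dot r r + t * quad pencilForm r              ≡⟨ cong (dot r r +_) (trans (cong (t *_) quadEq) (sym (∑-*ˡ t _))) ⟩
        dot r r + (∑[ i ] t * (s * (H · r) i * r i)) ≡⟨ sym (∑-+ _ _) ⟩
        (∑[ i ] r i * r i + t * (s * (H · r) i * r i)) ≡⟨ ∑-cong (λ i → trans (solve 4 (λ r t s h → r :* r :+ t :* (s :* h :* r) := (r :+ s :* t :* h) :* r) refl (r i) t s ((H · r) i)) (cong (_* r i) (sym (Rn i)))) ⟩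
        dot (R · n) r                                ≡⟨ Rn·r s≢0 ⟩
        0# ∎)
        where
        quadEq : quad pencilForm r ≡ (∑[ i ] s * (H · r) i * r i)
        quadEq = ∑-cong (λ i → trans (∑-cong (λ j → solve 4 (λ s h a b → s :* h :* (a :* b) := (s :* a) :* (h :* b)) refl s (H i j) (r i) (r j)))
                   (trans (∑-*ˡ _ _) (solve 3 (λ s r h → s :* r :* h := s :* h :* r) refl s (r i) ((H · r) i))))
      Av≡0 : ∀ i → (A · v) i ≡ 0#
      Av≡0 i with s ≟K 0#
      ... | no s≢0 = trans (Av i) (trans (cong (- (s * t) *_) (∑-0 (λ j → trans (cong (R j i *_) (r≡0 s≢0 j)) (zeroʳ _)))) (zeroʳ _))
      ... | yes s≡0 = trans (Av i) (trans (cong (λ z → - (z * t) * (Rᵗ · r) i) s≡0) (solve 2 (λ t x → (:- (con 0ℤ :* t)) :* x := con 0ℤ) refl t ((Rᵗ · r) i) ∙≡))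
        where
        _∙≡ : ∀ {x} → - (fromℤ 0ℤ * t) * x ≡ fromℤ 0ℤ → - (0# * t) * x ≡ 0#
        _∙≡ p rewrite 0-homo = p

  gram : ∀ {N n} {f : Fin N → ℕ} {g : Fin n → ℕ} (R : ∀ y x → Mat (Fin (g x)) (Fin (f y))) (s : Fin N → Fin n → K) (t : Fin n → K) →
    ∀ y → Mat (Fin (f y)) (Fin (f y))
  gram R s t y j k = ∑[ x ] s y x * t x * (∑[ l ] R y x l j * R y x l k)

  gram-sym : ∀ {N n} {f : Fin N → ℕ} {g : Fin n → ℕ} (R : ∀ y x → Mat (Fin (g x)) (Fin (f y))) s t y j k →
    gram R s t y j k ≡ gram R s t y k j
  gram-sym R s t y j k = ∑-cong (λ x → cong (s y x * t x *_) (∑-cong (λ l → *-comm _ _)))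

  -- Induction on the number of terms. A signed sum of squares can degenerate for special t, so the
  -- coefficient of the first index is chosen last, small against the forms `pencilForm` that arise
  -- from the remaining terms; `pencil` then separates the kernel of the new term from the kernel of
  -- the old form, for every y at once.
  generic : ∀ {N n} {f : Fin N → ℕ} {g : Fin n → ℕ} (R : ∀ y x → Mat (Fin (g x)) (Fin (f y))) (s : Fin N → Fin n → K) →
    Σ (Fin n → K) λ t → ∀ y v → (∀ i → (gram R s t y · v) i ≡ 0#) → ∀ x → s y x ≢ 0# → ∀ j → (R y x · v) j ≡ 0#
  generic {n = zero} R s = (λ ()) , λ _ _ _ ()
  generic {N} {suc n} {f} {g} R s = t' , conclude
    where
    R₁ = λ y x → R y (suc x)
    s₁ = λ y x → s y (suc x)
    t = proj₁ (generic R₁ s₁)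
    A : ∀ y → Mat (Fin (f y)) (Fin (f y))
    A = gram R₁ s₁ t
    A-sym : ∀ y i j → A y i j ≡ A y j i
    A-sym = gram-sym R₁ s₁ t
    S : ∀ y → Mat (Fin (g zero)) (Fin (g zero))
    S y = pencilForm (A y) (A-sym y) (R y zero) (s y zero)
    t₀ = proj₁ (small (λ _ → g zero) S)
    t' : Fin (suc n) → K
    t' zero    = t₀
    t' (suc x) = t x
    expand : ∀ y v i → (gram R s t' y · v) i ≡ (A y · v) i + s y zero * t₀ * (∑[ j ] R y zero j i * (R y zero · v) j)
    expand y v i = begin
      (∑[ k ] gram R s t' y i k * v k)
        ≡⟨ ∑-cong (λ k → trans (cong (_* v k) (∑Fin-suc {n} _)) (solve 3 (λ a b v → (a :+ b) :* v := b :* v :+ a :* v) refl _ (A y i k) (v k))) ⟩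
      (∑[ k ] A y i k * v k + s y zero * t₀ * (∑[ l ] R y zero l i * R y zero l k) * v k)
        ≡⟨ ∑-+ _ _ ⟩
      (A y · v) i + (∑[ k ] s y zero * t₀ * (∑[ l ] R y zero l i * R y zero l k) * v k)
        ≡⟨ cong ((A y · v) i +_) (trans (∑-cong (λ k → *-assoc _ _ _)) (trans (∑-*ˡ (s y zero * t₀) _)
             (cong (s y zero * t₀ *_) (·-assoc (λ i l → R y zero l i) (R y zero) v i)))) ⟩
      (A y · v) i + s y zero * t₀ * (∑[ j ] R y zero j i * (R y zero · v) j) ∎
      where open ≡-Reasoning
    conclude : ∀ y v → (∀ i → (gram R s t' y · v) i ≡ 0#) → ∀ x → s y x ≢ 0# → ∀ j → (R y x · v) j ≡ 0#
    conclude y v e = λ { zero → proj₂ P ; (suc x) → proj₂ (generic R₁ s₁) y v (proj₁ P) x }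
      where
      P = pencil (A y) (A-sym y) (R y zero) (s y zero) t₀ (proj₁ (proj₂ (small (λ _ → g zero) S)))
            (proj₂ (proj₂ (small (λ _ → g zero) S)) y) v (λ i → trans (sym (expand y v i)) (e i))

-- Determinantal rank

private
  adjacent-punchIn : ∀ {n} (j : Fin (suc (suc n))) (k : Fin (suc n)) → j ≢ inject₁ k → j ≢ suc k →
    Σ (Fin n) λ l → punchIn j (inject₁ l) ≡ inject₁ k × punchIn j (suc l) ≡ suc k
  adjacent-punchIn zero zero a b = ⊥-elim (a refl)
  adjacent-punchIn {suc n} zero (suc k) a b = k , refl , refl
  adjacent-punchIn (suc zero) zero a b = ⊥-elim (b refl)
  adjacent-punchIn {suc n} (suc (suc j)) zero a b = zero , refl , refl
  adjacent-punchIn {suc n} (suc j) (suc k) a b with adjacent-punchIn j k (λ e → a (cong suc e)) (λ e → b (cong suc e))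
  ... | l , e , e' = suc l , cong suc e , cong suc e'

  punchIn-adjacent : ∀ {n} (k : Fin n) (l : Fin n) →
    punchIn (inject₁ k) l ≡ punchIn (suc k) l ⊎ (punchIn (inject₁ k) l ≡ suc k × punchIn (suc k) l ≡ inject₁ k)
  punchIn-adjacent zero zero = inj₂ (refl , refl)
  punchIn-adjacent zero (suc l) = inj₁ refl
  punchIn-adjacent (suc k) zero = inj₁ refl
  punchIn-adjacent (suc k) (suc l) with punchIn-adjacent k l
  ... | inj₁ e = inj₁ (cong suc e)
  ... | inj₂ (e , e') = inj₂ (cong suc e , cong suc e')

  inject₁≢suc : ∀ {n} (k : Fin n) → inject₁ k ≢ suc k
  inject₁≢suc (suc k) e = inject₁≢suc k (Finₚ.suc-injective e)

module Det (F : OrderedField) where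
  open OrderedField F
  open Solver ring
  open Sums ring
  open LinAlg F

  sg : ℕ → K
  sg n = fromℤ (sgn n)

  sg-suc : ∀ n → sg (suc n) ≡ - sg n
  sg-suc n = -‿homo (sgn n)

  fromℤ-sumFin : ∀ {n} (f : Fin n → ℤ) → fromℤ (sumFin f) ≡ (∑[ i ] fromℤ (f i))
  fromℤ-sumFin {zero}  f = trans 0-homo (sym (∑Fin-zero _))
  fromℤ-sumFin {suc n} f = trans (+-homo (f zero) _) (trans (cong (fromℤ (f zero) +_) (fromℤ-sumFin (λ i → f (suc i)))) (sym (∑Fin-suc {n} _)))

  Sq : ℕ → Set
  Sq n = Mat (Fin n) (Fin n)

  minor : ∀ {n} → Fin (suc n) → Sq (suc n) → Sq n
  minor j M i k = M (suc i) (punchIn j k)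

  detK : ∀ n → Sq n → K
  detK zero    M = 1#
  detK (suc n) M = ∑[ j ] sg (toℕ j) * (M zero j * detK n (minor j M))

  detK-cong : ∀ n {M M' : Sq n} → M ≋ M' → detK n M ≡ detK n M'
  detK-cong zero    e = refl
  detK-cong (suc n) e = ∑-cong (λ j → cong (sg (toℕ j) *_) (cong₂ _*_ (e zero j) (detK-cong n (λ i k → e (suc i) (punchIn j k)))))

  fromℤ-det : ∀ n (M : Matrix n n) → fromℤ (det n M) ≡ detK n (λ i j → fromℤ (M i j))
  fromℤ-det zero    M = 1-homo
  fromℤ-det (suc n) M = trans (fromℤ-sumFin _) (∑-cong (λ j → trans (*-homo _ _) (cong (sg (toℕ j) *_) (trans (*-homo _ _) (cong (fromℤ (M zero j) *_) (fromℤ-det n _))))))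

  setCol : ∀ {n} → Sq n → Fin n → (Fin n → K) → Sq n
  setCol M c u i k = if does (k ≟ c) then u i else M i k

  setCol-≡ : ∀ {n} (M : Sq n) c u i → setCol M c u i c ≡ u i
  setCol-≡ M c u i with c ≟ c
  ... | yes _ = refl
  ... | no n  = ⊥-elim (n refl)

  setCol-≢ : ∀ {n} (M : Sq n) c u i {k} → k ≢ c → setCol M c u i k ≡ M i k
  setCol-≢ M c u i {k} n with k ≟ c
  ... | yes e = ⊥-elim (n e)
  ... | no _  = refl

  minor-setCol : ∀ {n} (M : Sq (suc n)) c u → minor c (setCol M c u) ≋ minor c M
  minor-setCol M c u i k = setCol-≢ M c u (suc i) (Finₚ.punchInᵢ≢i c k)

  minor-setCol-≢ : ∀ {n} (M : Sq (suc n)) {j c} (ne : j ≢ c) u →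
    minor j (setCol M c u) ≋ setCol (minor j M) (punchOut ne) (λ i → u (suc i))
  minor-setCol-≢ M {j} {c} ne u i k with k ≟ punchOut ne
  ... | yes refl = trans (cong (setCol M c u (suc i)) (Finₚ.punchIn-punchOut ne)) (setCol-≡ M c u (suc i))
  ... | no nk    = setCol-≢ M c u (suc i) (λ e → nk (Finₚ.punchIn-injective j k (punchOut ne) (trans e (sym (Finₚ.punchIn-punchOut ne)))))

  -- Linearity in one column, packaged as a coefficient vector: additivity, homogeneity and the
  -- substitution of a linear combination of columns all follow from it.
  cofactor : ∀ {n} (M : Sq n) c → Σ (Fin n → K) λ γ → ∀ u → detK n (setCol M c u) ≡ (∑[ i ] u i * γ i)
  cofactor {suc n} M c = γ , λ u → trans (∑-cong (term u)) (trans (∑-swap _) (∑-cong (λ i → ∑-*ˡ (u i) (λ j → β j i))))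
    where
    open ≡-Reasoning
    rec : ∀ j → (ne : j ≢ c) → Σ (Fin n → K) λ γ → ∀ u → detK n (setCol (minor j M) (punchOut ne) u) ≡ (∑[ i ] u i * γ i)
    rec j ne = cofactor (minor j M) (punchOut ne)

    β' : ∀ j → Dec (j ≡ c) → Fin (suc n) → K
    β' j (yes _) zero    = sg (toℕ j) * detK n (minor j M)
    β' j (yes _) (suc i) = 0#
    β' j (no ne) zero    = 0#
    β' j (no ne) (suc i) = sg (toℕ j) * (M zero j * proj₁ (rec j ne) i)

    β : Fin (suc n) → Fin (suc n) → K
    β j i = β' j (j ≟ c) i

    γ : Fin (suc n) → K
    γ i = ∑[ j ] β j i

    term : ∀ u j → sg (toℕ j) * (setCol M c u zero j * detK n (minor j (setCol M c u))) ≡ (∑[ i ] u i * β j i)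
    term u j = trans (body (j ≟ c)) (sym (∑Fin-suc {n} _))
      where
      body : (d : Dec (j ≡ c)) → sg (toℕ j) * ((if does d then u zero else M zero j) * detK n (minor j (setCol M c u)))
             ≡ u zero * β' j d zero + (∑[ i ] u (suc i) * β' j d (suc i))
      body (yes refl) = begin
        sg (toℕ j) * (u zero * detK n (minor j (setCol M j u)))   ≡⟨ cong (λ z → sg (toℕ j) * (u zero * z)) (detK-cong n (minor-setCol M j u)) ⟩
        sg (toℕ j) * (u zero * detK n (minor j M))                ≡⟨ solve 3 (λ s u d → s :* (u :* d) := u :* (s :* d)) refl _ _ _ ⟩
        u zero * (sg (toℕ j) * detK n (minor j M))                ≡⟨ sym (+-identityʳ _) ⟩
        u zero * (sg (toℕ j) * detK n (minor j M)) + 0#           ≡⟨ cong (u zero * (sg (toℕ j) * detK n (minor j M)) +_) (sym (∑-0 (λ i → zeroʳ _))) ⟩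
        u zero * (sg (toℕ j) * detK n (minor j M)) + (∑[ i ] u (suc i) * 0#) ∎
      body (no ne) = begin
        sg (toℕ j) * (M zero j * detK n (minor j (setCol M c u)))
          ≡⟨ cong (λ z → sg (toℕ j) * (M zero j * z)) (trans (detK-cong n (minor-setCol-≢ M ne u)) (proj₂ (rec j ne) (λ i → u (suc i)))) ⟩
        sg (toℕ j) * (M zero j * (∑[ i ] u (suc i) * proj₁ (rec j ne) i))
          ≡⟨ trans (sym (*-assoc _ _ _)) (trans (sym (∑-*ˡ _ _)) (∑-cong (λ i → solve 4 (λ s m u g → s :* m :* (u :* g) := u :* (s :* (m :* g))) refl (sg (toℕ j)) (M zero j) (u (suc i)) (proj₁ (rec j ne) i)))) ⟩
        (∑[ i ] u (suc i) * (sg (toℕ j) * (M zero j * proj₁ (rec j ne) i)))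
          ≡⟨ trans (sym (+-identityˡ _)) (cong (_+ (∑[ i ] u (suc i) * (sg (toℕ j) * (M zero j * proj₁ (rec j ne) i)))) (sym (zeroʳ (u zero)))) ⟩
        u zero * 0# + (∑[ i ] u (suc i) * (sg (toℕ j) * (M zero j * proj₁ (rec j ne) i))) ∎

  ∑-two : ∀ {n} {a b : Fin n} (f : Fin n → K) → a ≢ b → (∀ j → j ≢ a → j ≢ b → f j ≡ 0#) → ∑ f ≡ f a + f b
  ∑-two {a = a} {b} f ne z = trans (∑-cong term) (trans (∑-+ _ _) (cong₂ _+_ (∑-δ a f) (∑-δ b f)))
    where
    term : ∀ j → f j ≡ δ a j * f j + δ b j * f j
    term j with a ≟ j | b ≟ j
    ... | yes refl | yes refl = ⊥-elim (ne refl)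
    ... | yes refl | no _     = sym (trans (cong₂ _+_ (*-identityˡ _) (zeroˡ _)) (+-identityʳ _))
    ... | no _     | yes refl = sym (trans (cong₂ _+_ (zeroˡ _) (*-identityˡ _)) (+-identityˡ _))
    ... | no x     | no y     = trans (z j (λ e → x (sym e)) (λ e → y (sym e))) (sym (trans (cong₂ _+_ (zeroˡ _) (zeroˡ _)) (+-identityˡ _)))

  -- In the expansion along the first row, deleting any other column leaves two equal adjacent
  -- columns, so that minor vanishes by induction. The two remaining terms have equal minors and
  -- opposite signs.
  detK-adjacent : ∀ n (M : Sq (suc n)) (k : Fin n) → (∀ i → M i (inject₁ k) ≡ M i (suc k)) → detK (suc n) M ≡ 0#
  detK-adjacent (suc n) M k eq = trans (∑-two _ (inject₁≢suc k) others) (begin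
      sg (toℕ (inject₁ k)) * (M zero (inject₁ k) * detK (suc n) (minor (inject₁ k) M)) + sg (suc (toℕ k)) * (M zero (suc k) * D)
        ≡⟨ cong₂ _+_ (cong₂ _*_ (cong sg (Finₚ.toℕ-inject₁ k)) (cong₂ _*_ (eq zero) (detK-cong (suc n) same))) (cong (_* (M zero (suc k) * D)) (sg-suc (toℕ k))) ⟩
      sg (toℕ k) * (M zero (suc k) * D) + - sg (toℕ k) * (M zero (suc k) * D)
        ≡⟨ trans (solve 2 (λ s x → s :* x :+ (:- s) :* x := con 0ℤ) refl _ _) 0-homo ⟩
      0# ∎)
    where
    open ≡-Reasoning
    D = detK (suc n) (minor (suc k) M)
    same : minor (inject₁ k) M ≋ minor (suc k) M
    same i l with punchIn-adjacent k l
    ... | inj₁ e = cong (M (suc i)) e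
    ... | inj₂ (e , e') = trans (cong (M (suc i)) e) (trans (sym (eq (suc i))) (cong (M (suc i)) (sym e')))
    others : ∀ j → j ≢ inject₁ k → j ≢ suc k → sg (toℕ j) * (M zero j * detK (suc n) (minor j M)) ≡ 0#
    others j a b with adjacent-punchIn j k a b
    ... | l , e , e' = trans (cong (λ z → sg (toℕ j) * (M zero j * z)) (detK-adjacent n (minor j M) l
            (λ i → trans (cong (M (suc i)) e) (trans (eq (suc i)) (cong (M (suc i)) (sym e'))))))
            (trans (cong (sg (toℕ j) *_) (zeroʳ _)) (zeroʳ _))

  setCol-+ : ∀ {n} (M : Sq n) c u w → detK n (setCol M c (λ i → u i + w i)) ≡ detK n (setCol M c u) + detK n (setCol M c w)
  setCol-+ M c u w with cofactor M c
  ... | γ , lin = trans (lin _) (trans (∑-cong (λ i → distribʳ _ _ _)) (trans (∑-+ _ _) (cong₂ _+_ (sym (lin u)) (sym (lin w)))))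

  setCol₂ : ∀ {n} (M : Sq (suc n)) (k : Fin n) (u w : Fin (suc n) → K) → Sq (suc n)
  setCol₂ M k u w = setCol (setCol M (suc k) w) (inject₁ k) u

  setCol₂-comm : ∀ {n} (M : Sq (suc n)) (k : Fin n) u w → setCol₂ M k u w ≋ setCol (setCol M (inject₁ k) u) (suc k) w
  setCol₂-comm M k u w i j with j ≟ inject₁ k | j ≟ suc k
  ... | yes p | yes q = ⊥-elim (inject₁≢suc k (trans (sym p) q))
  ... | yes p | no q  = refl
  ... | no p  | yes q = refl
  ... | no p  | no q  = refl

  -- Polarisation: the determinant with u + w in both columns vanishes, and so do the terms with u
  -- twice and w twice.
  detK-swap : ∀ {n} (M : Sq (suc n)) (k : Fin n) u w → detK (suc n) (setCol₂ M k u w) ≡ - detK (suc n) (setCol₂ M k w u)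
  detK-swap {n} M k u w = x-y≡0 (begin
    D u w - - D w u                         ≡⟨ solve 2 (λ a b → a :- (:- b) := con 0ℤ :+ a :+ (b :+ con 0ℤ)) refl (D u w) (D w u) ⟩
    fromℤ 0ℤ + D u w + (D w u + fromℤ 0ℤ)   ≡⟨ cong₂ _+_ (cong (_+ D u w) (trans 0-homo (sym (alt u)))) (cong (D w u +_) (trans 0-homo (sym (alt w)))) ⟩
    D u u + D u w + (D w u + D w w)         ≡⟨ cong₂ _+_ (sym (right u)) (sym (right w)) ⟩
    D u s + D w s                           ≡⟨ sym (setCol-+ (setCol M (suc k) s) (inject₁ k) u w) ⟩
    D s s                                   ≡⟨ alt s ⟩
    0# ∎)
    where
    open ≡-Reasoning
    D : (u w : Fin (suc n) → K) → K
    D u w = detK (suc n) (setCol₂ M k u w)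
    s : Fin (suc n) → K
    s i = u i + w i
    alt : ∀ u → D u u ≡ 0#
    alt u = detK-adjacent n (setCol₂ M k u u) k (λ i → trans (setCol-≡ (setCol M (suc k) u) (inject₁ k) u i)
      (sym (trans (setCol-≢ (setCol M (suc k) u) (inject₁ k) u i (λ e → inject₁≢suc k (sym e))) (setCol-≡ M (suc k) u i))))
    right : ∀ x → D x s ≡ D x u + D x w
    right x = trans (detK-cong (suc n) (setCol₂-comm M k x s)) (trans (setCol-+ (setCol M (inject₁ k) x) (suc k) u w)
      (sym (cong₂ _+_ (detK-cong (suc n) (setCol₂-comm M k x u)) (detK-cong (suc n) (setCol₂-comm M k x w)))))

  setCol₂-self : ∀ {n} (M : Sq (suc n)) (k : Fin n) → setCol₂ M k (λ i → M i (inject₁ k)) (λ i → M i (suc k)) ≋ M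
  setCol₂-self M k i j with j ≟ inject₁ k
  ... | yes refl = refl
  ... | no _ with j ≟ suc k
  ...   | yes refl = refl
  ...   | no _ = refl

  -- Induction on the distance of the two equal columns: an adjacent swap, which only changes the
  -- sign, moves the right one a step towards the left one.
  detK-equal : ∀ d n (M : Sq n) (p q : Fin n) → toℕ q ≡ suc d ℕ.+ toℕ p → (∀ i → M i p ≡ M i q) → detK n M ≡ 0#
  detK-equal zero (suc n) M p (suc k) e eq =
    detK-adjacent n M k (λ i → trans (cong (M i) (Finₚ.toℕ-injective (trans (Finₚ.toℕ-inject₁ k) (ℕₚ.suc-injective e)))) (eq i))
  detK-equal (suc d) (suc n) M p (suc k) e eq = begin
    detK (suc n) M           ≡⟨ detK-cong (suc n) (λ i j → sym (setCol₂-self M k i j)) ⟩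
    detK (suc n) (setCol₂ M k (λ i → M i (inject₁ k)) (λ i → M i (suc k))) ≡⟨ detK-swap M k u₀ w₀ ⟩
    - detK (suc n) M'        ≡⟨ cong -_ (detK-equal d (suc n) M' p (inject₁ k) (trans (Finₚ.toℕ-inject₁ k) (ℕₚ.suc-injective e))
                                  (λ i → trans (p-col i) (trans (eq i) (sym (setCol-≡ (setCol M (suc k) u₀) (inject₁ k) w₀ i))))) ⟩
    - 0#                     ≡⟨ neg-0 ⟩
    0# ∎
    where
    open ≡-Reasoning
    u₀ = λ i → M i (inject₁ k)
    w₀ = λ i → M i (suc k)
    M' = setCol₂ M k w₀ u₀
    tk : toℕ k ≡ suc d ℕ.+ toℕ p
    tk = ℕₚ.suc-injective e
    p≢1 : p ≢ inject₁ k
    p≢1 refl = ℕₚ.m≢1+n+m (toℕ k) (trans tk (cong (λ z → suc d ℕ.+ z) (Finₚ.toℕ-inject₁ k)))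
    p≢2 : p ≢ suc k
    p≢2 refl = ℕₚ.m≢1+n+m (toℕ k) (trans tk (ℕₚ.+-suc (suc d) (toℕ k)))
    p-col : ∀ i → M' i p ≡ M i p
    p-col i = trans (setCol-≢ (setCol M (suc k) u₀) (inject₁ k) w₀ i p≢1) (setCol-≢ M (suc k) u₀ i p≢2)

  detK-alternating : ∀ {n} (M : Sq n) {p q} → p ≢ q → (∀ i → M i p ≡ M i q) → detK n M ≡ 0#
  detK-alternating {n} M {p} {q} ne eq with ℕₚ.<-cmp (toℕ p) (toℕ q)
  ... | tri≈ _ e _ = ⊥-elim (ne (Finₚ.toℕ-injective e))
  ... | tri< l _ _ = detK-equal (toℕ q ℕ.∸ suc (toℕ p)) n M p q (trans (sym (ℕₚ.m∸n+n≡m l)) (ℕₚ.+-suc _ _)) eq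
  ... | tri> _ _ l = detK-equal (toℕ p ℕ.∸ suc (toℕ q)) n M q p (trans (sym (ℕₚ.m∸n+n≡m l)) (ℕₚ.+-suc _ _)) (λ i → sym (eq i))

  -- Replacing column c by M v multiplies the determinant by v c, since every other column
  -- contributes a matrix with a repeated column; but M v is zero.
  detK-kernel : ∀ {n} (M : Sq n) v → (∀ i → (M · v) i ≡ 0#) → ∀ c → v c ≢ 0# → detK n M ≡ 0#
  detK-kernel {n} M v e c vc = *-cancel0 {v c} (begin
    v c * detK n M                              ≡⟨ cong (v c *_) (detK-cong n (λ i k → sym (self i k))) ⟩
    v c * detK n (setCol M c (λ i → M i c))     ≡⟨ sym (∑-one c (λ l → v l * detK n (setCol M c (λ i → M i l))) other) ⟩
    (∑[ l ] v l * detK n (setCol M c (λ i → M i l))) ≡⟨ ∑-cong (λ l → trans (cong (v l *_) (lin (λ i → M i l))) (sym (∑-*ˡ (v l) _))) ⟩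
    (∑[ l ] ∑[ i ] v l * (M i l * γ i))         ≡⟨ ∑-swap _ ⟩
    (∑[ i ] ∑[ l ] v l * (M i l * γ i))         ≡⟨ ∑-0 (λ i → trans (∑-cong (λ l → solve 3 (λ v m g → v :* (m :* g) := m :* v :* g) refl (v l) (M i l) (γ i))) (trans (∑-*ʳ (γ i) _) (trans (cong (_* γ i) (e i)) (zeroˡ _)))) ⟩
    0# ∎) vc
    where
    open ≡-Reasoning
    γ = proj₁ (cofactor M c)
    lin = proj₂ (cofactor M c)
    self : ∀ i k → setCol M c (λ i → M i c) i k ≡ M i k
    self i k with k ≟ c
    ... | yes refl = refl
    ... | no _ = refl
    other : ∀ l → l ≢ c → v l * detK n (setCol M c (λ i → M i l)) ≡ 0#
    other l ne = trans (cong (v l *_) (detK-alternating (setCol M c (λ i → M i l)) {l} {c} ne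
      (λ i → trans (setCol-≢ M c (λ i → M i l) i ne) (sym (setCol-≡ M c (λ i → M i l) i))))) (zeroʳ _)

  -- Id - Y X is idempotent of trace s - r. The trace of an idempotent is the dimension of its
  -- image, hence a natural number d with d + r = s.
  Id-factor⇒≤ : ∀ {r s} (X : Mat (Fin r) (Fin s)) (Y : Mat (Fin s) (Fin r)) → X ∙ Y ≋ Id → r ℕ.≤ s
  Id-factor⇒≤ {r} {s} X Y XY = ℕₚ.m+n≤o⇒n≤o dim (ℕₚ.≤-reflexive (fromℕ-inj (begin
      fromℕ (dim ℕ.+ r)             ≡⟨ fromℕ-+ dim r ⟩
      fromℕ dim + fromℕ r           ≡⟨ cong (_+ fromℕ r) (trans tr-dim (tr-sub Id (Y ∙ X))) ⟩
      tr (Id {Fin s}) - tr (Y ∙ X) + fromℕ r ≡⟨ cong₂ (λ a b → a - b + fromℕ r) (tr-Id s) (trans (tr-comm Y X) (trans (tr-cong XY) (tr-Id r))) ⟩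
      fromℕ s - fromℕ r + fromℕ r   ≡⟨ solve 2 (λ s r → s :- r :+ r := s) refl (fromℕ s) (fromℕ r) ⟩
      fromℕ s ∎)))
    where
    open ≡-Reasoning
    YX : (Y ∙ X) ∙ (Y ∙ X) ≋ Y ∙ X
    YX i j = trans (∙-assoc Y X (Y ∙ X) i j) (∙-congʳ Y (λ i j → trans (sym (∙-assoc X Y X i j)) (trans (∙-congˡ X XY i j) (∙-idˡ X i j))) i j)
    P = Id ⊝ (Y ∙ X)
    PP : P ∙ P ≋ P
    PP i j = trans (∙-subˡ Id (Y ∙ X) P i j) (trans (cong₂ _-_ (∙-idˡ P i j)
      (trans (∙-subʳ (Y ∙ X) Id (Y ∙ X) i j) (trans (cong₂ _-_ (∙-idʳ (Y ∙ X) i j) (YX i j)) (x-x _))))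
      (trans (cong (P i j +_) neg-0) (+-identityʳ _)))
    open Splitting (split P PP)

  module _ {m k : ℕ} (M : Matrix m k) where
    private
      A : Mat (Fin m) (Fin k)
      A i j = fromℤ (M i j)
      module FA = RankFactorization (factorize A)

    -- The submatrix factors through a space of dimension `rk A`. Its non-zero determinant makes it
    -- injective, so its left inverse turns this into a factorisation of the identity of size r.
    rank-minor≤ : ∀ {r} (f : Fin r → Fin m) (g : Fin r → Fin k) → det r (λ i j → M (f i) (g j)) ≢ 0ℤ → r ℕ.≤ rk A
    rank-minor≤ {r} f g nz = Id-factor⇒≤ (G ∙ L) R₀ (λ i j → trans (∙-assoc G L R₀ i j)
        (trans (∙-congʳ G (λ i j → sym (FA.span (f i) (g j))) i j) (left-inverse N inj i j)))
      where
      N : Mat (Fin r) (Fin r)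
      N i j = A (f i) (g j)
      L : Mat (Fin r) (Fin (rk A))
      L i l = (A ∙ FA.B⁺) (f i) l
      R₀ : Mat (Fin (rk A)) (Fin r)
      R₀ l j = FA.B l (g j)
      G = RankFactorization.G (factorize N)
      inj : ∀ v → (∀ i → (N · v) i ≡ 0#) → ∀ j → v j ≡ 0#
      inj v e j with v j ≟K 0#
      ... | yes z = z
      ... | no nv = ⊥-elim (nz (fromℤ-inj (trans (fromℤ-det r _) (trans (detK-kernel N v e j nv) (sym 0-homo)))))

    -- Cramer: expanding the vanishing bordered minors along the extra row writes every column through the columns g.
    rank-bordered≤ : ∀ {r} (f : Fin r → Fin m) (g : Fin r → Fin k) → det r (λ i j → M (f i) (g j)) ≢ 0ℤ →
      ((f : Fin (suc r) → Fin m) (g : Fin (suc r) → Fin k) → det (suc r) (λ i j → M (f i) (g j)) ≡ 0ℤ) → rk A ℕ.≤ r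
    rank-bordered≤ {r} f g nz van = Id-factor⇒≤ (FA.C ∙ U) (Q ∙ FA.B⁺) (λ i j → begin
        ((FA.C ∙ U) ∙ (Q ∙ FA.B⁺)) i j   ≡⟨ ∙-assoc FA.C U (Q ∙ FA.B⁺) i j ⟩
        (FA.C ∙ (U ∙ (Q ∙ FA.B⁺))) i j   ≡⟨ ∙-congʳ FA.C (λ i j → trans (sym (∙-assoc U Q FA.B⁺ i j)) (∙-congˡ FA.B⁺ (λ i j → sym (cramer i j)) i j)) i j ⟩
        (FA.C ∙ (A ∙ FA.B⁺)) i j         ≡⟨ sym (∙-assoc FA.C A FA.B⁺ i j) ⟩
        ((FA.C ∙ A) ∙ FA.B⁺) i j         ≡⟨ ∙-congˡ FA.B⁺ (λ i j → sym (FA.rows i j)) i j ⟩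
        (FA.B ∙ FA.B⁺) i j               ≡⟨ FA.BB⁺ i j ⟩
        Id i j ∎)
      where
      open ≡-Reasoning
      cons : ∀ {n} {X : Set} → X → (Fin n → X) → Fin (suc n) → X
      cons x h zero    = x
      cons x h (suc i) = h i
      D = detK r (λ i j → A (f i) (g j))
      D≢0 : D ≢ 0#
      D≢0 e = nz (fromℤ-inj (trans (fromℤ-det r _) (trans e (sym 0-homo))))
      m' : Fin k → Fin (suc r) → K
      m' j l = detK r (λ i c → A (f i) (cons j g (punchIn l c)))
      U : Mat (Fin m) (Fin r)
      U i l = A i (g l)
      Q : Mat (Fin r) (Fin k)
      Q l j = - (sg (suc (toℕ l)) * m' j (suc l) * inv D)
      expand : ∀ i j → 1# * (A i j * D) + (∑[ l ] sg (suc (toℕ l)) * (A i (g l) * m' j (suc l))) ≡ 0#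
      expand i j = trans (cong (_+ (∑[ l ] sg (suc (toℕ l)) * (A i (g l) * m' j (suc l)))) (cong (_* (A i j * D)) (sym 1-homo)))
        (trans (sym (∑Fin-suc {r} (λ l → sg (toℕ l) * (A i (cons j g l) * m' j l)))) (begin
        (∑[ l ] sg (toℕ l) * (A i (cons j g l) * m' j l))        ≡⟨ refl ⟩
        detK (suc r) (λ p q → A (cons i f p) (cons j g q))       ≡⟨ sym (fromℤ-det (suc r) (λ p q → M (cons i f p) (cons j g q))) ⟩
        fromℤ (det (suc r) (λ p q → M (cons i f p) (cons j g q))) ≡⟨ trans (cong fromℤ (van (cons i f) (cons j g))) 0-homo ⟩
        0# ∎))
      cramer : A ≋ U ∙ Q
      cramer i j = x-y≡0 (begin
        A i j - (U ∙ Q) i j    ≡⟨ cong₂ _-_ (trans (sym (*-identityˡ _)) (trans (cong (_* A i j) (sym (inverse D D≢0))) (solve 3 (λ d v a → d :* v :* a := a :* d :* v) refl D (inv D) (A i j))))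
                                    (trans (∑-cong (λ l → solve 4 (λ a s x v → a :* (:- (s :* x :* v)) := (:- v) :* (s :* (a :* x))) refl (A i (g l)) (sg (suc (toℕ l))) (m' j (suc l)) (inv D))) (∑-*ˡ (- inv D) _)) ⟩
        A i j * D * inv D - - inv D * S ≡⟨ solve 3 (λ a v s → a :* v :- (:- v) :* s := (a :+ s) :* v) refl (A i j * D) (inv D) S ⟩
        (A i j * D + S) * inv D ≡⟨ cong (_* inv D) (trans (cong (_+ S) (sym (*-identityˡ _))) (expand i j)) ⟩
        0# * inv D ≡⟨ zeroˡ _ ⟩
        0# ∎)
        where S = ∑[ l ] sg (suc (toℕ l)) * (A i (g l) * m' j (suc l))

    rank-RankIs : ∀ {r} → RankIs M r → rk A ≡ r
    rank-RankIs ((f , g , nz) , van) = ℕₚ.≤-antisym (rank-bordered≤ f g nz van) (rank-minor≤ f g nz)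

-- Simplicial chains as elements of the exterior algebra

≡ᵇ-refl : ∀ n → (n ≡ᵇ n) ≡ true
≡ᵇ-refl zero    = refl
≡ᵇ-refl (suc n) = ≡ᵇ-refl n

≡ᵇ⇒≡ : ∀ m n → (m ≡ᵇ n) ≡ true → m ≡ n
≡ᵇ⇒≡ zero    zero    e = refl
≡ᵇ⇒≡ (suc m) (suc n) e = cong suc (≡ᵇ⇒≡ m n e)

∧-true : ∀ {a b} → a ∧ b ≡ true → a ≡ true × b ≡ true
∧-true {true} {true} _ = refl , refl

countFin-false : ∀ {n} {p : Fin n → Bool} → (∀ i → p i ≡ false) → countFin p ≡ 0
countFin-false {zero}  e = refl
countFin-false {suc n} {p} e rewrite e zero = countFin-false (λ i → e (suc i))

sumFin-cong : ∀ {n} {f g : Fin n → ℤ} → (∀ i → f i ≡ g i) → sumFin f ≡ sumFin g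
sumFin-cong {zero}  e = refl
sumFin-cong {suc n} e = cong₂ ℤ._+_ (e zero) (sumFin-cong (λ i → e (suc i)))

sumFin-neg : ∀ {n} (f : Fin n → ℤ) → sumFin (λ i → ℤ.- f i) ≡ ℤ.- sumFin f
sumFin-neg {zero}  f = refl
sumFin-neg {suc n} f = trans (cong (ℤ._+_ (ℤ.- f zero)) (sumFin-neg (λ i → f (suc i)))) (sym (ℤₚ.neg-distrib-+ (f zero) _))

sumFin-0 : ∀ {n} {f : Fin n → ℤ} → (∀ i → f i ≡ 0ℤ) → sumFin f ≡ 0ℤ
sumFin-0 {zero}  e = refl
sumFin-0 {suc n} e = trans (cong₂ ℤ._+_ (e zero) (sumFin-0 (λ i → e (suc i)))) refl

subset-refl : ∀ {N} (S : VSet N) → subsetᵇ S S ≡ true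
subset-refl []          = refl
subset-refl (true ∷ S)  = subset-refl S
subset-refl (false ∷ S) = subset-refl S

subset-card : ∀ {N} (τ σ : VSet N) → subsetᵇ τ σ ≡ true → card τ ℕ.≤ card σ
subset-card []          []          e = ℕ.z≤n
subset-card (true ∷ τ)  (true ∷ σ)  e = ℕ.s≤s (subset-card τ σ e)
subset-card (false ∷ τ) (true ∷ σ)  e = ℕₚ.m≤n⇒m≤1+n (subset-card τ σ e)
subset-card (false ∷ τ) (false ∷ σ) e = subset-card τ σ e

subset-equal : ∀ {N} (τ σ : VSet N) → subsetᵇ τ σ ≡ true → card σ ≡ card τ → τ ≡ σ
subset-equal []          []          e c = refl
subset-equal (true ∷ τ)  (true ∷ σ)  e c = cong (true ∷_) (subset-equal τ σ e (ℕₚ.suc-injective c))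
subset-equal (false ∷ τ) (true ∷ σ)  e c = ⊥-elim (ℕₚ.1+n≰n (ℕₚ.≤-trans (ℕₚ.≤-reflexive c) (subset-card τ σ e)))
subset-equal (false ∷ τ) (false ∷ σ) e c = cong (false ∷_) (subset-equal τ σ e c)

private
  -- The signed sum in `incidence` without the containment factor. Its recursion on the first vertex
  -- is what links the counting definition of the sign to the exterior operators below.
  isum : ∀ {N} → VSet N → VSet N → ℤ
  isum τ σ = sumFin (λ u → boolℤ (lookup σ u ∧ not (lookup τ u)) ℤ.* sgn (countFin (λ w → lookup σ w ∧ (toℕ w <ᵇ toℕ u))))

  isum-refl : ∀ {N} (τ : VSet N) → isum τ τ ≡ 0ℤ
  isum-refl τ = sumFin-0 (λ u → h (lookup τ u) _)
    where
    h : ∀ b x → boolℤ (b ∧ not b) ℤ.* x ≡ 0ℤ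
    h true  x = ℤₚ.*-zeroˡ x
    h false x = ℤₚ.*-zeroˡ x

  isum-true : ∀ {N} (b : Bool) (τ σ : VSet N) → isum (b ∷ τ) (true ∷ σ) ≡ boolℤ (not b) ℤ.+ (ℤ.- isum τ σ)
  isum-true b τ σ = cong₂ ℤ._+_
    (trans (cong (λ n → boolℤ (not b) ℤ.* sgn n) (countFin-false {p = λ w → lookup (true ∷ σ) w ∧ (toℕ w <ᵇ 0)} (λ w → Boolₚ.∧-zeroʳ _))) (ℤₚ.*-identityʳ (boolℤ (not b))))
    (trans (sumFin-cong (λ u → sym (ℤₚ.neg-distribʳ-* (boolℤ (lookup σ u ∧ not (lookup τ u))) _))) (sumFin-neg (λ u → boolℤ (lookup σ u ∧ not (lookup τ u)) ℤ.* sgn (countFin (λ w → lookup σ w ∧ (toℕ w <ᵇ toℕ u))))))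

  isum-false : ∀ {N} (b : Bool) (τ σ : VSet N) → isum (b ∷ τ) (false ∷ σ) ≡ isum τ σ
  isum-false b τ σ = trans (cong (ℤ._+ isum τ σ) (ℤₚ.*-zeroˡ (sgn (countFin (λ w → lookup (false ∷ σ) w ∧ (toℕ w <ᵇ 0)))))) (ℤₚ.+-identityˡ _)

  inc-tt : ∀ {N} (τ σ : VSet N) → incidence (true ∷ τ) (true ∷ σ) ≡ ℤ.- incidence τ σ
  inc-tt τ σ = trans (cong (boolℤ (subsetᵇ τ σ) ℤ.*_) (trans (isum-true true τ σ) (ℤₚ.+-identityˡ _))) (sym (ℤₚ.neg-distribʳ-* (boolℤ (subsetᵇ τ σ)) (isum τ σ)))

  inc-ff : ∀ {N} (τ σ : VSet N) → incidence (false ∷ τ) (false ∷ σ) ≡ incidence τ σ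
  inc-ff τ σ = cong (boolℤ (subsetᵇ τ σ) ℤ.*_) (isum-false false τ σ)

  inc-tf : ∀ {N} (τ σ : VSet N) → incidence (true ∷ τ) (false ∷ σ) ≡ 0ℤ
  inc-tf τ σ = ℤₚ.*-zeroˡ (isum (true ∷ τ) (false ∷ σ))

  inc-ft : ∀ {N} (τ : VSet N) → incidence (false ∷ τ) (true ∷ τ) ≡ 1ℤ
  inc-ft τ rewrite subset-refl τ = trans (ℤₚ.*-identityˡ _) (trans (isum-true false τ τ) (cong (λ z → 1ℤ ℤ.+ (ℤ.- z)) (isum-refl τ)))

  inc-ft-≢ : ∀ {N} (τ σ : VSet N) → card σ ≡ card τ → τ ≢ σ → incidence (false ∷ τ) (true ∷ σ) ≡ 0ℤ
  inc-ft-≢ τ σ c n with subsetᵇ τ σ in e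
  ... | true  = ⊥-elim (n (subset-equal τ σ e c))
  ... | false = ℤₚ.*-zeroˡ (isum (false ∷ τ) (true ∷ σ))

∈-allSubsets : ∀ {N} (S : VSet N) → S ∈ allSubsets N
∈-allSubsets []          = Any.here refl
∈-allSubsets {suc N} (true ∷ S)  = ∈-++⁺ˡ (∈-map⁺ (true ∷_) (∈-allSubsets S))
∈-allSubsets {suc N} (false ∷ S) = ∈-++⁺ʳ (map (true ∷_) (allSubsets N)) (∈-map⁺ (false ∷_) (∈-allSubsets S))

∈-filterᵇ : ∀ {A : Set} (p : A → Bool) {x} xs → x ∈ xs → p x ≡ true → x ∈ filterᵇ p xs
∈-filterᵇ p (x ∷ xs) (Any.here refl) e rewrite e = Any.here refl
∈-filterᵇ p (y ∷ xs) (Any.there m) e with p y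
... | true  = Any.there (∈-filterᵇ p xs m e)
... | false = ∈-filterᵇ p xs m e

lookup-filterᵇ : ∀ {A : Set} (p : A → Bool) xs (i : Fin (length (filterᵇ p xs))) → p (L.lookup (filterᵇ p xs) i) ≡ true
lookup-filterᵇ p (x ∷ xs) i with p x in e
lookup-filterᵇ p (x ∷ xs) zero    | true = e
lookup-filterᵇ p (x ∷ xs) (suc i) | true = lookup-filterᵇ p xs i
lookup-filterᵇ p (x ∷ xs) i       | false = lookup-filterᵇ p xs i

lookup-index : ∀ {A : Set} {x : A} {xs} (m : x ∈ xs) → L.lookup xs (Any.index m) ≡ x
lookup-index (Any.here refl) = refl
lookup-index (Any.there m)   = lookup-index m

card-insert : ∀ {N} (S : VSet N) u → lookup S u ≡ false → card (S [ u ]≔ true) ≡ suc (card S)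
card-insert (false ∷ S) zero    e = refl
card-insert (true ∷ S)  (suc u) e = cong suc (card-insert S u e)
card-insert (false ∷ S) (suc u) e = card-insert S u e

module SumVSet (R : Ring≡) where
  open Ring≡ R
  open Sums R

  private
    _≟V_ : ∀ {N} (S T : VSet N) → Dec (S ≡ T)
    _≟V_ = Vecₚ.≡-dec Boolₚ._≟_

    splitL : ∀ {N} (f : VSet (suc N) → K) →
      sumL (allSubsets (suc N)) f ≡ sumL (allSubsets N) (λ S → f (true ∷ S)) + sumL (allSubsets N) (λ S → f (false ∷ S))
    splitL {N} f = trans (sumL-++ (map (true ∷_) (allSubsets N)) _ f)
      (cong₂ _+_ (sumL-map (true ∷_) (allSubsets N) f) (sumL-map (false ∷_) (allSubsets N) f))

    pickV : ∀ {N} j (f : VSet N → K) → sumL (allSubsets N) (λ i → [ does (j ≟V i) ] * f i) ≡ f j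
    pickV [] f = trans (+-identityʳ _) (*-identityˡ _)
    pickV {suc N} (true ∷ j) f = trans (splitL {N} _) (trans (cong₂ _+_ (trans (sumL-cong (allSubsets N) same) (pickV j (λ S → f (true ∷ S))))
        (trans (sumL-cong (allSubsets N) (λ i → zeroˡ _)) (sumL-0 (allSubsets N)))) (+-identityʳ _))
      where
      same : ∀ i → [ does ((true ∷ j) ≟V (true ∷ i)) ] * f (true ∷ i) ≡ [ does (j ≟V i) ] * f (true ∷ i)
      same i with j ≟V i
      ... | yes _ = refl
      ... | no _ = refl
    pickV {suc N} (false ∷ j) f = trans (splitL {N} _) (trans (cong₂ _+_ (trans (sumL-cong (allSubsets N) (λ i → zeroˡ _)) (sumL-0 (allSubsets N)))
        (trans (sumL-cong (allSubsets N) same) (pickV j (λ S → f (false ∷ S))))) (+-identityˡ _))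
      where
      same : ∀ i → [ does ((false ∷ j) ≟V (false ∷ i)) ] * f (false ∷ i) ≡ [ does (j ≟V i) ] * f (false ∷ i)
      same i with j ≟V i
      ... | yes _ = refl
      ... | no _ = refl

  instance
    finVSet : ∀ {N} → Finite (VSet N)
    finVSet {N} = record { enum = allSubsets N ; _≟_ = _≟V_ ; pick = pickV }

  opaque
    unfolding ∑

    ∑VSet-[] : (f : VSet 0 → K) → ∑ f ≡ f []
    ∑VSet-[] f = +-identityʳ _

    ∑VSet-∷ : ∀ {N} (f : VSet (suc N) → K) → ∑ f ≡ (∑[ S ] f (true ∷ S)) + (∑[ S ] f (false ∷ S))
    ∑VSet-∷ f = splitL f

    ∑VSet-filter : ∀ {N} (p : VSet N → Bool) f → sumL (filterᵇ p (allSubsets N)) f ≡ (∑[ S ] [ p S ] * f S)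
    ∑VSet-filter {N} p f = go (allSubsets N)
      where
      go : ∀ xs → sumL (filterᵇ p xs) f ≡ sumL xs (λ S → [ p S ] * f S)
      go [] = refl
      go (x ∷ xs) with p x
      ... | true  = cong₂ _+_ (sym (*-identityˡ _)) (go xs)
      ... | false = trans (go xs) (sym (trans (cong (_+ sumL xs (λ S → [ p S ] * f S)) (zeroˡ _)) (+-identityˡ _)))

module Exterior (F : OrderedField) where
  open OrderedField F
  open Solver ring
  open Sums ring
  open SumVSet ring
  open LinAlg F
  open Det F

  Chain : ℕ → Set
  Chain N = VSet N → K

  private
    pm : Bool → K → K
    pm true  x = - x
    pm false x = x

  -- Koszul signs. Both `κ u` and `ω u` are (-1) to the number of members of τ before u, on the sets
  -- without u (`κ`) and with u (`ω`), and zero elsewhere. So `ctr u` is contraction by the covector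
  -- dual to u, `wdg u` is exterior multiplication by u, and the simplicial boundary is the sum of
  -- all contractions.
  κ : ∀ {N} → Fin N → VSet N → K
  κ zero    (b ∷ τ) = [ not b ]
  κ (suc u) (b ∷ τ) = pm b (κ u τ)

  ω : ∀ {N} → Fin N → VSet N → K
  ω zero    (b ∷ τ) = [ b ]
  ω (suc u) (b ∷ τ) = pm b (ω u τ)

  ctr : ∀ {N} → Fin N → Chain N → Chain N
  ctr u c τ = κ u τ * c (τ [ u ]≔ true)

  wdg : ∀ {N} → Fin N → Chain N → Chain N
  wdg u c τ = ω u τ * c (τ [ u ]≔ false)

  bd : ∀ {N} → Chain N → Chain N
  bd c τ = ∑[ u ] ctr u c τ

  private
    pm-pm : ∀ b x y → pm b x * pm b y ≡ x * y
    pm-pm true  x y = solve 2 (λ x y → (:- x) :* (:- y) := x :* y) refl x y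
    pm-pm false x y = refl

    pm-0 : ∀ b {x} → x ≡ 0# → pm b x ≡ 0#
    pm-0 true  e = trans (cong -_ e) neg-0
    pm-0 false e = e

    pm-off : ∀ b x → pm b x * [ not b ] ≡ x * [ not b ]
    pm-off true  x = trans (zeroʳ _) (sym (zeroʳ _))
    pm-off false x = refl

    pm-on : ∀ b x → pm b x * [ b ] ≡ - x * [ b ]
    pm-on true  x = refl
    pm-on false x = trans (zeroʳ _) (sym (zeroʳ _))

  κ-κ : ∀ {N} (u v : Fin N) τ → κ u τ * κ v (τ [ u ]≔ true) ≡ - (κ v τ * κ u (τ [ v ]≔ true))
  κ-κ zero zero (b ∷ τ) = trans (zeroʳ _) (sym (trans (cong -_ (zeroʳ _)) neg-0))
  κ-κ zero (suc v) (b ∷ τ) = trans (solve 2 (λ a x → a :* (:- x) := :- (x :* a)) refl [ not b ] (κ v τ)) (cong -_ (sym (pm-off b (κ v τ))))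
  κ-κ (suc u) zero (b ∷ τ) = trans (pm-off b (κ u τ)) (solve 2 (λ a x → x :* a := :- (a :* (:- x))) refl [ not b ] (κ u τ))
  κ-κ (suc u) (suc v) (b ∷ τ) = trans (pm-pm b _ _) (trans (κ-κ u v τ) (cong -_ (sym (pm-pm b _ _))))

  κ-ω : ∀ {N} (u v : Fin N) τ → u ≢ v → κ u τ * ω v (τ [ u ]≔ true) ≡ - (ω v τ * κ u (τ [ v ]≔ false))
  κ-ω zero zero τ n = ⊥-elim (n refl)
  κ-ω zero (suc v) (b ∷ τ) n = trans (solve 2 (λ a x → a :* (:- x) := :- (x :* a)) refl [ not b ] (ω v τ)) (cong -_ (sym (pm-off b (ω v τ))))
  κ-ω (suc u) zero (b ∷ τ) n = trans (pm-on b (κ u τ)) (solve 2 (λ a x → (:- x) :* a := :- (a :* x)) refl [ b ] (κ u τ))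
  κ-ω (suc u) (suc v) (b ∷ τ) n = trans (pm-pm b _ _) (trans (κ-ω u v τ (λ e → n (cong suc e))) (cong -_ (sym (pm-pm b _ _))))

  κω-same : ∀ {N} (u : Fin N) τ → κ u τ * ω u (τ [ u ]≔ true) ≡ [ not (lookup τ u) ]
  κω-same zero    (b ∷ τ) = *-identityʳ _
  κω-same (suc u) (b ∷ τ) = trans (pm-pm b _ _) (κω-same u τ)

  ωκ-same : ∀ {N} (u : Fin N) τ → ω u τ * κ u (τ [ u ]≔ false) ≡ [ lookup τ u ]
  ωκ-same zero    (b ∷ τ) = *-identityʳ _
  ωκ-same (suc u) (b ∷ τ) = trans (pm-pm b _ _) (ωκ-same u τ)

  κ-∈ : ∀ {N} (u : Fin N) τ → lookup τ u ≡ true → κ u τ ≡ 0#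
  κ-∈ zero    (true ∷ τ) refl = refl
  κ-∈ (suc u) (b ∷ τ) e = pm-0 b (κ-∈ u τ e)

  ω-∉ : ∀ {N} (u : Fin N) τ → lookup τ u ≡ false → ω u τ ≡ 0#
  ω-∉ zero    (false ∷ τ) refl = refl
  ω-∉ (suc u) (b ∷ τ) e = pm-0 b (ω-∉ u τ e)

  ω-≢0 : ∀ {N} (u : Fin N) τ → lookup τ u ≡ true → ω u τ ≢ 0#
  ω-≢0 u τ e z = 1≢0 (trans (cong [_] (sym e)) (trans (sym (ωκ-same u τ)) (trans (cong (_* κ u (τ [ u ]≔ false)) z) (zeroˡ _))))

  ctr-ctr : ∀ {N} (u v : Fin N) c τ → ctr u (ctr v c) τ ≡ - ctr v (ctr u c) τ
  ctr-ctr u v c τ = begin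
    κ u τ * (κ v (τ [ u ]≔ true) * c ((τ [ u ]≔ true) [ v ]≔ true))       ≡⟨ sym (*-assoc _ _ _) ⟩
    κ u τ * κ v (τ [ u ]≔ true) * c ((τ [ u ]≔ true) [ v ]≔ true)         ≡⟨ cong₂ (λ x S → x * c S) (κ-κ u v τ) sets ⟩
    - (κ v τ * κ u (τ [ v ]≔ true)) * c ((τ [ v ]≔ true) [ u ]≔ true)     ≡⟨ solve 3 (λ a b x → (:- (a :* b)) :* x := :- (a :* (b :* x))) refl _ _ _ ⟩
    - (κ v τ * (κ u (τ [ v ]≔ true) * c ((τ [ v ]≔ true) [ u ]≔ true))) ∎
    where
    open ≡-Reasoning
    sets : (τ [ u ]≔ true) [ v ]≔ true ≡ (τ [ v ]≔ true) [ u ]≔ true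
    sets with u ≟ v
    ... | yes refl = refl
    ... | no n     = Vecₚ.[]≔-commutes τ u v n

  ctr-wdg-≢ : ∀ {N} {u v : Fin N} → u ≢ v → ∀ c τ → ctr u (wdg v c) τ ≡ - wdg v (ctr u c) τ
  ctr-wdg-≢ {u = u} {v} n c τ = begin
    κ u τ * (ω v (τ [ u ]≔ true) * c ((τ [ u ]≔ true) [ v ]≔ false))       ≡⟨ sym (*-assoc _ _ _) ⟩
    κ u τ * ω v (τ [ u ]≔ true) * c ((τ [ u ]≔ true) [ v ]≔ false)         ≡⟨ cong₂ (λ x S → x * c S) (κ-ω u v τ n) (Vecₚ.[]≔-commutes τ u v n) ⟩
    - (ω v τ * κ u (τ [ v ]≔ false)) * c ((τ [ v ]≔ false) [ u ]≔ true)    ≡⟨ solve 3 (λ a b x → (:- (a :* b)) :* x := :- (a :* (b :* x))) refl _ _ _ ⟩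
    - (ω v τ * (κ u (τ [ v ]≔ false) * c ((τ [ v ]≔ false) [ u ]≔ true))) ∎
    where open ≡-Reasoning

  private
    reset : ∀ {N} (τ : VSet N) u b → lookup τ u ≡ b → τ [ u ]≔ b ≡ τ
    reset τ u b refl = Vecₚ.[]≔-lookup τ u

    setset : ∀ {N} (τ : VSet N) u {b b'} → (τ [ u ]≔ b) [ u ]≔ b' ≡ τ [ u ]≔ b'
    setset τ u = Vecₚ.[]≔-idempotent τ u

  ctr-wdg-same : ∀ {N} (u : Fin N) c τ → ctr u (wdg u c) τ ≡ [ not (lookup τ u) ] * c τ
  ctr-wdg-same u c τ = trans (sym (*-assoc _ _ _)) (trans (cong₂ (λ x S → x * c S) (κω-same u τ) (setset τ u)) (h (lookup τ u) refl))
    where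
    h : ∀ b → lookup τ u ≡ b → [ not b ] * c (τ [ u ]≔ false) ≡ [ not b ] * c τ
    h true  e = trans (zeroˡ _) (sym (zeroˡ _))
    h false e = cong (λ S → 1# * c S) (reset τ u false e)

  wdg-ctr-same : ∀ {N} (u : Fin N) c τ → wdg u (ctr u c) τ ≡ [ lookup τ u ] * c τ
  wdg-ctr-same u c τ = trans (sym (*-assoc _ _ _)) (trans (cong₂ (λ x S → x * c S) (ωκ-same u τ) (setset τ u)) (h (lookup τ u) refl))
    where
    h : ∀ b → lookup τ u ≡ b → [ b ] * c (τ [ u ]≔ true) ≡ [ b ] * c τ
    h false e = trans (zeroˡ _) (sym (zeroˡ _))
    h true  e = cong (λ S → 1# * c S) (reset τ u true e)

  ctr-cong : ∀ {N} (u : Fin N) {c c'} → (∀ S → c S ≡ c' S) → ∀ τ → ctr u c τ ≡ ctr u c' τ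
  ctr-cong u e τ = cong (κ u τ *_) (e _)

  bd-cong : ∀ {N} {c c' : Chain N} → (∀ S → c S ≡ c' S) → ∀ τ → bd c τ ≡ bd c' τ
  bd-cong e τ = ∑-cong (λ u → ctr-cong u e τ)

  bd-0 : ∀ {N} {c : Chain N} → (∀ S → c S ≡ 0#) → ∀ τ → bd c τ ≡ 0#
  bd-0 e τ = ∑-0 (λ u → trans (cong (κ u τ *_) (e _)) (zeroʳ _))

  bd-+ : ∀ {N} (c c' : Chain N) τ → bd (λ S → c S + c' S) τ ≡ bd c τ + bd c' τ
  bd-+ c c' τ = trans (∑-cong (λ u → distribˡ _ _ _)) (∑-+ _ _)

  bd-sub : ∀ {N} (c c' : Chain N) τ → bd (λ S → c S - c' S) τ ≡ bd c τ - bd c' τ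
  bd-sub c c' τ = trans (∑-cong (λ u → solve 3 (λ k a b → k :* (a :- b) := k :* a :- k :* b) refl _ _ _)) (∑-sub _ _)

  bd-* : ∀ {N} a (c : Chain N) τ → bd (λ S → a * c S) τ ≡ a * bd c τ
  bd-* a c τ = trans (∑-cong (λ u → solve 3 (λ k a c → k :* (a :* c) := a :* (k :* c)) refl _ _ _)) (∑-*ˡ a _)

  bd-∑ : ∀ {N} {J : Set} {{_ : Finite J}} (c : J → Chain N) τ → bd (λ S → ∑[ j ] c j S) τ ≡ (∑[ j ] bd (c j) τ)
  bd-∑ c τ = trans (∑-cong (λ u → sym (∑-*ˡ (κ u τ) _))) (∑-swap _)

  ctr-bd : ∀ {N} (u : Fin N) c τ → ctr u (bd c) τ ≡ - bd (ctr u c) τ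
  ctr-bd u c τ = trans (sym (∑-*ˡ (κ u τ) _)) (trans (∑-cong (λ v → ctr-ctr u v c τ)) (∑-neg _))

  -- Contractions anticommute, so the double sum is its own negative; dividing by 2 replaces the
  -- pairing of terms.
  bd-bd : ∀ {N} (c : Chain N) τ → bd (bd c) τ ≡ 0#
  bd-bd c τ = *-cancel0 {1# + 1#} (trans (distribʳ X 1# 1#) (trans (cong₂ _+_ (*-identityˡ X) (trans (*-identityˡ X) X≡-X)) (x-x X))) two≢0
    where
    X = bd (bd c) τ
    X≡-X : X ≡ - X
    X≡-X = trans (∑-cong (λ u → ctr-bd u c τ)) (trans (∑-neg _) (cong -_ (trans (∑-swap _) (∑-cong (λ v → ∑-*ˡ (κ v τ) _)))))
    two≢0 : 1# + 1# ≢ 0#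
    two≢0 e with fromℤ-inj (trans (+-homo 1ℤ 1ℤ) (trans (cong₂ _+_ 1-homo 1-homo) (trans e (sym 0-homo))))
    ... | ()

  -- The Leibniz rule, or geometrically the boundary of the cone over c with apex v. In particular
  -- the cone over a cycle has that cycle as its boundary, which is how cells are attached later.
  bd-wdg : ∀ {N} (v : Fin N) c τ → bd (wdg v c) τ ≡ c τ - wdg v (bd c) τ
  bd-wdg v c τ = begin
    (∑[ u ] ctr u (wdg v c) τ)                          ≡⟨ ∑-cong term ⟩
    (∑[ u ] δ v u * c τ - wdg v (ctr u c) τ)            ≡⟨ ∑-sub _ _ ⟩
    (∑[ u ] δ v u * c τ) - (∑[ u ] wdg v (ctr u c) τ)   ≡⟨ cong₂ _-_ (∑-δ v (λ _ → c τ)) (∑-*ˡ (ω v τ) _) ⟩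
    c τ - wdg v (bd c) τ ∎
    where
    open ≡-Reasoning
    ite : ∀ b → [ not b ] * c τ ≡ 1# * c τ - [ b ] * c τ
    ite true  = trans (zeroˡ _) (sym (x-x _))
    ite false = sym (trans (cong (λ z → 1# * c τ - z) (zeroˡ _)) (trans (cong (1# * c τ +_) neg-0) (+-identityʳ _)))
    term : ∀ u → ctr u (wdg v c) τ ≡ δ v u * c τ - wdg v (ctr u c) τ
    term u with v ≟ u
    ... | yes refl = trans (ctr-wdg-same v c τ) (trans (ite (lookup τ v)) (cong (λ z → 1# * c τ - z) (sym (wdg-ctr-same v c τ))))
    ... | no n     = trans (ctr-wdg-≢ (λ e → n (sym e)) c τ) (trans (sym (+-identityˡ _)) (cong (_- wdg v (ctr u c) τ) (sym (zeroˡ (c τ)))))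

  inc : ∀ {N} → VSet N → VSet N → K
  inc τ σ = fromℤ (incidence τ σ)

  -- `incidence` checks containment but not sizes, and it can be non-zero when σ exceeds τ by more
  -- than one vertex; hence the indicator. The proof compares the two sides by recursion on the
  -- first vertex.
  bd-inc : ∀ {N} (c : Chain N) τ → (∑[ σ ] [ card σ ≡ᵇ suc (card τ) ] * (inc τ σ * c σ)) ≡ bd c τ
  bd-inc {zero} c [] = trans (∑VSet-[] _) (trans (zeroˡ _) (sym (∑Fin-zero _)))
  bd-inc {suc N} c (true ∷ τ) = begin
    (∑[ σ ] [ card σ ≡ᵇ suc (card (true ∷ τ)) ] * (inc (true ∷ τ) σ * c σ))  ≡⟨ ∑VSet-∷ _ ⟩
    (∑[ σ ] [ card σ ≡ᵇ suc (card τ) ] * (inc (true ∷ τ) (true ∷ σ) * c (true ∷ σ))) + (∑[ σ ] [ card σ ≡ᵇ suc (suc (card τ)) ] * (inc (true ∷ τ) (false ∷ σ) * c (false ∷ σ)))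
      ≡⟨ cong₂ _+_ (trans (∑-cong (λ σ → trans (cong (λ z → [ card σ ≡ᵇ suc (card τ) ] * (z * c (true ∷ σ))) (trans (cong fromℤ (inc-tt τ σ)) (-‿homo _))) (solve 3 (λ p i c → p :* ((:- i) :* c) := :- (p :* (i :* c))) refl _ _ _))) (trans (∑-neg _) (cong -_ (bd-inc (λ σ → c (true ∷ σ)) τ))))
                   (∑-0 (λ σ → trans (cong (λ z → [ card σ ≡ᵇ suc (suc (card τ)) ] * (z * c (false ∷ σ))) (trans (cong fromℤ (inc-tf τ σ)) 0-homo)) (trans (cong ([ card σ ≡ᵇ suc (suc (card τ)) ] *_) (zeroˡ _)) (zeroʳ _)))) ⟩
    - bd (λ σ → c (true ∷ σ)) τ + 0#  ≡⟨ trans (+-identityʳ _) (sym (∑-neg _)) ⟩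
    (∑[ u ] - ctr u (λ σ → c (true ∷ σ)) τ)  ≡⟨ ∑-cong (λ u → solve 2 (λ k c → :- (k :* c) := (:- k) :* c) refl _ _) ⟩
    (∑[ u ] ctr (suc u) c (true ∷ τ))  ≡⟨ sym (trans (∑Fin-suc {N} _) (trans (cong (_+ (∑[ u ] ctr (suc u) c (true ∷ τ))) (zeroˡ _)) (+-identityˡ _))) ⟩
    bd c (true ∷ τ) ∎
    where open ≡-Reasoning
  bd-inc {suc N} c (false ∷ τ) = begin
    (∑[ σ ] [ card σ ≡ᵇ suc (card τ) ] * (inc (false ∷ τ) σ * c σ))  ≡⟨ ∑VSet-∷ _ ⟩
    (∑[ σ ] [ card σ ≡ᵇ card τ ] * (inc (false ∷ τ) (true ∷ σ) * c (true ∷ σ))) + (∑[ σ ] [ card σ ≡ᵇ suc (card τ) ] * (inc (false ∷ τ) (false ∷ σ) * c (false ∷ σ)))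
      ≡⟨ cong₂ _+_ (trans (∑-cong diagonal) (∑-δ τ (λ σ → c (true ∷ σ))))
                   (trans (∑-cong (λ σ → cong (λ z → [ card σ ≡ᵇ suc (card τ) ] * (fromℤ z * c (false ∷ σ))) (inc-ff τ σ))) (bd-inc (λ σ → c (false ∷ σ)) τ)) ⟩
    c (true ∷ τ) + bd (λ σ → c (false ∷ σ)) τ ≡⟨ cong (_+ bd (λ σ → c (false ∷ σ)) τ) (sym (*-identityˡ _)) ⟩
    1# * c (true ∷ τ) + bd (λ σ → c (false ∷ σ)) τ ≡⟨ sym (∑Fin-suc {N} _) ⟩
    bd c (false ∷ τ) ∎
    where
    open ≡-Reasoning
    diagonal : ∀ σ → [ card σ ≡ᵇ card τ ] * (inc (false ∷ τ) (true ∷ σ) * c (true ∷ σ)) ≡ δ τ σ * c (true ∷ σ)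
    diagonal σ with τ ≟ σ
    ... | yes refl rewrite ≡ᵇ-refl (card τ) = trans (*-identityˡ _) (cong (_* c (true ∷ τ)) (trans (cong fromℤ (inc-ft τ)) 1-homo))
    ... | no n with card σ ≡ᵇ card τ in e
    ...   | false = trans (zeroˡ _) (sym (zeroˡ _))
    ...   | true  = trans (*-identityˡ _) (cong (_* c (true ∷ σ)) (trans (cong fromℤ (inc-ft-≢ τ σ (≡ᵇ⇒≡ (card σ) (card τ) e) n)) 0-homo))

  face : ∀ {N} → Complex N → ℕ → VSet N → Bool
  face L s S = L S ∧ (card S ≡ᵇ s)

  On : ∀ {N} → Complex N → ℕ → Chain N → Set
  On L s c = ∀ S → face L s S ≡ false → c S ≡ 0#

  mask : ∀ {N} {L : Complex N} {s c} → On L s c → ∀ S → [ face L s S ] * c S ≡ c S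
  mask {L = L} {s} on S with face L s S in e
  ... | true  = *-identityˡ _
  ... | false = trans (zeroˡ _) (sym (on S e))

  mask-On : ∀ {N} {L : Complex N} {s} (c : Chain N) → On L s (λ S → [ face L s S ] * c S)
  mask-On c S e rewrite e = zeroˡ _

  unmask : ∀ {N} {L : Complex N} {s} {c : Chain N} → (∀ S → [ face L s S ] * c S ≡ c S) → On L s c
  unmask m S e = trans (sym (m S)) (trans (cong (λ b → [ b ] * _) e) (zeroˡ _))

  -- The boundary matrix padded by zeros to all vertex sets, so that consecutive boundaries share
  -- one index type and compose without reindexing the lists of faces.
  D : ∀ {N} → Complex N → ℕ → Mat (VSet N) (VSet N)
  D L s τ σ = [ face L s τ ] * (inc τ σ * [ face L (suc s) σ ])

  DownClosed : ∀ {N} → Complex N → Set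
  DownClosed L = ∀ S u → lookup S u ≡ false → L (S [ u ]≔ true) ≡ true → L S ≡ true

  bd-On : ∀ {N} {L : Complex N} → DownClosed L → ∀ {s c} → On L (suc s) c → On L s (bd c)
  bd-On {L = L} down {s} {c} on S e = ∑-0 term
    where
    term : ∀ u → κ u S * c (S [ u ]≔ true) ≡ 0#
    term u with lookup S u in eu
    ... | true  = trans (cong (_* c (S [ u ]≔ true)) (κ-∈ u S eu)) (zeroˡ _)
    ... | false with face L (suc s) (S [ u ]≔ true) in ef
    ...   | false = trans (cong (κ u S *_) (on _ ef)) (zeroʳ _)
    ...   | true with ∧-true {L (S [ u ]≔ true)} ef
    ...     | l , k with trans (sym e) (cong₂ _∧_ (down S u eu l) (trans (cong (_≡ᵇ suc s) (sym (card-insert S u eu))) k))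
    ...       | ()

  D-· : ∀ {N} {L : Complex N} → DownClosed L → ∀ {s c} → On L (suc s) c → ∀ τ → (D L s · c) τ ≡ bd c τ
  D-· {L = L} down {s} {c} on τ = trans (∑-cong term) (trans (∑-*ˡ [ face L s τ ] _) (trans (body (face L s τ) refl) (mask {L = L} {s} (bd-On {L = L} down on) τ)))
    where
    term : ∀ σ → [ face L s τ ] * (inc τ σ * [ face L (suc s) σ ]) * c σ ≡ [ face L s τ ] * ([ card σ ≡ᵇ suc s ] * (inc τ σ * c σ))
    term σ with face L (suc s) σ in e
    ... | false = trans (cong ([ face L s τ ] * (inc τ σ * 0#) *_) (on σ e)) (trans (zeroʳ _) (sym (trans (cong (λ z → [ face L s τ ] * ([ card σ ≡ᵇ suc s ] * (inc τ σ * z))) (on σ e)) (trans (cong (λ z → [ face L s τ ] * ([ card σ ≡ᵇ suc s ] * z)) (zeroʳ _)) (trans (cong ([ face L s τ ] *_) (zeroʳ _)) (zeroʳ _))))))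
    ... | true rewrite proj₂ (∧-true {L σ} e) = solve 4 (λ f i o c → f :* (i :* o) :* c := f :* (o :* (i :* c))) refl [ face L s τ ] (inc τ σ) 1# (c σ)
    body : ∀ b → face L s τ ≡ b → [ b ] * (∑[ σ ] [ card σ ≡ᵇ suc s ] * (inc τ σ * c σ)) ≡ [ b ] * bd c τ
    body false e = trans (zeroˡ _) (sym (zeroˡ _))
    body true  e = cong (1# *_) (trans (∑-cong (λ σ → cong (λ n → [ card σ ≡ᵇ suc n ] * (inc τ σ * c σ)) (sym (≡ᵇ⇒≡ (card τ) s (proj₂ (∧-true {L τ} e)))))) (bd-inc c τ))

  rk-factor≤ : ∀ {I J I' J' : Set} {{_ : Finite I}} {{_ : Finite J}} {{_ : Finite I'}} {{_ : Finite J'}}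
    (A : Mat I J) (P : Mat I I') (M : Mat I' J') (Q : Mat J' J) → A ≋ (P ∙ M) ∙ Q → rk A ℕ.≤ rk M
  rk-factor≤ A P M Q e = Id-factor⇒≤ ((FA.C ∙ P) ∙ (M ∙ FM.B⁺)) (FM.B ∙ (Q ∙ FA.B⁺)) λ i j → begin
      (((FA.C ∙ P) ∙ (M ∙ FM.B⁺)) ∙ (FM.B ∙ (Q ∙ FA.B⁺))) i j ≡⟨ ∙-assoc (FA.C ∙ P) (M ∙ FM.B⁺) (FM.B ∙ (Q ∙ FA.B⁺)) i j ⟩
      ((FA.C ∙ P) ∙ ((M ∙ FM.B⁺) ∙ (FM.B ∙ (Q ∙ FA.B⁺)))) i j ≡⟨ ∙-congʳ (FA.C ∙ P) (λ i j → trans (sym (∙-assoc (M ∙ FM.B⁺) FM.B (Q ∙ FA.B⁺) i j)) (∙-congˡ (Q ∙ FA.B⁺) (λ i j → sym (FM.span i j)) i j)) i j ⟩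
      ((FA.C ∙ P) ∙ (M ∙ (Q ∙ FA.B⁺))) i j ≡⟨ ∙-assoc FA.C P (M ∙ (Q ∙ FA.B⁺)) i j ⟩
      (FA.C ∙ (P ∙ (M ∙ (Q ∙ FA.B⁺)))) i j ≡⟨ ∙-congʳ FA.C (λ i j → trans (sym (∙-assoc P M (Q ∙ FA.B⁺) i j)) (trans (sym (∙-assoc (P ∙ M) Q FA.B⁺ i j)) (∙-congˡ FA.B⁺ (λ i j → sym (e i j)) i j))) i j ⟩
      (FA.C ∙ (A ∙ FA.B⁺)) i j ≡⟨ sym (∙-assoc FA.C A FA.B⁺ i j) ⟩
      ((FA.C ∙ A) ∙ FA.B⁺) i j ≡⟨ ∙-congˡ FA.B⁺ (λ i j → sym (FA.rows i j)) i j ⟩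
      (FA.B ∙ FA.B⁺) i j ≡⟨ FA.BB⁺ i j ⟩
      Id i j ∎
    where
    open ≡-Reasoning
    module FA = RankFactorization (factorize A)
    module FM = RankFactorization (factorize M)

  rk-0 : ∀ {I J : Set} {{_ : Finite I}} {{_ : Finite J}} (A : Mat I J) → (∀ i j → A i j ≡ 0#) → rk A ≡ 0
  rk-0 A z = ℕₚ.n≤0⇒n≡0 (Id-factor⇒≤ {s = 0} (λ _ ()) (λ ()) λ i j → trans (∑Fin-zero _) (sym (trans (sym (BB⁺ i j))
      (∙-0ˡ {B = B⁺} (λ i j → trans (rows i j) (∙-0ʳ {A = C} z i j)) i j))))
    where open RankFactorization (factorize A)

  module _ {N : ℕ} (L : Complex N) where
    private
      pos' : ∀ s S b → face L s S ≡ b → Fin (length (facesOfSize L s)) → K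
      pos' s S true  e i = δ (Any.index (∈-filterᵇ (face L s) (allSubsets N) (∈-allSubsets S) e)) i
      pos' s S false e i = 0#

      pos : ∀ s → VSet N → Fin (length (facesOfSize L s)) → K
      pos s S i = pos' s S (face L s S) refl i

      X : ∀ s → Fin (length (facesOfSize L s)) → VSet N
      X s = L.lookup (facesOfSize L s)

      select : ∀ s S (f : Fin (length (facesOfSize L s)) → K) (g : VSet N → K) → (∀ i → f i ≡ g (X s i)) → (∑[ i ] pos s S i * f i) ≡ [ face L s S ] * g S
      select s S f g e = go (face L s S) refl
        where
        go : ∀ b (eq : face L s S ≡ b) → (∑[ i ] pos' s S b eq i * f i) ≡ [ b ] * g S
        go false eq = trans (∑-0 (λ i → zeroˡ _)) (sym (zeroˡ _))
        go true  eq = trans (∑-δ _ f) (trans (e _) (trans (cong g (lookup-index (∈-filterᵇ (face L s) (allSubsets N) (∈-allSubsets S) eq))) (sym (*-identityˡ _))))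

    bdK : ∀ s → Mat (Fin (length (facesOfSize L s))) (Fin (length (facesOfSize L (suc s))))
    bdK s i j = fromℤ (bdMat L s i j)

    -- Each of the two matrices arises from the other by multiplication with selection matrices on
    -- both sides, so neither has larger rank.
    rk-D : ∀ s → rk (D L s) ≡ rk (bdK s)
    rk-D s = ℕₚ.≤-antisym
      (rk-factor≤ (D L s) (pos s) (bdK s) (λ j σ → pos (suc s) σ j) (λ τ σ → sym (trans
         (∑-cong (λ j → trans (cong (_* pos (suc s) σ j) (select s τ (λ i → bdK s i j) (λ τ → inc τ (X (suc s) j)) (λ i → refl))) (*-comm _ _)))
         (trans (select (suc s) σ (λ j → [ face L s τ ] * inc τ (X (suc s) j)) (λ σ → [ face L s τ ] * inc τ σ) (λ j → refl))
           (solve 3 (λ f i g → g :* (f :* i) := f :* (i :* g)) refl [ face L s τ ] (inc τ σ) [ face L (suc s) σ ])))))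
      (rk-factor≤ (bdK s) (λ i τ → δ (X s i) τ) (D L s) (λ σ j → δ σ (X (suc s) j)) (λ i j → sym (trans
         (∑-δʳ (X (suc s) j) _) (trans (∑-δ (X s i) (λ τ → D L s τ (X (suc s) j)))
           (trans (cong₂ (λ a b → [ a ] * (inc (X s i) (X (suc s) j) * [ b ])) (lookup-filterᵇ (face L s) (allSubsets N) i) (lookup-filterᵇ (face L (suc s)) (allSubsets N) j))
             (trans (*-identityˡ _) (*-identityʳ _)))))))

    count-faces : ∀ s → (∑[ S ] [ face L s S ]) ≡ fromℕ (length (facesOfSize L s))
    count-faces s = trans (∑-cong (λ S → sym (*-identityʳ _))) (trans (sym (∑VSet-filter (face L s) (λ _ → 1#))) (go (facesOfSize L s)))
      where
      go : ∀ (xs : List (VSet N)) → sumL xs (λ _ → 1#) ≡ fromℕ (length xs)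
      go []       = sym 0-homo
      go (x ∷ xs) = trans (cong (1# +_) (go xs)) (sym (fromℕ-suc (length xs)))

  -- Cycles that represent a basis of reduced homology in degree s - 1: `decomp` says that they span
  -- modulo boundaries, `indep` that they are independent modulo boundaries. Only b = 0 and b = 1
  -- occur later, as exactness and as a fundamental cycle.
  record HomologyBasis {N : ℕ} (L : Complex N) (s b : ℕ) : Set where
    field
      g      : Fin b → Chain N
      g-On   : ∀ k → On L s (g k)
      g-cycle : ∀ k τ → bd (g k) τ ≡ 0#
      decomp : ∀ c → On L s c → (∀ τ → bd c τ ≡ 0#) →
        Σ (Fin b → K) λ a → Σ (Chain N) λ h → On L (suc s) h × (∀ S → c S ≡ bd h S + (∑[ k ] a k * g k S))
      indep  : ∀ (a : Fin b → K) h → On L (suc s) h → (∀ S → (∑[ k ] a k * g k S) ≡ bd h S) → ∀ k → a k ≡ 0#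

  bd-size0 : ∀ {N} {L : Complex N} {c} → On L 0 c → ∀ τ → bd c τ ≡ 0#
  bd-size0 {L = L} {c} on τ = ∑-0 term
    where
    term : ∀ u → κ u τ * c (τ [ u ]≔ true) ≡ 0#
    term u with lookup τ u in eu
    ... | true  = trans (cong (_* c (τ [ u ]≔ true)) (κ-∈ u τ eu)) (zeroˡ _)
    ... | false = trans (cong (κ u τ *_) (on _ (trans (cong (λ n → L (τ [ u ]≔ true) ∧ (n ≡ᵇ 0)) (card-insert τ u eu)) (Boolₚ.∧-zeroʳ _)))) (zeroʳ _)

  private
    Dout : ∀ {N} → Complex N → ℕ → Mat (VSet N) (VSet N)
    Dout L zero    _ _ = 0#
    Dout L (suc s)     = D L s

    rk-Dout : ∀ {N} (L : Complex N) s {r} → RankOut L s r → rk (Dout L s) ≡ r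
    rk-Dout {N} L zero    e = trans (rk-0 (Dout {N} L zero) (λ _ _ → refl)) (sym e)
    rk-Dout L (suc s) e = trans (rk-D L s) (rank-RankIs (bdMat L s) e)

    Dout-· : ∀ {N} {L : Complex N} → DownClosed L → ∀ s {c} → On L s c → ∀ τ → (Dout L s · c) τ ≡ bd c τ
    Dout-· {L = L} down zero    on τ = trans (∑-0 (λ σ → zeroˡ _)) (sym (bd-size0 {L = L} on τ))
    Dout-· down (suc s) on τ = D-· down on τ

  betti′ : ∀ {N} (L : Complex N) → DownClosed L → ∀ s b → BettiIs L s b → HomologyBasis L s b
  betti′ {N} L down s b (r₁ , r₂ , out , into , sum) = subst (HomologyBasis L s) dim≡b record
    { g = λ k S → σ S k
    ; g-On = on-σ
    ; g-cycle = λ k τ → trans (sym (Dout-· {L = L} down s (on-σ k) τ)) (Bσ τ k)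
    ; decomp = dec
    ; indep = ind }
    where
    A B : Mat (VSet N) (VSet N)
    A = D L s
    B = Dout L s
    colA : ∀ ρ τ → A τ ρ ≡ bd (λ S → [ face L (suc s) S ] * δ S ρ) τ
    colA ρ τ = trans (sym (∙-idʳ A τ ρ)) (trans (∑-cong (λ S → trans (cong (_* δ S ρ) (masked S)) (trans (*-assoc _ _ _) refl))) (D-· {L = L} down (mask-On {L = L} (λ S → δ S ρ)) τ))
      where
      masked : ∀ S → A τ S ≡ A τ S * [ face L (suc s) S ]
      masked S = trans (cong (λ z → [ face L s τ ] * (inc τ S * z)) (sym ([]-idem (face L (suc s) S)))) (solve 3 (λ f i g → f :* (i :* (g :* g)) := f :* (i :* g) :* g) refl _ _ _)
    colA-On : ∀ ρ → On L s (λ τ → A τ ρ)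
    colA-On ρ τ e rewrite e = zeroˡ _
    mA : ∀ v u → [ face L s v ] * A v u ≡ A v u
    mA v u = mask {L = L} {s} {λ v → A v u} (colA-On u) v
    Bm : ∀ w v → B w v * [ face L s v ] ≡ B w v
    Bm w v = go s
      where
      go : ∀ s → Dout L s w v * [ face L s v ] ≡ Dout L s w v
      go zero    = zeroˡ _
      go (suc s) = trans (solve 3 (λ f i g → f :* (i :* g) :* g := f :* (i :* (g :* g))) refl _ _ _) (cong (λ z → [ face L s w ] * (inc w v * z)) ([]-idem (face L (suc s) v)))
    BA : ∀ w u → (B ∙ A) w u ≡ 0#
    BA w u = trans (Dout-· {L = L} down s (colA-On u) w) (trans (bd-cong (colA u) w) (bd-bd (λ S → [ face L (suc s) S ] * δ S u) w))
    open Homology (face L s) A B mA Bm BA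

    dim≡b : dim ≡ b
    dim≡b = ℕₚ.+-cancelʳ-≡ (r₂ ℕ.+ r₁) dim b (fromℕ-inj (begin
      fromℕ (dim ℕ.+ (r₂ ℕ.+ r₁))        ≡⟨ trans (cong fromℕ (sym (ℕₚ.+-assoc dim r₂ r₁))) (trans (fromℕ-+ _ r₁) (cong (_+ fromℕ r₁) (fromℕ-+ dim r₂))) ⟩
      fromℕ dim + fromℕ r₂ + fromℕ r₁    ≡⟨ cong₂ (λ x y → fromℕ dim + fromℕ x + fromℕ y) (sym (trans (rk-D L s) (rank-RankIs (bdMat L s) into))) (sym (rk-Dout L s out)) ⟩
      fromℕ dim + fromℕ (rk A) + fromℕ (rk B) ≡⟨ trans dim-formula (count-faces L s) ⟩
      fromℕ (length (facesOfSize L s))   ≡⟨ cong fromℕ (trans (sym sum) (trans (ℕₚ.+-assoc b r₁ r₂) (cong (b ℕ.+_) (ℕₚ.+-comm r₁ r₂)))) ⟩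
      fromℕ (b ℕ.+ (r₂ ℕ.+ r₁)) ∎))
      where open ≡-Reasoning

    on-σ : ∀ k → On L s (λ S → σ S k)
    on-σ k = unmask {L = L} {s} {λ S → σ S k} (λ S → mσ S k)

    A-mask : ∀ (u : Chain N) S → (A · u) S ≡ bd (λ S → [ face L (suc s) S ] * u S) S
    A-mask u S = trans (∑-cong (λ ρ → trans (cong (λ z → [ face L s S ] * (inc S ρ * z) * u ρ) (sym ([]-idem (face L (suc s) ρ)))) (solve 4 (λ f i g u → f :* (i :* (g :* g)) :* u := f :* (i :* g) :* (g :* u)) refl _ _ _ _)))
      (D-· {L = L} down (mask-On {L = L} u) S)

    dec : ∀ c → On L s c → (∀ τ → bd c τ ≡ 0#) → Σ (Fin dim → K) λ a → Σ (Chain N) λ h → On L (suc s) h × (∀ S → c S ≡ bd h S + (∑[ k ] a k * σ S k))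
    dec c on cyc = π · c , (λ S → [ face L (suc s) S ] * u S) , mask-On {L = L} u ,
        λ S → trans (proj₂ dc S) (cong₂ _+_ (A-mask u S) (∑-cong (λ k → *-comm _ _)))
      where
      dc = decompose c (mask {L = L} {s} on) (λ w → trans (Dout-· {L = L} down s on w) (cyc w))
      u = proj₁ dc

    ind : ∀ (a : Fin dim → K) h → On L (suc s) h → (∀ S → (∑[ k ] a k * σ S k) ≡ bd h S) → ∀ k → a k ≡ 0#
    ind a h on e k = begin
      a k                     ≡⟨ sym (∙-idˡ a' k zero) ⟩
      (Id · a) k              ≡⟨ ∙-congˡ a' (λ i j → sym (πσ i j)) k zero ⟩
      ((π ∙ σ) · a) k         ≡⟨ ·-assoc π σ a k ⟩
      (π · (σ · a)) k         ≡⟨ ·-cong π (λ S → trans (∑-cong (λ k → *-comm _ _)) (trans (e S) (sym (D-· {L = L} down on S)))) k ⟩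
      (π · (A · h)) k         ≡⟨ sym (·-assoc π A h k) ⟩
      ((π ∙ A) · h) k         ≡⟨ ∙-0ˡ {B = λ u (_ : Fin 1) → h u} πA k zero ⟩
      0# ∎
      where
      open ≡-Reasoning
      a' : Mat (Fin dim) (Fin 1)
      a' k _ = a k

  abstract
    betti : ∀ {N} (L : Complex N) → DownClosed L → ∀ s b → BettiIs L s b → HomologyBasis L s b
    betti = betti′

-- Graded posets and their chains

allFin⇒ : ∀ {n} {p : Fin n → Bool} → allFin p ≡ true → ∀ i → p i ≡ true
allFin⇒ {suc n} {p} e zero    = proj₁ (∧-true {p zero} e)
allFin⇒ {suc n} {p} e (suc i) = allFin⇒ (proj₂ (∧-true {p zero} e)) i

⇒allFin : ∀ {n} {p : Fin n → Bool} → (∀ i → p i ≡ true) → allFin p ≡ true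
⇒allFin {zero}  e = refl
⇒allFin {suc n} {p} e = cong₂ _∧_ (e zero) (⇒allFin (λ i → e (suc i)))

≡-true-iff : ∀ {a b} → (a ≡ true → b ≡ true) → (b ≡ true → a ≡ true) → a ≡ b
≡-true-iff {true}  {b}     f g = sym (f refl)
≡-true-iff {false} {true}  f g = g refl
≡-true-iff {false} {false} f g = refl

not-true : ∀ {a} → not a ≡ true → a ≡ false
not-true {false} _ = refl

true≢false : true ≢ false
true≢false ()

implies : ∀ {a b} → not a ∨ b ≡ true → a ≡ true → b ≡ true
implies {true} e refl = e

⇒implies : ∀ {a b} → (a ≡ true → b ≡ true) → not a ∨ b ≡ true
⇒implies {true}  f = f refl
⇒implies {false} f = refl

∨-true : ∀ {a b} → a ∨ b ≡ true → a ≡ true ⊎ b ≡ true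
∨-true {true}  e = inj₁ refl
∨-true {false} e = inj₂ e

⇒∨ : ∀ {a b} → a ≡ true ⊎ b ≡ true → a ∨ b ≡ true
⇒∨ (inj₁ refl) = refl
⇒∨ {a} (inj₂ refl) = Boolₚ.∨-zeroʳ a

infix 4 _∈ˢ_
_∈ˢ_ : ∀ {N} → Fin N → VSet N → Set
u ∈ˢ S = lookup S u ≡ true

lookup-∪ : ∀ {N} (x y : VSet N) u → lookup (x ∪ˢ y) u ≡ lookup x u ∨ lookup y u
lookup-∪ x y u = Vecₚ.lookup-zipWith _∨_ u x y

module GradedPoset {N : ℕ} (P : PosetData N) (n : ℕ) (graded : IsGradedPoset P n) where
  open PosetData P public

  infix 4 _≼_ _≺_ _⋖_
  _≼_ _≺_ _⋖_ : Fin N → Fin N → Set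
  x ≼ y = x ≤ᵇ y ≡ true
  x ≺ y = x ≼ y × x ≢ y
  x ⋖ y = x ≺ y × (∀ z → ¬ (x ≺ z × z ≺ y))

  private
    _<b_ = _<ᵇ'_ P

  ≼-refl : ∀ {x} → x ≼ x
  ≼-refl {x} = proj₁ graded x

  ≼-antisym : ∀ {x y} → x ≼ y → y ≼ x → x ≡ y
  ≼-antisym {x} {y} = proj₁ (proj₂ graded) x y

  ≼-trans : ∀ {x y z} → x ≼ y → y ≼ z → x ≼ z
  ≼-trans {x} {y} {z} = proj₁ (proj₂ (proj₂ graded)) x y z

  𝟎≼ : ∀ x → 𝟎 ≼ x
  𝟎≼ = proj₁ (proj₂ (proj₂ (proj₂ graded)))

  ρ𝟎 : ρ 𝟎 ≡ 0
  ρ𝟎 = proj₁ (proj₂ (proj₂ (proj₂ (proj₂ graded))))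

  ≺-trans : ∀ {x y z} → x ≺ y → y ≺ z → x ≺ z
  ≺-trans (a , n) (b , _) = ≼-trans a b , λ { refl → n (≼-antisym a b) }

  ≼≺-trans : ∀ {x y z} → x ≼ y → y ≺ z → x ≺ z
  ≼≺-trans a (b , n) = ≼-trans a b , λ { refl → n (≼-antisym b a) }

  ≺≼-trans : ∀ {x y z} → x ≺ y → y ≼ z → x ≺ z
  ≺≼-trans (a , n) b = ≼-trans a b , λ { refl → n (≼-antisym a b) }

  <b⇒≺ : ∀ {x y} → x <b y ≡ true → x ≺ y
  <b⇒≺ {x} {y} e with x ≤ᵇ y in eq | x Finₚ.≟ y
  ... | true | no n = refl , n
  <b⇒≺ () | true | yes _

  ≺⇒<b : ∀ {x y} → x ≺ y → x <b y ≡ true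
  ≺⇒<b {x} {y} (e , n) with x Finₚ.≟ y
  ... | yes p = ⊥-elim (n p)
  ... | no _ rewrite e = refl

  _≺?_ : ∀ x y → Dec (x ≺ y)
  x ≺? y with x <b y in e
  ... | true  = yes (<b⇒≺ e)
  ... | false = no λ p → true≢false (trans (sym (≺⇒<b p)) e)

  cover-rank : ∀ {x y} → x ⋖ y → ρ y ≡ suc (ρ x)
  cover-rank {x} {y} (l , none) = proj₁ (proj₂ (proj₂ (proj₂ (proj₂ (proj₂ graded))))) x y (≺⇒<b l , λ z → no-between z)
    where
    no-between : ∀ z → (x <b z) ∧ (z <b y) ≡ false
    no-between z with (x <b z) ∧ (z <b y) in e
    ... | false = refl
    ... | true  = ⊥-elim (none z (<b⇒≺ (proj₁ (∧-true {x <b z} e)) , <b⇒≺ (proj₂ (∧-true {x <b z} e))))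

  private
    ≺-spo : IsStrictPartialOrder _≡_ _≺_
    ≺-spo = record { isEquivalence = isEquivalence ; irrefl = λ { refl (_ , n) → n refl } ; trans = ≺-trans ; <-resp-≈ = (λ { refl p → p }) , (λ { refl p → p }) }

  ≺-wf : WellFounded _≺_
  ≺-wf = spo-wellFounded ≺-spo

  ≻-wf : WellFounded (flip _≺_)
  ≻-wf = spo-noetherian ≺-spo

  coatom : ∀ {x y} → x ≺ y → Σ (Fin N) λ w → x ≼ w × w ⋖ y
  coatom {x} {y} = go (≻-wf x)
    where
    go : ∀ {x} → Acc (flip _≺_) x → x ≺ y → Σ (Fin N) λ w → x ≼ w × w ⋖ y
    go {x} (acc rs) l with Finₚ.any? (λ z → (x ≺? z) ×-dec (z ≺? y))
    ... | no none = x , ≼-refl , l , λ z p → none (z , p)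
    ... | yes (z , a , b) with go (rs a) b
    ...   | w , c , d = w , ≼-trans (proj₁ a) c , d

  atom : ∀ {x y} → x ≺ y → Σ (Fin N) λ w → x ⋖ w × w ≼ y
  atom {x} {y} = go (≺-wf y)
    where
    go : ∀ {y} → Acc _≺_ y → x ≺ y → Σ (Fin N) λ w → x ⋖ w × w ≼ y
    go {y} (acc rs) l with Finₚ.any? (λ z → (x ≺? z) ×-dec (z ≺? y))
    ... | no none = y , (l , λ z p → none (z , p)) , ≼-refl
    ... | yes (z , a , b) with go (rs b) a
    ...   | w , c , d = w , c , ≼-trans d (proj₁ b)

  ρ-mono : ∀ {x y} → x ≺ y → ρ x < ρ y
  ρ-mono {x} {y} = go (≺-wf y)
    where
    go : ∀ {y} → Acc _≺_ y → x ≺ y → ρ x < ρ y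
    go {y} (acc rs) l with coatom l
    ... | w , a , c with x Finₚ.≟ w
    ...   | yes refl = ℕₚ.≤-reflexive (sym (cover-rank c))
    ...   | no ne    = ℕₚ.<-trans (go (rs (proj₁ c)) (a , ne)) (ℕₚ.≤-reflexive (sym (cover-rank c)))

  ρ-mono-≼ : ∀ {x y} → x ≼ y → ρ x ≤ ρ y
  ρ-mono-≼ {x} {y} l with x Finₚ.≟ y
  ... | yes refl = ℕₚ.≤-refl
  ... | no ne    = ℕₚ.<⇒≤ (ρ-mono (l , ne))

  ≼-same-rank : ∀ {x y} → x ≼ y → ρ x ≡ ρ y → x ≡ y
  ≼-same-rank {x} {y} l e with x Finₚ.≟ y
  ... | yes p = p
  ... | no ne = ⊥-elim (ℕₚ.<-irrefl e (ρ-mono (l , ne)))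

  comparable-rank : ∀ {x y} → x ≼ y ⊎ y ≼ x → ρ x ≡ ρ y → x ≡ y
  comparable-rank (inj₁ l) e = ≼-same-rank l e
  comparable-rank (inj₂ l) e = sym (≼-same-rank l (sym e))

  ≼⇒⋖ : ∀ {x y} → x ≼ y → ρ y ≡ suc (ρ x) → x ⋖ y
  ≼⇒⋖ {x} {y} l e = (l , λ { refl → ℕₚ.1+n≢n (sym e) }) , λ z (a , b) → ℕₚ.<-irrefl refl (ℕₚ.<-≤-trans (ρ-mono a) (ℕ.s≤s⁻¹ (subst (ρ z <_) e (ρ-mono b))))

  rank0 : ∀ {x} → ρ x ≡ 0 → x ≡ 𝟎
  rank0 {x} e = sym (≼-same-rank (𝟎≼ x) (trans ρ𝟎 (sym e)))

  maximal? : ∀ y → ρ y ≡ n ⊎ Σ (Fin N) λ w → y ⋖ w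
  maximal? y with Finₚ.any? (y ≺?_)
  ... | yes (z , l) = inj₂ (proj₁ (atom l) , proj₁ (proj₂ (atom l)))
  ... | no none = inj₁ (proj₂ (proj₂ (proj₂ (proj₂ (proj₂ (proj₂ graded))))) y λ z l → max z l)
    where
    max : ∀ z → y ≼ z → z ≡ y
    max z l with y Finₚ.≟ z
    ... | yes p = sym p
    ... | no ne = ⊥-elim (none (z , l , ne))

  ρ≤n : ∀ y → ρ y ≤ n
  ρ≤n y = go (≻-wf y)
    where
    go : ∀ {y} → Acc (flip _≺_) y → ρ y ≤ n
    go {y} (acc rs) with maximal? y
    ... | inj₁ e = ℕₚ.≤-reflexive e
    ... | inj₂ (w , c) = ℕₚ.≤-trans (ℕₚ.<⇒≤ (ρ-mono (proj₁ c))) (go (rs (proj₁ c)))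

  record IsChainIn (W : Fin N → Bool) (S : VSet N) : Set where
    constructor mkChain
    field
      no𝟎   : lookup S 𝟎 ≡ false
      inside : ∀ {u} → u ∈ˢ S → W u ≡ true
      comparable : ∀ {u v} → u ∈ˢ S → v ∈ˢ S → u ≼ v ⊎ v ≼ u
  open IsChainIn public

  OC : (Fin N → Bool) → Complex N
  OC = OrderComplex P

  OC⇒ : ∀ {W S} → OC W S ≡ true → IsChainIn W S
  OC⇒ {W} {S} e = mkChain (not-true (proj₁ e₁)) (λ {u} → implies (allFin⇒ (proj₁ e₂) u))
      (λ {u} {v} a b → ∨-true (implies (allFin⇒ (allFin⇒ (proj₂ e₂) u) v) (cong₂ _∧_ a b)))
    where
    e₁ = ∧-true {not (lookup S 𝟎)} e
    e₂ = ∧-true {allFin (λ u → not (lookup S u) ∨ W u)} (proj₂ e₁)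

  ⇒OC : ∀ {W S} → IsChainIn W S → OC W S ≡ true
  ⇒OC {W} {S} (mkChain z i c) = cong₂ _∧_ (cong not z) (cong₂ _∧_ (⇒allFin (λ u → ⇒implies (i {u})))
    (⇒allFin (λ u → ⇒allFin (λ v → ⇒implies λ e → ⇒∨ (c {u} {v} (proj₁ (∧-true {lookup S u} e)) (proj₂ (∧-true {lookup S u} e)))))))

  ∈-insert : ∀ (S : VSet N) u v → v ∈ˢ (S [ u ]≔ true) → v ≡ u ⊎ v ∈ˢ S
  ∈-insert S u v e with v Finₚ.≟ u
  ... | yes p = inj₁ p
  ... | no ne = inj₂ (trans (sym (Vecₚ.lookup∘updateAt′ v u ne S)) e)

  insert-∈ : ∀ (S : VSet N) u v → v ∈ˢ S → v ∈ˢ (S [ u ]≔ true)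
  insert-∈ S u v e with v Finₚ.≟ u
  ... | yes refl = Vecₚ.lookup∘updateAt v S
  ... | no ne = trans (Vecₚ.lookup∘updateAt′ v u ne S) e

  insert-here : ∀ {S : VSet N} u → u ∈ˢ (S [ u ]≔ true)
  insert-here {S} u = Vecₚ.lookup∘updateAt u S

  remove-∈ : ∀ {S : VSet N} {u v} → v ∈ˢ (S [ u ]≔ false) → v ∈ˢ S × v ≢ u
  remove-∈ {S} {u} {v} e with v Finₚ.≟ u
  ... | yes refl = ⊥-elim (true≢false (trans (sym e) (Vecₚ.lookup∘updateAt v S)))
  ... | no ne = trans (sym (Vecₚ.lookup∘updateAt′ v u ne S)) e , ne

  ∈-remove : ∀ {S : VSet N} {u v} → v ∈ˢ S → v ≢ u → v ∈ˢ (S [ u ]≔ false)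
  ∈-remove {S} {u} {v} e ne = trans (Vecₚ.lookup∘updateAt′ v u ne S) e

  chain-insert : ∀ {W} {S : VSet N} {u} → IsChainIn W S → u ≢ 𝟎 → W u ≡ true → (∀ {v} → v ∈ˢ S → u ≼ v ⊎ v ≼ u) → IsChainIn W (S [ u ]≔ true)
  chain-insert {W} {S} {u} ch ne w cmp = mkChain (trans (Vecₚ.lookup∘updateAt′ 𝟎 u (λ e → ne (sym e)) S) (no𝟎 ch)) ins c
    where
    ins : ∀ {v} → v ∈ˢ (S [ u ]≔ true) → W v ≡ true
    ins {v} m with ∈-insert S u v m
    ... | inj₁ refl = w
    ... | inj₂ m'   = inside ch m'
    c : ∀ {a b} → a ∈ˢ (S [ u ]≔ true) → b ∈ˢ (S [ u ]≔ true) → a ≼ b ⊎ b ≼ a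
    c {a} {b} ma mb with ∈-insert S u a ma | ∈-insert S u b mb
    ... | inj₁ refl | inj₁ refl = inj₁ ≼-refl
    ... | inj₁ refl | inj₂ m    = cmp m
    ... | inj₂ m    | inj₁ refl = swap (cmp m)
    ... | inj₂ m    | inj₂ m'   = comparable ch m m'

  chain-sub : ∀ {W W'} {S S' : VSet N} → IsChainIn W S → (∀ {v} → v ∈ˢ S' → v ∈ˢ S) → (∀ {v} → v ∈ˢ S' → W' v ≡ true) → IsChainIn W' S'
  chain-sub {S = S} {S'} ch sub w = mkChain z w (λ a b → comparable ch (sub a) (sub b))
    where
    z : lookup S' 𝟎 ≡ false
    z with lookup S' 𝟎 in e
    ... | false = refl
    ... | true  = ⊥-elim (true≢false (trans (sym (sub e)) (no𝟎 ch)))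

  OC-down : ∀ W S u → lookup S u ≡ false → OC W (S [ u ]≔ true) ≡ true → OC W S ≡ true
  OC-down W S u _ e = ⇒OC (chain-sub {W} {W} {S [ u ]≔ true} {S} (OC⇒ e) (λ {v} → insert-∈ S u v) (λ {v} m → inside (OC⇒ {W} {S [ u ]≔ true} e) (insert-∈ S u v m)))

  -- x is a chain whose link in the complex of chains in Q is the complex of chains in W.
  record Frame (Q W : Fin N → Bool) (k : ℕ) : Set where
    field
      x      : VSet N
      chain  : IsChainIn Q x
      size   : card x ≡ k
      to     : ∀ {u} → W u ≡ true → u ≢ 𝟎 × Q u ≡ true × lookup x u ≡ false × (∀ {v} → v ∈ˢ x → u ≼ v ⊎ v ≼ u)
      from   : ∀ {u} → u ≢ 𝟎 → Q u ≡ true → lookup x u ≡ false → (∀ {v} → v ∈ˢ x → u ≼ v ⊎ v ≼ u) → W u ≡ true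

  frame-link : ∀ {Q W k} (f : Frame Q W k) → ∀ τ → Link (OC Q) (Frame.x f) τ ≡ OC W τ
  frame-link {Q} {W} f τ = ≡-true-iff
      (λ e → ⇒OC (down e))
      (λ e → cong₂ _∧_ (⇒allFin (λ u → disj (OC⇒ e) u)) (⇒OC (up (OC⇒ e))))
    where
    open Frame f
    disj : IsChainIn W τ → ∀ u → not (lookup x u ∧ lookup τ u) ≡ true
    disj ch u with lookup τ u in e
    ... | false = cong not (Boolₚ.∧-zeroʳ (lookup x u))
    ... | true  = cong not (trans (Boolₚ.∧-identityʳ (lookup x u)) (proj₁ (proj₂ (proj₂ (to (inside ch e))))))
    split : ∀ {u} → u ∈ˢ (x ∪ˢ τ) → u ∈ˢ x ⊎ u ∈ˢ τ
    split {u} m = ∨-true (trans (sym (lookup-∪ x τ u)) m)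
    inl : ∀ {u} → u ∈ˢ x → u ∈ˢ (x ∪ˢ τ)
    inl {u} m = trans (lookup-∪ x τ u) (⇒∨ (inj₁ m))
    inr : ∀ {u} → u ∈ˢ τ → u ∈ˢ (x ∪ˢ τ)
    inr {u} m = trans (lookup-∪ x τ u) (⇒∨ (inj₂ m))
    up : IsChainIn W τ → IsChainIn Q (x ∪ˢ τ)
    up ch = mkChain (trans (lookup-∪ x τ 𝟎) (cong₂ _∨_ (no𝟎 chain) (no𝟎 ch))) ins c
      where
      ins : ∀ {u} → u ∈ˢ (x ∪ˢ τ) → Q u ≡ true
      ins m with split m
      ... | inj₁ a = inside chain a
      ... | inj₂ a = proj₁ (proj₂ (to (inside ch a)))
      c : ∀ {a b} → a ∈ˢ (x ∪ˢ τ) → b ∈ˢ (x ∪ˢ τ) → a ≼ b ⊎ b ≼ a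
      c ma mb with split ma | split mb
      ... | inj₁ p | inj₁ q = comparable chain p q
      ... | inj₁ p | inj₂ q = swap (proj₂ (proj₂ (proj₂ (to (inside ch q)))) p)
      ... | inj₂ p | inj₁ q = proj₂ (proj₂ (proj₂ (to (inside ch p)))) q
      ... | inj₂ p | inj₂ q = comparable ch p q
    down : Link (OC Q) x τ ≡ true → IsChainIn W τ
    down e = chain-sub all inr (λ {u} m → from (λ { refl → true≢false (trans (sym (inr m)) (no𝟎 all)) }) (inside all (inr m))
        (out m) (λ v∈x → comparable all (inr m) (inl v∈x)))
      where
      all : IsChainIn Q (x ∪ˢ τ)
      all = OC⇒ (proj₂ (∧-true {disjoint x τ} e))
      out : ∀ {u} → u ∈ˢ τ → lookup x u ≡ false
      out {u} m with lookup x u in eq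
      ... | false = refl
      ... | true  = ⊥-elim (true≢false (trans (sym (allFin⇒ (proj₁ (∧-true {disjoint x τ} e)) u)) (cong not (cong₂ _∧_ eq m))))

  -- X extended by a saturated chain from 𝟎 (excluded) up to z.
  record Below (Q : Fin N → Bool) (z : Fin N) (X : VSet N) : Set where
    field
      x     : VSet N
      chain : IsChainIn Q x
      size  : card x ≡ card X ℕ.+ ρ z
      old   : ∀ {v} → v ∈ˢ X → v ∈ˢ x
      new   : ∀ {v} → v ∈ˢ x → v ∈ˢ X ⊎ v ≼ z
      ranks : ∀ k → 0 < k → k ≤ ρ z → Σ (Fin N) λ v → v ∈ˢ x × ρ v ≡ k

  below : ∀ Q → (∀ {u v} → u ≼ v → Q v ≡ true → Q u ≡ true) → ∀ z X → (z ≢ 𝟎 → Q z ≡ true) → IsChainIn Q X → (∀ {v} → v ∈ˢ X → z ≺ v) → Below Q z X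
  below Q downQ z = go (≺-wf z)
    where
    go : ∀ {z} → Acc _≺_ z → ∀ X → (z ≢ 𝟎 → Q z ≡ true) → IsChainIn Q X → (∀ {v} → v ∈ˢ X → z ≺ v) → Below Q z X
    go {z} (acc rs) X Qz ch ab with 𝟎 ≺? z
    ... | no nl = record { x = X ; chain = ch ; size = trans (sym (ℕₚ.+-identityʳ _)) (cong (card X ℕ.+_) (sym ρz)) ; old = λ m → m ; new = inj₁
                         ; ranks = λ k a b → ⊥-elim (ℕₚ.<-irrefl refl (ℕₚ.<-≤-trans a (subst (k ≤_) ρz b))) }
      where
      ρz : ρ z ≡ 0
      ρz with 𝟎 Finₚ.≟ z
      ... | yes refl = ρ𝟎
      ... | no ne = ⊥-elim (nl (𝟎≼ z , ne))
    ... | yes l with coatom l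
    ...   | w , _ , c = record
            { x = B.x ; chain = B.chain
            ; size = trans B.size (trans (cong (ℕ._+ ρ w) (card-insert X z out)) (trans (sym (ℕₚ.+-suc (card X) (ρ w))) (cong (card X ℕ.+_) (sym (cover-rank c)))))
            ; old = λ {v} m → B.old (insert-∈ X z v m) ; new = nw ; ranks = rks }
      where
      z≢ : z ≢ 𝟎
      z≢ e = proj₂ l (sym e)
      out : lookup X z ≡ false
      out with lookup X z in e
      ... | false = refl
      ... | true  = ⊥-elim (proj₂ (ab e) refl)
      above' : ∀ {v} → v ∈ˢ (X [ z ]≔ true) → w ≺ v
      above' {v} m with ∈-insert X z v m
      ... | inj₁ refl = proj₁ c
      ... | inj₂ m'   = ≺-trans (proj₁ c) (ab m')
      b = go (rs (proj₁ c)) (X [ z ]≔ true) (λ _ → downQ (proj₁ (proj₁ c)) (Qz z≢)) (chain-insert ch z≢ (Qz z≢) (λ m → inj₁ (proj₁ (ab m)))) above'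
      module B = Below b
      nw : ∀ {v} → v ∈ˢ B.x → v ∈ˢ X ⊎ v ≼ z
      nw {v} m with B.new m
      ... | inj₂ le = inj₂ (≼-trans le (proj₁ (proj₁ c)))
      ... | inj₁ m' with ∈-insert X z v m'
      ...   | inj₁ refl = inj₂ ≼-refl
      ...   | inj₂ m''  = inj₁ m''
      rks : ∀ k → 0 < k → k ≤ ρ z → Σ (Fin N) λ v → v ∈ˢ B.x × ρ v ≡ k
      rks k a le with k ℕₚ.≟ ρ z
      ... | yes refl = z , B.old (insert-here {X} z) , refl
      ... | no ne = B.ranks k a (ℕ.s≤s⁻¹ (subst (k <_) (cover-rank c) (ℕₚ.≤∧≢⇒< le ne)))

  below-top : ∀ {Q z X} (b : Below Q z X) → (∀ {v} → v ∈ˢ X → z ≺ v) → z ≢ 𝟎 → z ∈ˢ Below.x b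
  below-top {z = z} b ab ne with Below.ranks b (ρ z) (ℕₚ.n≢0⇒n>0 (λ e → ne (rank0 e))) ℕₚ.≤-refl
  ... | v , m , e with Below.new b m
  ...   | inj₁ m' = ⊥-elim (ℕₚ.<-irrefl (sym e) (ρ-mono (ab m')))
  ...   | inj₂ le = subst (_∈ˢ Below.x b) (≼-same-rank le e) m

  -- If u were below z, the saturated chain would have a member of the rank of u; being comparable
  -- and of equal rank, it would be u, which is not in the chain.
  below-comparable : ∀ {Q z X} (b : Below Q z X) → (∀ {v} → v ∈ˢ X → z ≺ v) → ∀ {u} → u ≢ 𝟎 → lookup (Below.x b) u ≡ false →
    (∀ {v} → v ∈ˢ Below.x b → u ≼ v ⊎ v ≼ u) → z ≺ u
  below-comparable {z = z} b ab {u} ne out cmp with z Finₚ.≟ 𝟎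
  ... | yes refl = 𝟎≼ u , λ e → ne (sym e)
  ... | no nz with cmp (below-top b ab nz)
  ...   | inj₂ le = le , λ { refl → true≢false (trans (sym (below-top b ab nz)) out) }
  ...   | inj₁ le with Below.ranks b (ρ u) (ℕₚ.n≢0⇒n>0 (λ e → ne (rank0 e))) (ρ-mono-≼ le)
  ...     | v , m , e = ⊥-elim (true≢false (trans (sym (subst (_∈ˢ Below.x b) (sym (comparable-rank (cmp m) (sym e))) m)) out))

  -- The counterpart of `Below`: a saturated chain from y to a maximal element, of rank n. It meets
  -- every rank from ρ y to n, so an element outside it that is comparable with all of it must lie
  -- below y.
  record Above (y : Fin N) : Set where
    field
      x     : VSet N
      chain : IsChainIn (fullSet P) x
      size  : card x ℕ.+ ρ y ≡ suc n
      here  : y ∈ˢ x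
      new   : ∀ {v} → v ∈ˢ x → y ≼ v
      ranks : ∀ k → ρ y ≤ k → k ≤ n → Σ (Fin N) λ v → v ∈ˢ x × ρ v ≡ k

  private
    ∅ : VSet N
    ∅ = replicate N false

    ∉∅ : ∀ u → lookup ∅ u ≡ false
    ∉∅ u = Vecₚ.lookup-replicate u false

    ∅-chain : ∀ {W} → IsChainIn W ∅
    ∅-chain = mkChain (∉∅ 𝟎) (λ {u} m → ⊥-elim (true≢false (trans (sym m) (∉∅ u)))) (λ {u} m → ⊥-elim (true≢false (trans (sym m) (∉∅ u))))

    card∅ : card ∅ ≡ 0
    card∅ = countFin-false ∉∅

  above : ∀ y → y ≢ 𝟎 → Above y
  above y = go (≻-wf y)
    where
    go : ∀ {y} → Acc (flip _≺_) y → y ≢ 𝟎 → Above y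
    go {y} (acc rs) ne with maximal? y
    ... | inj₁ e = record
          { x = ∅ [ y ]≔ true ; chain = chain-insert ∅-chain ne refl (λ {v} m → ⊥-elim (true≢false (trans (sym m) (∉∅ v))))
          ; size = trans (cong (ℕ._+ ρ y) (trans (card-insert ∅ y (∉∅ y)) (cong suc card∅))) (cong suc e)
          ; here = insert-here {∅} y ; new = nw
          ; ranks = λ k a b → y , insert-here {∅} y , ℕₚ.≤-antisym a (subst (k ≤_) (sym e) b) }
      where
      nw : ∀ {v} → v ∈ˢ (∅ [ y ]≔ true) → y ≼ v
      nw {v} m with ∈-insert ∅ y v m
      ... | inj₁ refl = ≼-refl
      ... | inj₂ m'   = ⊥-elim (true≢false (trans (sym m') (∉∅ v)))
    ... | inj₂ (w , c) = record
          { x = A.x [ y ]≔ true ; chain = chain-insert A.chain ne refl (λ m → inj₁ (proj₁ (ylt m)))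
          ; size = trans (cong (ℕ._+ ρ y) (card-insert A.x y out)) (trans (sym (ℕₚ.+-suc (card A.x) (ρ y))) (trans (cong (card A.x ℕ.+_) (sym (cover-rank c))) A.size))
          ; here = insert-here {A.x} y ; new = nw ; ranks = rks }
      where
      a = go (rs (proj₁ c)) (λ { refl → proj₂ (proj₁ c) (≼-antisym (proj₁ (proj₁ c)) (𝟎≼ y)) })
      module A = Above a
      ylt : ∀ {v} → v ∈ˢ A.x → y ≺ v
      ylt m = ≺≼-trans (proj₁ c) (A.new m)
      out : lookup A.x y ≡ false
      out with lookup A.x y in e
      ... | false = refl
      ... | true  = ⊥-elim (proj₂ (ylt e) refl)
      nw : ∀ {v} → v ∈ˢ (A.x [ y ]≔ true) → y ≼ v
      nw {v} m with ∈-insert A.x y v m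
      ... | inj₁ refl = ≼-refl
      ... | inj₂ m'   = proj₁ (ylt m')
      rks : ∀ k → ρ y ≤ k → k ≤ n → Σ (Fin N) λ v → v ∈ˢ (A.x [ y ]≔ true) × ρ v ≡ k
      rks k p q with k ℕₚ.≟ ρ y
      ... | yes refl = y , insert-here {A.x} y , refl
      ... | no nk with A.ranks k (subst (_≤ k) (sym (cover-rank c)) (ℕₚ.≤∧≢⇒< p (λ e → nk (sym e)))) q
      ...   | v , m , e = v , insert-∈ A.x y v m , e

  upto : (Fin N → Bool) → Fin N → Fin N → Bool
  upto Q z u = Q u ∧ (z <b u)

  between : Fin N → Fin N → Fin N → Bool
  between z y u = (u <b y) ∧ (z <b u)

  upto⇒ : ∀ {Q z u} → upto Q z u ≡ true → Q u ≡ true × z ≺ u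
  upto⇒ {Q} {z} {u} e = proj₁ (∧-true {Q u} e) , <b⇒≺ (proj₂ (∧-true {Q u} e))

  ⇒upto : ∀ {Q z u} → Q u ≡ true → z ≺ u → upto Q z u ≡ true
  ⇒upto q l = cong₂ _∧_ q (≺⇒<b l)

  frame-up : ∀ Q → (∀ {u v} → u ≼ v → Q v ≡ true → Q u ≡ true) → ∀ z → Q z ≡ true →
    Σ (Frame Q (upto Q z) (ρ z)) λ f → (∀ {v} → v ∈ˢ Frame.x f → v ≼ z) × (z ≢ 𝟎 → z ∈ˢ Frame.x f)
  frame-up Q downQ z Qz = record
    { x = B.x ; chain = B.chain ; size = trans B.size (cong (ℕ._+ ρ z) card∅)
    ; to = to ; from = λ ne q out cmp → ⇒upto {Q} {z} q (below-comparable b none ne out cmp) } , le , below-top b none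
    where
    none : ∀ {v} → v ∈ˢ ∅ → z ≺ v
    none {v} m = ⊥-elim (true≢false (trans (sym m) (∉∅ v)))
    b = below Q downQ z ∅ (λ _ → Qz) ∅-chain none
    module B = Below b
    le : ∀ {v} → v ∈ˢ B.x → v ≼ z
    le {v} m with B.new m
    ... | inj₁ m' = ⊥-elim (true≢false (trans (sym m') (∉∅ v)))
    ... | inj₂ l = l
    to : ∀ {u} → upto Q z u ≡ true → u ≢ 𝟎 × Q u ≡ true × lookup B.x u ≡ false × (∀ {v} → v ∈ˢ B.x → u ≼ v ⊎ v ≼ u)
    to {u} e with upto⇒ {Q} {z} {u} e
    ... | q , l = (λ { refl → proj₂ l (≼-antisym (proj₁ l) (𝟎≼ z)) }) , q , out , λ m → inj₂ (≼-trans (le m) (proj₁ l))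
      where
      out : lookup B.x u ≡ false
      out with lookup B.x u in eq
      ... | false = refl
      ... | true  = ⊥-elim (proj₂ l (≼-antisym (proj₁ l) (le eq)))

  -- A saturated chain up to z followed by one from y to a maximal element leaves only the open
  -- interval as its link. The member of rank n is recorded because it keeps the chain out of the
  -- boundary, so that the link is a sphere and not a ball.
  frame-between : ∀ z y → z ≺ y → Σ (Frame (fullSet P) (between z y) (suc n ∸ ρ y ℕ.+ ρ z)) λ f → Σ (Fin N) λ v → v ∈ˢ Frame.x f × ρ v ≡ n
  frame-between z y l = record
      { x = B.x ; chain = B.chain
      ; size = trans B.size (cong (ℕ._+ ρ z) (trans (sym (ℕₚ.m+n∸n≡m (card A.x) (ρ y))) (cong (_∸ ρ y) A.size)))
      ; to = to ; from = from } ,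
      proj₁ top , B.old (proj₁ (proj₂ top)) , proj₂ (proj₂ top)
    where
    y≢ : y ≢ 𝟎
    y≢ refl = proj₂ l (≼-antisym (proj₁ l) (𝟎≼ z))
    a = above y y≢
    module A = Above a
    ab : ∀ {v} → v ∈ˢ A.x → z ≺ v
    ab m = ≺≼-trans l (A.new m)
    b = below (fullSet P) (λ _ _ → refl) z A.x (λ _ → refl) A.chain ab
    module B = Below b
    top = A.ranks n (ρ≤n y) ℕₚ.≤-refl
    to : ∀ {u} → between z y u ≡ true → u ≢ 𝟎 × true ≡ true × lookup B.x u ≡ false × (∀ {v} → v ∈ˢ B.x → u ≼ v ⊎ v ≼ u)
    to {u} e = (λ { refl → proj₂ zu (≼-antisym (proj₁ zu) (𝟎≼ z)) }) , refl , out , cmp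
      where
      uy : u ≺ y
      uy = <b⇒≺ (proj₁ (∧-true {u <b y} e))
      zu : z ≺ u
      zu = <b⇒≺ (proj₂ (∧-true {u <b y} e))
      out : lookup B.x u ≡ false
      out with lookup B.x u in eq
      ... | false = refl
      ... | true with B.new eq
      ...   | inj₁ m = ⊥-elim (proj₂ uy (≼-antisym (proj₁ uy) (A.new m)))
      ...   | inj₂ q = ⊥-elim (proj₂ zu (≼-antisym (proj₁ zu) q))
      cmp : ∀ {v} → v ∈ˢ B.x → u ≼ v ⊎ v ≼ u
      cmp m with B.new m
      ... | inj₁ m' = inj₁ (≼-trans (proj₁ uy) (A.new m'))
      ... | inj₂ q  = inj₂ (≼-trans q (proj₁ zu))
    from : ∀ {u} → u ≢ 𝟎 → true ≡ true → lookup B.x u ≡ false → (∀ {v} → v ∈ˢ B.x → u ≼ v ⊎ v ≼ u) → between z y u ≡ true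
    from {u} ne _ out cmp = cong₂ _∧_ (≺⇒<b uy) (≺⇒<b (below-comparable b ab ne out cmp))
      where
      uy : u ≺ y
      uy with cmp (B.old A.here)
      ... | inj₁ q = q , λ { refl → true≢false (trans (sym (B.old A.here)) out) }
      ... | inj₂ q with A.ranks (ρ u) (ρ-mono-≼ q) (ρ≤n u)
      ...   | v , m , e = ⊥-elim (true≢false (trans (sym (subst (_∈ˢ B.x) (sym (comparable-rank (cmp (B.old m)) (sym e))) (B.old m))) out))

-- Cells as sums of saturated chains

≡ᵇ-false : ∀ {m n} → m ≢ n → (m ≡ᵇ n) ≡ false
≡ᵇ-false {m} {n} ne with m ≡ᵇ n in e
... | false = refl
... | true  = ⊥-elim (ne (≡ᵇ⇒≡ m n e))

card-remove : ∀ {N} (S : VSet N) u → lookup S u ≡ true → card S ≡ suc (card (S [ u ]≔ false))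
card-remove S u e = trans (cong card (sym (trans (Vecₚ.[]≔-idempotent S u) (trans (cong (S [ u ]≔_) (sym e)) (Vecₚ.[]≔-lookup S u)))))
  (card-insert (S [ u ]≔ false) u (Vecₚ.lookup∘updateAt u S))

witness : ∀ {A : Set} (d : Dec A) → does d ≡ true → A
witness (yes a) _ = a

module Chains (F : OrderedField) {N : ℕ} (P : PosetData N) (n : ℕ) (graded : IsGradedPoset P n) where
  open OrderedField F
  open Solver ring
  open Sums ring
  open SumVSet ring
  open LinAlg F
  open Exterior F
  open GradedPoset P n graded

  ∑≢0 : ∀ {J : Set} {{_ : Finite J}} (f : J → K) → ∑ f ≢ 0# → Σ J λ j → f j ≢ 0#
  ∑≢0 f ne with zero? f
  ... | inj₁ z = ⊥-elim (ne (∑-0 z))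
  ... | inj₂ w = w

  *≢0 : ∀ {x y} → x * y ≢ 0# → x ≢ 0# × y ≢ 0#
  *≢0 {x} {y} ne = (λ { refl → ne (zeroˡ _) }) , (λ { refl → ne (zeroʳ _) })

  Supp : (Fin N → Bool) → ℕ → Chain N → Set
  Supp W s c = ∀ S → c S ≢ 0# → IsChainIn W S × card S ≡ s

  Supp⇒On : ∀ {W s c} → Supp W s c → On (OC W) s c
  Supp⇒On {W} {s} {c} sp S e with c S ≟K 0#
  ... | yes z = z
  ... | no ne = ⊥-elim (true≢false (trans (sym (cong₂ _∧_ (⇒OC (proj₁ (sp S ne))) (trans (cong (_≡ᵇ s) (proj₂ (sp S ne))) (≡ᵇ-refl s)))) e))

  On⇒Supp : ∀ {W s c} → On (OC W) s c → Supp W s c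
  On⇒Supp {W} {s} {c} on S ne with face (OC W) s S in e
  ... | false = ⊥-elim (ne (on S e))
  ... | true  = OC⇒ (proj₁ (∧-true {OC W S} e)) , ≡ᵇ⇒≡ (card S) s (proj₂ (∧-true {OC W S} e))

  ctr-≢0 : ∀ (u : Fin N) (c : Chain N) τ → ctr u c τ ≢ 0# → lookup τ u ≡ false × c (τ [ u ]≔ true) ≢ 0#
  ctr-≢0 u c τ ne with lookup τ u in e
  ... | true  = ⊥-elim (proj₁ (*≢0 ne) (κ-∈ u τ e))
  ... | false = refl , proj₂ (*≢0 ne)

  wdg-≢0 : ∀ (u : Fin N) (c : Chain N) τ → wdg u c τ ≢ 0# → lookup τ u ≡ true × c (τ [ u ]≔ false) ≢ 0#
  wdg-≢0 u c τ ne with lookup τ u in e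
  ... | false = ⊥-elim (proj₁ (*≢0 ne) (ω-∉ u τ e))
  ... | true  = refl , proj₂ (*≢0 ne)

  -- Comparable elements of equal rank coincide, so a chain has at most one member in each of the b
  -- ranks.
  chain-size : ∀ {W S} → IsChainIn W S → ∀ a b → (∀ {v} → v ∈ˢ S → a < ρ v × ρ v ≤ a ℕ.+ b) → card S ≤ b
  chain-size {S = S} ch a zero bnd = ℕₚ.≤-reflexive (countFin-false λ v → out v)
    where
    out : ∀ v → lookup S v ≡ false
    out v with lookup S v in e
    ... | false = refl
    ... | true  = ⊥-elim (ℕₚ.<-irrefl refl (ℕₚ.<-≤-trans (proj₁ (bnd e)) (subst (ρ v ≤_) (ℕₚ.+-identityʳ a) (proj₂ (bnd e)))))
  chain-size {W} {S} ch a (suc b) bnd with Finₚ.any? (λ v → (lookup S v Boolₚ.≟ true) ×-dec (ρ v ℕₚ.≟ a ℕ.+ suc b))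
  ... | no none = ℕₚ.m≤n⇒m≤1+n (chain-size ch a b (λ {v} m → proj₁ (bnd m) ,
          ℕ.s≤s⁻¹ (subst (ρ v <_) (ℕₚ.+-suc a b) (ℕₚ.≤∧≢⇒< (proj₂ (bnd m)) (λ e → none (v , m , e))))))
  ... | yes (u , m , e) = subst (_≤ suc b) (sym (card-remove S u m)) (s≤s (chain-size {W} {S [ u ]≔ false}
          (chain-sub ch (λ {v} m' → proj₁ (remove-∈ {S} {u} {v} m')) (λ {v} m' → inside ch (proj₁ (remove-∈ {S} {u} {v} m')))) a b λ {v} m' →
            proj₁ (bnd (proj₁ (remove-∈ {S} {u} {v} m'))) ,
            ℕ.s≤s⁻¹ (subst (ρ v <_) (ℕₚ.+-suc a b) (ℕₚ.≤∧≢⇒< (proj₂ (bnd (proj₁ (remove-∈ {S} {u} {v} m'))))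
              (λ e' → proj₂ (remove-∈ {S} {u} {v} m') (comparable-rank (comparable ch (proj₁ (remove-∈ {S} {u} {v} m')) m) (trans e' (sym e))))))))

  [yes] : ∀ {A : Set} (d : Dec A) → A → [ does d ] ≡ 1#
  [yes] (yes _) a = refl
  [yes] (no na) a = ⊥-elim (na a)

  [dec] : ∀ {A : Set} (d : Dec A) {x} → (A → x ≡ 0#) → [ does d ] * x ≡ 0#
  [dec] (yes a) h = trans (*-identityˡ _) (h a)
  [dec] (no _)  h = zeroˡ _

  -- Vanishing of reduced homology, in degree s - 1, of the complex of chains in W.
  Ex : (Fin N → Bool) → ℕ → Set
  Ex W s = ∀ c → Supp W s c → (∀ τ → bd c τ ≡ 0#) → Σ (Chain N) λ h → Supp W (suc s) h × (∀ S → c S ≡ bd h S)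

  basis⇒Ex′ : ∀ {W s} → HomologyBasis (OC W) s 0 → Ex W s
  basis⇒Ex′ {W} H c sp cyc with HomologyBasis.decomp H c (Supp⇒On sp) cyc
  ... | a , h , on , e = h , On⇒Supp on , λ S → trans (e S) (trans (cong (bd h S +_) (∑Fin-zero _)) (+-identityʳ _))

  abstract
    basis⇒Ex : ∀ {W s} → HomologyBasis (OC W) s 0 → Ex W s
    basis⇒Ex = basis⇒Ex′

  Ex-cong : ∀ {W W' s} → (∀ v → W v ≡ W' v) → Ex W s → Ex W' s
  Ex-cong {W} {W'} {s} e ex c sp cyc with ex c (λ S ne → conv (λ v → sym (e v)) (proj₁ (sp S ne)) , proj₂ (sp S ne)) cyc
    where
    conv : ∀ {A B S} → (∀ v → A v ≡ B v) → IsChainIn A S → IsChainIn B S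
    conv eq ch = chain-sub ch (λ m → m) (λ {v} m → trans (sym (eq v)) (inside ch m))
  ... | h , sh , eq = h , (λ S ne → chain-sub (proj₁ (sh S ne)) (λ m → m) (λ {v} m → trans (sym (e v)) (inside (proj₁ (sh S ne)) m)) , proj₂ (sh S ne)) , eq

  -- The cycles of size s form a one-dimensional space. In the top degree this is the homology of a
  -- sphere, and g is its fundamental cycle.
  Line : (Fin N → Bool) → ℕ → Set
  Line W s = Σ (Chain N) λ g → Supp W s g × (∀ τ → bd g τ ≡ 0#) × (Σ (VSet N) λ S → g S ≢ 0#) ×
    (∀ c → Supp W s c → (∀ τ → bd c τ ≡ 0#) → Σ K λ a → ∀ S → c S ≡ a * g S)

  -- In the top degree there are no boundaries.
  basis⇒Line′ : ∀ {W s} → (∀ S → IsChainIn W S → card S ≢ suc s) → HomologyBasis (OC W) s 1 → Line W s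
  basis⇒Line′ {W} {s} top H = g₀ , On⇒Supp (g-On zero) , g-cycle zero , nonzero , line
    where
    open HomologyBasis H
    g₀ = g zero
    ∑1 : ∀ (f : Fin 1 → K) → ∑ f ≡ f zero
    ∑1 f = trans (∑Fin-suc {0} f) (trans (cong (f zero +_) (∑Fin-zero _)) (+-identityʳ _))
    bd≡0 : ∀ h → On (OC W) (suc s) h → ∀ S → h S ≡ 0#
    bd≡0 h on S with h S ≟K 0#
    ... | yes z = z
    ... | no ne = ⊥-elim (top S (proj₁ (On⇒Supp {W} {suc s} on S ne)) (proj₂ (On⇒Supp {W} {suc s} on S ne)))
    nonzero : Σ (VSet N) λ S → g₀ S ≢ 0#
    nonzero with zero? g₀
    ... | inj₂ w = w
    ... | inj₁ z = ⊥-elim (1≢0 (indep (λ _ → 1#) (λ _ → 0#) (λ _ _ → refl)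
        (λ S → trans (trans (∑1 (λ k → 1# * g k S)) (trans (cong (1# *_) (z S)) (zeroʳ _))) (sym (bd-0 {c = λ _ → 0#} (λ _ → refl) S))) zero))
    line : ∀ c → Supp W s c → (∀ τ → bd c τ ≡ 0#) → Σ K λ a → ∀ S → c S ≡ a * g₀ S
    line c sp cyc with decomp c (Supp⇒On sp) cyc
    ... | a , h , on , e = a zero , λ S → trans (e S) (trans (cong₂ _+_ (bd-0 (bd≡0 h on) S) (∑1 (λ k → a k * g k S))) (+-identityˡ _))

  abstract
    basis⇒Line : ∀ {W s} → (∀ S → IsChainIn W S → card S ≢ suc s) → HomologyBasis (OC W) s 1 → Line W s
    basis⇒Line = basis⇒Line′

  -- Contraction by u keeps what accompanies u in a chain. Since u has the largest rank allowed in
  -- W, its companions can only lie below it.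
  ctr-supp : ∀ z {W r s h} → (∀ {v} → W v ≡ true → z ≺ v × ρ v ≤ r) → Supp W (suc s) h → ∀ u → ρ u ≡ r → Supp (between z u) s (ctr u h)
  ctr-supp z {W} {r} {s} {h} Wb sp u ru τ ne =
      chain-sub ch (λ {v} m → insert-∈ τ u v m) (λ {v} m → cong₂ _∧_ (≺⇒<b (lt v m)) (≺⇒<b (proj₁ (Wb (inW v m))))) ,
      ℕₚ.suc-injective (trans (sym (card-insert τ u out)) (proj₂ sp'))
    where
    out = proj₁ (ctr-≢0 u h τ ne)
    sp' = sp (τ [ u ]≔ true) (proj₂ (ctr-≢0 u h τ ne))
    ch : IsChainIn W (τ [ u ]≔ true)
    ch = proj₁ sp'
    inW : ∀ v → v ∈ˢ τ → W v ≡ true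
    inW v m = inside ch (insert-∈ τ u v m)
    lt : ∀ v → v ∈ˢ τ → v ≺ u
    lt v m with comparable ch (insert-∈ τ u v m) (insert-here {τ} u)
    ... | inj₁ le = le , λ { refl → true≢false (trans (sym m) out) }
    ... | inj₂ le = ⊥-elim (true≢false (trans (sym (subst (_∈ˢ τ) (sym u≡v) m)) out))
      where
      u≡v : u ≡ v
      u≡v = ≼-same-rank le (ℕₚ.≤-antisym (ρ-mono-≼ le) (subst (ρ v ≤_) (sym ru) (proj₂ (Wb (inW v m)))))

  -- `nz` is claimed only up to rank k, so that the numbers can be built rank by rank, while `supp`
  -- and `rel` hold at every stage for all elements.
  record Incidence (k : ℕ) : Set where
    field
      ε    : Fin N → Fin N → K
      supp : ∀ {w u} → ε w u ≢ 0# → w ⋖ u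
      nz   : ∀ {w u} → w ⋖ u → ρ u ≤ k → ε w u ≢ 0#
      rel  : ∀ v u → (∑[ w ] ε v w * ε w u) ≡ 0#

  Above? : Fin N → Fin N → Bool
  Above? z u = (z ≤ᵇ u) ∧ not ⌊ z Finₚ.≟ u ⌋

  module WithIncidence {k : ℕ} (I : Incidence k) (z : Fin N) where
    open Incidence I

    private
      ∅ : VSet N
      ∅ = replicate N false

      ∉∅ : ∀ u → lookup ∅ u ≡ false
      ∉∅ u = Vecₚ.lookup-replicate u false

    -- The cell u as the sum of all saturated chains from z (excluded) to u.
    cell : ℕ → Fin N → Chain N
    sphere : ℕ → Fin N → Chain N
    cell zero    u S = δ z u * δ ∅ S
    cell (suc j) u   = wdg u (sphere j u)
    sphere j u S     = ∑[ w ] ε w u * cell j w S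

    record CellSupp (j : ℕ) (u : Fin N) (S : VSet N) : Set where
      field
        z≼u   : z ≼ u
        rank  : ρ u ≡ ρ z ℕ.+ j
        chain : IsChainIn (Above? z) S
        size  : card S ≡ j
        under : ∀ {v} → v ∈ˢ S → v ≼ u
        here  : 0 < j → u ∈ˢ S

    sphere-≢0 : ∀ j u S → sphere j u S ≢ 0# → Σ (Fin N) λ w → w ⋖ u × cell j w S ≢ 0#
    sphere-≢0 j u S ne with ∑≢0 _ ne
    ... | w , ne' = w , supp (proj₁ (*≢0 ne')) , proj₂ (*≢0 ne')

    cell-supp : ∀ j u S → cell j u S ≢ 0# → CellSupp j u S
    cell-supp zero u S ne with z Finₚ.≟ u | ∅ ≟ S
    ... | no _ | _ = ⊥-elim (ne (zeroˡ _))
    ... | yes refl | no _ = ⊥-elim (ne (zeroʳ _))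
    ... | yes refl | yes refl = record { z≼u = ≼-refl ; rank = sym (ℕₚ.+-identityʳ _)
        ; chain = mkChain (∉∅ 𝟎) (λ {v} m → ⊥-elim (true≢false (trans (sym m) (∉∅ v)))) (λ {v} m → ⊥-elim (true≢false (trans (sym m) (∉∅ v))))
        ; size = countFin-false ∉∅ ; under = λ {v} m → ⊥-elim (true≢false (trans (sym m) (∉∅ v))) ; here = λ () }
    cell-supp (suc j) u S ne with wdg-≢0 u (sphere j u) S ne
    ... | u∈S , ne' with sphere-≢0 j u (S [ u ]≔ false) ne'
    ...   | w , w⋖u , ne'' = record
        { z≼u = ≼-trans z≼w (proj₁ (proj₁ w⋖u)) ; rank = trans (cover-rank w⋖u) (trans (cong suc IH.rank) (sym (ℕₚ.+-suc (ρ z) j)))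
        ; chain = subst (IsChainIn (Above? z)) restore (chain-insert IH.chain u≢0 (≺⇒<b z≺u) (λ m → inj₂ (≼-trans (IH.under m) (proj₁ (proj₁ w⋖u)))))
        ; size = trans (card-remove S u u∈S) (cong suc IH.size)
        ; under = bel ; here = λ _ → u∈S }
      where
      module IH = CellSupp (cell-supp j w (S [ u ]≔ false) ne'')
      z≼w = IH.z≼u
      z≺u : z ≺ u
      z≺u = ≼≺-trans z≼w (proj₁ w⋖u)
      u≢0 : u ≢ 𝟎
      u≢0 refl = proj₂ z≺u (≼-antisym (proj₁ z≺u) (𝟎≼ z))
      restore : (S [ u ]≔ false) [ u ]≔ true ≡ S
      restore = trans (Vecₚ.[]≔-idempotent S u) (trans (cong (S [ u ]≔_) (sym u∈S)) (Vecₚ.[]≔-lookup S u))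
      bel : ∀ {v} → v ∈ˢ S → v ≼ u
      bel {v} m with v Finₚ.≟ u
      ... | yes refl = ≼-refl
      ... | no ne = ≼-trans (IH.under (∈-remove {S} {u} {v} m ne)) (proj₁ (proj₁ w⋖u))

    sphere-supp : ∀ j u → Supp (between z u) j (sphere j u)
    sphere-supp j u S ne with sphere-≢0 j u S ne
    ... | w , w⋖u , ne' = chain-sub C.chain (λ m → m) (λ m → cong₂ _∧_ (≺⇒<b (≼≺-trans (C.under m) (proj₁ w⋖u))) (inside C.chain m)) , C.size
      where module C = CellSupp (cell-supp j w S ne')

    -- Mutual induction. A cell is the cone with apex u over its sphere, so its boundary is the
    -- sphere as soon as the sphere is a cycle; and the boundary of a sphere is a sum of lower
    -- spheres, whose coefficients vanish by Σ ε ε = 0.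
    bd-sphere : ∀ j u S → bd (sphere j u) S ≡ 0#
    bd-cell : ∀ j u S → bd (cell (suc j) u) S ≡ sphere j u S
    bd-sphere zero u S = bd-size0 {L = OC (between z u)} (Supp⇒On (sphere-supp zero u)) S
    bd-sphere (suc j) u S = begin
      bd (λ S → ∑[ w ] ε w u * cell (suc j) w S) S       ≡⟨ bd-∑ (λ w S → ε w u * cell (suc j) w S) S ⟩
      (∑[ w ] bd (λ S → ε w u * cell (suc j) w S) S)     ≡⟨ ∑-cong (λ w → trans (bd-* (ε w u) (cell (suc j) w) S) (cong (ε w u *_) (bd-cell j w S))) ⟩
      (∑[ w ] ε w u * (∑[ v ] ε v w * cell j v S))       ≡⟨ ∑-cong (λ w → sym (∑-*ˡ (ε w u) _)) ⟩
      (∑[ w ] ∑[ v ] ε w u * (ε v w * cell j v S))       ≡⟨ ∑-swap _ ⟩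
      (∑[ v ] ∑[ w ] ε w u * (ε v w * cell j v S))       ≡⟨ ∑-0 (λ v → trans (∑-cong (λ w → solve 3 (λ a b c → a :* (b :* c) := b :* a :* c) refl (ε w u) (ε v w) (cell j v S)))
                                                               (trans (∑-*ʳ (cell j v S) _) (trans (cong (_* cell j v S) (rel v u)) (zeroˡ _)))) ⟩
      0# ∎
      where open ≡-Reasoning
    bd-cell j u S = trans (bd-wdg u (sphere j u) S) (trans (cong (λ x → sphere j u S - x) (trans (cong (ω u S *_) (bd-sphere j u _)) (zeroʳ _)))
      (trans (cong (sphere j u S +_) neg-0) (+-identityʳ _)))

    -- The comparison map from cellular to simplicial chains above z; `bd-Θ` makes it a chain map.
    -- Here j is the rank relative to z: a cell of relative rank j is a sum of chains with j
    -- members, and z itself becomes the empty chain.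
    Θ : ℕ → (Fin N → K) → Chain N
    Θ j a S = ∑[ u ] a u * cell j u S

    bd-Θ : ∀ j a S → bd (Θ (suc j) a) S ≡ Θ j (λ w → ∑[ u ] ε w u * a u) S
    bd-Θ j a S = begin
      bd (Θ (suc j) a) S                              ≡⟨ trans (bd-∑ (λ u S → a u * cell (suc j) u S) S) (∑-cong (λ u → trans (bd-* (a u) (cell (suc j) u) S) (cong (a u *_) (bd-cell j u S)))) ⟩
      (∑[ u ] a u * (∑[ w ] ε w u * cell j w S))      ≡⟨ trans (∑-cong (λ u → sym (∑-*ˡ (a u) _))) (∑-swap _) ⟩
      (∑[ w ] ∑[ u ] a u * (ε w u * cell j w S))      ≡⟨ ∑-cong (λ w → trans (∑-cong (λ u → solve 3 (λ a e c → a :* (e :* c) := e :* a :* c) refl (a u) (ε w u) (cell j w S))) (∑-*ʳ (cell j w S) _)) ⟩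
      Θ j (λ w → ∑[ u ] ε w u * a u) S ∎
      where open ≡-Reasoning

    Θ-supp : ∀ j a (W : Fin N → Bool) → (∀ u → a u ≢ 0# → ∀ v → v ≼ u → z ≺ v → W v ≡ true) → Supp W j (Θ j a)
    Θ-supp j a W h S ne with ∑≢0 _ ne
    ... | u , ne' = chain-sub C.chain (λ m → m) (λ {v} m → h u (proj₁ (*≢0 ne')) v (C.under m) (<b⇒≺ (inside C.chain m))) , C.size
      where module C = CellSupp (cell-supp j u S (proj₂ (*≢0 ne')))

    bd-Θ0 : ∀ a S → bd (Θ 0 a) S ≡ 0#
    bd-Θ0 a S = bd-size0 {L = OC (λ _ → true)} (Supp⇒On (Θ-supp 0 a (λ _ → true) (λ _ _ _ _ _ → refl))) S

    -- The cells have disjoint supports, because the largest member of S is u. A coefficient of a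
    -- cellular chain can therefore be read off at a single simplex.
    cell-unique : ∀ j {u u' S} → cell j u S ≢ 0# → cell j u' S ≢ 0# → u ≡ u'
    cell-unique zero {u} {u'} {S} a b = trans (sym (≼-same-rank A.z≼u (sym (trans A.rank (ℕₚ.+-identityʳ _))))) (≼-same-rank B.z≼u (sym (trans B.rank (ℕₚ.+-identityʳ _))))
      where
      module A = CellSupp (cell-supp zero u S a)
      module B = CellSupp (cell-supp zero u' S b)
    cell-unique (suc j) {u} {u'} {S} a b = comparable-rank (comparable A.chain (A.here (s≤s z≤n)) (B.here (s≤s z≤n))) (trans A.rank (sym B.rank))
      where
      module A = CellSupp (cell-supp (suc j) u S a)
      module B = CellSupp (cell-supp (suc j) u' S b)

    Θ-value : ∀ j a {u S} → cell j u S ≢ 0# → Θ j a S ≡ a u * cell j u S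
    Θ-value j a {u} {S} ne = ∑-one u _ other
      where
      other : ∀ i → i ≢ u → a i * cell j i S ≡ 0#
      other i i≢u with cell j i S ≟K 0#
      ... | yes e = trans (cong (a i *_) e) (zeroʳ _)
      ... | no ne' = ⊥-elim (i≢u (cell-unique j {S = S} ne' ne))

    cell-nonzero : ∀ j u → z ≼ u → ρ u ≤ k → ρ u ≡ ρ z ℕ.+ j → Σ (VSet N) λ S → cell j u S ≢ 0#
    sphere-nonzero : ∀ j u → z ≼ u → ρ u ≤ k → ρ u ≡ ρ z ℕ.+ suc j → Σ (VSet N) λ S → sphere j u S ≢ 0#
    cell-nonzero zero u le _ e with ≼-same-rank le (sym (trans e (ℕₚ.+-identityʳ _)))
    ... | refl = ∅ , λ q → 1≢0 (trans (sym (trans (cong₂ _*_ (δ-refl z) (δ-refl ∅)) (*-identityˡ 1#))) q)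
    cell-nonzero (suc j) u le b e with sphere-nonzero j u le b e
    ... | T , ne = T [ u ]≔ true , λ q → *-≢0 (ω-≢0 u (T [ u ]≔ true) (Vecₚ.lookup∘updateAt u T)) (λ q' → ne (trans (cong (sphere j u) (sym back)) q')) q
      where
      out : lookup T u ≡ false
      out with lookup T u in eq
      ... | false = refl
      ... | true  = ⊥-elim (proj₂ (<b⇒≺ (proj₁ (∧-true {_<ᵇ'_ P u u} (inside (proj₁ (sphere-supp j u T ne)) eq)))) refl)
      back : (T [ u ]≔ true) [ u ]≔ false ≡ T
      back = trans (Vecₚ.[]≔-idempotent T u) (trans (cong (T [ u ]≔_) (sym out)) (Vecₚ.[]≔-lookup T u))
    sphere-nonzero j u le b e with coatom {z} {u} (le , λ { refl → ℕₚ.m≢1+m+n (ρ z) (trans e (ℕₚ.+-suc (ρ z) j)) })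
    ... | w , z≼w , w⋖u with cell-nonzero j w z≼w (ℕₚ.≤-trans (ρ-mono-≼ (proj₁ (proj₁ w⋖u))) b) (ℕₚ.suc-injective (trans (sym (cover-rank w⋖u)) (trans e (ℕₚ.+-suc (ρ z) j))))
    ...   | T , ne = T , λ q → *-≢0 (nz w⋖u b) ne (trans (sym (Θ-value j (λ w → ε w u) ne)) q)

    Θ-injective : ∀ j a → (∀ S → Θ j a S ≡ 0#) → ∀ u → z ≼ u → ρ u ≤ k → ρ u ≡ ρ z ℕ.+ j → a u ≡ 0#
    Θ-injective j a e u le b r with a u ≟K 0#
    ... | yes q = q
    ... | no ne with cell-nonzero j u le b r
    ...   | S , ne' = ⊥-elim (*-≢0 ne ne' (trans (sym (Θ-value j a ne')) (e S)))

    module _ (T1 : ∀ {u j} → z ≺ u → ρ u ≡ ρ z ℕ.+ suc j → Line (between z u) j) where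

      -- The top cycles of the open interval form a line with some generator g. The sphere is a
      -- non-zero multiple of g, hence a generator too.
      sphere-spans′ : ∀ {u j} → z ≺ u → ρ u ≤ k → ρ u ≡ ρ z ℕ.+ suc j → ∀ c → Supp (between z u) j c → (∀ τ → bd c τ ≡ 0#) →
        Σ K λ a → ∀ S → c S ≡ a * sphere j u S
      sphere-spans′ {u} {j} l b e c sp cyc = a * inv a' , λ S → begin
          c S                        ≡⟨ ea S ⟩
          a * g S                    ≡⟨ cong (a *_) (sym (trans (cong (_* g S) (inverse a' a'≢0)) (*-identityˡ _))) ⟩
          a * (a' * inv a' * g S)    ≡⟨ solve 4 (λ a b i g → a :* (b :* i :* g) := a :* i :* (b :* g)) refl a a' (inv a') (g S) ⟩
          a * inv a' * (a' * g S)    ≡⟨ cong (a * inv a' *_) (sym (ea' S)) ⟩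
          a * inv a' * sphere j u S ∎
        where
        open ≡-Reasoning
        L = T1 l e
        g = proj₁ L
        line = proj₂ (proj₂ (proj₂ (proj₂ L)))
        a = proj₁ (line c sp cyc)
        ea : ∀ S → c S ≡ a * g S
        ea = proj₂ (line c sp cyc)
        a' = proj₁ (line (sphere j u) (sphere-supp j u) (bd-sphere j u))
        ea' : ∀ S → sphere j u S ≡ a' * g S
        ea' = proj₂ (line (sphere j u) (sphere-supp j u) (bd-sphere j u))
        nonzero = sphere-nonzero j u (proj₁ l) b e
        a'≢0 : a' ≢ 0#
        a'≢0 q = proj₂ nonzero (trans (ea' (proj₁ nonzero)) (trans (cong (_* g (proj₁ nonzero)) q) (zeroˡ _)))

      abstract
        sphere-spans : ∀ {u j} → z ≺ u → ρ u ≤ k → ρ u ≡ ρ z ℕ.+ suc j → ∀ c → Supp (between z u) j c → (∀ τ → bd c τ ≡ 0#) →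
          Σ K λ a → ∀ S → c S ≡ a * sphere j u S
        sphere-spans = sphere-spans′

      -- A chain of j + 1 members in j + 1 available ranks contains exactly one element u of the top
      -- rank. Contraction by u leaves a top cycle of the interval below u, that is, a multiple of
      -- its sphere; multiplying by u again gives the same multiple of the cell.
      top-decompose′ : ∀ {W j h} → ρ z ℕ.+ suc j ≤ k → (∀ {v} → W v ≡ true → z ≺ v × ρ v ≤ ρ z ℕ.+ suc j) → Supp W (suc j) h →
        (∀ u → ρ u ≡ ρ z ℕ.+ suc j → ∀ τ → bd (ctr u h) τ ≡ 0#) →
        Σ (Fin N → K) λ a → (∀ u → a u ≢ 0# → W u ≡ true × ρ u ≡ ρ z ℕ.+ suc j) × (∀ S → h S ≡ Θ (suc j) a S)
      top-decompose′ {W} {j} {h} kb Wb sp cyc = a , a-supp , eq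
        where
        r = ρ z ℕ.+ suc j
        good? : ∀ u → Dec (W u ≡ true × ρ u ≡ r)
        good? u = (W u Boolₚ.≟ true) ×-dec (ρ u ℕₚ.≟ r)
        coef : ∀ u → W u ≡ true × ρ u ≡ r → Σ K λ a → ∀ S → ctr u h S ≡ a * sphere j u S
        coef u (w , e) = sphere-spans (proj₁ (Wb w)) (subst (_≤ k) (sym e) kb) e (ctr u h) (ctr-supp z Wb sp u e) (cyc u e)
        a' : ∀ u → Dec (W u ≡ true × ρ u ≡ r) → K
        a' u (yes p) = proj₁ (coef u p)
        a' u (no _)  = 0#
        a : Fin N → K
        a u = a' u (good? u)
        a-supp : ∀ u → a u ≢ 0# → W u ≡ true × ρ u ≡ r
        a-supp u = go (good? u)
          where
          go : ∀ d → a' u d ≢ 0# → W u ≡ true × ρ u ≡ r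
          go (yes p) _  = p
          go (no _)  ne = ⊥-elim (ne refl)
        term : ∀ u S → a u * cell (suc j) u S ≡ [ does (good? u) ] * ([ lookup S u ] * h S)
        term u S = term' (good? u)
         where
         term' : ∀ d → a' u d * cell (suc j) u S ≡ [ does d ] * ([ lookup S u ] * h S)
         term' (no _) = trans (zeroˡ _) (sym (zeroˡ _))
         term' (yes p) = trans (trans (solve 3 (λ a o s → a :* (o :* s) := o :* (a :* s)) refl (proj₁ (coef u p)) (ω u S) (sphere j u (S [ u ]≔ false)))
            (trans (cong (ω u S *_) (sym (proj₂ (coef u p) (S [ u ]≔ false)))) (wdg-ctr-same u h S))) (sym (*-identityˡ _))
        eq : ∀ S → h S ≡ Θ (suc j) a S
        eq S with h S ≟K 0#
        ... | yes q = trans q (sym (∑-0 (λ u → trans (term u S) (trans (cong (λ x → [ does (good? u) ] * ([ lookup S u ] * x)) q) (trans (cong ([ does (good? u) ] *_) (zeroʳ _)) (zeroʳ _))))))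
        ... | no ne with Finₚ.any? (λ u → (lookup S u Boolₚ.≟ true) ×-dec (ρ u ℕₚ.≟ r))
        ...   | no none = ⊥-elim (ℕₚ.1+n≰n (subst (_≤ j) (proj₂ (sp S ne)) (chain-size (proj₁ (sp S ne)) (ρ z) j (λ {v} m →
                  ρ-mono (proj₁ (Wb (inside (proj₁ (sp S ne)) m))) ,
                  ℕ.s≤s⁻¹ (subst (ρ v <_) (ℕₚ.+-suc (ρ z) j) (ℕₚ.≤∧≢⇒< (proj₂ (Wb (inside (proj₁ (sp S ne)) m))) (λ e → none (v , m , e))))))))
        ...   | yes (u , m , e) = sym (trans (∑-cong (λ u → term u S)) (trans (∑-one u _ other) (trans (cong₂ (λ p q → p * (q * h S)) here' (cong [_] m)) (trans (*-identityˡ _) (*-identityˡ _)))))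
          where
          here' : [ does (good? u) ] ≡ 1#
          here' = [yes] (good? u) (inside (proj₁ (sp S ne)) m , e)
          other : ∀ i → i ≢ u → [ does (good? i) ] * ([ lookup S i ] * h S) ≡ 0#
          other i i≢u = [dec] (good? i) λ p → absent (lookup S i) refl (proj₂ p)
            where
            absent : ∀ b → lookup S i ≡ b → ρ i ≡ r → [ b ] * h S ≡ 0#
            absent false _  _  = zeroˡ _
            absent true  mi e' = ⊥-elim (i≢u (comparable-rank (comparable (proj₁ (sp S ne)) mi m) (trans e' (sym e))))

      abstract
        top-decompose : ∀ {W j h} → ρ z ℕ.+ suc j ≤ k → (∀ {v} → W v ≡ true → z ≺ v × ρ v ≤ ρ z ℕ.+ suc j) → Supp W (suc j) h →
          (∀ u → ρ u ≡ ρ z ℕ.+ suc j → ∀ τ → bd (ctr u h) τ ≡ 0#) →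
          Σ (Fin N → K) λ a → (∀ u → a u ≢ 0# → W u ≡ true × ρ u ≡ ρ z ℕ.+ suc j) × (∀ S → h S ≡ Θ (suc j) a S)
        top-decompose = top-decompose′

  module Push (z : Fin N) (Q : Fin N → Bool) (downQ : ∀ {u v} → u ≼ v → Q v ≡ true → Q u ≡ true)
    (T1 : ∀ {u s} → z ≺ u → s ≢ ρ u ∸ suc (ρ z) → Ex (between z u) s) where

    upto≤ : ℕ → Fin N → Bool
    upto≤ r v = upto Q z v ∧ does (ρ v ≤? r)

    upto≤⇒ : ∀ {r v} → upto≤ r v ≡ true → upto Q z v ≡ true × ρ v ≤ r
    upto≤⇒ {r} {v} e = proj₁ (∧-true {upto Q z v} e) , witness (ρ v ≤? r) (proj₂ (∧-true {upto Q z v} e))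

    ⇒upto≤ : ∀ {r v} → upto Q z v ≡ true → ρ v ≤ r → upto≤ r v ≡ true
    ⇒upto≤ {r} {v} e le = cong₂ _∧_ e (dec-true (ρ v ≤? r) le)

    -- Cellular approximation. For u of rank r + 1 the contraction of the filling h by u is a cycle
    -- of the interval between z and u, because c does not involve u. Its degree lies below that of
    -- the sphere, so it bounds some l. Replacing the cone over it with apex u by l removes u from h
    -- and keeps the boundary.
    push′ : ∀ {r s} → s ℕ.+ ρ z < r → Ex (upto≤ (suc r)) s → Ex (upto≤ r) s
    push′ {r} {s} lt ex c sp cyc = h' , supp' , λ S → sym (bd-h' S)
      where
      W = upto≤ (suc r)
      e₀ = ex c (λ S ne → chain-sub (proj₁ (sp S ne)) (λ m → m) (λ {v} m → let p = upto≤⇒ {r} {v} (inside (proj₁ (sp S ne)) m) in ⇒upto≤ (proj₁ p) (ℕₚ.m≤n⇒m≤1+n (proj₂ p))) , proj₂ (sp S ne)) cyc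
      h = proj₁ e₀
      sh : Supp W (suc s) h
      sh = proj₁ (proj₂ e₀)
      bh : ∀ S → c S ≡ bd h S
      bh = proj₂ (proj₂ e₀)
      Wb : ∀ {v} → W v ≡ true → z ≺ v × ρ v ≤ suc r
      Wb {v} e = proj₂ (upto⇒ {Q} {z} (proj₁ (upto≤⇒ {suc r} {v} e))) , proj₂ (upto≤⇒ {suc r} {v} e)
      good? : ∀ u → Dec (W u ≡ true × ρ u ≡ suc r)
      good? u = (W u Boolₚ.≟ true) ×-dec (ρ u ℕₚ.≟ suc r)
      cycle : ∀ u → ρ u ≡ suc r → ∀ τ → bd (ctr u h) τ ≡ 0#
      cycle u ru τ = trans (solve 1 (λ x → x := :- (:- x)) refl (bd (ctr u h) τ)) (trans (cong -_ (trans (sym (ctr-bd u h τ)) (trans (cong (κ u τ *_) (sym (bh (τ [ u ]≔ true)))) (trans (cong (κ u τ *_) c≡0) (zeroʳ _))))) neg-0)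
        where
        c≡0 : c (τ [ u ]≔ true) ≡ 0#
        c≡0 with c (τ [ u ]≔ true) ≟K 0#
        ... | yes q = q
        ... | no ne = ⊥-elim (ℕₚ.1+n≰n (subst (_≤ r) ru (proj₂ (upto≤⇒ {r} {u} (inside (proj₁ (sp (τ [ u ]≔ true) ne)) (insert-here {τ} u))))))
      fill : ∀ u → W u ≡ true × ρ u ≡ suc r → Σ (Chain N) λ l → Supp (between z u) (suc s) l × (∀ S → ctr u h S ≡ bd l S)
      fill u (w , e) = T1 (proj₁ (Wb w)) (λ q → ℕₚ.<-irrefl (trans (cong (ℕ._+ ρ z) q) (trans (cong (λ x → x ∸ suc (ρ z) ℕ.+ ρ z) e) (ℕₚ.m∸n+n≡m (ℕₚ.≤-trans (ℕₚ.m≤n+m (ρ z) s) (ℕₚ.<⇒≤ lt))))) lt) (ctr u h) (ctr-supp z (λ {v} → Wb {v}) sh u e) (cycle u e)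
      l' : ∀ u → Dec (W u ≡ true × ρ u ≡ suc r) → Chain N
      l' u (yes p) = proj₁ (fill u p)
      l' u (no _)  = λ _ → 0#
      corr : Fin N → Chain N
      corr u S = l' u (good? u) S - [ does (good? u) ] * wdg u (ctr u h) S
      h' : Chain N
      h' S = h S + (∑[ u ] corr u S)
      bd-corr : ∀ u S → bd (corr u) S ≡ 0#
      bd-corr u S = go (good? u)
       where
       go : ∀ d → bd (λ S → l' u d S - [ does d ] * wdg u (ctr u h) S) S ≡ 0#
       go (no _) = bd-0 (λ S → trans (cong (λ x → 0# - x) (zeroˡ (wdg u (ctr u h) S))) (x-x 0#)) S
       go (yes p) = trans (bd-sub (proj₁ (fill u p)) (λ S → 1# * wdg u (ctr u h) S) S)
          (trans (cong₂ _-_ (sym (proj₂ (proj₂ (fill u p)) S)) (trans (bd-* 1# (wdg u (ctr u h)) S) (trans (*-identityˡ _) (trans (bd-wdg u (ctr u h) S)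
            (trans (cong (λ x → ctr u h S - x) (trans (cong (ω u S *_) (cycle u (proj₂ p) _)) (zeroʳ _))) (trans (cong (ctr u h S +_) neg-0) (+-identityʳ _))))))) (x-x _))
      bd-h' : ∀ S → bd h' S ≡ c S
      bd-h' S = trans (bd-+ h (λ S → ∑[ u ] corr u S) S) (trans (cong₂ _+_ (sym (bh S)) (trans (bd-∑ corr S) (∑-0 (λ u → bd-corr u S)))) (+-identityʳ _))
      supp' : Supp (upto≤ r) (suc s) h'
      supp' S ne with Finₚ.any? (λ u → ¬? (l' u (good? u) S ≟K 0#))
      ... | yes (u , ln) = from-l u (good? u) ln
        where
        from-l : ∀ u d → l' u d S ≢ 0# → IsChainIn (upto≤ r) S × card S ≡ suc s
        from-l u (no _) f = ⊥-elim (f refl)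
        from-l u (yes (w , e)) f = chain-sub ch (λ m → m) (λ {v} m → ⇒upto≤ (⇒upto {Q} {z} (downQ (proj₁ (vu v m)) Qu) (zv v m)) (ℕ.s≤s⁻¹ (subst (ρ v <_) e (ρ-mono (vu v m))))) , proj₂ cs
          where
          cs : IsChainIn (between z u) S × card S ≡ suc s
          cs = proj₁ (proj₂ (fill u (w , e))) S f
          ch = proj₁ cs
          Qu : Q u ≡ true
          Qu = proj₁ (upto⇒ {Q} {z} (proj₁ (upto≤⇒ {suc r} {u} w)))
          vu : ∀ v → v ∈ˢ S → v ≺ u
          vu v m = <b⇒≺ (proj₁ (∧-true {_<ᵇ'_ P v u} (inside ch m)))
          zv : ∀ v → v ∈ˢ S → z ≺ v
          zv v m = <b⇒≺ (proj₂ (∧-true {_<ᵇ'_ P v u} (inside ch m)))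
      -- If no replacement chain l is non-zero at S, a member of S of rank r + 1 would contribute
      -- the correction - h S and cancel the value of h there; so S has no such member.
      ... | no none = chain-sub ch (λ m → m) (λ {v} m → let p = upto≤⇒ {suc r} {v} (inside ch m) in ⇒upto≤ (proj₁ p) (ℕ.s≤s⁻¹ (ℕₚ.≤∧≢⇒< (proj₂ p) (λ e → no-top v m (inside ch m , e))))) , proj₂ (sh S h≢0)
        where
        l≡0 : ∀ u → l' u (good? u) S ≡ 0#
        l≡0 u with l' u (good? u) S ≟K 0#
        ... | yes q = q
        ... | no f = ⊥-elim (none (u , f))
        wd : ∀ u → corr u S ≡ - ([ does (good? u) ] * ([ lookup S u ] * h S))
        wd u = trans (cong₂ _-_ (l≡0 u) (cong ([ does (good? u) ] *_) (wdg-ctr-same u h S))) (+-identityˡ _)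
        h≢0 : h S ≢ 0#
        h≢0 q = ne (trans (cong₂ _+_ q (∑-0 (λ u → trans (wd u) (trans (cong (λ x → - ([ does (good? u) ] * ([ lookup S u ] * x))) q) (trans (cong -_ (trans (cong ([ does (good? u) ] *_) (zeroʳ _)) (zeroʳ _))) neg-0))))) (+-identityʳ _))
        ch = proj₁ (sh S h≢0)
        no-top : ∀ v → v ∈ˢ S → ¬ (W v ≡ true × ρ v ≡ suc r)
        no-top v m p = ne (trans (cong (h S +_) (trans (∑-cong wd) (trans (∑-one v _ other) (cong -_ (trans (cong₂ (λ a b → a * (b * h S)) here' (cong [_] m)) (trans (*-identityˡ _) (*-identityˡ _))))))) (x-x _))
          where
          here' : [ does (good? v) ] ≡ 1#
          here' = [yes] (good? v) p
          other : ∀ i → i ≢ v → - ([ does (good? i) ] * ([ lookup S i ] * h S)) ≡ 0#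
          other i i≢v = trans (cong -_ ([dec] (good? i) λ q → absent (lookup S i) refl (proj₂ q))) neg-0
            where
            absent : ∀ b → lookup S i ≡ b → ρ i ≡ suc r → [ b ] * h S ≡ 0#
            absent false _  _  = zeroˡ _
            absent true  mi e' = ⊥-elim (i≢v (comparable-rank (comparable ch mi m) (trans e' (sym (proj₂ p)))))

    abstract
      push : ∀ {r s} → s ℕ.+ ρ z < r → Ex (upto≤ (suc r)) s → Ex (upto≤ r) s
      push = push′

    push-down′ : ∀ {s} → Ex (upto Q z) s → ∀ r → s ℕ.+ ρ z < r → Ex (upto≤ r) s
    push-down′ {s} ex r lt = go (n ∸ r) r (ℕₚ.m≤n+m∸n n r) lt
      where
      go : ∀ d r → n ≤ r ℕ.+ d → s ℕ.+ ρ z < r → Ex (upto≤ r) s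
      go zero r le lt = Ex-cong (λ v → sym (all v)) ex
        where
        all : ∀ v → upto≤ r v ≡ upto Q z v
        all v = trans (cong (upto Q z v ∧_) (dec-true (ρ v ≤? r) (ℕₚ.≤-trans (ρ≤n v) (subst (n ≤_) (ℕₚ.+-identityʳ r) le)))) (Boolₚ.∧-identityʳ _)
      go (suc d) r le lt = push lt (go d (suc r) (subst (n ≤_) (ℕₚ.+-suc r d) le) (ℕₚ.m≤n⇒m≤1+n lt))

    abstract
      push-down : ∀ {s} → Ex (upto Q z) s → ∀ r → s ℕ.+ ρ z < r → Ex (upto≤ r) s
      push-down = push-down′

-- Incidence numbers and the cellular complex

module Incidences (F : OrderedField) {N : ℕ} (P : PosetData N) (n : ℕ) (graded : IsGradedPoset P n)
  (T : ∀ z y → GradedPoset._≺_ P n graded z y → ∀ s →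
    Exterior.HomologyBasis F (OrderComplex P (GradedPoset.between P n graded z y)) s (if s ≡ᵇ (PosetData.ρ P y ∸ suc (PosetData.ρ P z)) then 1 else 0))
  where
  open OrderedField F
  open Solver ring
  open Sums ring
  open SumVSet ring
  open LinAlg F
  open Exterior F
  open GradedPoset P n graded
  open Chains F P n graded

  between⇒ : ∀ {z y u} → between z y u ≡ true → z ≺ u × u ≺ y
  between⇒ {z} {y} {u} e = <b⇒≺ (proj₂ p) , <b⇒≺ (proj₁ p)
    where p = ∧-true {_<ᵇ'_ P u y} e

  ⇒between : ∀ {z y u} → z ≺ u → u ≺ y → between z y u ≡ true
  ⇒between a b = cong₂ _∧_ (≺⇒<b b) (≺⇒<b a)

  interval-Ex′ : ∀ {z u s} → z ≺ u → s ≢ ρ u ∸ suc (ρ z) → Ex (between z u) s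
  interval-Ex′ {z} {u} {s} l ne = basis⇒Ex (subst (λ b → HomologyBasis (OC (between z u)) s (if b then 1 else 0)) (≡ᵇ-false ne) (T z u l s))

  abstract
    interval-Ex : ∀ {z u s} → z ≺ u → s ≢ ρ u ∸ suc (ρ z) → Ex (between z u) s
    interval-Ex = interval-Ex′

  interval-Line′ : ∀ z {u j} → z ≺ u → ρ u ≡ ρ z ℕ.+ suc j → Line (between z u) j
  interval-Line′ z {u} {j} l e = basis⇒Line top (subst (λ b → HomologyBasis (OC (between z u)) j (if b then 1 else 0)) (trans (cong (j ≡ᵇ_) dim) (≡ᵇ-refl j)) (T z u l j))
    where
    dim : ρ u ∸ suc (ρ z) ≡ j
    dim = trans (cong (_∸ suc (ρ z)) (trans e (ℕₚ.+-suc (ρ z) j))) (ℕₚ.m+n∸m≡n (ρ z) j)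
    top : ∀ S → IsChainIn (between z u) S → card S ≢ suc j
    top S ch q = ℕₚ.1+n≰n (subst (_≤ j) q (chain-size ch (ρ z) j λ {v} m → let p = between⇒ {z} {u} {v} (inside ch m) in
      ρ-mono (proj₁ p) , ℕ.s≤s⁻¹ (subst (ρ v <_) (trans e (ℕₚ.+-suc (ρ z) j)) (ρ-mono (proj₂ p)))))

  abstract
    interval-Line : ∀ z {u j} → z ≺ u → ρ u ≡ ρ z ℕ.+ suc j → Line (between z u) j
    interval-Line = interval-Line′

  private
    ∅ : VSet N
    ∅ = replicate N false

    ∉∅ : ∀ u → lookup ∅ u ≡ false
    ∉∅ u = Vecₚ.lookup-replicate u false

    point : Fin N → Chain N
    point w = wdg w (δ ∅)

    point-supp : ∀ {W w} → w ≢ 𝟎 → W w ≡ true → Supp W 1 (point w)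
    point-supp {W} {w} ne q S nz with wdg-≢0 w (δ ∅) S nz
    ... | m , nz' with ∅ ≟ (S [ w ]≔ false)
    ...   | no _  = ⊥-elim (nz' refl)
    ...   | yes e = subst (IsChainIn W) (trans (cong (_[ w ]≔ true) e) restore) (chain-insert {W} {∅} {w} empty ne q (λ {v} m → ⊥-elim (true≢false (trans (sym m) (∉∅ v))))) ,
            trans (card-remove S w m) (cong suc (trans (cong card (sym e)) (countFin-false ∉∅)))
      where
      restore : (S [ w ]≔ false) [ w ]≔ true ≡ S
      restore = trans (Vecₚ.[]≔-idempotent S w) (trans (cong (S [ w ]≔_) (sym m)) (Vecₚ.[]≔-lookup S w))
      empty : IsChainIn W ∅
      empty = mkChain (∉∅ 𝟎) (λ {v} m → ⊥-elim (true≢false (trans (sym m) (∉∅ v)))) (λ {v} m → ⊥-elim (true≢false (trans (sym m) (∉∅ v))))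

    insert≢∅ : ∀ τ u → ∅ ≢ (τ [ u ]≔ true)
    insert≢∅ τ u e = true≢false (trans (sym (Vecₚ.lookup∘updateAt u τ)) (trans (cong (λ S → lookup S u) (sym e)) (∉∅ u)))

    bd-∅ : ∀ S → bd (δ ∅) S ≡ 0#
    bd-∅ S = ∑-0 (λ u → trans (cong (κ u S *_) (δ-≢ (insert≢∅ S u))) (zeroʳ _))

    bd-point : ∀ w S → bd (point w) S ≡ δ ∅ S
    bd-point w S = trans (bd-wdg w (δ ∅) S) (trans (cong (λ x → δ ∅ S - x) (trans (cong (ω w S *_) (bd-∅ (S [ w ]≔ false))) (zeroʳ _))) (trans (cong (δ ∅ S +_) neg-0) (+-identityʳ _)))

    ctr-point : ∀ v w → ctr v (point w) ∅ ≡ δ v w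
    ctr-point v w with v Finₚ.≟ w
    ... | yes refl = trans (ctr-wdg-same v (δ ∅) ∅) (trans (cong₂ (λ a b → [ not a ] * b) (∉∅ v) (δ-refl ∅)) (*-identityˡ 1#))
    ... | no ne    = trans (ctr-wdg-≢ ne (δ ∅) ∅) (trans (cong -_ (trans (cong (_* ctr v (δ ∅) (∅ [ w ]≔ false)) (ω-∉ w ∅ (∉∅ w))) (zeroˡ _))) neg-0)

  -- χ is locally constant on the interval, and H̃₀ vanishes.
  connected′ : ∀ {x u} → Ex (between x u) 1 → (χ : Fin N → K) →
    (∀ {v v'} → between x u v ≡ true → between x u v' ≡ true → v ≼ v' → χ v ≡ χ v') →
    ∀ {w w'} → between x u w ≡ true → between x u w' ≡ true → χ w ≡ χ w'
  connected′ {x} {u} ex χ loc {w} {w'} bw bw' = x-y≡0 (begin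
      χ w - χ w'                                                ≡⟨ cong₂ _-_ (sym (∑-δʳ w χ)) (sym (∑-δʳ w' χ)) ⟩
      (∑[ v ] χ v * δ v w) - (∑[ v ] χ v * δ v w')              ≡⟨ sym (∑-sub _ _) ⟩
      (∑[ v ] χ v * δ v w - χ v * δ v w')                       ≡⟨ ∑-cong (λ v → trans (cong₂ (λ a b → χ v * a - χ v * b) (sym (ctr-point v w)) (sym (ctr-point v w')))
                                                                     (solve 4 (λ c k a b → c :* (k :* a) :- c :* (k :* b) := c :* (k :* (a :- b))) refl (χ v) (κ v ∅) (point w (∅ [ v ]≔ true)) (point w' (∅ [ v ]≔ true)))) ⟩
      (∑[ v ] χ v * ctr v c ∅)                                  ≡⟨ ∑-cong (λ v → cong (χ v *_) (trans (cong (κ v ∅ *_) (bh _)) (sym (∑-*ˡ (κ v ∅) _)))) ⟩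
      (∑[ v ] χ v * (∑[ t ] A v t))                             ≡⟨ ∑-cong (λ v → sym (∑-*ˡ (χ v) _)) ⟩
      X                                                         ≡⟨ X≡0 ⟩
      0# ∎)
    where
    open ≡-Reasoning
    nz : ∀ {w} → between x u w ≡ true → w ≢ 𝟎
    nz b refl = proj₂ (proj₁ (between⇒ b)) (≼-antisym (proj₁ (proj₁ (between⇒ b))) (𝟎≼ x))
    c : Chain N
    c S = point w S - point w' S
    c-supp : Supp (between x u) 1 c
    c-supp S ne = either (point w S ≟K 0#)
      where
      either : Dec (point w S ≡ 0#) → IsChainIn (between x u) S × card S ≡ 1
      either (no q)  = point-supp (nz bw) bw S q
      either (yes q) = point-supp (nz bw') bw' S (λ q' → ne (trans (cong₂ _-_ q q') (x-x 0#)))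
    r = ex c c-supp (λ τ → trans (bd-sub (point w) (point w') τ) (trans (cong₂ _-_ (bd-point w τ) (bd-point w' τ)) (x-x _)))
    h = proj₁ r
    bh = proj₂ (proj₂ r)
    A : Fin N → Fin N → K
    A v t = ctr v (ctr t h) ∅
    -- The pairing of χ with the boundary of h. On every edge of h the values χ v and χ t agree,
    -- while A v t is antisymmetric, so X equals its own negative.
    X = ∑[ v ] ∑[ t ] χ v * A v t
    sym-χ : ∀ v t → χ v * A v t ≡ χ t * A v t
    sym-χ v t = trans (*-comm _ _) (trans (*-on same) (*-comm _ _))
      where
      same : A v t ≢ 0# → χ v ≡ χ t
      same ne = pick-order (comparable ch v∈ t∈)
        where
        ne' = proj₂ (ctr-≢0 t h (∅ [ v ]≔ true) (proj₂ (ctr-≢0 v (ctr t h) ∅ ne)))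
        ch : IsChainIn (between x u) ((∅ [ v ]≔ true) [ t ]≔ true)
        ch = proj₁ (proj₁ (proj₂ r) ((∅ [ v ]≔ true) [ t ]≔ true) ne')
        v∈ = insert-∈ (∅ [ v ]≔ true) t v (insert-here {∅} v)
        t∈ = insert-here {∅ [ v ]≔ true} t
        pick-order : v ≼ t ⊎ t ≼ v → χ v ≡ χ t
        pick-order (inj₁ l) = loc (inside ch v∈) (inside ch t∈) l
        pick-order (inj₂ l) = sym (loc (inside ch t∈) (inside ch v∈) l)
    X≡-X : X ≡ - X
    X≡-X = begin
      X                                    ≡⟨ ∑-cong (λ v → ∑-cong (λ t → sym-χ v t)) ⟩
      (∑[ v ] ∑[ t ] χ t * A v t)          ≡⟨ ∑-swap _ ⟩
      (∑[ t ] ∑[ v ] χ t * A v t)          ≡⟨ ∑-cong (λ t → trans (∑-cong (λ v → trans (cong (χ t *_) (ctr-ctr v t h ∅)) (solve 2 (λ a b → a :* (:- b) := :- (a :* b)) refl (χ t) (A t v)))) (∑-neg _)) ⟩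
      (∑[ t ] - (∑[ v ] χ t * A t v))      ≡⟨ ∑-neg _ ⟩
      - X ∎
    X≡0 : X ≡ 0#
    X≡0 = *-cancel0 {1# + 1#} (trans (distribʳ X 1# 1#) (trans (cong₂ _+_ (*-identityˡ X) (trans (*-identityˡ X) X≡-X)) (x-x X))) two≢0
      where
      two≢0 : 1# + 1# ≢ 0#
      two≢0 e with fromℕ-inj {2} {0} (trans (fromℕ-suc 1) (trans (cong (1# +_) 1-homo) (trans e (sym 0-homo))))
      ... | ()

  abstract
    connected : ∀ {x u} → Ex (between x u) 1 → (χ : Fin N → K) →
      (∀ {v v'} → between x u v ≡ true → between x u v' ≡ true → v ≼ v' → χ v ≡ χ v') →
      ∀ {w w'} → between x u w ≡ true → between x u w' ≡ true → χ w ≡ χ w'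
    connected = connected′

  private
    ρ0 : ∀ j → ρ 𝟎 ℕ.+ j ≡ j
    ρ0 j = cong (ℕ._+ j) ρ𝟎

  -- The fundamental cycle of the open interval below u is cellular; its coefficients are the new incidence numbers.
  fundamental : ∀ {k} (I : Incidence (suc k)) (u : Fin N) → ρ u ≡ suc (suc k) →
    Σ (Fin N → K) λ a → (∀ w → a w ≢ 0# → w ⋖ u) × (∀ v → (∑[ w ] Incidence.ε I v w * a w) ≡ 0#) × Σ (Fin N) λ w → a w ≢ 0#
  fundamental {k} I u ru = a , a-supp , a-rel , some (zero? a)
    where
    open Incidence I
    𝟎≺u : 𝟎 ≺ u
    𝟎≺u = 𝟎≼ u , λ e → ℕₚ.1+n≢0 (trans (sym ru) (trans (cong ρ (sym e)) ρ𝟎))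
    L = interval-Line 𝟎 {u} {suc k} 𝟎≺u (trans ru (sym (ρ0 (suc (suc k)))))
    g = proj₁ L
    g-cycle : ∀ τ → bd g τ ≡ 0#
    g-cycle = proj₁ (proj₂ (proj₂ L))
    g≢0 : Σ (VSet N) λ S → g S ≢ 0#
    g≢0 = proj₁ (proj₂ (proj₂ (proj₂ L)))
    module W0 = WithIncidence I 𝟎
    dec = W0.top-decompose (interval-Line 𝟎) {between 𝟎 u} {k} {g} (ℕₚ.≤-reflexive (ρ0 (suc k)))
      (λ {v} e → let p = between⇒ {𝟎} {u} {v} e in proj₁ p , subst (ρ v ≤_) (sym (ρ0 (suc k))) (ℕ.s≤s⁻¹ (subst (ρ v <_) ru (ρ-mono (proj₂ p)))))
      (proj₁ (proj₂ L))
      (λ w _ τ → trans (solve 1 (λ x → x := :- (:- x)) refl (bd (ctr w g) τ)) (trans (cong -_ (trans (sym (ctr-bd w g τ)) (trans (cong (κ w τ *_) (g-cycle _)) (zeroʳ _)))) neg-0))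
    a : Fin N → K
    a = proj₁ dec
    g≡Θ : ∀ S → g S ≡ W0.Θ (suc k) a S
    g≡Θ = proj₂ (proj₂ dec)
    a-supp : ∀ w → a w ≢ 0# → w ⋖ u
    a-supp w ne = ≼⇒⋖ (proj₁ (proj₂ (between⇒ {𝟎} {u} (proj₁ br)))) (trans ru (cong suc (sym (trans (proj₂ br) (ρ0 (suc k))))))
      where
      br : between 𝟎 u w ≡ true × ρ w ≡ ρ 𝟎 ℕ.+ suc k
      br = proj₁ (proj₂ dec) w ne
    a-rel : ∀ v → (∑[ w ] ε v w * a w) ≡ 0#
    a-rel v = go (ρ v ℕₚ.≟ k)
      where
      go : Dec (ρ v ≡ k) → (∑[ w ] ε v w * a w) ≡ 0#
      go (yes r) = W0.Θ-injective k (λ v → ∑[ w ] ε v w * a w)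
              (λ S → trans (sym (W0.bd-Θ k a S)) (trans (bd-cong (λ S → sym (g≡Θ S)) S) (g-cycle S)))
              v (𝟎≼ v) (ℕₚ.m≤n⇒m≤1+n (ℕₚ.≤-reflexive r)) (trans r (sym (ρ0 k)))
      go (no nr) = ∑-0 λ w → vanish λ p q → nr (ℕₚ.suc-injective (ℕₚ.suc-injective (trans (cong suc (sym (cover-rank (supp p)))) (trans (sym (cover-rank (a-supp w q))) ru))))
    some : (∀ w → a w ≡ 0#) ⊎ Σ (Fin N) (λ w → a w ≢ 0#) → Σ (Fin N) λ w → a w ≢ 0#
    some (inj₂ w) = w
    some (inj₁ z) = ⊥-elim (proj₂ g≢0 (trans (g≡Θ _) (∑-0 (λ w → trans (cong (_* W0.cell (suc k) w (proj₁ g≢0)) (z w)) (zeroˡ _)))))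

  module Step {k : ℕ} (I : Incidence (suc k)) (u : Fin N) (ru : ρ u ≡ suc (suc k)) (a : Fin N → K)
    (a-supp : ∀ w → a w ≢ 0# → w ⋖ u) (a-rel : ∀ v → (∑[ w ] Incidence.ε I v w * a w) ≡ 0#) (some : Σ (Fin N) λ w → a w ≢ 0#) where
    open Incidence I

    private
      𝟎≺u : 𝟎 ≺ u
      𝟎≺u = 𝟎≼ u , λ e → ℕₚ.1+n≢0 (trans (sym ru) (trans (cong ρ (sym e)) ρ𝟎))

      -- A relation Σ ε a = 0 alone does not exclude that some coefficient of the fundamental cycle
      -- vanishes. Non-vanishing is transported from one coatom of u to another through the elements
      -- x below both, and x = 𝟎 is the case that is wanted.
      Spread : Fin N → Set
      Spread x = ∀ w w' → w ⋖ u → w' ⋖ u → x ≼ w → x ≼ w' → a w ≢ 0# → a w' ≢ 0#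

      -- Below a rank-two interval the two boundary coefficients determine each other.
      spread₂ : ∀ x → x ≺ u → ρ u ≡ ρ x ℕ.+ 2 → Spread x
      spread₂ x l e w w' c c' xw xw' aw aw' with w Finₚ.≟ w'
      ... | yes refl = aw aw'
      ... | no w≢w' = aw (Wx.Θ-injective 1 a (λ S → trans (ec S) (trans (cong (_* g' S) λ₁≡0) (zeroˡ _))) w xw rw≤ rw)
        where
        module Wx = WithIncidence I x
        L' = interval-Line x {u} {1} l e
        g' = proj₁ L'
        rank1 : ∀ {w} → w ⋖ u → ρ w ≡ ρ x ℕ.+ 1
        rank1 c = ℕₚ.suc-injective (trans (sym (cover-rank c)) (trans e (ℕₚ.+-suc (ρ x) 1)))
        rw = rank1 c
        rw' = rank1 c'
        bound : ∀ {w} → w ⋖ u → ρ w ≤ suc k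
        bound c = ℕₚ.≤-reflexive (ℕₚ.suc-injective (trans (sym (cover-rank c)) ru))
        rw≤ = bound c
        cov : ∀ {w} → w ⋖ u → x ≼ w → x ⋖ w
        cov c xw = ≼⇒⋖ xw (trans (rank1 c) (ℕₚ.+-comm (ρ x) 1))
        supp1 : ∀ b → (∀ w → b w ≢ 0# → w ⋖ u) → Supp (between x u) 1 (Wx.Θ 1 b)
        supp1 b h = Wx.Θ-supp 1 b (between x u) (λ w nw v vw xv → ⇒between xv (≼≺-trans vw (proj₁ (h w nw))))
        cyc1 : ∀ b → (∑[ w ] ε x w * b w) ≡ 0# → ∀ S → bd (Wx.Θ 1 b) S ≡ 0#
        cyc1 b q S = trans (Wx.bd-Θ 0 b S) (∑-0 (λ v → term v))
          where
          term : ∀ v → (∑[ w ] ε v w * b w) * (δ x v * δ ∅ S) ≡ 0#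
          term v with x Finₚ.≟ v
          ... | yes refl = trans (cong (_* (1# * δ ∅ S)) q) (zeroˡ _)
          ... | no _ = trans (cong ((∑[ w ] ε v w * b w) *_) (zeroˡ _)) (zeroʳ _)
        -- A test cycle supported on w and w' alone, with coefficients dictated by the single
        -- relation at x. It is non-zero at w', so the generator g' is non-zero on the cell w'. A
        -- vanishing a w' then makes Θ 1 a the zero multiple of g', and a w vanishes as well.
        b : Fin N → K
        b v = δ v w * inv (ε x w) - δ v w' * inv (ε x w')
        b-supp : ∀ v → b v ≢ 0# → v ⋖ u
        b-supp v ne with v Finₚ.≟ w | v Finₚ.≟ w'
        ... | yes refl | _ = c
        ... | no _ | yes refl = c'
        ... | no p | no q = ⊥-elim (ne (trans (cong₂ _-_ (zeroˡ _) (zeroˡ _)) (x-x 0#)))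
        b-rel : (∑[ v ] ε x v * b v) ≡ 0#
        b-rel = trans (∑-cong (λ v → solve 5 (λ e d i d' i' → e :* (d :* i :- d' :* i') := e :* d :* i :- e :* d' :* i') refl (ε x v) (δ v w) (inv (ε x w)) (δ v w') (inv (ε x w'))))
          (trans (∑-sub _ _) (trans (cong₂ _-_ (one w (cov c xw) rw≤) (one w' (cov c' xw') (bound c'))) (x-x 1#)))
          where
          one : ∀ w → x ⋖ w → ρ w ≤ suc k → (∑[ v ] ε x v * δ v w * inv (ε x w)) ≡ 1#
          one w cw bw = trans (∑-*ʳ _ _) (trans (cong (_* inv (ε x w)) (∑-δʳ w (ε x))) (inverse _ (nz cw bw)))
        la = proj₂ (proj₂ (proj₂ (proj₂ L'))) (Wx.Θ 1 a) (supp1 a a-supp) (cyc1 a (a-rel x))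
        lb = proj₂ (proj₂ (proj₂ (proj₂ L'))) (Wx.Θ 1 b) (supp1 b b-supp) (cyc1 b b-rel)
        ec = proj₂ la
        S' = Wx.cell-nonzero 1 w' xw' (bound c') rw'
        bw' : b w' ≢ 0#
        bw' q = 1≢0 (trans (sym (inverse _ (nz (cov c' xw') (bound c')))) (trans (cong (ε x w' *_) i≡0) (zeroʳ _)))
          where
          i≡0 : inv (ε x w') ≡ 0#
          i≡0 = trans (solve 1 (λ i → i := :- (con ℤ0 :- con ℤ1 :* i)) refl (inv (ε x w'))) (trans (cong -_ (trans (cong₂ _-_ (trans 0-homo (sym (trans (cong (_* inv (ε x w)) (δ-≢ (λ e → w≢w' (sym e)))) (zeroˡ _)))) (cong (_* inv (ε x w')) (trans 1-homo (sym (δ-refl w'))))) q)) neg-0)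
            where open import Data.Integer using () renaming (0ℤ to ℤ0; 1ℤ to ℤ1)
        g'S≢0 : g' (proj₁ S') ≢ 0#
        g'S≢0 q = *-≢0 bw' (proj₂ S') (trans (sym (Wx.Θ-value 1 b (proj₂ S'))) (trans (proj₂ lb (proj₁ S')) (trans (cong (proj₁ lb *_) q) (zeroʳ _))))
        λ₁≡0 : proj₁ la ≡ 0#
        λ₁≡0 = *-cancel0 {g' (proj₁ S')} (trans (*-comm _ _) (trans (sym (ec (proj₁ S'))) (trans (Wx.Θ-value 1 a (proj₂ S')) (trans (cong (_* Wx.cell 1 w' (proj₁ S')) aw') (zeroˡ _))))) g'S≢0

      -- Let χ v indicate that some coatom above v has a non-zero coefficient. By induction on the
      -- shorter intervals below u, χ is constant along relations inside the open interval between x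
      -- and u. From length 3 on this interval is connected, so χ takes the same value at any two
      -- coatoms.
      spread : ∀ {x} → Acc (flip _≺_) x → x ≺ u → ρ x ℕ.+ 2 ≤ ρ u → Spread x
      spread {x} (acc rs) l le with ρ x ℕ.+ 2 ℕₚ.≟ ρ u
      ... | yes e = spread₂ x l (sym e)
      ... | no ne = λ w w' c c' xw xw' aw aw' → ⊥-elim (1≢0 (trans (sym (χ-one w c ≼-refl aw)) (trans
              (connected (interval-Ex l (λ q → ℕₚ.<-irrefl refl (ℕₚ.<-≤-trans lt3 (ℕₚ.≤-reflexive (dim q))))) χ loc (btw c xw) (btw c' xw'))
              (χ-zero w' (λ v cv le' → subst (λ v → a v ≡ 0#) (≼-same-rank le' (ℕₚ.suc-injective (trans (sym (cover-rank c')) (cover-rank cv)))) aw')))))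
        where
        lt3 : ρ x ℕ.+ 2 < ρ u
        lt3 = ℕₚ.≤∧≢⇒< le ne
        dim : 1 ≡ ρ u ∸ suc (ρ x) → ρ u ≡ ρ x ℕ.+ 2
        dim q = trans (sym (ℕₚ.m∸n+n≡m (ρ-mono l))) (trans (cong (ℕ._+ suc (ρ x)) (sym q)) (ℕₚ.+-comm 2 (ρ x)))
        btw : ∀ {w} → w ⋖ u → x ≼ w → between x u w ≡ true
        btw {w} c xw = ⇒between (xw , λ { refl → ℕₚ.<-irrefl refl (ℕₚ.<-≤-trans lt3 (subst (_≤ ρ x ℕ.+ 2) (sym (cover-rank c)) (ℕₚ.≤-trans (ℕₚ.n≤1+n _) (ℕₚ.≤-reflexive (ℕₚ.+-comm 2 (ρ x)))))) }) (proj₁ c)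
        hit? : ∀ v → Dec (Σ (Fin N) λ w → (w ≺ u × ρ u ≡ suc (ρ w)) × v ≼ w × a w ≢ 0#)
        hit? v = Finₚ.any? (λ w → ((w ≺? u) ×-dec (ρ u ℕₚ.≟ suc (ρ w))) ×-dec ((v ≤ᵇ w) Boolₚ.≟ true) ×-dec ¬? (a w ≟K 0#))
        χ : Fin N → K
        χ v = [ does (hit? v) ]
        χ-one : ∀ {v} w → w ⋖ u → v ≼ w → a w ≢ 0# → χ v ≡ 1#
        χ-one {v} w c vw aw with hit? v
        ... | yes _ = refl
        ... | no nh = ⊥-elim (nh (w , (proj₁ c , cover-rank c) , vw , aw))
        χ-zero : ∀ v → (∀ w → w ⋖ u → v ≼ w → a w ≡ 0#) → χ v ≡ 0#
        χ-zero v all with hit? v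
        ... | no _ = refl
        ... | yes (w , (lw , rw) , vw , aw) = ⊥-elim (aw (all w (≼⇒⋖ (proj₁ lw) rw) vw))
        loc : ∀ {v v'} → between x u v ≡ true → between x u v' ≡ true → v ≼ v' → χ v ≡ χ v'
        loc {v} {v'} bv bv' vv' with v Finₚ.≟ v'
        ... | yes refl = refl
        ... | no v≢v' with hit? v'
        ...   | yes (w , (lw , rw) , v'w , aw) = χ-one w (≼⇒⋖ (proj₁ lw) rw) (≼-trans vv' v'w) aw
        ...   | no nh = χ-zero v λ w c vw → dec0 w c vw
          where
          dec0 : ∀ w → w ⋖ u → v ≼ w → a w ≡ 0#
          dec0 w c vw with a w ≟K 0#
          ... | yes q = q
          ... | no aw with coatom (proj₂ (between⇒ {x} {u} bv'))
          ...   | w' , v'w' , c' = ⊥-elim (nh (w' , (proj₁ c' , cover-rank c') , v'w' ,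
                  spread (rs (proj₁ (between⇒ {x} {u} bv))) (proj₂ (between⇒ {x} {u} bv)) (subst (_≤ ρ u) (ℕₚ.+-comm 2 (ρ v)) (ℕₚ.≤-trans (s≤s (ρ-mono (vv' , v≢v'))) (ρ-mono (proj₂ (between⇒ {x} {u} bv'))))) w w' c c' vw (≼-trans vv' v'w') aw))

    a-nz : ∀ w → w ⋖ u → a w ≢ 0#
    a-nz w c = spread (≻-wf 𝟎) 𝟎≺u (subst (_≤ ρ u) (sym (ρ0 2)) (subst (2 ≤_) (sym ru) (s≤s (s≤s z≤n)))) (proj₁ some) w (a-supp (proj₁ some) (proj₂ some)) c (𝟎≼ _) (𝟎≼ w) (proj₂ some)

  private
    -- The numbers are kept zero above rank k, so that attaching coefficients in rank k + 1 leaves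
    -- every old relation untouched.
    Bounded : ℕ → Set
    Bounded k = Σ (Incidence k) λ I → ∀ w u → Incidence.ε I w u ≢ 0# → ρ u ≤ k

    record Row {k : ℕ} (I : Incidence k) (u : Fin N) : Set where
      field
        a    : Fin N → K
        supp : ∀ w → a w ≢ 0# → w ⋖ u
        nz   : ∀ w → w ⋖ u → a w ≢ 0#
        rel  : ∀ v → (∑[ w ] Incidence.ε I v w * a w) ≡ 0#

    -- Rank 1 is separate: u covers only 𝟎, and the coefficient 1 is a choice of orientation. From
    -- rank 2 on the coefficients come from the fundamental cycle below u.
    row : ∀ {k} (I : Incidence k) u → ρ u ≡ suc k → Row I u
    row {zero} I u ru = record
      { a = δ 𝟎
      ; supp = λ w ne → cov w ne
      ; nz = λ w c q → 1≢0 (trans (sym (δ-refl 𝟎)) (trans (cong (δ 𝟎) (sym (rank0 (ℕₚ.suc-injective (trans (sym (cover-rank c)) ru))))) q))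
      ; rel = λ v → ∑-0 (λ w → term v w) }
      where
      cov : ∀ w → δ 𝟎 w ≢ 0# → w ⋖ u
      cov w ne with 𝟎 Finₚ.≟ w
      ... | yes refl = ≼⇒⋖ (𝟎≼ u) (trans ru (cong suc (sym ρ𝟎)))
      ... | no _ = ⊥-elim (ne refl)
      term : ∀ v w → Incidence.ε I v w * δ 𝟎 w ≡ 0#
      term v w with 𝟎 Finₚ.≟ w
      ... | no _ = zeroʳ _
      ... | yes refl with Incidence.ε I v 𝟎 ≟K 0#
      ...   | yes q = trans (cong (_* 1#) q) (zeroˡ _)
      ...   | no ne = ⊥-elim (ℕₚ.1+n≢0 (trans (sym (cover-rank (Incidence.supp I ne))) ρ𝟎))
    row {suc k} I u ru = record { a = proj₁ fu ; supp = proj₁ (proj₂ fu) ; nz = a-nz ; rel = proj₁ (proj₂ (proj₂ fu)) }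
      where
      fu = fundamental I u ru
      open Step I u ru (proj₁ fu) (proj₁ (proj₂ fu)) (proj₁ (proj₂ (proj₂ fu))) (proj₂ (proj₂ (proj₂ fu)))

    build : ∀ k → Bounded k
    build zero = record { ε = λ _ _ → 0# ; supp = λ ne → ⊥-elim (ne refl) ; nz = λ {w} {u} c le → ⊥-elim (ℕₚ.1+n≢0 (trans (sym (cover-rank c)) (ℕₚ.n≤0⇒n≡0 le)))
                        ; rel = λ v u → ∑-0 (λ w → zeroˡ _) } , λ _ _ ne → ⊥-elim (ne refl)
    build (suc k) = record { ε = ε' ; supp = λ {w} {u} → supp' w u ; nz = λ {w} {u} → nz' w u ; rel = rel' } , bound'
      where
      I = proj₁ (build k)
      bound = proj₂ (build k)
      open Incidence I
      r : ∀ u → ρ u ≡ suc k → Row I u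
      r = row I
      ε″ : ∀ w u → Dec (ρ u ≡ suc k) → K
      ε″ w u (yes e) = Row.a (r u e) w
      ε″ w u (no _)  = ε w u
      ε' : Fin N → Fin N → K
      ε' w u = ε″ w u (ρ u ℕₚ.≟ suc k)
      supp' : ∀ w u → ε' w u ≢ 0# → w ⋖ u
      supp' w u ne with ρ u ℕₚ.≟ suc k
      ... | yes e = Row.supp (r u e) w ne
      ... | no _  = supp ne
      nz' : ∀ w u → w ⋖ u → ρ u ≤ suc k → ε' w u ≢ 0#
      nz' w u c le with ρ u ℕₚ.≟ suc k
      ... | yes e = Row.nz (r u e) w c
      ... | no ne = nz c (ℕ.s≤s⁻¹ (ℕₚ.≤∧≢⇒< le ne))
      bound' : ∀ w u → ε' w u ≢ 0# → ρ u ≤ suc k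
      bound' w u ne with ρ u ℕₚ.≟ suc k
      ... | yes e = ℕₚ.≤-reflexive e
      ... | no _  = ℕₚ.m≤n⇒m≤1+n (bound w u ne)
      low : ∀ v w → ρ w ≢ suc k → ε' v w ≡ ε v w
      low v w ne with ρ w ℕₚ.≟ suc k
      ... | yes e = ⊥-elim (ne e)
      ... | no _ = refl
      rel' : ∀ v u → (∑[ w ] ε' v w * ε' w u) ≡ 0#
      rel' v u with ρ u ℕₚ.≟ suc k
      ... | yes e = trans (∑-cong term) (Row.rel (r u e) v)
        where
        term : ∀ w → ε' v w * Row.a (r u e) w ≡ ε v w * Row.a (r u e) w
        term w with Row.a (r u e) w ≟K 0#
        ... | yes q = trans (cong (ε' v w *_) q) (trans (zeroʳ _) (sym (trans (cong (ε v w *_) q) (zeroʳ _))))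
        ... | no q = cong (_* Row.a (r u e) w) (low v w (λ rw → ℕₚ.1+n≢n (trans (cong suc (sym rw)) (trans (sym (cover-rank (Row.supp (r u e) w q))) e))))
      ... | no ne = trans (∑-cong term) (rel v u)
        where
        term : ∀ w → ε' v w * ε w u ≡ ε v w * ε w u
        term w with ε w u ≟K 0#
        ... | yes q = trans (cong (ε' v w *_) q) (trans (zeroʳ _) (sym (trans (cong (ε v w *_) q) (zeroʳ _))))
        ... | no q = cong (_* ε w u) (low v w (λ rw → ℕₚ.1+n≰n (ℕₚ.≤-trans (ℕₚ.≤-trans (ℕₚ.n≤1+n _) (ℕₚ.≤-reflexive (trans (cong suc (sym rw)) (sym (cover-rank (supp q)))))) (bound w u q))))

  incidence-numbers : Incidence n
  incidence-numbers = proj₁ (build n)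

-- Exactness and top cycles of cellular chain complexes

module Cellular (F : OrderedField) {N : ℕ} (P : PosetData N) (n : ℕ) (graded : IsGradedPoset P n)
  (T : ∀ z y → GradedPoset._≺_ P n graded z y → ∀ s →
    Exterior.HomologyBasis F (OrderComplex P (GradedPoset.between P n graded z y)) s (if s ≡ᵇ (PosetData.ρ P y ∸ suc (PosetData.ρ P z)) then 1 else 0))
  (incidence-numbers : Chains.Incidence F P n graded n)
  where
  open OrderedField F
  open Solver ring
  open Sums ring
  open SumVSet ring
  open LinAlg F
  open Exterior F
  open GradedPoset P n graded
  open Chains F P n graded
  open Incidences F P n graded T using (between⇒; ⇒between; interval-Ex; interval-Line)

  open Incidence incidence-numbers public

  ε-nz : ∀ {w u} → w ⋖ u → ε w u ≢ 0#
  ε-nz {w} {u} c = nz c (ρ≤n u)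

  ∂ : (Fin N → K) → Fin N → K
  ∂ c v = ∑[ u ] ε v u * c u

  CellOn : (Fin N → Bool) → Fin N → ℕ → (Fin N → K) → Set
  CellOn Q z r c = ∀ u → c u ≢ 0# → z ≼ u × Q u ≡ true × ρ u ≡ r

  -- Vanishing of homology in rank r for the cellular complex of the members of Q above z.
  -- Boundaries are compared only at v ≽ z, which discards the faces of a cell that leave the upper
  -- set.
  CellEx : (Fin N → Bool) → Fin N → ℕ → Set
  CellEx Q z r = ∀ c → CellOn Q z r c → (∀ v → z ≼ v → ∂ c v ≡ 0#) →
    Σ (Fin N → K) λ a → CellOn Q z (suc r) a × (∀ v → z ≼ v → c v ≡ ∂ a v)

  CellLine : (Fin N → Bool) → Fin N → ℕ → Set
  CellLine Q z r = Σ (Fin N → K) λ a → CellOn Q z r a × (∀ v → z ≼ v → ∂ a v ≡ 0#) × (Σ (Fin N) λ u → a u ≢ 0#) ×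
    (∀ c → CellOn Q z r c → (∀ v → z ≼ v → ∂ c v ≡ 0#) → Σ K λ t → ∀ u → c u ≡ t * a u)

  module CellComplex (Q : Fin N → Bool) (downQ : ∀ {u v} → u ≼ v → Q v ≡ true → Q u ≡ true) (z : Fin N) where
    open WithIncidence incidence-numbers z
    open Push z Q downQ interval-Ex

    Θ-cycle : ∀ j c → (∀ v → z ≼ v → ∂ c v ≡ 0#) → ∀ S → bd (Θ j c) S ≡ 0#
    Θ-cycle zero    c cyc S = bd-Θ0 c S
    Θ-cycle (suc j) c cyc S = trans (bd-Θ j c S) (∑-0 term)
      where
      term : ∀ v → ∂ c v * cell j v S ≡ 0#
      term v with cell j v S ≟K 0#
      ... | yes q = trans (cong (∂ c v *_) q) (zeroʳ _)
      ... | no ne = trans (cong (_* cell j v S) (cyc v (CellSupp.z≼u (cell-supp j v S ne)))) (zeroˡ _)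

    Θ-On : ∀ j c → CellOn Q z (ρ z ℕ.+ j) c → ∀ r → ρ z ℕ.+ j ≤ r → Supp (upto≤ r) j (Θ j c)
    Θ-On j c on r le = Θ-supp j c (upto≤ r) (λ u ne v vu zv → ⇒upto≤ (⇒upto {Q} {z} (downQ vu (proj₁ (proj₂ (on u ne)))) zv)
      (ℕₚ.≤-trans (ρ-mono-≼ vu) (subst (_≤ r) (sym (proj₂ (proj₂ (on u ne)))) le)))

    Θ-equal : ∀ j c c' → CellOn Q z (ρ z ℕ.+ j) c → (∀ u → c' u ≢ 0# → ρ u ≡ ρ z ℕ.+ j) →
      (∀ S → Θ j c S ≡ Θ j c' S) → ∀ v → z ≼ v → c v ≡ c' v
    Θ-equal j c c' on on' e v zv with ρ v ℕₚ.≟ ρ z ℕ.+ j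
    ... | yes r = x-y≡0 (Θ-injective j (λ u → c u - c' u) (λ S → trans (∑-cong (λ u → solve 3 (λ a b x → (a :- b) :* x := a :* x :- b :* x) refl (c u) (c' u) (cell j u S)))
                    (trans (∑-sub _ _) (trans (cong (_- Θ j c' S) (e S)) (x-x _)))) v zv (ρ≤n v) r)
    ... | no nr with c v ≟K 0# | c' v ≟K 0#
    ...   | yes p | yes q = trans p (sym q)
    ...   | no p  | _     = ⊥-elim (nr (proj₂ (proj₂ (on v p))))
    ...   | yes _ | no q  = ⊥-elim (nr (on' v q))

    ∂-rank : ∀ {r} a → CellOn Q z (suc r) a → ∀ v → ∂ a v ≢ 0# → ρ v ≡ r
    ∂-rank a on v ne with ∑≢0 _ ne
    ... | u , ne' = ℕₚ.suc-injective (trans (sym (cover-rank (supp (proj₁ (*≢0 ne'))))) (proj₂ (proj₂ (on u (proj₂ (*≢0 ne'))))))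

    -- A filling of the simplicial cycle Θ c can be pushed into rank ≤ r + 1; there it is cellular.
    cell-exact′ : ∀ j → Ex (upto Q z) j → CellEx Q z (ρ z ℕ.+ j)
    cell-exact′ j ex c on cyc = result (ρ z ℕ.+ suc j ≤? n)
      where
      pd = push-down ex (ρ z ℕ.+ suc j) (subst (_≤ ρ z ℕ.+ suc j) (trans (ℕₚ.+-suc (ρ z) j) (cong suc (ℕₚ.+-comm (ρ z) j))) ℕₚ.≤-refl)
             (Θ j c) (Θ-On j c on (ρ z ℕ.+ suc j) (ℕₚ.+-monoʳ-≤ (ρ z) (ℕₚ.n≤1+n j))) (Θ-cycle j c cyc)
      h = proj₁ pd
      hs : Supp (upto≤ (ρ z ℕ.+ suc j)) (suc j) h
      hs = proj₁ (proj₂ pd)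
      bh : ∀ S → Θ j c S ≡ bd h S
      bh = proj₂ (proj₂ pd)
      r = ρ z ℕ.+ suc j
      Wb : ∀ {v} → upto≤ r v ≡ true → z ≺ v × ρ v ≤ r
      Wb {v} e = proj₂ (upto⇒ {Q} {z} (proj₁ (upto≤⇒ {r} {v} e))) , proj₂ (upto≤⇒ {r} {v} e)
      cyc' : ∀ u → ρ u ≡ r → ∀ τ → bd (ctr u h) τ ≡ 0#
      cyc' u ru τ = trans (solve 1 (λ x → x := :- (:- x)) refl (bd (ctr u h) τ)) (trans (cong -_ (trans (sym (ctr-bd u h τ)) (trans (cong (κ u τ *_) (trans (sym (bh (τ [ u ]≔ true))) Θ≡0)) (zeroʳ _)))) neg-0)
        where
        Θ≡0 : Θ j c (τ [ u ]≔ true) ≡ 0#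
        Θ≡0 = 0-or λ ne → (ℕₚ.1+n≰n (subst (_≤ ρ z ℕ.+ j) (trans ru (ℕₚ.+-suc (ρ z) j))
                (proj₂ (upto≤⇒ {ρ z ℕ.+ j} {u} (inside (proj₁ (Θ-On j c on (ρ z ℕ.+ j) ℕₚ.≤-refl (τ [ u ]≔ true) ne)) (insert-here {τ} u))))))
      result : Dec (r ≤ n) → Σ (Fin N → K) λ a → CellOn Q z (suc (ρ z ℕ.+ j)) a × (∀ v → z ≼ v → c v ≡ ∂ a v)
      result (yes rn) = a , a-on , Θ-equal j c (∂ a) on (∂-rank a a-on) (λ S → trans (bh S) (trans (bd-cong (proj₂ (proj₂ TD)) S) (bd-Θ j a S)))
        where
        TD = top-decompose (interval-Line z) {upto≤ r} {j} {h} rn Wb hs cyc'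
        a = proj₁ TD
        a-on : CellOn Q z (suc (ρ z ℕ.+ j)) a
        a-on u ne = proj₁ (proj₂ ql) , proj₁ ql , trans (proj₂ we) (ℕₚ.+-suc (ρ z) j)
          where
          we : upto≤ r u ≡ true × ρ u ≡ r
          we = proj₁ (proj₂ TD) u ne
          ql = upto⇒ {Q} {z} {u} (proj₁ (upto≤⇒ {r} {u} (proj₁ we)))
      result (no nr) = (λ _ → 0#) , (λ u ne → ⊥-elim (ne refl)) , λ v zv → trans (Θ-equal j c (λ _ → 0#) on (λ u ne → ⊥-elim (ne refl)) (λ S → trans (bh S) (trans (bd-0 h≡0 S) (sym (∑-0 (λ u → zeroˡ _))))) v zv) (sym (∑-0 (λ u → zeroʳ _)))
        where
        h≡0 : ∀ S → h S ≡ 0#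
        h≡0 S = 0-or λ ne → (ℕₚ.1+n≰n (subst (_≤ j) (proj₂ (hs S ne)) (chain-size (proj₁ (hs S ne)) (ρ z) j (λ {v} m → let p = Wb {v} (inside (proj₁ (hs S ne)) m) in
                ρ-mono (proj₁ p) , ℕ.s≤s⁻¹ (subst (ρ v <_) (ℕₚ.+-suc (ρ z) j) (ℕₚ.≤-<-trans (ρ≤n v) (ℕₚ.≰⇒> nr)))))))

    abstract
      cell-exact : ∀ j → Ex (upto Q z) j → CellEx Q z (ρ z ℕ.+ j)
      cell-exact = cell-exact′

    cell-line′ : ∀ j → Line (upto Q z) j → (∀ v → Q v ≡ true → z ≼ v → ρ v ≤ ρ z ℕ.+ j) → Q z ≡ true →
      CellLine Q z (ρ z ℕ.+ j)
    cell-line′ zero L top Qz = δ z , on , ∂δ , (z , λ q → 1≢0 (trans (sym (δ-refl z)) q)) , λ c cOn _ → c z , λ u → val c cOn u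
      where
      on : CellOn Q z (ρ z ℕ.+ 0) (δ z)
      on u ne with z Finₚ.≟ u
      ... | yes refl = ≼-refl , Qz , sym (ℕₚ.+-identityʳ _)
      ... | no _ = ⊥-elim (ne refl)
      ∂δ : ∀ v → z ≼ v → ∂ (δ z) v ≡ 0#
      ∂δ v zv = trans (∑-cong (λ u → *-comm _ _)) (trans (∑-δ z (ε v)) εvz)
        where
        εvz : ε v z ≡ 0#
        εvz with ε v z ≟K 0#
        ... | yes q = q
        ... | no ne = ⊥-elim (proj₂ (proj₁ (supp ne)) (≼-antisym (proj₁ (proj₁ (supp ne))) zv))
      val : ∀ c → CellOn Q z (ρ z ℕ.+ 0) c → ∀ u → c u ≡ c z * δ z u
      val c cOn u with z Finₚ.≟ u
      ... | yes refl = sym (*-identityʳ _)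
      ... | no ne with c u ≟K 0#
      ...   | yes q = trans q (sym (zeroʳ _))
      ...   | no cu = ⊥-elim (ne (≼-same-rank (proj₁ (cOn u cu)) (trans (sym (ℕₚ.+-identityʳ _)) (sym (proj₂ (proj₂ (cOn u cu)))))))
    cell-line′ (suc j) (g , gs , gc , (S₀ , g≢0) , line) top Qz = result (ρ z ℕ.+ suc j ≤? n)
      where
      r = ρ z ℕ.+ suc j
      Wb : ∀ {v} → upto Q z v ≡ true → z ≺ v × ρ v ≤ r
      Wb {v} e = proj₂ (upto⇒ {Q} {z} {v} e) , top v (proj₁ (upto⇒ {Q} {z} {v} e)) (proj₁ (proj₂ (upto⇒ {Q} {z} {v} e)))
      result : Dec (r ≤ n) → CellLine Q z r
      result (no nr) = ⊥-elim (ℕₚ.1+n≰n (subst (_≤ j) (proj₂ (gs S₀ g≢0)) (chain-size (proj₁ (gs S₀ g≢0)) (ρ z) j (λ {v} m → let p = Wb {v} (inside (proj₁ (gs S₀ g≢0)) m) in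
                ρ-mono (proj₁ p) , ℕ.s≤s⁻¹ (subst (ρ v <_) (ℕₚ.+-suc (ρ z) j) (ℕₚ.≤-<-trans (ρ≤n v) (ℕₚ.≰⇒> nr)))))))
      result (yes rn) = a , a-on , a-cyc , a-nz , multiples
        where
        TD = top-decompose (interval-Line z) {upto Q z} {j} {g} rn (λ {v} → Wb {v}) gs
              (λ u _ τ → trans (solve 1 (λ x → x := :- (:- x)) refl (bd (ctr u g) τ)) (trans (cong -_ (trans (sym (ctr-bd u g τ)) (trans (cong (κ u τ *_) (gc _)) (zeroʳ _)))) neg-0))
        a = proj₁ TD
        a-on : CellOn Q z r a
        a-on u ne = proj₁ (proj₂ ql) , proj₁ ql , proj₂ we
          where
          we : upto Q z u ≡ true × ρ u ≡ r
          we = proj₁ (proj₂ TD) u ne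
          ql = upto⇒ {Q} {z} {u} (proj₁ we)
        a-on' : CellOn Q z (suc (ρ z ℕ.+ j)) a
        a-on' u ne = proj₁ (a-on u ne) , proj₁ (proj₂ (a-on u ne)) , trans (proj₂ (proj₂ (a-on u ne))) (ℕₚ.+-suc (ρ z) j)
        a-cyc : ∀ v → z ≼ v → ∂ a v ≡ 0#
        a-cyc v zv = 0-or λ ne → ne (Θ-injective j (∂ a) (λ S → trans (sym (bd-Θ j a S)) (trans (bd-cong (λ S → sym (proj₂ (proj₂ TD) S)) S) (gc S))) v zv (ρ≤n v) (∂-rank a a-on' v ne))
        a-nz : Σ (Fin N) λ u → a u ≢ 0#
        a-nz = go (zero? a)
          where
          go : (∀ u → a u ≡ 0#) ⊎ Σ (Fin N) (λ u → a u ≢ 0#) → Σ (Fin N) λ u → a u ≢ 0#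
          go (inj₂ w) = w
          go (inj₁ q) = ⊥-elim (g≢0 (trans (proj₂ (proj₂ TD) S₀) (∑-0 (λ u → trans (cong (_* cell (suc j) u S₀) (q u)) (zeroˡ _)))))
        multiples : ∀ c → CellOn Q z r c → (∀ v → z ≼ v → ∂ c v ≡ 0#) → Σ K λ t → ∀ u → c u ≡ t * a u
        multiples c cOn cyc = t , λ u → val u (z ≤ᵇ u) refl
          where
          lc = line (Θ (suc j) c) (Θ-supp (suc j) c (upto Q z) (λ u ne v vu zv → ⇒upto {Q} {z} (downQ vu (proj₁ (proj₂ (cOn u ne)))) zv)) (Θ-cycle (suc j) c cyc)
          t = proj₁ lc
          val : ∀ u b → (z ≤ᵇ u) ≡ b → c u ≡ t * a u
          val u true zu = Θ-equal (suc j) c (λ u → t * a u) cOn (λ u ne → proj₂ (proj₂ (a-on u (proj₂ (*≢0 ne)))))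
                  (λ S → trans (proj₂ lc S) (trans (cong (t *_) (proj₂ (proj₂ TD) S)) (trans (sym (∑-*ˡ t _)) (∑-cong (λ u → sym (*-assoc _ _ _)))))) u zu
          val u false zu = trans (0-or λ p → true≢false (trans (sym (proj₁ (cOn u p))) zu))
            (sym (trans (cong (t *_) (0-or λ q → true≢false (trans (sym (proj₁ (a-on u q))) zu))) (zeroʳ _)))

    abstract
      cell-line : ∀ j → Line (upto Q z) j → (∀ v → Q v ≡ true → z ≼ v → ρ v ≤ ρ z ℕ.+ j) → Q z ≡ true →
        CellLine Q z (ρ z ℕ.+ j)
      cell-line = cell-line′

  upper : Fin N → Fin N → Bool
  upper y u = u ≤ᵇ y

  -- A closed interval is a closed cell. Below rank ρ y - 1 exactness is that of the bounding
  -- sphere; a cycle in rank ρ y - 1 is a multiple of the sphere and is filled by y; in rank ρ y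
  -- only y is left, and its boundary has a non-zero coefficient at a coatom.
  interval-exact : ∀ {x y} → x ≺ y → ∀ r → CellEx (upper y) x r
  interval-exact {x} {y} l r c on cyc with ρ x ≤? r
  ... | no lt = (λ _ → 0#) , (λ u ne → ⊥-elim (ne refl)) , λ v xv → trans (c≡0 v) (sym (∑-0 (λ u → zeroʳ _)))
    where
    c≡0 : ∀ v → c v ≡ 0#
    c≡0 v with c v ≟K 0#
    ... | yes q = q
    ... | no ne = ⊥-elim (lt (subst (ρ x ≤_) (proj₂ (proj₂ (on v ne))) (ρ-mono-≼ (proj₁ (on v ne)))))
  ... | yes le = main (r ∸ ρ x) (ρ y ∸ suc (ρ x)) (sym (ℕₚ.m+[n∸m]≡n le)) (trans (sym (ℕₚ.m+[n∸m]≡n (ρ-mono l))) (sym (ℕₚ.+-suc (ρ x) _)))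
    where
    main : ∀ j t → r ≡ ρ x ℕ.+ j → ρ y ≡ ρ x ℕ.+ suc t → Σ (Fin N → K) λ a → CellOn (upper y) x (suc r) a × (∀ v → x ≼ v → c v ≡ ∂ a v)
    main j t refl ry with ℕₚ.<-cmp j t
    ... | tri< lt _ _ = convert (cell-exact j (interval-Ex l (λ q → ℕₚ.<-irrefl (trans q dim) lt)) c strict cyc)
      where
      open CellComplex (λ u → _<ᵇ'_ P u y) (λ uv vy → ≺⇒<b (≼≺-trans uv (<b⇒≺ vy))) x
      dim : ρ y ∸ suc (ρ x) ≡ t
      dim = trans (cong (_∸ suc (ρ x)) (trans ry (ℕₚ.+-suc (ρ x) t))) (ℕₚ.m+n∸m≡n (ρ x) t)
      strict : CellOn (λ u → _<ᵇ'_ P u y) x (ρ x ℕ.+ j) c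
      strict u ne = proj₁ (on u ne) , ≺⇒<b (proj₁ (proj₂ (on u ne)) , λ { refl → ℕₚ.<-irrefl (ℕₚ.+-cancelˡ-≡ (ρ x) j (suc t) (trans (sym (proj₂ (proj₂ (on u ne)))) ry)) (ℕₚ.m≤n⇒m≤1+n lt) }) , proj₂ (proj₂ (on u ne))
      convert : (Σ (Fin N → K) λ a → CellOn (λ u → _<ᵇ'_ P u y) x (suc r) a × (∀ v → x ≼ v → c v ≡ ∂ a v)) → Σ (Fin N → K) λ a → CellOn (upper y) x (suc r) a × (∀ v → x ≼ v → c v ≡ ∂ a v)
      convert (a , aon , e) = a , (λ u ne → proj₁ (aon u ne) , proj₁ (<b⇒≺ (proj₁ (proj₂ (aon u ne)))) , proj₂ (proj₂ (aon u ne))) , e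
    ... | tri≈ _ refl _ = (λ u → s * δ u y) , a-on , λ v xv → trans (Θ-equal j c (λ u → s * ε u y) strict (λ u ne → ℕₚ.suc-injective (trans (sym (cover-rank (supp (proj₂ (*≢0 ne))))) (trans ry (ℕₚ.+-suc (ρ x) j)))) eq v xv)
          (sym (trans (∑-cong (λ u → solve 3 (λ e s d → e :* (s :* d) := s :* e :* d) refl (ε v u) s (δ u y))) (∑-δʳ y (λ u → s * ε v u))))
      where
      open CellComplex (λ u → _<ᵇ'_ P u y) (λ uv vy → ≺⇒<b (≼≺-trans uv (<b⇒≺ vy))) x
      open WithIncidence incidence-numbers x
      strict : CellOn (λ u → _<ᵇ'_ P u y) x (ρ x ℕ.+ j) c
      strict u ne = proj₁ (on u ne) , ≺⇒<b (proj₁ (proj₂ (on u ne)) , λ { refl → ℕₚ.1+n≢n (trans (sym (trans ry (ℕₚ.+-suc (ρ x) j))) (proj₂ (proj₂ (on u ne)))) }) , proj₂ (proj₂ (on u ne))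
      sp = sphere-spans (interval-Line x) l (ρ≤n y) ry (Θ j c) (Θ-supp j c (between x y) (λ u ne v vu xv → ⇒between xv (≼≺-trans vu (<b⇒≺ (proj₁ (proj₂ (strict u ne))))))) (Θ-cycle j c cyc)
      s = proj₁ sp
      eq : ∀ S → Θ j c S ≡ Θ j (λ u → s * ε u y) S
      eq S = trans (proj₂ sp S) (trans (sym (∑-*ˡ s _)) (∑-cong (λ u → sym (*-assoc _ _ _))))
      a-on : CellOn (upper y) x (suc r) (λ u → s * δ u y)
      a-on u ne with u Finₚ.≟ y
      ... | yes refl = proj₁ l , ≼-refl , trans ry (ℕₚ.+-suc (ρ x) j)
      ... | no _ = ⊥-elim (ne (zeroʳ _))
    ... | tri> _ _ gt = (λ _ → 0#) , (λ u ne → ⊥-elim (ne refl)) , λ v xv → trans (c≡0 v) (sym (∑-0 (λ u → zeroʳ _)))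
      where
      only-y : ∀ v → c v ≢ 0# → v ≡ y
      only-y v ne = ≼-same-rank (proj₁ (proj₂ (on v ne))) (ℕₚ.≤-antisym (ρ-mono-≼ (proj₁ (proj₂ (on v ne)))) (subst₂ _≤_ (sym ry) (sym (proj₂ (proj₂ (on v ne)))) (ℕₚ.+-monoʳ-≤ (ρ x) gt)))
      cy≡0 : c y ≡ 0#
      cy≡0 with coatom l
      ... | w , xw , cw = *-cancel0 {ε w y} (trans (sym (∑-one y (λ u → ε w u * c u) other)) (cyc w xw)) (ε-nz cw)
        where
        other : ∀ i → i ≢ y → ε w i * c i ≡ 0#
        other i ne with c i ≟K 0#
        ... | yes q = trans (cong (ε w i *_) q) (zeroʳ _)
        ... | no q = ⊥-elim (ne (only-y i q))
      c≡0 : ∀ v → c v ≡ 0#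
      c≡0 v with c v ≟K 0#
      ... | yes q = q
      ... | no ne = trans (cong c (only-y v ne)) cy≡0

-- Cohen–Macaulay sheaves

module Duality (F : OrderedField) where
  open OrderedField F
  open Solver ring
  open Sums ring
  open LinAlg F

  module _ {T : Set} {{_ : Finite T}} (D : Mat T T) (p c : T → Bool) where

    -- Exactness at the level selected by c, for the coboundary coming from the level p below it;
    -- `ChainExact` is exactness at the same level for the transposed maps, with p now the target.
    -- The first form defines the Cohen-Macaulay property, the second produces preimages of cycles
    -- and dimension counts.
    CochainExact : Set
    CochainExact = ∀ (w : T → K) → (∀ t → w t ≢ 0# → c t ≡ true) → (∀ t' → (∑[ t ] D t t' * w t) ≡ 0#) →
      Σ (T → K) λ w' → (∀ t → w' t ≢ 0# → p t ≡ true) × (∀ t → c t ≡ true → w t ≡ (∑[ t' ] D t' t * w' t'))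

    ChainExact : Set
    ChainExact = ∀ (u : T → K) → (∀ t → u t ≢ 0# → c t ≡ true) → (∀ t → p t ≡ true → (∑[ t' ] D t t' * u t') ≡ 0#) →
      Σ (T → K) λ v → ∀ t → c t ≡ true → u t ≡ (∑[ t' ] D t t' * v t')

    private
      cut : ∀ (q : T → Bool) (w : T → K) t → [ q t ] * w t ≢ 0# → q t ≡ true
      cut q w t ne with q t
      ... | true  = refl
      ... | false = ⊥-elim (ne (zeroˡ _))

      keep : ∀ (q : T → Bool) (w : T → K) t → q t ≡ true → [ q t ] * w t ≡ w t
      keep q w t e rewrite e = *-identityˡ _

      only : ∀ (q : T → Bool) (u : T → K) → (∀ t → u t ≢ 0# → q t ≡ true) → ∀ t (w : T → K) → w t * u t ≡ [ q t ] * w t * u t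
      only q u h t w = trans (*-comm _ _) (trans (*-on (λ ne → sym (keep q w t (h t ne)))) (*-comm _ _))

    -- Fredholm alternative: a vector orthogonal to the kernel of the transpose is in the image.
    cochain⇒chain : CochainExact → ChainExact
    cochain⇒chain ex u us cyc = proj₁ sol , λ t ct → trans (proj₂ sol t) (∑-cong (λ t' → cong (_* proj₁ sol t') (keep c (λ t → D t t') t ct)))
      where
      open ≡-Reasoning
      sol = fredholm (λ t t' → [ c t ] * D t t') u orth
        where
        orth : ∀ (w : T → K) → (∀ j → (∑[ i ] w i * ([ c i ] * D i j)) ≡ 0#) → (∑[ i ] w i * u i) ≡ 0#
        orth w e = begin
          (∑[ t ] w t * u t)                              ≡⟨ ∑-cong (λ t → only c u us t w) ⟩
          (∑[ t ] [ c t ] * w t * u t)                    ≡⟨ ∑-cong (λ t → trans (*-comm _ _) (trans (*-on (λ ne → ew t (us t ne))) (*-comm _ _))) ⟩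
          (∑[ t ] (∑[ t' ] D t' t * w' t') * u t)         ≡⟨ ∑-cong (λ t → sym (∑-*ʳ (u t) _)) ⟩
          (∑[ t ] ∑[ t' ] D t' t * w' t' * u t)           ≡⟨ ∑-swap _ ⟩
          (∑[ t' ] ∑[ t ] D t' t * w' t' * u t)           ≡⟨ ∑-0 (λ t' → trans (∑-cong (λ t → solve 3 (λ d w u → d :* w :* u := w :* (d :* u)) refl (D t' t) (w' t') (u t))) (trans (∑-*ˡ (w' t') _) (trans (*-on (λ ne → cyc t' (w's t' ne))) (zeroʳ _)))) ⟩
          0# ∎
          where
          r = ex (λ t → [ c t ] * w t) (cut c w) (λ t' → trans (∑-cong (λ t → solve 3 (λ d m w → d :* (m :* w) := w :* (m :* d)) refl (D t t') [ c t ] (w t))) (e t'))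
          w' = proj₁ r
          w's = proj₁ (proj₂ r)
          ew = proj₂ (proj₂ r)

    chain⇒cochain : ChainExact → CochainExact
    chain⇒cochain ex w ws cl = (λ t → [ p t ] * v t) , cut p v , λ t ct → trans (proj₂ sol t) (∑-cong (λ t' → trans (cong (_* v t') (trans (cong ([ c t ] *_) refl) (trans (keep c (λ t → [ p t' ] * D t' t) t ct) refl))) (solve 3 (λ m d v → m :* d :* v := d :* (m :* v)) refl [ p t' ] (D t' t) (v t'))))
      where
      open ≡-Reasoning
      sol = fredholm (λ t t' → [ c t ] * ([ p t' ] * D t' t)) w orth
        where
        orth : ∀ (u : T → K) → (∀ j → (∑[ i ] u i * ([ c i ] * ([ p j ] * D j i))) ≡ 0#) → (∑[ i ] u i * w i) ≡ 0#
        orth u e = begin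
          (∑[ t ] u t * w t)                              ≡⟨ ∑-cong (λ t → only c w ws t u) ⟩
          (∑[ t ] [ c t ] * u t * w t)                    ≡⟨ ∑-cong (λ t → trans (*-comm _ _) (trans (*-on (λ ne → ev t (ws t ne))) (*-comm _ _))) ⟩
          (∑[ t ] (∑[ t' ] D t t' * v t') * w t)          ≡⟨ ∑-cong (λ t → sym (∑-*ʳ (w t) _)) ⟩
          (∑[ t ] ∑[ t' ] D t t' * v t' * w t)            ≡⟨ ∑-swap _ ⟩
          (∑[ t' ] ∑[ t ] D t t' * v t' * w t)            ≡⟨ ∑-0 (λ t' → trans (∑-cong (λ t → solve 3 (λ d v w → d :* v :* w := v :* (d :* w)) refl (D t t') (v t') (w t))) (trans (∑-*ˡ (v t') _) (trans (cong (v t' *_) (cl t')) (zeroʳ _)))) ⟩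
          0# ∎
          where
          r = ex (λ t → [ c t ] * u t) (cut c u) (λ t pt → trans (∑-cong (λ t' → trans (cong (_* ([ c t' ] * u t')) (sym (keep p (λ t → D t t') t pt))) (solve 4 (λ m d k u → m :* d :* (k :* u) := u :* (k :* (m :* d))) refl [ p t ] (D t t') [ c t' ] (u t')))) (e t))
          v = proj₁ r
          ev = proj₂ r
      v = proj₁ sol

module CellStructures (F : OrderedField) {N : ℕ} (P : PosetData N) (n : ℕ) (graded : IsGradedPoset P n) where
  open OrderedField F
  open Sums ring
  open GradedPoset P n graded

  record CellStructure : Set where
    field
      ε    : Fin N → Fin N → K
      supp : ∀ {w u} → ε w u ≢ 0# → w ⋖ u
      ε-nz : ∀ {w u} → w ⋖ u → ε w u ≢ 0#
      rel  : ∀ v u → (∑[ w ] ε v w * ε w u) ≡ 0#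
      interval-exact : ∀ {x y} → x ≺ y → ∀ r (c : Fin N → K) → (∀ u → c u ≢ 0# → x ≼ u × u ≼ y × ρ u ≡ r) →
        (∀ v → x ≼ v → (∑[ u ] ε v u * c u) ≡ 0#) →
        Σ (Fin N → K) λ a → (∀ u → a u ≢ 0# → x ≼ u × u ≼ y × ρ u ≡ suc r) × (∀ v → x ≼ v → c v ≡ (∑[ u ] ε v u * a u))

module Sheaves (F : OrderedField) {N : ℕ} (P : PosetData N) (n : ℕ) (graded : IsGradedPoset P n)
  (C : CellStructures.CellStructure F P n graded) where
  open OrderedField F
  open Solver ring
  open Sums ring
  open LinAlg F
  open Generic F
  open Duality F
  open GradedPoset P n graded
  open Chains F P n graded using (∑≢0; *≢0)
  open CellStructures.CellStructure C

  at : Fin N → ℕ → Fin N → Bool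
  at x j y = (x ≤ᵇ y) ∧ (ρ y ≡ᵇ j)

  at⇒ : ∀ {x j y} → at x j y ≡ true → x ≼ y × ρ y ≡ j
  at⇒ {x} {j} {y} e = proj₁ (∧-true {x ≤ᵇ y} e) , ≡ᵇ⇒≡ (ρ y) j (proj₂ (∧-true {x ≤ᵇ y} e))

  ⇒at : ∀ {x j y} → x ≼ y → ρ y ≡ j → at x j y ≡ true
  ⇒at {j = j} a refl = cong₂ _∧_ a (≡ᵇ-refl j)

  -- level j - 1
  at⁻ : Fin N → ℕ → Fin N → Bool
  at⁻ x j y = (x ≤ᵇ y) ∧ (suc (ρ y) ≡ᵇ j)

  at⁻⇒ : ∀ {x j y} → at⁻ x j y ≡ true → x ≼ y × suc (ρ y) ≡ j
  at⁻⇒ {x} {j} {y} e = proj₁ (∧-true {x ≤ᵇ y} e) , ≡ᵇ⇒≡ (suc (ρ y)) j (proj₂ (∧-true {x ≤ᵇ y} e))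

  ⇒at⁻ : ∀ {x j y} → x ≼ y → suc (ρ y) ≡ j → at⁻ x j y ≡ true
  ⇒at⁻ {y = y} a refl = cong₂ _∧_ a (≡ᵇ-refl (ρ y))

  ε-≼ : ∀ {x y} → ε x y ≢ 0# → x ≼ y
  ε-≼ ne = proj₁ (proj₁ (supp ne))

  [≢0] : ∀ {b} → [ b ] ≢ 0# → b ≡ true
  [≢0] {true}  _  = refl
  [≢0] {false} ne = ⊥-elim (ne refl)

  -- The dual of `interval-exact`. The matrix ε is cut off outside the lower set of y, because the
  -- coboundary of an element of the interval may leave it upwards.
  interval-coexact′ : ∀ {x y} → x ≺ y → ∀ j (g : Fin N → K) → (∀ w → g w ≢ 0# → x ≼ w × w ≼ y × ρ w ≡ j) →
    (∀ w' → w' ≼ y → (∑[ w ] ε w w' * g w) ≡ 0#) →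
    Σ (Fin N → K) λ h → (∀ v → h v ≢ 0# → x ≼ v × v ≼ y × suc (ρ v) ≡ j) × (∀ w → w ≼ y → g w ≡ (∑[ v ] ε v w * h v))
  interval-coexact′ {x} {y} l j g gs cl = h , h-supp , eq
    where
    εy : Mat (Fin N) (Fin N)
    εy w w' = ε w w' * [ w' ≤ᵇ y ]
    p c : Fin N → Bool
    p v = at⁻ x j v ∧ (v ≤ᵇ y)
    c v = at x j v ∧ (v ≤ᵇ y)
    p⇒ : ∀ {v} → p v ≡ true → x ≼ v × v ≼ y × suc (ρ v) ≡ j
    p⇒ {v} e = let q = ∧-true {at⁻ x j v} e ; q' = at⁻⇒ {x} {j} (proj₁ q) in proj₁ q' , proj₂ q , proj₂ q'
    chain : ChainExact εy p c
    chain u us cyc = a , λ t ct → trans (proj₂ (proj₂ ie) t (proj₁ (c⇒ t ct))) (∑-cong (λ t' → trans (*-comm _ _) (trans (*-on (λ na → on-y t t' (proj₁ (proj₂ (proj₁ (proj₂ ie) t' na))))) (*-comm _ _))))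
      where
      c⇒ : ∀ t → c t ≡ true → x ≼ t × t ≼ y × ρ t ≡ j
      c⇒ t e = let q = ∧-true {at x j t} e ; q' = at⇒ {x} {j} (proj₁ q) in proj₁ q' , proj₂ q , proj₂ q'
      on-y : ∀ v t → t ≼ y → ε v t ≡ ε v t * [ t ≤ᵇ y ]
      on-y v t ty = trans (sym (*-identityʳ _)) (cong (λ b → ε v t * [ b ]) (sym ty))
      cyc' : ∀ v → x ≼ v → (∑[ t ] ε v t * u t) ≡ 0#
      cyc' v xv = 0-or λ ne → ne (trans (∑-cong (λ t → trans (*-comm _ _) (trans (*-on (λ nu → on-y v t (proj₁ (proj₂ (c⇒ t (us t nu)))))) (*-comm _ _)))) (cyc v (pv (∑≢0 _ ne))))
        where
        pv : (Σ (Fin N) λ t → ε v t * u t ≢ 0#) → p v ≡ true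
        pv (t , ne') = cong₂ _∧_ (⇒at⁻ xv (trans (sym (cover-rank (supp (proj₁ (*≢0 ne'))))) (proj₂ (proj₂ ct)))) (≼-trans (ε-≼ (proj₁ (*≢0 ne'))) (proj₁ (proj₂ ct)))
          where ct = c⇒ t (us t (proj₂ (*≢0 ne')))
      ie = interval-exact l j u (λ t ne → c⇒ t (us t ne)) cyc'
      a = proj₁ ie
    sol = chain⇒cochain εy p c chain g (λ t ne → cong₂ _∧_ (⇒at (proj₁ (gs t ne)) (proj₂ (proj₂ (gs t ne)))) (proj₁ (proj₂ (gs t ne)))) cl'
      where
      cl' : ∀ t' → (∑[ t ] ε t t' * [ t' ≤ᵇ y ] * g t) ≡ 0#
      cl' t' = go (t' ≤ᵇ y) refl
        where
        go : ∀ b → (t' ≤ᵇ y) ≡ b → (∑[ t ] ε t t' * [ b ] * g t) ≡ 0#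
        go true  e = trans (∑-cong (λ t → cong (_* g t) (*-identityʳ _))) (cl t' e)
        go false e = ∑-0 (λ t → trans (cong (_* g t) (zeroʳ _)) (zeroˡ _))
    h = proj₁ sol
    h-supp : ∀ v → h v ≢ 0# → x ≼ v × v ≼ y × suc (ρ v) ≡ j
    h-supp v ne = p⇒ (proj₁ (proj₂ sol) v ne)
    eq : ∀ w → w ≼ y → g w ≡ (∑[ v ] ε v w * h v)
    eq w wy = go (c w) refl
      where
      go : ∀ b → c w ≡ b → g w ≡ (∑[ v ] ε v w * h v)
      go true cw = trans (proj₂ (proj₂ sol) w cw) (∑-cong (λ v → cong (_* h v) (trans (cong (λ b → ε v w * [ b ]) wy) (*-identityʳ _))))
      go false cw = trans (0-or (λ ne → true≢false (trans (sym (cong₂ _∧_ (⇒at (proj₁ (gs w ne)) (proj₂ (proj₂ (gs w ne)))) (proj₁ (proj₂ (gs w ne))))) cw)))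
          (sym (∑-0 (λ v → vanish (λ ne nh → true≢false (trans (sym (cong₂ _∧_ (⇒at (≼-trans (proj₁ (h-supp v nh)) (ε-≼ ne)) (trans (cover-rank (supp ne)) (proj₂ (proj₂ (h-supp v nh))))) wy)) cw)))))

  abstract
    interval-coexact : ∀ {x y} → x ≺ y → ∀ j (g : Fin N → K) → (∀ w → g w ≢ 0# → x ≼ w × w ≼ y × ρ w ≡ j) →
      (∀ w' → w' ≼ y → (∑[ w ] ε w w' * g w) ≡ 0#) →
      Σ (Fin N → K) λ h → (∀ v → h v ≢ 0# → x ≼ v × v ≼ y × suc (ρ v) ≡ j) × (∀ w → w ≼ y → g w ≡ (∑[ v ] ε v w * h v))
    interval-coexact = interval-coexact′

  -- A functor from P to coordinate spaces. The matrix `R x y` carries meaning for x ≼ y, as the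
  -- restriction from the stalk at x to the stalk at y.
  record Sheaf : Set where
    field
      f      : Fin N → ℕ
      R      : ∀ x y → Mat (Fin (f y)) (Fin (f x))
      R-id   : ∀ x → R x x ≋ Id
      R-comp : ∀ {x y z} → x ≼ y → y ≼ z → R y z ∙ R x y ≋ R x z

    Tot : Set
    Tot = Σ (Fin N) (λ x → Fin (f x))

    loc : Tot → Fin N
    loc = proj₁

    -- The cellular differential on the sum of all stalks. Summed over its first index it is the
    -- coboundary, which raises the rank. Summed over its second index it lowers the rank and
    -- restrictions act by transposes, so cycles have their values in the dual stalks.
    D : Mat Tot Tot
    D (x , a) (y , b) = ε x y * R x y b a

    D-≼ : ∀ {t t'} → D t t' ≢ 0# → loc t ⋖ loc t'
    D-≼ ne = supp (proj₁ (*≢0 ne))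

    DD : ∀ t t'' → (∑[ t' ] D t t' * D t' t'') ≡ 0#
    DD (x , a) (z , c) = begin
      (∑[ t' ] D (x , a) t' * D t' (z , c))                                     ≡⟨ ∑Σ _ ⟩
      (∑[ y ] ∑[ b ] ε x y * R x y b a * (ε y z * R y z c b))                   ≡⟨ ∑-cong (λ y → trans (∑-cong (λ b → solve 4 (λ e r e' r' → e :* r :* (e' :* r') := e :* e' :* (r' :* r)) refl (ε x y) (R x y b a) (ε y z) (R y z c b))) (∑-*ˡ (ε x y * ε y z) _)) ⟩
      (∑[ y ] ε x y * ε y z * (R y z ∙ R x y) c a)                              ≡⟨ ∑-cong (λ y → *-on (λ ne → R-comp (ε-≼ (proj₁ (*≢0 ne))) (ε-≼ (proj₂ (*≢0 ne))) c a)) ⟩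
      (∑[ y ] ε x y * ε y z * R x z c a)                                        ≡⟨ trans (∑-*ʳ (R x z c a) _) (trans (cong (_* R x z c a) (rel x z)) (zeroˡ _)) ⟩
      0# ∎
      where open ≡-Reasoning

    lev lev⁻ : Fin N → ℕ → Tot → Bool
    lev x j t  = at x j (loc t)
    lev⁻ x j t = at⁻ x j (loc t)

    CM : ℕ → Set
    CM m = ∀ x j → j < m → CochainExact D (lev⁻ x j) (lev x j)

    CM-chain : ∀ {m} → CM m → ∀ x j → j < m → ChainExact D (lev⁻ x j) (lev x j)
    CM-chain cm x j lt = cochain⇒chain D (lev⁻ x j) (lev x j) (cm x j lt)

    -- The sheaf w ↦ {cycles in ⊕ of the stalks of rank i above w} is again Cohen–Macaulay.
    ZExact : ℕ → Set
    ZExact i = ∀ x j → j < i → (ζ : Fin N → Tot → K) →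
      (∀ w t → ζ w t ≢ 0# → x ≼ w × ρ w ≡ j × w ≼ loc t × ρ (loc t) ≡ i) →
      (∀ w t' → w ≼ loc t' → (∑[ t ] D t' t * ζ w t) ≡ 0#) →
      (∀ w' t → w' ≼ loc t → (∑[ w ] ε w w' * ζ w t) ≡ 0#) →
      Σ (Fin N → Tot → K) λ ξ →
        (∀ v t → ξ v t ≢ 0# → x ≼ v × suc (ρ v) ≡ j × v ≼ loc t × ρ (loc t) ≡ i) ×
        (∀ v t' → v ≼ loc t' → (∑[ t ] D t' t * ξ v t) ≡ 0#) ×
        (∀ w t → w ≼ loc t → ζ w t ≡ (∑[ v ] ε v w * ξ v t))

    -- A zigzag in the double complex of pairs w ≼ `loc t`. For fixed t the interval from x to
    -- `loc t` is exact, which gives η with dη = ζ. The boundaries θ of η form a cocycle of the same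
    -- kind with both ranks lowered by one, so θ = dκ' by induction. The Cohen-Macaulay property
    -- writes κ' as the boundary of κ, and ξ = η - dκ consists of cycles and still maps to ζ.
    z-exact : ∀ {m} → CM m → ∀ i → i ≤ m → ZExact i
    z-exact cm zero _ x j ()
    z-exact {m} cm (suc i) i<m x j j<i ζ ζs cyc cl = result j j<i refl
      where
      open ≡-Reasoning
      slice : ∀ t → Σ (Fin N → K) λ h → (∀ v → h v ≢ 0# → x ≼ v × v ≼ loc t × suc (ρ v) ≡ j × ρ (loc t) ≡ suc i) × (∀ w → w ≼ loc t → ζ w t ≡ (∑[ v ] ε v w * h v))
      slice t = go (x ≺? loc t) (ρ (loc t) ℕₚ.≟ suc i)
        where
        Slice = Σ (Fin N → K) λ h → (∀ v → h v ≢ 0# → x ≼ v × v ≼ loc t × suc (ρ v) ≡ j × ρ (loc t) ≡ suc i) × (∀ w → w ≼ loc t → ζ w t ≡ (∑[ v ] ε v w * h v))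
        empty : (∀ w → x ≼ w × ρ w ≡ j × w ≼ loc t × ρ (loc t) ≡ suc i → ⊥) → Slice
        empty no-w = (λ _ → 0#) , (λ v ne → ⊥-elim (ne refl)) , λ w le → trans (0-or (λ ne → no-w w (ζs w t ne))) (sym (∑-0 (λ v → zeroʳ _)))
        go : Dec (x ≺ loc t) → Dec (ρ (loc t) ≡ suc i) → Slice
        go (yes l) (yes r) = proj₁ ic , (λ v ne → let s = proj₁ (proj₂ ic) v ne in proj₁ s , proj₁ (proj₂ s) , proj₂ (proj₂ s) , r) , proj₂ (proj₂ ic)
          where ic = interval-coexact l j (λ w → ζ w t) (λ w ne → let s = ζs w t ne in proj₁ s , proj₁ (proj₂ (proj₂ s)) , proj₁ (proj₂ s)) (λ w' le → cl w' t le)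
        go (yes l) (no nr) = empty (λ w s → nr (proj₂ (proj₂ (proj₂ s))))
        go (no nl) _ = empty λ w (a , b , c , d) → nl (≼-trans a c , λ { refl → ℕₚ.<-irrefl (trans (sym b) (trans (cong ρ (≼-antisym c a)) d)) j<i })
      η : Fin N → Tot → K
      η v t = proj₁ (slice t) v
      ηs : ∀ v t → η v t ≢ 0# → x ≼ v × v ≼ loc t × suc (ρ v) ≡ j × ρ (loc t) ≡ suc i
      ηs v t ne = proj₁ (proj₂ (slice t)) v ne
      ηe : ∀ w t → w ≼ loc t → ζ w t ≡ (∑[ v ] ε v w * η v t)
      ηe w t le = proj₂ (proj₂ (slice t)) w le
      result : ∀ j' → j' < suc i → j ≡ j' → Σ (Fin N → Tot → K) λ ξ →
        (∀ v t → ξ v t ≢ 0# → x ≼ v × suc (ρ v) ≡ j × v ≼ loc t × ρ (loc t) ≡ suc i) ×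
        (∀ v t' → v ≼ loc t' → (∑[ t ] D t' t * ξ v t) ≡ 0#) × (∀ w t → w ≼ loc t → ζ w t ≡ (∑[ v ] ε v w * ξ v t))
      -- For j = 0 there is no level below: η is zero by its support, and hence so is ζ.
      result zero _ refl = (λ _ _ → 0#) , (λ v t ne → ⊥-elim (ne refl)) , (λ v t' _ → ∑-0 (λ t → zeroʳ _)) ,
        λ w t le → trans (ηe w t le) (∑-cong (λ v → cong (ε v w *_) (0-or (λ ne → ℕₚ.1+n≢0 (proj₁ (proj₂ (proj₂ (ηs v t ne))))))))
      result (suc j') lt refl = ξ , ξs , ξcyc , ξe
        where
        θ : Fin N → Tot → K
        θ v t' = [ v ≤ᵇ loc t' ] * (∑[ t ] D t' t * η v t)
        θ-val : ∀ v t' → v ≼ loc t' → θ v t' ≡ (∑[ t ] D t' t * η v t)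
        θ-val v t' le = trans (cong (λ b → [ b ] * (∑[ t ] D t' t * η v t)) le) (*-identityˡ _)
        θs : ∀ v t' → θ v t' ≢ 0# → x ≼ v × ρ v ≡ j' × v ≼ loc t' × ρ (loc t') ≡ i
        θs v t' ne = proj₁ e , ℕₚ.suc-injective (proj₁ (proj₂ (proj₂ e))) , [≢0] (proj₁ (*≢0 ne)) , ℕₚ.suc-injective (trans (sym (cover-rank (D-≼ {t'} {t} (proj₁ (*≢0 (proj₂ s)))))) (proj₂ (proj₂ (proj₂ e))))
          where
          s = ∑≢0 _ (proj₂ (*≢0 ne))
          t = proj₁ s
          e = ηs v t (proj₂ (*≢0 (proj₂ s)))
        θcyc : ∀ v t'' → v ≼ loc t'' → (∑[ t' ] D t'' t' * θ v t') ≡ 0#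
        θcyc v t'' le = begin
          (∑[ t' ] D t'' t' * θ v t')                           ≡⟨ ∑-cong (λ t' → *-on (λ ne → θ-val v t' (≼-trans le (proj₁ (proj₁ (D-≼ {t''} {t'} ne)))))) ⟩
          (D · (D · η v)) t''                                   ≡⟨ sym (·-assoc D D (η v) t'') ⟩
          ((D ∙ D) · η v) t''                                   ≡⟨ ∙-0ˡ {B = λ t (_ : Fin 1) → η v t} DD t'' zero ⟩
          0# ∎
        θcl : ∀ w t' → w ≼ loc t' → (∑[ v ] ε v w * θ v t') ≡ 0#
        θcl w t' le = begin
          (∑[ v ] ε v w * θ v t')                               ≡⟨ ∑-cong (λ v → *-on (λ ne → θ-val v t' (≼-trans (ε-≼ ne) le))) ⟩
          (∑[ v ] ε v w * (∑[ t ] D t' t * η v t))              ≡⟨ trans (∑-cong (λ v → sym (∑-*ˡ (ε v w) _))) (∑-swap _) ⟩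
          (∑[ t ] ∑[ v ] ε v w * (D t' t * η v t))              ≡⟨ ∑-cong (λ t → trans (∑-cong (λ v → solve 3 (λ e d h → e :* (d :* h) := d :* (e :* h)) refl (ε v w) (D t' t) (η v t))) (∑-*ˡ (D t' t) _)) ⟩
          (∑[ t ] D t' t * (∑[ v ] ε v w * η v t))              ≡⟨ ∑-cong (λ t → *-on (λ ne → sym (ηe w t (≼-trans le (proj₁ (proj₁ (D-≼ {t'} {t} ne))))))) ⟩
          (∑[ t ] D t' t * ζ w t)                               ≡⟨ cyc w t' le ⟩
          0# ∎
        ih = z-exact cm i (ℕₚ.<⇒≤ i<m) x j' (ℕ.s≤s⁻¹ lt) θ θs θcyc θcl
        κ' = proj₁ ih
        κ's : ∀ u t → κ' u t ≢ 0# → x ≼ u × suc (ρ u) ≡ j' × u ≼ loc t × ρ (loc t) ≡ i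
        κ's = proj₁ (proj₂ ih)
        κ'cyc : ∀ u t' → u ≼ loc t' → (∑[ t ] D t' t * κ' u t) ≡ 0#
        κ'cyc = proj₁ (proj₂ (proj₂ ih))
        θe : ∀ v t' → v ≼ loc t' → θ v t' ≡ (∑[ u ] ε u v * κ' u t')
        θe = proj₂ (proj₂ (proj₂ ih))
        lift : ∀ u → Σ (Tot → K) λ v → ∀ t → lev u i t ≡ true → κ' u t ≡ (∑[ t' ] D t t' * v t')
        lift u = CM-chain cm u i i<m (κ' u) (λ t ne → let s = κ's u t ne in ⇒at (proj₁ (proj₂ (proj₂ s))) (proj₂ (proj₂ (proj₂ s))))
                   (λ t pt → κ'cyc u t (proj₁ (at⁻⇒ {u} {i} pt)))
        gd : Fin N → Tot → Bool
        gd u t = at⁻ x j' u ∧ lev u (suc i) t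
        κ : Fin N → Tot → K
        κ u t = [ gd u t ] * proj₁ (lift u) t
        κs : ∀ u t → κ u t ≢ 0# → (x ≼ u × suc (ρ u) ≡ j') × (u ≼ loc t × ρ (loc t) ≡ suc i)
        κs u t ne = at⁻⇒ {x} {j'} (proj₁ (∧-true {at⁻ x j' u} e)) , at⇒ {u} {suc i} (proj₂ (∧-true {at⁻ x j' u} e))
          where e = [≢0] (proj₁ (*≢0 ne))
        κe : ∀ u t' → u ≼ loc t' → (∑[ t ] D t' t * κ u t) ≡ κ' u t'
        κe u t' le = go (at⁻ x j' u) refl (ρ (loc t') ℕₚ.≟ i)
          where
          go : ∀ b → at⁻ x j' u ≡ b → Dec (ρ (loc t') ≡ i) → (∑[ t ] D t' t * κ u t) ≡ κ' u t'
          go false eu _ = trans (∑-0 (λ t → vanish (λ _ nk → true≢false (trans (sym (⇒at⁻ (proj₁ (proj₁ (κs u t nk))) (proj₂ (proj₁ (κs u t nk))))) eu))))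
            (sym (0-or (λ ne → true≢false (trans (sym (⇒at⁻ (proj₁ (κ's u t' ne)) (proj₁ (proj₂ (κ's u t' ne))))) eu))))
          go true eu (yes r) = trans (∑-cong (λ t → *-on (λ ne → trans (cong (λ b → [ b ] * proj₁ (lift u) t) (cong₂ _∧_ eu (⇒at (≼-trans le (proj₁ (proj₁ (D-≼ {t'} {t} ne)))) (trans (cover-rank (D-≼ {t'} {t} ne)) (cong suc r))))) (*-identityˡ _)))) (sym (proj₂ (lift u) t' (⇒at le r)))
          go true eu (no nr) = trans (∑-0 (λ t → vanish (λ nd nk → nr (ℕₚ.suc-injective (trans (sym (cover-rank (D-≼ {t'} {t} nd))) (proj₂ (proj₂ (κs u t nk)))))))) (sym (0-or (λ ne → nr (proj₂ (proj₂ (proj₂ (κ's u t' ne)))))))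
        dκ : Fin N → Tot → K
        dκ v t = [ v ≤ᵇ loc t ] * (∑[ u ] ε u v * κ u t)
        dκ-val : ∀ v t → v ≼ loc t → dκ v t ≡ (∑[ u ] ε u v * κ u t)
        dκ-val v t le = trans (cong (λ b → [ b ] * (∑[ u ] ε u v * κ u t)) le) (*-identityˡ _)
        ξ : Fin N → Tot → K
        ξ v t = η v t - dκ v t
        ξs : ∀ v t → ξ v t ≢ 0# → x ≼ v × suc (ρ v) ≡ suc j' × v ≼ loc t × ρ (loc t) ≡ suc i
        ξs v t ne = go (η v t ≟K 0#)
          where
          from-κ : (Σ (Fin N) λ u → ε u v * κ u t ≢ 0#) → v ≼ loc t → x ≼ v × suc (ρ v) ≡ suc j' × v ≼ loc t × ρ (loc t) ≡ suc i
          from-κ (u , nu) le = ≼-trans (proj₁ (proj₁ k)) (ε-≼ (proj₁ (*≢0 nu))) , cong suc (trans (cover-rank (supp (proj₁ (*≢0 nu)))) (proj₂ (proj₁ k))) , le , proj₂ (proj₂ k)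
            where k = κs u t (proj₂ (*≢0 nu))
          go : Dec (η v t ≡ 0#) → x ≼ v × suc (ρ v) ≡ suc j' × v ≼ loc t × ρ (loc t) ≡ suc i
          go (no nη) = let s = ηs v t nη in proj₁ s , proj₁ (proj₂ (proj₂ s)) , proj₁ (proj₂ s) , proj₂ (proj₂ (proj₂ s))
          go (yes q) = from-κ (∑≢0 _ (proj₂ (*≢0 nd))) ([≢0] (proj₁ (*≢0 nd)))
            where
            nd : dκ v t ≢ 0#
            nd q' = ne (trans (cong₂ _-_ q q') (x-x 0#))
        ξcyc : ∀ v t' → v ≼ loc t' → (∑[ t ] D t' t * ξ v t) ≡ 0#
        ξcyc v t' le = trans step1 (trans step2 step3)
          where
          step1 : (∑[ t ] D t' t * (η v t - dκ v t)) ≡ (∑[ t ] D t' t * η v t) - (∑[ t ] D t' t * dκ v t)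
          step1 = trans (∑-cong (λ t → solve 3 (λ d a b → d :* (a :- b) := d :* a :- d :* b) refl (D t' t) (η v t) (dκ v t))) (∑-sub _ _)
          second : (∑[ t ] D t' t * dκ v t) ≡ (∑[ u ] ε u v * κ' u t')
          second = begin
            (∑[ t ] D t' t * dκ v t)                         ≡⟨ ∑-cong (λ t → *-on (λ ne → dκ-val v t (≼-trans le (proj₁ (proj₁ (D-≼ {t'} {t} ne)))))) ⟩
            (∑[ t ] D t' t * (∑[ u ] ε u v * κ u t))         ≡⟨ trans (∑-cong (λ t → sym (∑-*ˡ (D t' t) _))) (∑-swap _) ⟩
            (∑[ u ] ∑[ t ] D t' t * (ε u v * κ u t))         ≡⟨ ∑-cong (λ u → trans (∑-cong (λ t → solve 3 (λ d e k → d :* (e :* k) := e :* (d :* k)) refl (D t' t) (ε u v) (κ u t))) (∑-*ˡ (ε u v) _)) ⟩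
            (∑[ u ] ε u v * (∑[ t ] D t' t * κ u t))         ≡⟨ ∑-cong (λ u → *-on (λ ne → κe u t' (≼-trans (ε-≼ ne) le))) ⟩
            (∑[ u ] ε u v * κ' u t') ∎
          step2 : (∑[ t ] D t' t * η v t) - (∑[ t ] D t' t * dκ v t) ≡ θ v t' - (∑[ u ] ε u v * κ' u t')
          step2 = cong₂ _-_ (sym (θ-val v t' le)) second
          step3 : θ v t' - (∑[ u ] ε u v * κ' u t') ≡ 0#
          step3 = trans (cong (λ z → z - (∑[ u ] ε u v * κ' u t')) (θe v t' le)) (x-x (∑[ u ] ε u v * κ' u t'))
        ξe : ∀ w t → w ≼ loc t → ζ w t ≡ (∑[ v ] ε v w * ξ v t)
        ξe w t le = sym (begin
          (∑[ v ] ε v w * (η v t - dκ v t))                                   ≡⟨ trans (∑-cong (λ v → solve 3 (λ d a b → d :* (a :- b) := d :* a :- d :* b) refl (ε v w) (η v t) (dκ v t))) (∑-sub _ _) ⟩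
          (∑[ v ] ε v w * η v t) - (∑[ v ] ε v w * dκ v t)                    ≡⟨ cong₂ _-_ (sym (ηe w t le)) zero' ⟩
          ζ w t - 0#                                                          ≡⟨ trans (cong (ζ w t +_) neg-0) (+-identityʳ _) ⟩
          ζ w t ∎)
          where
          zero' : (∑[ v ] ε v w * dκ v t) ≡ 0#
          zero' = begin
            (∑[ v ] ε v w * dκ v t)                          ≡⟨ ∑-cong (λ v → *-on (λ ne → dκ-val v t (≼-trans (ε-≼ ne) le))) ⟩
            (∑[ v ] ε v w * (∑[ u ] ε u v * κ u t))          ≡⟨ trans (∑-cong (λ v → sym (∑-*ˡ (ε v w) _))) (∑-swap _) ⟩
            (∑[ u ] ∑[ v ] ε v w * (ε u v * κ u t))          ≡⟨ ∑-0 (λ u → trans (∑-cong (λ v → solve 3 (λ a b k → a :* (b :* k) := b :* a :* k) refl (ε v w) (ε u v) (κ u t))) (trans (∑-*ʳ (κ u t) _) (trans (cong (_* κ u t) (rel u w)) (zeroˡ _)))) ⟩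
            0# ∎

-- The derived sheaf

module Omega (R : Ring≡) {N : ℕ} (P : PosetData N) where
  open Ring≡ R
  open Sums R
  open PosetData P

  rankSum : ℕ → (Fin N → K) → Fin N → K
  rankSum j φ x = ∑[ y ] [ (x ≤ᵇ y) ∧ (ρ y ≡ᵇ j) ] * φ y

  ω : ℕ → (Fin N → K) → Fin N → K
  ω zero    φ x = rankSum zero φ x
  ω (suc j) φ x = rankSum (suc j) φ x - ω j φ x

module Stalks (F : OrderedField) {N : ℕ} (P : PosetData N) (n : ℕ) (graded : IsGradedPoset P n)
  (C : CellStructures.CellStructure F P n graded) (S : Sheaves.Sheaf F P n graded C) where
  open OrderedField F
  open Solver ring
  open Sums ring
  open LinAlg F
  open Exterior F using (rk-0)
  open Generic F
  open Duality F
  open GradedPoset P n graded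
  open Chains F P n graded using (∑≢0; *≢0)
  open CellStructures.CellStructure C
  open Sheaves F P n graded C hiding (module Sheaf)
  open Sheaves.Sheaf S
  open Omega ring P

  ext : ∀ y → (Fin (f y) → K) → Tot → K
  ext y v (z , b) with z Finₚ.≟ y
  ... | yes refl = v b
  ... | no _     = 0#

  ext-here : ∀ y v b → ext y v (y , b) ≡ v b
  ext-here y v b with y Finₚ.≟ y
  ... | yes refl = refl
  ... | no n     = ⊥-elim (n refl)

  ext-≢0 : ∀ y v t → ext y v t ≢ 0# → loc t ≡ y
  ext-≢0 y v (z , b) ne with z Finₚ.≟ y
  ... | yes refl = refl
  ... | no _     = ⊥-elim (ne refl)

  ∑-ext : ∀ y v (g : Tot → K) → (∑[ t ] g t * ext y v t) ≡ (∑[ b ] g (y , b) * v b)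
  ∑-ext y v g = trans (∑Σ _) (trans (∑-one y _ (λ z ne → ∑-0 (λ b → vanish (λ _ nz → ne (ext-≢0 y v (z , b) nz))))) (∑-cong (λ b → cong (g (y , b) *_) (ext-here y v b))))

  bdry : Fin N → ℕ → Mat Tot Tot
  bdry x j t' t = [ x ≤ᵇ loc t' ] * (D t' t * [ lev x j t ])

  bdry-· : ∀ x j {c} → (∀ t → c t ≢ 0# → lev x j t ≡ true) → ∀ t' → (bdry x j · c) t' ≡ [ x ≤ᵇ loc t' ] * (∑[ t ] D t' t * c t)
  bdry-· x j {c} cs t' = trans (∑-cong (λ t → trans (*-on' t) (*-assoc _ _ _))) (∑-*ˡ _ _)
    where
    *-on' : ∀ t → bdry x j t' t * c t ≡ [ x ≤ᵇ loc t' ] * D t' t * c t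
    *-on' t = trans (*-comm _ _) (trans (*-on (λ ne → trans (cong (λ b → [ x ≤ᵇ loc t' ] * (D t' t * [ b ])) (cs t ne)) (cong ([ x ≤ᵇ loc t' ] *_) (*-identityʳ _)))) (*-comm _ _))

  bdry-rank : ∀ x j t' t → bdry x j t' t ≢ 0# → x ≼ loc t' × suc (ρ (loc t')) ≡ j
  bdry-rank x j t' t ne = [≢0] (proj₁ (*≢0 ne)) , trans (sym (cover-rank (D-≼ {t'} {t} (proj₁ (*≢0 (proj₂ (*≢0 ne))))))) (proj₂ (at⇒ {x} {j} ([≢0] (proj₂ (*≢0 (proj₂ (*≢0 ne)))))))

  size : Fin N → ℕ → K
  size x j = ∑[ t ] [ lev x j t ]

  size-rankSum : ∀ x j → size x j ≡ rankSum j (λ y → fromℕ (f y)) x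
  size-rankSum x j = trans (∑Σ _) (∑-cong (λ y → trans (∑-cong (λ b → sym (*-identityʳ _))) (trans (∑-*ˡ [ at x j y ] (λ _ → 1#)) (cong ([ at x j y ] *_) (∑-1 (f y))))))

  bdry-mask : ∀ x j w v → bdry x j w v * [ lev x j v ] ≡ bdry x j w v
  bdry-mask x j w v = trans (solve 3 (λ a d m → a :* (d :* m) :* m := a :* (d :* (m :* m))) refl _ _ _) (cong (λ z → [ x ≤ᵇ loc w ] * (D w v * z)) ([]-idem (lev x j v)))

  rank-step : ∀ x j → ChainExact D (lev⁻ x j) (lev x j) → fromℕ (rk (bdry x (suc j))) + fromℕ (rk (bdry x j)) ≡ size x j
  rank-step x j ex = trans (sym (trans (cong (λ z → z + fromℕ (rk (bdry x (suc j))) + fromℕ (rk (bdry x j))) (trans (cong fromℕ (exact⇒dim≡0 exact)) 0-homo))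
      (cong (_+ fromℕ (rk (bdry x j))) (+-identityˡ _)))) dim-formula
    where
    mA : ∀ v u → [ lev x j v ] * bdry x (suc j) v u ≡ bdry x (suc j) v u
    mA v u = trans (*-comm _ _) (trans (*-on (λ ne → trans (cong [_] (let q = bdry-rank x (suc j) v u ne in ⇒at (proj₁ q) (ℕₚ.suc-injective (proj₂ q)))) refl)) (*-identityʳ _))
    BA : ∀ w u → (bdry x j ∙ bdry x (suc j)) w u ≡ 0#
    BA w u = trans (bdry-· x j (λ t ne → let q = bdry-rank x (suc j) t u ne in ⇒at (proj₁ q) (ℕₚ.suc-injective (proj₂ q))) w)
      (trans (*-on (λ nx → trans (∑-cong (λ t → *-on (λ nd → trans (cong (λ b → [ b ] * (D t u * [ lev x (suc j) u ])) (≼-trans ([≢0] nx) (proj₁ (proj₁ (D-≼ {w} {t} nd))))) (*-identityˡ _))))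
        (trans (∑-cong (λ t → sym (*-assoc _ _ _))) (trans (∑-*ʳ [ lev x (suc j) u ] _) (trans (cong (_* [ lev x (suc j) u ]) (DD w u)) (zeroˡ _)))))) (zeroʳ _))
    open Homology (lev x j) (bdry x (suc j)) (bdry x j) mA (bdry-mask x j) BA
    exact : ∀ c → (∀ v → [ lev x j v ] * c v ≡ c v) → (∀ w → (bdry x j · c) w ≡ 0#) → Σ (Tot → K) λ u → ∀ v → c v ≡ (bdry x (suc j) · u) v
    exact c mc Bc = u , λ v → go v (lev x j v) refl
      where
      cs : ∀ t → c t ≢ 0# → lev x j t ≡ true
      cs t ne = [≢0] (λ q → ne (trans (sym (mc t)) (trans (cong (_* c t) q) (zeroˡ _))))
      sol = ex c cs (λ t pt → trans (sym (trans (cong (λ b → [ b ] * (∑[ t' ] D t t' * c t')) (proj₁ (at⁻⇒ {x} {j} pt))) (*-identityˡ _))) (trans (sym (bdry-· x j cs t)) (Bc t)))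
      u = proj₁ sol
      go : ∀ v b → lev x j v ≡ b → c v ≡ (bdry x (suc j) · u) v
      go v true  e = trans (proj₂ sol v e) (∑-cong (λ t → cong (_* u t) (sym (trans (cong (λ b → [ b ] * (D v t * [ lev x (suc j) t ])) (proj₁ (at⇒ {x} {j} e)))
        (trans (*-identityˡ _) (trans (*-on (λ nd → cong [_] (⇒at (≼-trans (proj₁ (at⇒ {x} {j} e)) (proj₁ (proj₁ (D-≼ {v} {t} nd)))) (trans (cover-rank (D-≼ {v} {t} nd)) (cong suc (proj₂ (at⇒ {x} {j} e))))))) (*-identityʳ _)))))))
      go v false e = trans (0-or (λ ne → true≢false (trans (sym (cs v ne)) e))) (sym (∑-0 (λ t → vanish (λ nb _ → true≢false (trans (sym (let q = bdry-rank x (suc j) v t nb in ⇒at (proj₁ q) (ℕₚ.suc-injective (proj₂ q)))) e)))))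

  -- At an exact level the cycles are the boundaries from the next level. So the dimension of the
  -- cycles in rank j is the size of level j minus the dimension of the cycles in rank j - 1, which
  -- is the recursion that defines `ω`.
  cycles-ω : ∀ x j → (∀ i → i < j → ChainExact D (lev⁻ x i) (lev x i)) → size x j - fromℕ (rk (bdry x j)) ≡ ω j (λ y → fromℕ (f y)) x
  cycles-ω x zero _ = trans (cong₂ _-_ (size-rankSum x zero) (trans (cong fromℕ (rk-0 (bdry x zero) (λ t' t → 0-or (λ ne → ℕₚ.1+n≢0 (proj₂ (bdry-rank x zero t' t ne)))))) 0-homo)) (trans (cong (rankSum zero (λ y → fromℕ (f y)) x +_) neg-0) (+-identityʳ _))
  cycles-ω x (suc j) ex = trans (cong (λ z → size x (suc j) - z) (x-y≡0 (trans (solve 3 (λ a s b → a :- (s :- b) := (a :+ b) :- s) refl (fromℕ (rk (bdry x (suc j)))) (size x j) (fromℕ (rk (bdry x j)))) (trans (cong (_- size x j) (rank-step x j (ex j (ℕₚ.n<1+n j)))) (x-x _)))))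
    (cong₂ _-_ (size-rankSum x (suc j)) (cycles-ω x j (λ i lt → ex i (ℕₚ.m<n⇒m<1+n lt))))

module Derived (F : OrderedField) {N : ℕ} (P : PosetData N) (n : ℕ) (graded : IsGradedPoset P n)
  (C : CellStructures.CellStructure F P n graded) (S : Sheaves.Sheaf F P n graded C)
  (m : ℕ) (cm : Sheaves.Sheaf.CM S m) (i : ℕ) (i<m : i < m) where
  open OrderedField F
  open Solver ring
  open Sums ring
  open LinAlg F
  open Generic F
  open Duality F
  open GradedPoset P n graded
  open Chains F P n graded using (∑≢0; *≢0)
  open CellStructures.CellStructure C
  open Sheaves F P n graded C hiding (module Sheaf)
  open Sheaves.Sheaf S
  open Omega ring P
  open Stalks F P n graded C S

  -- Exactness at the bottom level of the complex above y: a vector killed by all covers is a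
  -- cocycle there, and no level below can map onto it.
  covers-injective : ∀ y → ρ y < m → ∀ v → (∀ x → y ⋖ x → ∀ j → (R y x · v) j ≡ 0#) → ∀ b → v b ≡ 0#
  covers-injective y lt v h b = trans (sym (ext-here y v b)) (trans (proj₂ (proj₂ sol) (y , b) (⇒at ≼-refl refl)) (∑-0 (λ t → vanish (λ _ nw → none t (proj₁ (proj₂ sol) t nw)))))
    where
    closed : ∀ t' → (∑[ t ] D t t' * ext y v t) ≡ 0#
    closed (x , j) = trans (∑-ext y v (λ t → D t (x , j))) (trans (∑-cong (λ b → *-assoc _ _ _)) (trans (∑-*ˡ (ε y x) _) (vanish (λ ne nv → nv (h x (supp ne) j)))))
    sol = cm y (ρ y) lt (ext y v) (λ t ne → ⇒at (subst (y ≼_) (sym (ext-≢0 y v t ne)) ≼-refl) (cong ρ (ext-≢0 y v t ne))) closed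
    none : ∀ t → lev⁻ y (ρ y) t ≡ true → ⊥
    none t e = ℕₚ.<-irrefl refl (ℕₚ.<-≤-trans (ℕₚ.≤-reflexive (proj₂ (at⁻⇒ {y} {ρ y} {loc t} e))) (ρ-mono-≼ (proj₁ (at⁻⇒ {y} {ρ y} {loc t} e))))

  -- Injectivity into the covers is iterated from x up to rank i; every rank on the way is below m.
  restrict-injective : ∀ d x → ρ x ℕ.+ d ≡ i → ∀ v → (∀ y → x ≼ y → ρ y ≡ i → ∀ b → (R x y · v) b ≡ 0#) → ∀ b → v b ≡ 0#
  restrict-injective zero x e v h b = trans (sym (∙-idˡ (λ b (_ : Fin 1) → v b) b zero)) (trans (∑-cong (λ c → cong (_* v c) (sym (R-id x b c)))) (h x ≼-refl (trans (sym (ℕₚ.+-identityʳ _)) e) b))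
  restrict-injective (suc d) x e v h = covers-injective x (ℕₚ.≤-<-trans (ℕₚ.m≤m+n (ρ x) (suc d)) (subst (_< m) (sym e) i<m)) v
    (λ z c → restrict-injective d z (trans (cong (ℕ._+ d) (cover-rank c)) (trans (sym (ℕₚ.+-suc (ρ x) d)) e)) (R x z · v)
      (λ y zy ry b → trans (sym (·-assoc (R z y) (R x z) v b)) (trans (∑-cong (λ k → cong (_* v k) (R-comp (proj₁ (proj₁ c)) zy b k))) (h y (≼-trans (proj₁ (proj₁ c)) zy) ry b))))

  module WithForm (t : Fin N → K)
    (gen : ∀ y v → (∀ b → (gram R ε t y · v) b ≡ 0#) → ∀ x → ε y x ≢ 0# → ∀ j → (R y x · v) j ≡ 0#) where

    Q : ∀ y → Mat (Fin (f y)) (Fin (f y))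
    Q = gram R ε t

    Q-injective : ∀ y → ρ y < m → ∀ v → (∀ b → (Q y · v) b ≡ 0#) → ∀ b → v b ≡ 0#
    Q-injective y lt v e = covers-injective y lt v (λ x c → gen y v e x (ε-nz c))

    Q-form : ∀ y (u v : Fin (f y) → K) → (∑[ b ] u b * (Q y · v) b) ≡ (∑[ x ] ε y x * t x * (∑[ l ] (R y x · u) l * (R y x · v) l))
    Q-form y u v = begin
      (∑[ b ] u b * (∑[ k ] Q y b k * v k))                            ≡⟨ ∑-cong (λ b → cong (u b *_) (inner b)) ⟩
      (∑[ b ] u b * (∑[ x ] ε y x * t x * (∑[ l ] R y x l b * (R y x · v) l)))  ≡⟨ trans (∑-cong (λ b → sym (∑-*ˡ (u b) _))) (∑-swap _) ⟩
      (∑[ x ] ∑[ b ] u b * (ε y x * t x * (∑[ l ] R y x l b * (R y x · v) l)))  ≡⟨ ∑-cong (λ x → outer x) ⟩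
      (∑[ x ] ε y x * t x * (∑[ l ] (R y x · u) l * (R y x · v) l)) ∎
      where
      open ≡-Reasoning
      inner : ∀ b → (∑[ k ] Q y b k * v k) ≡ (∑[ x ] ε y x * t x * (∑[ l ] R y x l b * (R y x · v) l))
      inner b = begin
        (∑[ k ] Q y b k * v k)                                                     ≡⟨ trans (∑-cong (λ k → sym (∑-*ʳ (v k) _))) (∑-swap _) ⟩
        (∑[ x ] ∑[ k ] ε y x * t x * (∑[ l ] R y x l b * R y x l k) * v k)         ≡⟨ ∑-cong (λ x → trans (∑-cong (λ k → *-assoc _ _ _)) (∑-*ˡ (ε y x * t x) _)) ⟩
        (∑[ x ] ε y x * t x * (∑[ k ] (∑[ l ] R y x l b * R y x l k) * v k))       ≡⟨ ∑-cong (λ x → cong (ε y x * t x *_) (·-assoc (λ b l → R y x l b) (R y x) v b)) ⟩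
        (∑[ x ] ε y x * t x * (∑[ l ] R y x l b * (R y x · v) l)) ∎
      outer : ∀ x → (∑[ b ] u b * (ε y x * t x * (∑[ l ] R y x l b * (R y x · v) l))) ≡ ε y x * t x * (∑[ l ] (R y x · u) l * (R y x · v) l)
      outer x = begin
        (∑[ b ] u b * (ε y x * t x * (∑[ l ] R y x l b * (R y x · v) l)))          ≡⟨ trans (∑-cong (λ b → solve 3 (λ u e s → u :* (e :* s) := e :* (u :* s)) refl (u b) (ε y x * t x) _)) (∑-*ˡ (ε y x * t x) _) ⟩
        ε y x * t x * (∑[ b ] u b * (∑[ l ] R y x l b * (R y x · v) l))            ≡⟨ cong (ε y x * t x *_) (trans (∑-cong (λ b → sym (∑-*ˡ (u b) _))) (∑-swap _)) ⟩
        ε y x * t x * (∑[ l ] ∑[ b ] u b * (R y x l b * (R y x · v) l))            ≡⟨ cong (ε y x * t x *_) (∑-cong (λ l → trans (∑-cong (λ b → solve 3 (λ u r w → u :* (r :* w) := r :* u :* w) refl (u b) (R y x l b) ((R y x · v) l))) (∑-*ʳ ((R y x · v) l) _))) ⟩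
        ε y x * t x * (∑[ l ] (R y x · u) l * (R y x · v) l) ∎

    Φ : ∀ x → Mat Tot (Fin (f x))
    Φ x (y , b) a = [ at x i y ] * (Q y ∙ R x y) b a

    Φ-lev : ∀ x t a → Φ x t a ≢ 0# → lev x i t ≡ true
    Φ-lev x t a ne = [≢0] (proj₁ (*≢0 ne))

    -- In the component at w, functoriality turns the contribution of y and its cover z into the
    -- term t_z R(w,z)ᵗ R(x,z), in which y no longer appears. What is left is the factor Σ ε(w,y)
    -- ε(y,z) over y, which is zero.
    Φ-cycle : ∀ x t' → x ≼ loc t' → ∀ a → (∑[ t ] D t' t * Φ x t a) ≡ 0#
    Φ-cycle x (w , c) xw a = trans (∑Σ _) (trans (∑-cong term) (go (suc (ρ w) ℕₚ.≟ i)))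
      where
      open ≡-Reasoning
      M : Fin N → K
      M z = t z * (∑[ l ] R w z l c * R x z l a)
      term : ∀ y → (∑[ b ] D (w , c) (y , b) * Φ x (y , b) a) ≡ ε w y * ([ at x i y ] * (∑[ z ] ε y z * M z))
      term y = begin
        (∑[ b ] ε w y * R w y b c * ([ at x i y ] * (Q y ∙ R x y) b a))     ≡⟨ trans (∑-cong (λ b → solve 4 (λ e r m q → e :* r :* (m :* q) := e :* (m :* (r :* q))) refl (ε w y) (R w y b c) [ at x i y ] ((Q y ∙ R x y) b a))) (trans (∑-*ˡ (ε w y) _) (cong (ε w y *_) (∑-*ˡ [ at x i y ] _))) ⟩
        ε w y * ([ at x i y ] * (∑[ b ] R w y b c * (Q y · (λ k → R x y k a)) b)) ≡⟨ *-on (λ nw → *-on (λ na → trans (Q-form y (λ b → R w y b c) (λ k → R x y k a)) (∑-cong (λ z → trans (*-assoc _ _ _) (*-on (λ ny → cong (t z *_) (∑-cong (λ l → cong₂ _*_ (R-comp (ε-≼ nw) (ε-≼ ny) l c) (R-comp (proj₁ (at⇒ {x} {i} ([≢0] na))) (ε-≼ ny) l a))))))))) ⟩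
        ε w y * ([ at x i y ] * (∑[ z ] ε y z * M z)) ∎
      go : Dec (suc (ρ w) ≡ i) → (∑[ y ] ε w y * ([ at x i y ] * (∑[ z ] ε y z * M z))) ≡ 0#
      go (no nr) = ∑-0 (λ y → vanish (λ nw n' → nr (trans (sym (cover-rank (supp nw))) (proj₂ (at⇒ {x} {i} ([≢0] (proj₁ (*≢0 n'))))))))
      go (yes r) = begin
        (∑[ y ] ε w y * ([ at x i y ] * (∑[ z ] ε y z * M z)))   ≡⟨ ∑-cong (λ y → *-on (λ nw → trans (cong (λ b → [ b ] * (∑[ z ] ε y z * M z)) (⇒at (≼-trans xw (ε-≼ nw)) (trans (cover-rank (supp nw)) r))) (*-identityˡ _))) ⟩
        (∑[ y ] ε w y * (∑[ z ] ε y z * M z))                    ≡⟨ trans (∑-cong (λ y → sym (∑-*ˡ (ε w y) _))) (∑-swap _) ⟩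
        (∑[ z ] ∑[ y ] ε w y * (ε y z * M z))                    ≡⟨ ∑-0 (λ z → trans (∑-cong (λ y → sym (*-assoc _ _ _))) (trans (∑-*ʳ (M z) _) (trans (cong (_* M z) (rel w z)) (zeroˡ _)))) ⟩
        0# ∎

    Φ-natural : ∀ {x x'} → x ≼ x' → ∀ t → lev x' i t ≡ true → ∀ a → (∑[ a' ] Φ x' t a' * R x x' a' a) ≡ Φ x t a
    Φ-natural {x} {x'} le (y , b) e a = trans (∑-cong (λ a' → *-assoc _ _ _)) (trans (∑-*ˡ [ at x' i y ] _) (cong₂ _*_ masks (trans (∙-assoc (Q y) (R x' y) (R x x') b a) (∙-congʳ (Q y) (R-comp le x'y) b a))))
      where
      x'y = proj₁ (at⇒ {x'} {i} e)
      masks : [ at x' i y ] ≡ [ at x i y ]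
      masks = cong [_] (trans e (sym (⇒at (≼-trans le x'y) (proj₂ (at⇒ {x'} {i} e)))))

    Φ-injective : ∀ x → ρ x ≤ i → ∀ s → (∀ t → (Φ x · s) t ≡ 0#) → ∀ a → s a ≡ 0#
    Φ-injective x le s e = restrict-injective (i ∸ ρ x) x (ℕₚ.m+[n∸m]≡n le) s (λ y xy ry → Q-injective y (subst (_< m) (sym ry) i<m) (R x y · s)
      (λ b → trans (sym (·-assoc (Q y) (R x y) s b)) (trans (∑-cong (λ a → cong (_* s a) (sym (trans (cong (λ z → [ z ] * (Q y ∙ R x y) b a) (⇒at xy ry)) (*-identityˡ _))))) (e (y , b)))))

    -- The stalk of E = Z / F at x, obtained as the homology of the stalk of F mapped by `Φ x` to
    -- level i, followed by the boundary to level i - 1. The columns of σ are cycles representing a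
    -- basis of classes, π takes the class of a cycle, and `dec` splits a cycle into its F-part and
    -- its representative. The dimension is known for ρ x ≤ i, where `Φ x` is injective.
    record Stalk (x : Fin N) : Set where
      field
        e     : ℕ
        σ     : Mat Tot (Fin e)
        π     : Mat (Fin e) Tot
        πσ    : π ∙ σ ≋ Id
        σ-lev : ∀ t k → σ t k ≢ 0# → lev x i t ≡ true
        σ-cyc : ∀ t' → x ≼ loc t' → ∀ k → (∑[ t ] D t' t * σ t k) ≡ 0#
        πΦ    : ∀ k a → (π ∙ Φ x) k a ≡ 0#
        dec   : ∀ (c : Tot → K) → (∀ t → c t ≢ 0# → lev x i t ≡ true) → (∀ t' → x ≼ loc t' → (∑[ t ] D t' t * c t) ≡ 0#) →
                Σ (Fin (f x) → K) λ s → ∀ t → c t ≡ (Φ x · s) t + (σ · (π · c)) t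
        e-dim : ρ x ≤ i → fromℕ e ≡ ω i (λ y → fromℕ (f y)) x - fromℕ (f x)

    private
      stalk′ : ∀ x → Stalk x
      stalk′ x = record
        { e = dim ; σ = σ ; π = π ; πσ = πσ ; σ-lev = σl
        ; σ-cyc = λ t' le k → trans (sym (trans (cong (λ b → [ b ] * (∑[ t ] D t' t * σ t k)) le) (*-identityˡ _))) (trans (sym (bdry-· x i (λ t → σl t k) t')) (Bσ t' k))
        ; πΦ = πA
        ; dec = λ c cs cyc → decompose c (λ v → trans (*-comm _ _) (trans (*-on (λ ne → cong [_] (cs v ne))) (*-identityʳ _)))
            (λ t' → trans (bdry-· x i cs t') (trans (*-on (λ nx → cyc t' ([≢0] nx))) (zeroʳ _)))
        ; e-dim = λ le → begin
            fromℕ dim                                                ≡⟨ solve 3 (λ d a b → d := (d :+ a :+ b) :- b :- a) refl (fromℕ dim) (fromℕ (rk (Φ x))) (fromℕ (rk (bdry x i))) ⟩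
            fromℕ dim + fromℕ (rk (Φ x)) + fromℕ (rk (bdry x i)) - fromℕ (rk (bdry x i)) - fromℕ (rk (Φ x))  ≡⟨ cong₂ (λ a b → a - fromℕ (rk (bdry x i)) - fromℕ b) dim-formula (injective⇒rk (Φ x) (Φ-injective x le)) ⟩
            size x i - fromℕ (rk (bdry x i)) - fromℕ (f x)           ≡⟨ cong (_- fromℕ (f x)) (cycles-ω x i (λ j lt → CM-chain cm x j (ℕₚ.<-trans lt i<m))) ⟩
            ω i (λ y → fromℕ (f y)) x - fromℕ (f x) ∎ }
        where
        open ≡-Reasoning
        mA : ∀ v u → [ lev x i v ] * Φ x v u ≡ Φ x v u
        mA v u = trans (*-comm _ _) (trans (*-on (λ ne → cong [_] (Φ-lev x v u ne))) (*-identityʳ _))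
        BA : ∀ w u → (bdry x i ∙ Φ x) w u ≡ 0#
        BA w u = trans (bdry-· x i (λ t → Φ-lev x t u) w) (trans (*-on (λ nx → Φ-cycle x w ([≢0] nx) u)) (zeroʳ _))
        open Homology (lev x i) (Φ x) (bdry x i) mA (bdry-mask x i) BA
        σl : ∀ t k → σ t k ≢ 0# → lev x i t ≡ true
        σl t k ne = [≢0] (λ q → ne (trans (sym (mσ t k)) (trans (cong (_* σ t k) q) (zeroˡ _))))

    abstract
      stalk : ∀ x → Stalk x
      stalk = stalk′

    module Quotient (st : ∀ x → Stalk x) where
      module St (x : Fin N) = Stalk (st x)

      -- The restriction of the sheaf Z: components at elements that are not above x are forgotten.
      cut : Fin N → (Tot → K) → Tot → K
      cut x v t = [ lev x i t ] * v t

      record InZ (x : Fin N) (v : Tot → K) : Set where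
        constructor mkZ
        field
          on  : ∀ t → v t ≢ 0# → lev x i t ≡ true
          cyc : ∀ t' → x ≼ loc t' → (∑[ t ] D t' t * v t) ≡ 0#

      cut-Z : ∀ {x x' v} → x ≼ x' → InZ x v → InZ x' (cut x' v)
      cut-Z {x} {x'} {v} le (mkZ on cyc) = mkZ (λ t ne → [≢0] (proj₁ (*≢0 ne)))
        (λ t' le' → trans (∑-cong (λ t → *-on (λ nd → trans (*-comm _ _) (trans (*-on (λ nv → cong [_] (⇒at (≼-trans le' (proj₁ (proj₁ (D-≼ {t'} {t} nd)))) (proj₂ (at⇒ {x} {i} (on t nv)))))) (*-identityʳ _))))) (cyc t' (≼-trans le le')))

      ∑-Z : ∀ {x} (a : Fin N → K) (g : Fin N → Tot → K) → (∀ v → a v ≢ 0# → InZ x (g v)) → InZ x (λ t → ∑[ v ] a v * g v t)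
      ∑-Z {x} a g h = mkZ (λ t ne → let s = ∑≢0 _ ne in InZ.on (h (proj₁ s) (proj₁ (*≢0 (proj₂ s)))) t (proj₂ (*≢0 (proj₂ s))))
        (λ t' le → trans (∑-cong (λ t → sym (∑-*ˡ (D t' t) _))) (trans (∑-swap _) (∑-0 (λ v → trans (∑-cong (λ t → solve 3 (λ d a g → d :* (a :* g) := a :* (d :* g)) refl (D t' t) (a v) (g v t))) (trans (∑-*ˡ (a v) _) (trans (*-on (λ ne → InZ.cyc (h v ne) t' le)) (zeroʳ _)))))))

      ∑-σ-Z : ∀ x (w : Fin (St.e x) → K) → InZ x (St.σ x · w)
      ∑-σ-Z x w = mkZ (λ t ne → let s = ∑≢0 _ ne in St.σ-lev x t (proj₁ s) (proj₁ (*≢0 (proj₂ s))))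
        (λ t' le → trans (sym (·-assoc D (St.σ x) w t')) (∑-0 (λ k → trans (cong (_* w k) (St.σ-cyc x t' le k)) (zeroˡ _))))

      Φ-Z : ∀ x (s : Fin (f x) → K) → InZ x (Φ x · s)
      Φ-Z x s = mkZ (λ t ne → let q = ∑≢0 _ ne in Φ-lev x t (proj₁ q) (proj₁ (*≢0 (proj₂ q))))
        (λ t' le → trans (sym (·-assoc D (Φ x) s t')) (∑-0 (λ a → trans (cong (_* s a) (Φ-cycle x t' le a)) (zeroˡ _))))

      cut-Φ : ∀ {x x'} → x ≼ x' → ∀ (s : Fin (f x) → K) t → cut x' (Φ x · s) t ≡ (Φ x' · (R x x' · s)) t
      cut-Φ {x} {x'} le s t = go (lev x' i t) refl
        where
        go : ∀ b → lev x' i t ≡ b → [ b ] * (Φ x · s) t ≡ (Φ x' · (R x x' · s)) t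
        go true  e = trans (*-identityˡ _) (trans (∑-cong (λ a → cong (_* s a) (sym (Φ-natural le t e a)))) (·-assoc (Φ x') (R x x') s t))
        go false e = trans (zeroˡ _) (sym (∑-0 (λ a → vanish (λ ne _ → true≢false (trans (sym (Φ-lev x' t a ne)) e)))))

      RE : ∀ x x' → Mat (Fin (St.e x')) (Fin (St.e x))
      RE x x' = St.π x' ∙ (λ t k → cut x' (λ t → St.σ x t k) t)

      π-Φ : ∀ x (s : Fin (f x) → K) k → (St.π x · (Φ x · s)) k ≡ 0#
      π-Φ x s k = trans (sym (·-assoc (St.π x) (Φ x) s k)) (∑-0 (λ a → trans (cong (_* s a) (St.πΦ x k a)) (zeroˡ _)))

      RE-· : ∀ x x' (w : Fin (St.e x) → K) k → (RE x x' · w) k ≡ (St.π x' · cut x' (St.σ x · w)) k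
      RE-· x x' w k = trans (·-assoc (St.π x') (λ t k → cut x' (λ t → St.σ x t k) t) w k) (·-cong (St.π x') (λ t → trans (∑-cong (λ k → *-assoc _ _ _)) (∑-*ˡ [ lev x' i t ] _)) k)

      -- The restriction of a class does not depend on the representing cycle: the F-part of v is
      -- cut to an F-part at x' by naturality of Φ, and π kills it there.
      RE-π : ∀ {x x' v} → x ≼ x' → InZ x v → ∀ k → (RE x x' · (St.π x · v)) k ≡ (St.π x' · cut x' v) k
      RE-π {x} {x'} {v} le (mkZ on cyc) k = begin
        (RE x x' · (St.π x · v)) k                         ≡⟨ RE-· x x' (St.π x · v) k ⟩
        (St.π x' · cut x' (St.σ x · (St.π x · v))) k       ≡⟨ sym (trans (cong (_+ (St.π x' · cut x' (St.σ x · (St.π x · v))) k) zero') (+-identityˡ _)) ⟩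
        (St.π x' · cut x' (Φ x · s)) k + (St.π x' · cut x' (St.σ x · (St.π x · v))) k  ≡⟨ sym (∑-+ _ _) ⟩
        (∑[ t ] St.π x' k t * cut x' (Φ x · s) t + St.π x' k t * cut x' (St.σ x · (St.π x · v)) t)  ≡⟨ ∑-cong (λ t → trans (solve 4 (λ p l a b → p :* (l :* a) :+ p :* (l :* b) := p :* (l :* (a :+ b))) refl (St.π x' k t) [ lev x' i t ] ((Φ x · s) t) ((St.σ x · (St.π x · v)) t)) (cong (λ z → St.π x' k t * ([ lev x' i t ] * z)) (sym (proj₂ d t)))) ⟩
        (St.π x' · cut x' v) k ∎
        where
        open ≡-Reasoning
        d = St.dec x v on cyc
        s = proj₁ d
        zero' : (St.π x' · cut x' (Φ x · s)) k ≡ 0#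
        zero' = trans (·-cong (St.π x') (cut-Φ le s) k) (π-Φ x' (R x x' · s) k)

      E : Sheaves.Sheaf F P n graded C
      E = record
        { f = St.e ; R = RE
        ; R-id = λ x k l → trans (∑-cong (λ t → cong (St.π x k t *_) (trans (*-comm _ _) (trans (*-on (λ ne → cong [_] (St.σ-lev x t l ne))) (*-identityʳ _))))) (St.πσ x k l)
        ; R-comp = λ {x} {y} {z} xy yz k l → trans (RE-π {v = cut y (λ t → St.σ x t l)} yz (cut-Z xy (mkZ (λ t → St.σ-lev x t l) (λ t' le → St.σ-cyc x t' le l))) k)
            (∑-cong (λ t → cong (St.π z k t *_) (trans (sym (*-assoc _ _ _)) (cong (_* St.σ x t l) (masks x y z yz t))))) }
        where
        masks : ∀ x y z → y ≼ z → ∀ t → [ lev z i t ] * [ lev y i t ] ≡ [ lev z i t ]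
        masks x y z yz t = trans (*-on (λ ne → cong [_] (⇒at (≼-trans yz (proj₁ (at⇒ {z} {i} ([≢0] ne)))) (proj₂ (at⇒ {z} {i} ([≢0] ne)))))) (*-identityʳ _)

      module ES = Sheaves.Sheaf E

      ∑-total : ∀ {g : Fin N → ℕ} (h : Fin N → K) (A : ∀ v → Fin (g v) → K) (w : Σ (Fin N) (λ v → Fin (g v)) → K) →
        (∑[ t ] h (proj₁ t) * A (proj₁ t) (proj₂ t) * w t) ≡ (∑[ v ] h v * (∑[ k ] A v k * w (v , k)))
      ∑-total h A w = trans (∑Σ _) (∑-cong (λ v → trans (∑-cong (λ k → *-assoc _ _ _)) (∑-*ˡ (h v) _)))

      -- The chase through the long exact sequence of 0 → F → Z → E → 0. A cocycle w of E is
      -- represented by cycles ζ. Their coboundary η has class zero, so η = Φ s', and s' is closed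
      -- because Φ is injective. Exactness of F in rank j + 1 gives s' = d s''. Then ζ - Φ s'' is a
      -- cocycle of Z, hence the coboundary of some ξ, and the class of ξ maps to w.
      module CMProof (i₀ : ℕ) (i≡ : i ≡ suc i₀) (x : Fin N) (j : ℕ) (j<i₀ : j < i₀) (w : ES.Tot → K)
        (ws : ∀ t → w t ≢ 0# → ES.lev x j t ≡ true) (closed : ∀ t' → (∑[ t ] ES.D t t' * w t) ≡ 0#) where
        open ≡-Reasoning

        private
          j<i : j < i
          j<i = subst (j <_) (sym i≡) (ℕₚ.m≤n⇒m≤1+n j<i₀)
          sj<m : suc j < m
          sj<m = ℕₚ.≤-<-trans j<i i<m
          -- Closedness of s' is tested in rank j + 2, where the injectivity of Φ requires j + 2 ≤
          -- i; this is what restricts j to j < i - 1.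
          ssj≤i : suc (suc j) ≤ i
          ssj≤i = subst (suc (suc j) ≤_) (sym i≡) (s≤s j<i₀)

          wv : ∀ v → Fin (St.e v) → K
          wv v k = w (v , k)

        ζ : Fin N → Tot → K
        ζ v = St.σ v · wv v

        ζ-Z : ∀ v → InZ v (ζ v)
        ζ-Z v = ∑-σ-Z v (wv v)

        ζ-at : ∀ v t → ζ v t ≢ 0# → x ≼ v × ρ v ≡ j
        ζ-at v t ne = let s = ∑≢0 _ ne in at⇒ {x} {j} (ws (v , proj₁ s) (proj₂ (*≢0 (proj₂ s))))

        πζ : ∀ v k → (St.π v · ζ v) k ≡ w (v , k)
        πζ v k = trans (sym (·-assoc (St.π v) (St.σ v) (wv v) k)) (trans (∑-cong (λ l → cong (_* wv v l) (St.πσ v k l))) (∑-δ k (wv v)))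

        η : Fin N → Tot → K
        η v' t = ∑[ v ] ε v v' * cut v' (ζ v) t

        η-Z : ∀ v' → InZ v' (η v')
        η-Z v' = ∑-Z (λ v → ε v v') (λ v → cut v' (ζ v)) (λ v ne → cut-Z (ε-≼ ne) (ζ-Z v))

        π-∑ : ∀ v' (a : Fin N → K) (g : Fin N → Tot → K) k → (St.π v' · (λ t → ∑[ v ] a v * g v t)) k ≡ (∑[ v ] a v * (St.π v' · g v) k)
        π-∑ v' a g k = trans (∑-cong (λ t → sym (∑-*ˡ (St.π v' k t) _))) (trans (∑-swap _) (∑-cong (λ v → trans (∑-cong (λ t → solve 3 (λ p a g → p :* (a :* g) := a :* (p :* g)) refl (St.π v' k t) (a v) (g v t))) (∑-*ˡ (a v) _))))

        πη : ∀ v' k → (St.π v' · η v') k ≡ 0#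
        πη v' k = begin
          (St.π v' · η v') k                                    ≡⟨ π-∑ v' (λ v → ε v v') (λ v → cut v' (ζ v)) k ⟩
          (∑[ v ] ε v v' * (St.π v' · cut v' (ζ v)) k)          ≡⟨ ∑-cong (λ v → *-on (λ ne → trans (sym (RE-π (ε-≼ ne) (ζ-Z v) k)) (·-cong (RE v v') (πζ v) k))) ⟩
          (∑[ v ] ε v v' * (RE v v' · wv v) k)                  ≡⟨ sym (∑-total (λ v → ε v v') (λ v l → RE v v' k l) w) ⟩
          (∑[ t ] ES.D t (v' , k) * w t)                        ≡⟨ closed (v' , k) ⟩
          0# ∎

        s : ∀ v' → Fin (f v') → K
        s v' = proj₁ (St.dec v' (η v') (InZ.on (η-Z v')) (InZ.cyc (η-Z v')))

        s' : Tot → K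
        s' (v' , a) = [ at x (suc j) v' ] * s v' a

        s'v : ∀ v' → Fin (f v') → K
        s'v v' a = s' (v' , a)

        η-at : ∀ v' t → η v' t ≢ 0# → at x (suc j) v' ≡ true
        η-at v' t ne = let q = ∑≢0 _ ne ; z = ζ-at (proj₁ q) t (proj₂ (*≢0 (proj₂ (*≢0 (proj₂ q))))) ; c = supp (proj₁ (*≢0 (proj₂ q))) in
          ⇒at (≼-trans (proj₁ z) (proj₁ (proj₁ c))) (trans (cover-rank c) (cong suc (proj₂ z)))

        η≡Φ : ∀ v' t → η v' t ≡ (Φ v' · s'v v') t
        η≡Φ v' t = go (at x (suc j) v') refl
          where
          go : ∀ b → at x (suc j) v' ≡ b → η v' t ≡ (Φ v' · (λ a → [ b ] * s v' a)) t
          go true  e = trans (proj₂ (St.dec v' (η v') (InZ.on (η-Z v')) (InZ.cyc (η-Z v'))) t)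
            (trans (cong ((Φ v' · s v') t +_) (∑-0 (λ k → trans (cong (St.σ v' t k *_) (πη v' k)) (zeroʳ _)))) (trans (+-identityʳ _) (∑-cong (λ a → cong (Φ v' t a *_) (sym (*-identityˡ _))))))
          go false e = trans (0-or (λ ne → true≢false (trans (sym (η-at v' t ne)) e))) (sym (∑-0 (λ a → trans (cong (Φ v' t a *_) (zeroˡ _)) (zeroʳ _))))

        ds : ∀ v'' → Fin (f v'') → K
        ds v'' a = ∑[ v' ] ε v' v'' * (R v' v'' · s'v v') a

        Φ-∑ : ∀ v (a : Fin N → K) (g : Fin N → Fin (f v) → K) t → (Φ v · (λ b → ∑[ u ] a u * g u b)) t ≡ (∑[ u ] a u * (Φ v · g u) t)
        Φ-∑ v a g t = trans (∑-cong (λ b → sym (∑-*ˡ (Φ v t b) _))) (trans (∑-swap _) (∑-cong (λ u → trans (∑-cong (λ b → solve 3 (λ p a g → p :* (a :* g) := a :* (p :* g)) refl (Φ v t b) (a u) (g u b))) (∑-*ˡ (a u) _))))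

        Φds : ∀ v'' t → (Φ v'' · ds v'') t ≡ 0#
        Φds v'' t = trans (Φ-∑ v'' (λ v' → ε v' v'') (λ v' → R v' v'' · s'v v') t) (trans (∑-cong (λ v' → *-on (λ ne → trans (sym (cut-Φ (ε-≼ ne) (s'v v') t)) (cong ([ lev v'' i t ] *_) (sym (η≡Φ v' t)))))) (go (lev v'' i t) refl))
          where
          go : ∀ b → lev v'' i t ≡ b → (∑[ v' ] ε v' v'' * ([ b ] * η v' t)) ≡ 0#
          go false e = ∑-0 (λ v' → trans (cong (ε v' v'' *_) (zeroˡ _)) (zeroʳ _))
          go true  e = begin
            (∑[ v' ] ε v' v'' * (1# * η v' t))                              ≡⟨ ∑-cong (λ v' → *-on (λ ne → trans (*-identityˡ _) (∑-cong (λ v → cong (ε v v' *_) (trans (cong (λ b → [ b ] * ζ v t) (⇒at (≼-trans (ε-≼ ne) (proj₁ (at⇒ {v''} {i} e))) (proj₂ (at⇒ {v''} {i} e)))) (*-identityˡ _)))))) ⟩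
            (∑[ v' ] ε v' v'' * (∑[ v ] ε v v' * ζ v t))                    ≡⟨ trans (∑-cong (λ v' → sym (∑-*ˡ (ε v' v'') _))) (∑-swap _) ⟩
            (∑[ v ] ∑[ v' ] ε v' v'' * (ε v v' * ζ v t))                    ≡⟨ ∑-0 (λ v → trans (∑-cong (λ v' → solve 3 (λ a b c → a :* (b :* c) := b :* a :* c) refl (ε v' v'') (ε v v') (ζ v t))) (trans (∑-*ʳ (ζ v t) _) (trans (cong (_* ζ v t) (rel v v'')) (zeroˡ _)))) ⟩
            0# ∎

        s'-at : ∀ t → s' t ≢ 0# → lev x (suc j) t ≡ true
        s'-at t ne = [≢0] (proj₁ (*≢0 ne))

        s'-closed : ∀ t'' → (∑[ t' ] D t' t'' * s' t') ≡ 0#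
        s'-closed (v'' , a) = trans (∑-total (λ v' → ε v' v'') (λ v' b → R v' v'' a b) s') (go (ρ v'' ≤? i))
          where
          go : Dec (ρ v'' ≤ i) → ds v'' a ≡ 0#
          go (yes le) = Φ-injective v'' le (ds v'') (Φds v'') a
          go (no nle) = ∑-0 (λ v' → vanish (λ ne nr → let q = ∑≢0 _ nr in
            nle (subst (_≤ i) (sym (trans (cover-rank (supp ne)) (cong suc (proj₂ (at⇒ {x} {suc j} (s'-at (v' , proj₁ q) (proj₂ (*≢0 (proj₂ q))))))))) ssj≤i)))

        private
          lift = cm x (suc j) sj<m s' s'-at s'-closed

        s'' : Tot → K
        s'' = proj₁ lift

        s''v : ∀ v → Fin (f v) → K
        s''v v a = s'' (v , a)

        s''-at : ∀ v a → s'' (v , a) ≢ 0# → x ≼ v × ρ v ≡ j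
        s''-at v a ne = let q = at⁻⇒ {x} {suc j} {v} (proj₁ (proj₂ lift) (v , a) ne) in proj₁ q , ℕₚ.suc-injective (proj₂ q)

        s'≡d : ∀ v' a → s'v v' a ≡ (∑[ v ] ε v v' * (R v v' · s''v v) a)
        s'≡d v' a = trans (go (lev x (suc j) (v' , a)) refl) (∑-total (λ v → ε v v') (λ v b → R v v' a b) s'')
          where
          go : ∀ b → lev x (suc j) (v' , a) ≡ b → s' (v' , a) ≡ (∑[ t ] D t (v' , a) * s'' t)
          go true  e = proj₂ (proj₂ lift) (v' , a) e
          go false e = trans (0-or (λ ne → true≢false (trans (sym (s'-at (v' , a) ne)) e)))
            (sym (∑-0 (λ t → vanish (λ nd ns → let q = s''-at (loc t) (proj₂ t) ns ; c = D-≼ {t} {v' , a} nd in true≢false (trans (sym (⇒at (≼-trans (proj₁ q) (proj₁ (proj₁ c))) (trans (cover-rank c) (cong suc (proj₂ q))))) e)))))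

        Φs : ∀ v → Tot → K
        Φs v = Φ v · s''v v

        ζ' : Fin N → Tot → K
        ζ' v t = ζ v t - Φs v t

        ζ'-supp : ∀ v t → ζ' v t ≢ 0# → x ≼ v × ρ v ≡ j × v ≼ loc t × ρ (loc t) ≡ i
        ζ'-supp v t ne = go (ζ v t ≟K 0#)
          where
          join : x ≼ v × ρ v ≡ j → lev v i t ≡ true → x ≼ v × ρ v ≡ j × v ≼ loc t × ρ (loc t) ≡ i
          join (a , b) l = a , b , at⇒ {v} {i} l
          go : Dec (ζ v t ≡ 0#) → x ≼ v × ρ v ≡ j × v ≼ loc t × ρ (loc t) ≡ i
          go (no nz)  = join (ζ-at v t nz) (InZ.on (ζ-Z v) t nz)
          go (yes q) = join (let r = ∑≢0 _ nΦ in s''-at v (proj₁ r) (proj₂ (*≢0 (proj₂ r)))) (InZ.on (Φ-Z v (s''v v)) t nΦ)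
            where
            nΦ : Φs v t ≢ 0#
            nΦ q' = ne (trans (cong₂ _-_ q q') (x-x 0#))

        ζ'-cyc : ∀ v t' → v ≼ loc t' → (∑[ t ] D t' t * ζ' v t) ≡ 0#
        ζ'-cyc v t' le = trans (∑-cong (λ t → solve 3 (λ d a b → d :* (a :- b) := d :* a :- d :* b) refl (D t' t) (ζ v t) (Φs v t)))
          (trans (∑-sub _ _) (trans (cong₂ _-_ (InZ.cyc (ζ-Z v) t' le) (InZ.cyc (Φ-Z v (s''v v)) t' le)) (x-x 0#)))

        η-val : ∀ v' t → lev v' i t ≡ true → (∑[ v ] ε v v' * ζ v t) ≡ η v' t
        η-val v' t e = ∑-cong (λ v → cong (ε v v' *_) (sym (trans (cong (λ b → [ b ] * ζ v t) e) (*-identityˡ _))))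

        Φs-val : ∀ v' t → lev v' i t ≡ true → (∑[ v ] ε v v' * Φs v t) ≡ (Φ v' · s'v v') t
        Φs-val v' t e = trans (∑-cong (λ v → *-on (λ ne → trans (sym (trans (cong (λ b → [ b ] * Φs v t) e) (*-identityˡ _))) (cut-Φ (ε-≼ ne) (s''v v) t))))
          (trans (sym (Φ-∑ v' (λ v → ε v v') (λ v → R v v' · s''v v) t)) (·-cong (Φ v') (λ a → sym (s'≡d v' a)) t))

        ζ'-closed : ∀ v' t → v' ≼ loc t → (∑[ v ] ε v v' * ζ' v t) ≡ 0#
        ζ'-closed v' t le = go (ρ (loc t) ℕₚ.≟ i)
          where
          go : Dec (ρ (loc t) ≡ i) → (∑[ v ] ε v v' * ζ' v t) ≡ 0#
          go (no nr) = ∑-0 (λ v → vanish (λ _ nz → nr (proj₂ (proj₂ (proj₂ (ζ'-supp v t nz))))))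
          go (yes r) = trans (∑-cong (λ v → solve 3 (λ d a b → d :* (a :- b) := d :* a :- d :* b) refl (ε v v') (ζ v t) (Φs v t)))
            (trans (∑-sub _ _) (trans (cong₂ _-_ (trans (η-val v' t (⇒at le r)) (η≡Φ v' t)) (Φs-val v' t (⇒at le r))) (x-x ((Φ v' · s'v v') t))))

        private
          zx = z-exact cm i (ℕₚ.<⇒≤ i<m) x j j<i ζ' ζ'-supp ζ'-cyc ζ'-closed

        ξ : Fin N → Tot → K
        ξ = proj₁ zx

        ξ-supp : ∀ v t → ξ v t ≢ 0# → x ≼ v × suc (ρ v) ≡ j × v ≼ loc t × ρ (loc t) ≡ i
        ξ-supp = proj₁ (proj₂ zx)

        ξ-Z : ∀ v → InZ v (ξ v)
        ξ-Z v = mkZ (λ t ne → ⇒at (proj₁ (proj₂ (proj₂ (ξ-supp v t ne)))) (proj₂ (proj₂ (proj₂ (ξ-supp v t ne))))) (λ t' le → proj₁ (proj₂ (proj₂ zx)) v t' le)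

        ξ-d : ∀ v t → v ≼ loc t → ζ' v t ≡ (∑[ u ] ε u v * ξ u t)
        ξ-d = proj₂ (proj₂ (proj₂ zx))

        w' : ES.Tot → K
        w' (v , k) = (St.π v · ξ v) k

        w'-at : ∀ t → w' t ≢ 0# → ES.lev⁻ x j t ≡ true
        w'-at (v , k) ne = let q = ∑≢0 _ ne ; r = ξ-supp v (proj₁ q) (proj₂ (*≢0 (proj₂ q))) in ⇒at⁻ (proj₁ r) (proj₁ (proj₂ r))

        cutξ : ∀ v t → (∑[ u ] ε u v * cut v (ξ u) t) ≡ ζ' v t
        cutξ v t = go (lev v i t) refl
          where
          go : ∀ b → lev v i t ≡ b → (∑[ u ] ε u v * ([ b ] * ξ u t)) ≡ ζ' v t
          go true  e = trans (∑-cong (λ u → cong (ε u v *_) (*-identityˡ _))) (sym (ξ-d v t (proj₁ (at⇒ {v} {i} e))))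
          go false e = trans (∑-0 (λ u → trans (cong (ε u v *_) (zeroˡ _)) (zeroʳ _))) (sym (0-or (λ ne → true≢false (trans (sym (⇒at (proj₁ (proj₂ (proj₂ (ζ'-supp v t ne)))) (proj₂ (proj₂ (proj₂ (ζ'-supp v t ne)))))) e))))

        πζ' : ∀ v k → (St.π v · ζ' v) k ≡ w (v , k)
        πζ' v k = trans (∑-cong (λ t → solve 3 (λ d a b → d :* (a :- b) := d :* a :- d :* b) refl (St.π v k t) (ζ v t) (Φs v t)))
          (trans (∑-sub _ _) (trans (cong₂ _-_ (πζ v k) (π-Φ v (s''v v) k)) (trans (cong (w (v , k) +_) neg-0) (+-identityʳ _))))

        w≡d : ∀ t → w t ≡ (∑[ t' ] ES.D t' t * w' t')
        w≡d (v , k) = sym (begin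
          (∑[ t' ] ES.D t' (v , k) * w' t')                      ≡⟨ ∑-total (λ u → ε u v) (λ u l → RE u v k l) w' ⟩
          (∑[ u ] ε u v * (RE u v · (St.π u · ξ u)) k)           ≡⟨ ∑-cong (λ u → *-on (λ ne → RE-π (ε-≼ ne) (ξ-Z u) k)) ⟩
          (∑[ u ] ε u v * (St.π v · cut v (ξ u)) k)              ≡⟨ sym (π-∑ v (λ u → ε u v) (λ u → cut v (ξ u)) k) ⟩
          (St.π v · (λ t → ∑[ u ] ε u v * cut v (ξ u) t)) k      ≡⟨ ·-cong (St.π v) (cutξ v) k ⟩
          (St.π v · ζ' v) k                                      ≡⟨ πζ' v k ⟩
          w (v , k) ∎)

      E-CM : ∀ i₀ → i ≡ suc i₀ → ES.CM i₀
      E-CM i₀ i≡ x j lt w ws cl = w' , w'-at , λ t _ → w≡d t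
        where open CMProof i₀ i≡ x j lt w ws cl

module Derive (F : OrderedField) {N : ℕ} (P : PosetData N) (n : ℕ) (graded : IsGradedPoset P n)
  (C : CellStructures.CellStructure F P n graded) where
  open OrderedField F
  open Sums ring
  open LinAlg F using (fromℕ)
  open Generic F
  open GradedPoset P n graded
  open CellStructures.CellStructure C
  open Sheaves F P n graded C
  open Omega ring P

  derive : ∀ (S : Sheaf) {m} → Sheaf.CM S m → ∀ i₀ → suc i₀ < m →
    Σ Sheaf λ E → Sheaf.CM E i₀ × (∀ x → ρ x ≤ suc i₀ → fromℕ (Sheaf.f E x) ≡ ω (suc i₀) (λ y → fromℕ (Sheaf.f S y)) x - fromℕ (Sheaf.f S x))
  derive S {m} cm i₀ lt = E , E-CM i₀ refl , λ x le → Stalk.e-dim (stalk x) le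
    where
    open Derived F P n graded C S m cm (suc i₀) lt
    g = generic (Sheaf.R S) ε
    open WithForm (proj₁ g) (proj₂ g)
    open Quotient stalk

-- Constant sheaves

⟦_⟧ : Bool → ℕ
⟦ b ⟧ = if b then 1 else 0

⟦⟧-inhabited : ∀ b → Fin ⟦ b ⟧ → b ≡ true
⟦⟧-inhabited true _ = refl

⟦⟧-unique : ∀ b (i j : Fin ⟦ b ⟧) → i ≡ j
⟦⟧-unique true zero zero = refl

⟦⟧-point : ∀ b → b ≡ true → Fin ⟦ b ⟧
⟦⟧-point true _ = zero

module TopCycles (F : OrderedField) {N : ℕ} (P : PosetData N) (n : ℕ) (graded : IsGradedPoset P n)
  (C : CellStructures.CellStructure F P n graded) (S : Sheaves.Sheaf F P n graded C) where
  open OrderedField F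
  open Sums ring
  open LinAlg F
  open Det F using (Id-factor⇒≤)
  open Exterior F using (rk-0)
  open Duality F
  open GradedPoset P n graded
  open Sheaves F P n graded C hiding (module Sheaf)
  open Sheaves.Sheaf S
  open Stalks F P n graded C S
  open Omega ring P

  ω-exact : ∀ x j → (∀ i → i ≤ j → ChainExact D (lev⁻ x i) (lev x i)) → (∀ t → ρ (loc t) ≢ suc j) → ω j (λ y → fromℕ (f y)) x ≡ 0#
  ω-exact x j ex none = trans (sym (cycles-ω x j (λ i lt → ex i (ℕₚ.<⇒≤ lt)))) (trans (cong (_- fromℕ (rk (bdry x j))) (sym (rank-step x j (ex j ℕₚ.≤-refl))))
      (trans (cong (λ z → z + fromℕ (rk (bdry x j)) - fromℕ (rk (bdry x j))) (trans (cong fromℕ (rk-0 (bdry x (suc j)) (λ t' t → 0-or λ ne → none t (proj₂ (at⇒ {x} {suc j} (level t' t ne)))))) 0-homo))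
        (trans (cong (_- fromℕ (rk (bdry x j))) (+-identityˡ _)) (x-x _))))
    where
    open Chains F P n graded using (*≢0)
    level : ∀ t' t → bdry x (suc j) t' t ≢ 0# → lev x (suc j) t ≡ true
    level t' t ne = [≢0] (proj₂ (*≢0 (proj₂ (*≢0 ne))))

  -- By `cycles-ω` the value of `ω` is the dimension of the cycles of rank j above x, and the
  -- hypotheses say that these are the multiples of one non-zero cycle g.
  ω-line : ∀ x j → (∀ i → i < j → ChainExact D (lev⁻ x i) (lev x i)) →
    (g : Tot → K) → (∀ t → g t ≢ 0# → lev x j t ≡ true) → (∀ t → x ≼ loc t → (∑[ t' ] D t t' * g t') ≡ 0#) → (Σ Tot λ t → g t ≢ 0#) →
    (∀ (u : Tot → K) → (∀ t → u t ≢ 0# → lev x j t ≡ true) → (∀ t → x ≼ loc t → (∑[ t' ] D t t' * u t') ≡ 0#) → Σ K λ a → ∀ t → u t ≡ a * g t) →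
    ω j (λ y → fromℕ (f y)) x ≡ 1#
  ω-line x j ex g gs gc (t₀ , nz) mult = trans (sym (cycles-ω x j ex)) (trans (cong (_- fromℕ (rk (bdry x j))) (sym total)) cancel)
    where
    open Solver ring
    -- The incoming map is from the zero space, so that the homology at this level is the whole
    -- space of cycles.
    A : Mat Tot (Fin 0)
    A _ ()
    open Homology (lev x j) A (bdry x j) (λ _ ()) (bdry-mask x j) (λ _ ())
    masked : ∀ (u : Tot → K) → (∀ t → [ lev x j t ] * u t ≡ u t) → ∀ t → u t ≢ 0# → lev x j t ≡ true
    masked u mu t ne = [≢0] (λ q → ne (trans (sym (mu t)) (trans (cong (_* u t) q) (zeroˡ _))))
    cycle : ∀ (u : Tot → K) → (∀ t → u t ≢ 0# → lev x j t ≡ true) → (∀ t → (bdry x j · u) t ≡ 0#) → ∀ t → x ≼ loc t → (∑[ t' ] D t t' * u t') ≡ 0#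
    cycle u us cyc t xt = trans (sym (trans (cong (λ b → [ b ] * (∑[ t' ] D t t' * u t')) xt) (*-identityˡ _))) (trans (sym (bdry-· x j us t)) (cyc t))
    coef : ∀ k → Σ K λ a → ∀ t → σ t k ≡ a * g t
    coef k = mult (λ t → σ t k) (masked _ (λ t → mσ t k)) (cycle _ (masked _ (λ t → mσ t k)) (λ t → Bσ t k))
    dim≤1 : dim ≤ 1
    dim≤1 = Id-factor⇒≤ {dim} {1} (λ k _ → (π · g) k) (λ _ l → proj₁ (coef l)) (λ k l → trans (∑Fin-suc {0} _) (trans (cong ((π · g) k * proj₁ (coef l) +_) (∑Fin-zero _)) (trans (+-identityʳ _)
      (trans (sym (∑-*ʳ (proj₁ (coef l)) _)) (trans (∑-cong (λ t → trans (*-assoc _ _ _) (cong (π k t *_) (trans (*-comm _ _) (sym (proj₂ (coef l) t)))))) (πσ k l))))))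
    dim≢0 : dim ≢ 0
    dim≢0 e = nz (trans (proj₂ dec t₀) (trans (cong₂ _+_ (∑Fin-zero _) (∑-0 (λ k → ⊥-elim (Finₚ.¬Fin0 (subst Fin e k))))) (+-identityˡ 0#)))
      where
      mg : ∀ t → [ lev x j t ] * g t ≡ g t
      mg t = trans (*-comm _ _) (trans (*-on (λ ne → cong [_] (gs t ne))) (*-identityʳ _))
      dec = decompose g mg (λ t → trans (bdry-· x j gs t) (trans (*-on (λ nx → gc t ([≢0] nx))) (zeroʳ _)))
    dim≡1 : dim ≡ 1
    dim≡1 = ℕₚ.≤-antisym dim≤1 (ℕₚ.n≢0⇒n>0 dim≢0)
    total : 1# + 0# + fromℕ (rk (bdry x j)) ≡ size x j
    total = trans (cong₂ (λ a b → a + b + fromℕ (rk (bdry x j))) (sym (trans (cong fromℕ dim≡1) 1-homo)) (sym (trans (cong fromℕ (rk-0 A (λ _ ()))) 0-homo))) dim-formula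
    cancel : 1# + 0# + fromℕ (rk (bdry x j)) - fromℕ (rk (bdry x j)) ≡ 1#
    cancel = trans (cong (λ z → z + fromℕ (rk (bdry x j)) - fromℕ (rk (bdry x j))) (+-identityʳ 1#)) (solve 2 (λ a b → a :+ b :- b := a) refl 1# (fromℕ (rk (bdry x j))))

module ConstantSheaf (F : OrderedField) {N : ℕ} (P : PosetData N) (n : ℕ) (graded : IsGradedPoset P n)
  (C : CellStructures.CellStructure F P n graded) (Q : Fin N → Bool)
  (convex : ∀ {x y z} → GradedPoset._≼_ P n graded x y → GradedPoset._≼_ P n graded y z → Q x ≡ true → Q z ≡ true → Q y ≡ true) where
  open OrderedField F
  open Sums ring
  open LinAlg F
  open Duality F
  open GradedPoset P n graded
  open Chains F P n graded using (∑≢0; *≢0)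
  open CellStructures.CellStructure C
  open Sheaves F P n graded C hiding (module Sheaf)
  open Omega ring P

  constant : Sheaf
  constant = record
    { f      = λ y → ⟦ Q y ⟧
    ; R      = λ _ _ _ _ → 1#
    ; R-id   = λ x i j → sym (trans (cong (δ i) (⟦⟧-unique (Q x) j i)) (δ-refl i))
    -- Convexity enters here: between two non-zero stalks the middle stalk is non-zero, so the
    -- composite is 1 and not 0.
    ; R-comp = λ {x} {y} {z} xy yz c a → trans (∑-one (⟦⟧-point (Q y) (convex xy yz (⟦⟧-inhabited (Q x) a) (⟦⟧-inhabited (Q z) c))) _ (λ i ne → ⊥-elim (ne (⟦⟧-unique (Q y) i _)))) (*-identityˡ 1#)
    }

  open Sheaves.Sheaf constant

  ∂ : (Fin N → K) → Fin N → K
  ∂ c v = ∑[ u ] ε v u * c u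

  -- Cellular exactness of Q above x where boundaries are tested only inside Q. For Q the complement
  -- of ∂P these are relative chains; for a down-closed Q nothing is lost, since the boundary stays
  -- in Q.
  RelEx : Fin N → ℕ → Set
  RelEx x r = ∀ c → (∀ u → c u ≢ 0# → x ≼ u × Q u ≡ true × ρ u ≡ r) → (∀ v → x ≼ v → Q v ≡ true → ∂ c v ≡ 0#) →
    Σ (Fin N → K) λ a → (∀ u → a u ≢ 0# → Q u ≡ true) × (∀ v → x ≼ v → Q v ≡ true → c v ≡ ∂ a v)

  private
    flat : (Tot → K) → Fin N → K
    flat u y = ∑[ b ] u (y , b)

    flat-val : ∀ u t → flat u (loc t) ≡ u t
    flat-val u (y , b) = ∑-one b _ (λ i ne → ⊥-elim (ne (⟦⟧-unique (Q y) i b)))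

    flat-loc : ∀ (a : Fin N → K) → (∀ u → a u ≢ 0# → Q u ≡ true) → ∀ y → flat (λ t → a (loc t)) y ≡ a y
    flat-loc a as y = go (a y ≟K 0#)
      where
      go : Dec (a y ≡ 0#) → flat (λ t → a (loc t)) y ≡ a y
      go (yes q) = trans (∑-0 (λ _ → q)) (sym q)
      go (no ne) = flat-val (λ t → a (loc t)) (y , ⟦⟧-point (Q y) (as y ne))

    D-flat : ∀ u t → (∑[ t' ] D t t' * u t') ≡ ∂ (flat u) (loc t)
    D-flat u (v , a) = trans (∑Σ _) (∑-cong (λ y → trans (∑-cong (λ b → cong (_* u (y , b)) (*-identityʳ _))) (∑-*ˡ (ε v y) _)))

    flat-supp : ∀ x r u → (∀ t → u t ≢ 0# → lev x r t ≡ true) → ∀ y → flat u y ≢ 0# → x ≼ y × Q y ≡ true × ρ y ≡ r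
    flat-supp x r u us y ne = let q = ∑≢0 _ ne ; l = at⇒ {x} {r} (us (y , proj₁ q) (proj₂ q)) in proj₁ l , ⟦⟧-inhabited (Q y) (proj₁ q) , proj₂ l

    ∂-rank : ∀ {r} c → (∀ u → c u ≢ 0# → ρ u ≡ r) → ∀ v → ∂ c v ≢ 0# → suc (ρ v) ≡ r
    ∂-rank c cs v ne = let q = ∑≢0 _ ne in trans (sym (cover-rank (supp (proj₁ (*≢0 (proj₂ q)))))) (cs (proj₁ q) (proj₂ (*≢0 (proj₂ q))))

    point : ∀ v → Q v ≡ true → Tot
    point v q = v , ⟦⟧-point (Q v) q

  chain-exact : ∀ x r → RelEx x r → ChainExact D (lev⁻ x r) (lev x r)
  chain-exact x r ex u us cyc = (λ t → proj₁ sol (loc t)) , λ t lt → trans (sym (flat-val u t)) (trans (proj₂ (proj₂ sol) (loc t) (proj₁ (at⇒ {x} {r} lt)) (⟦⟧-inhabited (Q (loc t)) (proj₂ t)))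
      (trans (∑-cong (λ y → cong (ε (loc t) y *_) (sym (flat-loc (proj₁ sol) (proj₁ (proj₂ sol)) y)))) (sym (D-flat (λ t → proj₁ sol (loc t)) t))))
    where
    fs = flat-supp x r u us
    sol = ex (flat u) fs (λ v xv qv → 0-or λ ne → ne (trans (sym (D-flat u (point v qv))) (cyc (point v qv) (⇒at⁻ xv (∂-rank (flat u) (λ y ne → proj₂ (proj₂ (fs y ne))) v ne)))))

  constant-CM : ∀ m → (∀ x r → r < m → RelEx x r) → CM m
  constant-CM m ex x r lt = chain⇒cochain D (lev⁻ x r) (lev x r) (chain-exact x r (ex x r lt))

  open TopCycles F P n graded C constant

  ω-constant-exact : ∀ x j → (∀ i → i ≤ j → RelEx x i) → (∀ y → Q y ≡ true → ρ y ≢ suc j) → ω j (λ y → fromℕ ⟦ Q y ⟧) x ≡ 0#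
  ω-constant-exact x j ex none = ω-exact x j (λ i le → chain-exact x i (ex i le)) (λ t → none (loc t) (⟦⟧-inhabited (Q (loc t)) (proj₂ t)))

  ω-constant-line : (∀ {u v} → u ≼ v → Q v ≡ true → Q u ≡ true) → ∀ x j → (∀ i → i < j → RelEx x i) →
    (a : Fin N → K) → (∀ u → a u ≢ 0# → x ≼ u × Q u ≡ true × ρ u ≡ j) → (∀ v → x ≼ v → ∂ a v ≡ 0#) → (Σ (Fin N) λ u → a u ≢ 0#) →
    (∀ c → (∀ u → c u ≢ 0# → x ≼ u × Q u ≡ true × ρ u ≡ j) → (∀ v → x ≼ v → ∂ c v ≡ 0#) → Σ K λ t → ∀ u → c u ≡ t * a u) →
    ω j (λ y → fromℕ ⟦ Q y ⟧) x ≡ 1#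
  ω-constant-line down x j ex a as ac (u₀ , nz) mult = ω-line x j (λ i lt → chain-exact x i (ex i lt)) (λ t → a (loc t))
      (λ t ne → let q = as (loc t) ne in ⇒at (proj₁ q) (proj₂ (proj₂ q)))
      (λ t xt → trans (D-flat (λ t → a (loc t)) t) (trans (∑-cong (λ y → cong (ε (loc t) y *_) (flat-loc a (λ u ne → proj₁ (proj₂ (as u ne))) y))) (ac (loc t) xt)))
      (point u₀ (proj₁ (proj₂ (as u₀ nz))) , nz)
      (λ u us cyc → let r = mult (flat u) (flat-supp x j u us) (closed u us cyc) in proj₁ r , λ t → trans (sym (flat-val u t)) (proj₂ r (loc t)))
    where
    closed : ∀ u → (∀ t → u t ≢ 0# → lev x j t ≡ true) → (∀ t → x ≼ loc t → (∑[ t' ] D t t' * u t') ≡ 0#) → ∀ v → x ≼ v → ∂ (flat u) v ≡ 0#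
    closed u us cyc v xv = 0-or λ ne → let q = ∑≢0 _ ne ; s = flat-supp x j u us (proj₁ q) (proj₂ (*≢0 (proj₂ q))) in
      ne (trans (sym (D-flat u (point v (down (ε-≼ (proj₁ (*≢0 (proj₂ q)))) (proj₁ (proj₂ s)))))) (cyc (point v (down (ε-≼ (proj₁ (*≢0 (proj₂ q)))) (proj₁ (proj₂ s)))) xv))

-- Near-Gorenstein* posets

module NearGorenstein (F : OrderedField) {N : ℕ} (P : PosetData N) (m : ℕ) (B : Fin N → Bool)
  (graded : IsGradedPoset P (suc m)) (boundary : IsDownClosedOfRank P B m)
  (near : IsNearGorenstein (OrderComplex P (fullSet P)) (OrderComplex P B) (suc m)) where
  open OrderedField F
  open Solver ring
  open Sums ring
  open LinAlg F
  open Exterior F using (HomologyBasis; On; betti)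
  open GradedPoset P (suc m) graded
  open Chains F P (suc m) graded

  B𝟎 : B 𝟎 ≡ true
  B𝟎 = proj₁ boundary

  downB : ∀ {x y} → x ≼ y → B y ≡ true → B x ≡ true
  downB = proj₁ (proj₂ boundary) _ _

  full : Fin N → Bool
  full = fullSet P

  down-full : ∀ {x y} → x ≼ y → full y ≡ true → full x ≡ true
  down-full _ _ = refl

  B-rank : ∀ {y} → B y ≡ true → ρ y ≤ m
  B-rank {y} = go (≻-wf y)
    where
    go : ∀ {y} → Acc (flip _≺_) y → B y ≡ true → ρ y ≤ m
    go {y} (acc rs) by = decide (Finₚ.any? (λ z → (y ≺? z) ×-dec (B z Boolₚ.≟ true)))
      where
      decide : Dec (Σ (Fin N) λ z → y ≺ z × B z ≡ true) → ρ y ≤ m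
      decide (yes (z , l , bz)) = ℕₚ.≤-trans (ℕₚ.<⇒≤ (ρ-mono l)) (go (rs l) bz)
      decide (no none) = ℕₚ.≤-reflexive (proj₂ (proj₂ boundary) y by (λ z bz l → same z bz l (z Finₚ.≟ y)))
        where
        same : ∀ z → B z ≡ true → y ≼ z → Dec (z ≡ y) → z ≡ y
        same z bz l (yes e) = e
        same z bz l (no ne) = ⊥-elim (none (z , (l , λ e → ne (sym e)) , bz))

  basis-cong : ∀ {L L' : Complex N} {s b} → (∀ S → L S ≡ L' S) → HomologyBasis L s b → HomologyBasis L' s b
  basis-cong {L} {L'} {s} e H = record
    { g = g ; g-On = λ k → On-cong e (g-On k) ; g-cycle = g-cycle
    ; decomp = λ c on cyc → let r = decomp c (On-cong (λ S → sym (e S)) on) cyc in proj₁ r , proj₁ (proj₂ r) , On-cong e (proj₁ (proj₂ (proj₂ r))) , proj₂ (proj₂ (proj₂ r))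
    ; indep = λ a h on → indep a h (On-cong (λ S → sym (e S)) on) }
    where
    open HomologyBasis H
    On-cong : ∀ {L L' : Complex N} {s c} → (∀ S → L S ≡ L' S) → On L s c → On L' s c
    On-cong {s = s} eq on S q = on S (trans (cong (_∧ (card S ≡ᵇ s)) (eq S)) q)

  frame-basis : ∀ {Q W k} (f : Frame Q W k) s b → BettiIs (Link (OC Q) (Frame.x f)) s b → HomologyBasis (OC W) s b
  frame-basis {Q} {W} f s b h = basis-cong (frame-link f) (betti (Link (OC Q) (Frame.x f))
    (λ S u out e → trans (frame-link f S) (OC-down W S u out (trans (sym (frame-link f _)) e))) s b h)

  interval-basis : ∀ z y → z ≺ y → ∀ s → HomologyBasis (OC (between z y)) s (if s ≡ᵇ (ρ y ∸ suc (ρ z)) then 1 else 0)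
  interval-basis z y z≺y s = subst (λ b → HomologyBasis (OC (between z y)) s (if b then 1 else 0)) eq
      (frame-basis f s _ (proj₂ near (Frame.x f) (⇒OC {full} {Frame.x f} (Frame.chain f)) s))
    where
    fr = frame-between z y z≺y
    f = proj₁ fr
    v = proj₁ (proj₂ fr)
    interior : ∀ b → OC B (Frame.x f) ≡ b → b ≡ false
    interior false _ = refl
    interior true  e = ⊥-elim (ℕₚ.1+n≰n (subst (_≤ m) (proj₂ (proj₂ (proj₂ fr))) (B-rank (inside (OC⇒ {B} {Frame.x f} e) (proj₁ (proj₂ (proj₂ fr)))))))
    -- The frame consists of m + 2 - ρ y + ρ z elements, so the homology of its link sits in size ρ
    -- y - ρ z - 1, the number of ranks strictly between z and y.
    arith : suc m ∸ (suc (suc m) ∸ ρ y ℕ.+ ρ z) ≡ ρ y ∸ suc (ρ z)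
    arith = trans (sym (ℕₚ.∸-+-assoc (suc m) (suc (suc m) ∸ ρ y) (ρ z))) (trans (cong (_∸ ρ z) (lem (ρ y) (ρ≤n y) (ℕₚ.≤-<-trans z≤n (ρ-mono z≺y)))) (ℕₚ.∸-+-assoc (ρ y) 1 (ρ z)))
      where
      lem : ∀ r → r ≤ suc m → 0 < r → suc m ∸ (suc (suc m) ∸ r) ≡ r ∸ 1
      lem (suc r) (s≤s le) _ = trans (cong (suc m ∸_) (ℕₚ.+-∸-assoc 1 le)) (ℕₚ.m∸[m∸n]≡n le)
    eq : (s ≡ᵇ (suc m ∸ card (Frame.x f))) ∧ not (OC B (Frame.x f)) ≡ (s ≡ᵇ (ρ y ∸ suc (ρ z)))
    eq = trans (cong₂ (λ k b → (s ≡ᵇ (suc m ∸ k)) ∧ not b) (Frame.size f) (interior (OC B (Frame.x f)) refl)) (trans (Boolₚ.∧-identityʳ _) (cong (s ≡ᵇ_) arith))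

  open Incidences F P (suc m) graded interval-basis using (incidence-numbers)
  open Cellular F P (suc m) graded interval-basis incidence-numbers

  cells : CellStructures.CellStructure F P (suc m) graded
  cells = record { ε = ε ; supp = supp ; ε-nz = ε-nz ; rel = rel
    ; interval-exact = λ l r c on cyc → interval-exact l r c on cyc }

  open Sheaves F P (suc m) graded cells using ([≢0])

  -- A saturated chain up to z lies in ∂P exactly if z does, because z is its largest member and ∂P
  -- is down-closed; for z = 𝟎 the chain is empty and 𝟎 belongs to ∂P.
  upper-basis : ∀ z s → HomologyBasis (OC (upto full z)) s (if (s ≡ᵇ (suc m ∸ ρ z)) ∧ not (B z) then 1 else 0)
  upper-basis z s = subst (λ b → HomologyBasis (OC (upto full z)) s (if b then 1 else 0))
      (cong₂ (λ k b → (s ≡ᵇ (suc m ∸ k)) ∧ not b) (Frame.size f) (≡-true-iff in-B (λ bz → ⇒OC {B} {Frame.x f} (chain-sub (Frame.chain f) (λ i → i) (λ i → downB (proj₁ (proj₂ fr) i) bz)))))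
      (frame-basis f s _ (proj₂ near (Frame.x f) (⇒OC {full} {Frame.x f} (Frame.chain f)) s))
    where
    fr = frame-up full down-full z refl
    f = proj₁ fr
    in-B : OC B (Frame.x f) ≡ true → B z ≡ true
    in-B e = go (z Finₚ.≟ 𝟎)
      where
      go : Dec (z ≡ 𝟎) → B z ≡ true
      go (yes q) = subst (λ v → B v ≡ true) (sym q) B𝟎
      go (no ne) = inside (OC⇒ {B} {Frame.x f} e) (proj₂ (proj₂ fr) ne)

  boundary-basis : ∀ z → B z ≡ true → ∀ s → HomologyBasis (OC (upto B z)) s (if s ≡ᵇ (m ∸ ρ z) then 1 else 0)
  boundary-basis z bz s = subst (λ k → HomologyBasis (OC (upto B z)) s (if s ≡ᵇ (m ∸ k) then 1 else 0)) (Frame.size f)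
      (frame-basis f s _ (proj₁ near (Frame.x f) (⇒OC {B} {Frame.x f} (Frame.chain f)) s))
    where f = proj₁ (frame-up B downB z bz)

  no-cells : ∀ Q z r → (∀ u → z ≼ u → Q u ≡ true → ρ u ≢ r) → CellEx Q z r
  no-cells Q z r none c on cyc = (λ _ → 0#) , (λ u ne → ⊥-elim (ne refl)) ,
    λ v zv → trans (0-or (λ ne → let q = on v ne in none v (proj₁ q) (proj₁ (proj₂ q)) (proj₂ (proj₂ q)))) (sym (∑-0 (λ u → zeroʳ _)))

  cells-from : ∀ Q → (∀ {u v} → u ≼ v → Q v ≡ true → Q u ≡ true) → ∀ z r → (∀ j → ρ z ℕ.+ j ≡ r → Ex (upto Q z) j) → CellEx Q z r
  cells-from Q downQ z r ex = go (ρ z ≤? r)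
    where
    go : Dec (ρ z ≤ r) → CellEx Q z r
    go (no lt)  = no-cells Q z r (λ u zu _ e → lt (subst (ρ z ≤_) e (ρ-mono-≼ zu)))
    go (yes le) = subst (CellEx Q z) (ℕₚ.m+[n∸m]≡n le) (CellComplex.cell-exact Q downQ z (r ∸ ρ z) (ex (r ∸ ρ z) (ℕₚ.m+[n∸m]≡n le)))

  acyclic : ∀ {W s b} → b ≡ false → HomologyBasis (OC W) s (if b then 1 else 0) → Ex W s
  acyclic {W} {s} e H = basis⇒Ex (subst (λ b → HomologyBasis (OC W) s (if b then 1 else 0)) e H)

  not-top : ∀ {a j k r} → a ℕ.+ j ≡ r → r < k → (j ≡ᵇ (k ∸ a)) ≡ false
  not-top {a} {j} {k} refl lt = ≡ᵇ-false (λ e → ℕₚ.<-irrefl (trans (cong (a ℕ.+_) e) (ℕₚ.m+[n∸m]≡n (ℕₚ.≤-trans (ℕₚ.m≤m+n a j) (ℕₚ.<⇒≤ lt)))) lt)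

  -- Homology above z can occur only in rank m + 1. At a boundary element it does not occur at all,
  -- since the link there is acyclic.
  exact-full : ∀ z r → r ≤ m ⊎ B z ≡ true → CellEx full z r
  exact-full z r h = cells-from full down-full z r (λ j e → acyclic (go j e h) (upper-basis z j))
    where
    go : ∀ j → ρ z ℕ.+ j ≡ r → r ≤ m ⊎ B z ≡ true → (j ≡ᵇ (suc m ∸ ρ z)) ∧ not (B z) ≡ false
    go j e (inj₁ le) = cong (_∧ not (B z)) (not-top {ρ z} {j} e (s≤s le))
    go j e (inj₂ bz) = trans (cong (λ b → (j ≡ᵇ (suc m ∸ ρ z)) ∧ not b) bz) (Boolₚ.∧-zeroʳ _)

  exact-B : ∀ z r → r < m → CellEx B z r
  exact-B z r lt = go (B z) refl
    where
    go : ∀ b → B z ≡ b → CellEx B z r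
    go true  bz = cells-from B downB z r (λ j e → acyclic (not-top {ρ z} {j} e lt) (boundary-basis z bz j))
    go false nb = no-cells B z r (λ u zu bu _ → true≢false (trans (sym (downB zu bu)) nb))

  line-at : ∀ Q → (∀ {u v} → u ≼ v → Q v ≡ true → Q u ≡ true) → ∀ z k → (∀ v → Q v ≡ true → ρ v ≤ k) → Q z ≡ true → HomologyBasis (OC (upto Q z)) (k ∸ ρ z) 1 → CellLine Q z k
  line-at Q downQ z k ranks qz H = subst (CellLine Q z) e (CellComplex.cell-line Q downQ z (k ∸ ρ z)
      (basis⇒Line (λ S ch c → ℕₚ.1+n≰n (subst (_≤ k ∸ ρ z) c (chain-size ch (ρ z) (k ∸ ρ z) (λ i → let q = upto⇒ {Q} {z} (inside ch i) in ρ-mono (proj₂ q) , subst (_ ≤_) (sym e) (ranks _ (proj₁ q)))))) H)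
      (λ v qv _ → subst (ρ v ≤_) (sym e) (ranks v qv)) qz)
    where
    e : ρ z ℕ.+ (k ∸ ρ z) ≡ k
    e = ℕₚ.m+[n∸m]≡n (ranks z qz)

  line-full : ∀ z → B z ≡ false → CellLine full z (suc m)
  line-full z nb = line-at full down-full z (suc m) (λ v _ → ρ≤n v) refl
    (subst (λ b → HomologyBasis (OC (upto full z)) (suc m ∸ ρ z) (if b then 1 else 0)) (cong₂ (λ a b → a ∧ not b) (≡ᵇ-refl (suc m ∸ ρ z)) nb) (upper-basis z (suc m ∸ ρ z)))

  line-B : ∀ z → B z ≡ true → CellLine B z m
  line-B z bz = line-at B downB z m (λ v → B-rank) bz
    (subst (λ b → HomologyBasis (OC (upto B z)) (m ∸ ρ z) (if b then 1 else 0)) (≡ᵇ-refl (m ∸ ρ z)) (boundary-basis z bz (m ∸ ρ z)))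

  interiorᵇ : Fin N → Bool
  interiorᵇ x = not (B x)

  up-interior : ∀ {x y} → x ≼ y → interiorᵇ x ≡ true → interiorᵇ y ≡ true
  up-interior {x} {y} xy nx = cong not (outside (B y) refl)
    where
    outside : ∀ b → B y ≡ b → b ≡ false
    outside false _ = refl
    outside true  e = ⊥-elim (true≢false (trans (sym (downB xy e)) (not-true nx)))

  module FullSheaf = ConstantSheaf F P (suc m) graded cells full (λ _ _ _ _ → refl)
  module BoundarySheaf = ConstantSheaf F P (suc m) graded cells B (λ _ yz _ bz → downB yz bz)
  module InteriorSheaf = ConstantSheaf F P (suc m) graded cells interiorᵇ (λ xy _ nx _ → up-interior xy nx)
  module PrincipalSheaf (z : Fin N) = ConstantSheaf F P (suc m) graded cells (upper z) (λ _ yz _ qz → ≼-trans yz qz)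

  ∂-supp : ∀ c v → ∂ c v ≢ 0# → Σ (Fin N) λ u → v ⋖ u × c u ≢ 0#
  ∂-supp c v ne = let q = ∑≢0 _ ne in proj₁ q , supp (proj₁ (*≢0 (proj₂ q))) , proj₂ (*≢0 (proj₂ q))

  ⋖⇒≼ : ∀ {v u} → v ⋖ u → v ≼ u
  ⋖⇒≼ l = proj₁ (proj₁ l)

  rel-full : ∀ x r → CellEx full x r → FullSheaf.RelEx x r
  rel-full x r ex c on cyc = let s = ex c on (λ v xv → cyc v xv refl) in proj₁ s , (λ _ _ → refl) , λ v xv _ → proj₂ (proj₂ s) v xv

  rel-principal : ∀ z x r → CellEx (upper z) x r → PrincipalSheaf.RelEx z x r
  rel-principal z x r ex c on cyc = let s = ex c on (λ v xv → 0-or λ ne → ne (cyc v xv (let q = ∂-supp c v ne in ≼-trans (⋖⇒≼ (proj₁ (proj₂ q))) (proj₁ (proj₂ (on (proj₁ q) (proj₂ (proj₂ q)))))))) in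
    proj₁ s , (λ u ne → proj₁ (proj₂ (proj₁ (proj₂ s) u ne))) , λ v xv _ → proj₂ (proj₂ s) v xv

  rel-B : ∀ x r → CellEx B x r → BoundarySheaf.RelEx x r
  rel-B x r ex c on cyc = let s = ex c on (λ v xv → 0-or λ ne → ne (cyc v xv (let q = ∂-supp c v ne in downB (⋖⇒≼ (proj₁ (proj₂ q))) (proj₁ (proj₂ (on (proj₁ q) (proj₂ (proj₂ q)))))))) in
    proj₁ s , (λ u ne → proj₁ (proj₂ (proj₁ (proj₂ s) u ne))) , λ v xv _ → proj₂ (proj₂ s) v xv

  ∂∂ : ∀ c v → ∂ (∂ c) v ≡ 0#
  ∂∂ c v = trans (sym (·-assoc ε ε c v)) (∙-0ˡ {B = λ t (_ : Fin 1) → c t} rel v zero)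

  ∂-sub : ∀ a b v → ∂ (λ u → a u - b u) v ≡ ∂ a v - ∂ b v
  ∂-sub a b v = trans (∑-cong (λ u → solve 3 (λ e a b → e :* (a :- b) := e :* a :- e :* b) refl (ε v u) (a u) (b u))) (∑-sub _ _)

  -- A relative cycle of (P, ∂P) is completed to a cycle of P by a chain in ∂P that bounds its boundary.
  rel-interior : ∀ x r → r ≤ m → InteriorSheaf.RelEx x r
  rel-interior x r le c on cyc = a' , a'-on , eq
    where
    e : Fin N → K
    e v = [ x ≤ᵇ v ] * ∂ c v
    e-val : ∀ v → x ≼ v → e v ≡ ∂ c v
    e-val v xv = trans (cong (λ b → [ b ] * ∂ c v) xv) (*-identityˡ _)
    e-on : ∀ v → e v ≢ 0# → x ≼ v × B v ≡ true × suc (ρ v) ≡ r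
    e-on v ne = [≢0] (proj₁ (*≢0 ne)) , in-B (B v) refl , trans (sym (cover-rank (proj₁ (proj₂ q)))) (proj₂ (proj₂ (on (proj₁ q) (proj₂ (proj₂ q)))))
      where
      q = ∂-supp c v (proj₂ (*≢0 ne))
      in-B : ∀ b → B v ≡ b → b ≡ true
      in-B true  _  = refl
      in-B false nb = ⊥-elim (proj₂ (*≢0 ne) (cyc v ([≢0] (proj₁ (*≢0 ne))) (cong not nb)))
    e-cycle : ∀ v → x ≼ v → ∂ e v ≡ 0#
    e-cycle v xv = trans (∑-cong (λ u → *-on (λ ne → e-val u (≼-trans xv (⋖⇒≼ (supp ne)))))) (∂∂ c v)
    Fill = Σ (Fin N → K) λ b → (∀ u → b u ≢ 0# → x ≼ u × B u ≡ true × ρ u ≡ r) × (∀ v → x ≼ v → e v ≡ ∂ b v)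
    fill : ∀ k → r ≡ k → Fill
    -- A chain in rank 0 has zero boundary, and there is nothing to fill. Otherwise the boundary
    -- lies in rank r - 1 < m, where ∂P is exact.
    fill zero    refl = (λ _ → 0#) , (λ u ne → ⊥-elim (ne refl)) , λ v xv → trans (0-or (λ ne → ℕₚ.1+n≢0 (proj₂ (proj₂ (e-on v ne))))) (sym (∑-0 (λ u → zeroʳ _)))
    fill (suc k) refl = exact-B x k le e (λ v ne → let q = e-on v ne in proj₁ q , proj₁ (proj₂ q) , ℕₚ.suc-injective (proj₂ (proj₂ q))) e-cycle
    b = proj₁ (fill r refl)
    b-on : ∀ u → b u ≢ 0# → x ≼ u × B u ≡ true × ρ u ≡ r
    b-on = proj₁ (proj₂ (fill r refl))
    b-eq : ∀ v → x ≼ v → e v ≡ ∂ b v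
    b-eq = proj₂ (proj₂ (fill r refl))
    d : Fin N → K
    d u = c u - b u
    d-on : ∀ u → d u ≢ 0# → x ≼ u × full u ≡ true × ρ u ≡ r
    d-on u ne = go (c u ≟K 0#)
      where
      go : Dec (c u ≡ 0#) → x ≼ u × full u ≡ true × ρ u ≡ r
      go (no nc) = let q = on u nc in proj₁ q , refl , proj₂ (proj₂ q)
      go (yes z) = let q = b-on u (λ z' → ne (trans (cong₂ _-_ z z') (x-x 0#))) in proj₁ q , refl , proj₂ (proj₂ q)
    sol = exact-full x r (inj₁ le) d d-on (λ v xv → trans (∂-sub c b v) (trans (cong (λ z → ∂ c v - z) (trans (sym (b-eq v xv)) (e-val v xv))) (x-x _)))
    a a' : Fin N → K
    a = proj₁ sol
    a' u = [ interiorᵇ u ] * a u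
    a'-on : ∀ u → a' u ≢ 0# → interiorᵇ u ≡ true
    a'-on u ne = [≢0] (proj₁ (*≢0 ne))
    eq : ∀ v → x ≼ v → interiorᵇ v ≡ true → c v ≡ ∂ a' v
    eq v xv nv = trans (sym (trans (cong (λ z → c v - z) (0-or (λ ne → true≢false (trans (sym (proj₁ (proj₂ (b-on v ne)))) (not-true nv))))) (trans (cong (c v +_) neg-0) (+-identityʳ _))))
        (trans (proj₂ (proj₂ sol) v xv) (∑-cong (λ u → *-on (λ ne → sym (trans (cong (λ b → [ b ] * a u) (up-interior (⋖⇒≼ (supp ne)) nv)) (*-identityˡ _))))))

  open Omega ring P

  boundary-CM : Sheaves.Sheaf.CM BoundarySheaf.constant m
  boundary-CM = BoundarySheaf.constant-CM m (λ x r lt → rel-B x r (exact-B x r lt))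

  interior-CM : Sheaves.Sheaf.CM InteriorSheaf.constant (suc m)
  interior-CM = InteriorSheaf.constant-CM (suc m) (λ x r lt → rel-interior x r (ℕ.s≤s⁻¹ lt))

  -- ∂P is sphere-like: above a member of ∂P the top cycles form a line, and above any other element
  -- there are no cells of ∂P.
  ω-B : ∀ x → ω m (λ y → fromℕ ⟦ B y ⟧) x ≡ [ B x ]
  ω-B x = go (B x) refl
    where
    go : ∀ b → B x ≡ b → ω m (λ y → fromℕ ⟦ B y ⟧) x ≡ [ b ]
    go true  bx = let l = line-B x bx in BoundarySheaf.ω-constant-line downB x m (λ i lt → rel-B x i (exact-B x i lt)) (proj₁ l) (proj₁ (proj₂ l)) (proj₁ (proj₂ (proj₂ l))) (proj₁ (proj₂ (proj₂ (proj₂ l)))) (proj₂ (proj₂ (proj₂ (proj₂ l))))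
    go false nb = BoundarySheaf.ω-constant-exact x m (λ i _ → rel-B x i (no-cells B x i (λ u xu bu _ → true≢false (trans (sym (downB xu bu)) nb)))) (λ y by e → ℕₚ.1+n≰n (subst (_≤ m) e (B-rank by)))

  -- P is ball-like: above an interior element the top cycles form a line, while above a boundary
  -- element the complex is exact in all ranks and the alternating sum vanishes.
  ω-full : ∀ x → ω (suc m) (λ y → fromℕ ⟦ full y ⟧) x ≡ [ interiorᵇ x ]
  ω-full x = go (B x) refl
    where
    go : ∀ b → B x ≡ b → ω (suc m) (λ y → fromℕ ⟦ full y ⟧) x ≡ [ not b ]
    go true  bx = FullSheaf.ω-constant-exact x (suc m) (λ i _ → rel-full x i (exact-full x i (inj₂ bx))) (λ y _ e → ℕₚ.1+n≰n (subst (_≤ suc m) e (ρ≤n y)))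
    go false nb = let l = line-full x nb in FullSheaf.ω-constant-line down-full x (suc m) (λ i lt → rel-full x i (exact-full x i (inj₁ (ℕ.s≤s⁻¹ lt)))) (proj₁ l) (proj₁ (proj₂ l)) (proj₁ (proj₂ (proj₂ l))) (proj₁ (proj₂ (proj₂ (proj₂ l)))) (proj₂ (proj₂ (proj₂ (proj₂ l))))

  -- The Euler relation of the closed interval, read off from the exactness of its cellular complex
  -- with constant coefficients.
  ω-interval : ∀ x z → x ≺ z → ω (ρ z) (λ y → fromℕ ⟦ upper z y ⟧) x ≡ 0#
  ω-interval x z l = PrincipalSheaf.ω-constant-exact z x (ρ z) (λ i _ → rel-principal z x i (interval-exact l i)) (λ y yz e → ℕₚ.1+n≰n (subst (_≤ ρ z) e (ρ-mono-≼ yz)))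

-- Comparison of integer and field-valued rank sums

module Transfer (F : OrderedField) {N : ℕ} (P : PosetData N) where
  open OrderedField F
  open Sums ring
  open PosetData P
  private
    module ℤS = Sums ℤring
    module ℤΩ = Omega ℤring P
  open Omega ring P

  fromℤ-∑ : ∀ {n} (f : Fin n → ℤ) → fromℤ (ℤS.∑ f) ≡ ∑ (λ i → fromℤ (f i))
  fromℤ-∑ {zero}  f = trans (cong fromℤ (ℤS.∑Fin-zero f)) (trans 0-homo (sym (∑Fin-zero _)))
  fromℤ-∑ {suc n} f = trans (cong fromℤ (ℤS.∑Fin-suc f)) (trans (+-homo (f zero) (ℤS.∑ (λ i → f (suc i)))) (trans (cong (fromℤ (f zero) +_) (fromℤ-∑ (λ i → f (suc i)))) (sym (∑Fin-suc (λ i → fromℤ (f i))))))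

  fromℤ-[] : ∀ b → fromℤ ℤS.[ b ] ≡ [ b ]
  fromℤ-[] true  = 1-homo
  fromℤ-[] false = 0-homo

  fromℤ-sub : ∀ i j → fromℤ (i ℤ.- j) ≡ fromℤ i - fromℤ j
  fromℤ-sub i j = trans (+-homo i (ℤ.- j)) (cong (fromℤ i +_) (-‿homo j))

  fromℤ-rankSum : ∀ j {φ ψ} → (∀ y → ρ y ≡ j → fromℤ (φ y) ≡ ψ y) → ∀ x → fromℤ (ℤΩ.rankSum j φ x) ≡ rankSum j ψ x
  fromℤ-rankSum j {φ} {ψ} e x = trans (fromℤ-∑ _) (∑-cong (λ y → trans (*-homo ℤS.[ (x ≤ᵇ y) ∧ (ρ y ≡ᵇ j) ] (φ y)) (trans (cong (_* fromℤ (φ y)) (fromℤ-[] ((x ≤ᵇ y) ∧ (ρ y ≡ᵇ j)))) (go y (ρ y ≡ᵇ j) refl))))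
    where
    go : ∀ y b → (ρ y ≡ᵇ j) ≡ b → [ (x ≤ᵇ y) ∧ b ] * fromℤ (φ y) ≡ [ (x ≤ᵇ y) ∧ b ] * ψ y
    go y true  q = cong ([ (x ≤ᵇ y) ∧ true ] *_) (e y (≡ᵇ⇒≡ (ρ y) j q))
    go y false q = trans (cong (λ b → [ b ] * fromℤ (φ y)) (Boolₚ.∧-zeroʳ (x ≤ᵇ y))) (trans (zeroˡ _) (sym (trans (cong (λ b → [ b ] * ψ y) (Boolₚ.∧-zeroʳ (x ≤ᵇ y))) (zeroˡ _))))

  fromℤ-ω : ∀ j {φ ψ} → (∀ y → ρ y ≤ j → fromℤ (φ y) ≡ ψ y) → ∀ x → fromℤ (ℤΩ.ω j φ x) ≡ ω j ψ x
  fromℤ-ω zero    e x = fromℤ-rankSum zero (λ y q → e y (ℕₚ.≤-reflexive q)) x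
  fromℤ-ω (suc j) {φ} e x = trans (fromℤ-sub (ℤΩ.rankSum (suc j) φ x) (ℤΩ.ω j φ x)) (cong₂ _-_ (fromℤ-rankSum (suc j) (λ y q → e y (ℕₚ.≤-reflexive q)) x) (fromℤ-ω j (λ y le → e y (ℕₚ.m≤n⇒m≤1+n le)) x))

-- Coefficients of ab- and cd-words

open import Data.Integer using (_+_; _*_; -_; _-_)
open import Data.Integer.Tactic.RingSolver using (solve-∀)

coeff-++ : ∀ p q w → coeffAB (p ++ q) w ≡ coeffAB p w + coeffAB q w
coeff-++ []            q w = sym (ℤₚ.+-identityˡ _)
coeff-++ ((c , v) ∷ p) q w = trans (cong ((if eqWord eqAB v w then c else 0ℤ) +_) (coeff-++ p q w)) (sym (ℤₚ.+-assoc (if eqWord eqAB v w then c else 0ℤ) _ _))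

coeff-⊖ : ∀ p w → coeffAB (⊖ p) w ≡ - coeffAB p w
coeff-⊖ []            w = refl
coeff-⊖ ((c , v) ∷ p) w = trans (cong₂ _+_ (neg-if (eqWord eqAB v w)) (coeff-⊖ p w)) (sym (ℤₚ.neg-distrib-+ (if eqWord eqAB v w then c else 0ℤ) _))
  where
  neg-if : ∀ b → (if b then - c else 0ℤ) ≡ - (if b then c else 0ℤ)
  neg-if true  = refl
  neg-if false = refl

rest : List AB → List AB → Maybe (List AB)
rest []      w       = just w
rest (x ∷ v) []      = nothing
rest (x ∷ v) (y ∷ w) = if eqAB x y then rest v w else nothing

coeffM : ABPoly → Maybe (List AB) → ℤ
coeffM q (just w) = coeffAB q w
coeffM q nothing  = 0ℤ

private
  eqM : List AB → Maybe (List AB) → Bool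
  eqM u (just w) = eqWord eqAB u w
  eqM u nothing  = false

  eqWord-++ : ∀ v u w → eqWord eqAB (v ++ u) w ≡ eqM u (rest v w)
  eqWord-++ []      u w       = refl
  eqWord-++ (x ∷ v) u []      = refl
  eqWord-++ (x ∷ v) u (y ∷ w) with eqAB x y
  ... | true  = eqWord-++ v u w
  ... | false = refl

coeff-single : ∀ c v q w → coeffAB (((c , v) ∷ []) ⊗ q) w ≡ c * coeffM q (rest v w)
coeff-single c v [] w = sym (trans (cong (c *_) (nil (rest v w))) (ℤₚ.*-zeroʳ c))
  where
  nil : ∀ m → coeffM [] m ≡ 0ℤ
  nil (just _) = refl
  nil nothing  = refl
coeff-single c v ((c' , u) ∷ q) w = trans (cong₂ _+_ (cong (λ b → if b then c * c' else 0ℤ) (eqWord-++ v u w)) (coeff-single c v q w)) (go (rest v w))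
  where
  go : ∀ m → (if eqM u m then c * c' else 0ℤ) + c * coeffM q m ≡ c * coeffM ((c' , u) ∷ q) m
  go nothing  = ℤₚ.+-identityˡ _
  go (just w) with eqWord eqAB u w
  ... | true  = sym (ℤₚ.*-distribˡ-+ c c' _)
  ... | false = trans (ℤₚ.+-identityˡ _) (cong (c *_) (sym (ℤₚ.+-identityˡ _)))

⊗-∷ : ∀ x p q → (x ∷ p) ⊗ q ≡ ((x ∷ []) ⊗ q) ++ (p ⊗ q)
⊗-∷ (c , v) p q = cong (_++ (p ⊗ q)) (sym (Listₚ.++-identityʳ _))

coeff-∷⊗ : ∀ c v p q w → coeffAB (((c , v) ∷ p) ⊗ q) w ≡ c * coeffM q (rest v w) + coeffAB (p ⊗ q) w
coeff-∷⊗ c v p q w = trans (cong (λ r → coeffAB r w) (⊗-∷ (c , v) p q)) (trans (coeff-++ (((c , v) ∷ []) ⊗ q) (p ⊗ q) w) (cong (_+ coeffAB (p ⊗ q) w) (coeff-single c v q w)))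

-- The coefficient of a letter in a single factor of a weight: b at a rank that the chain meets, a -
-- b at a rank that it misses.
kap : Bool → AB → ℤ
kap true  𝐚 = 0ℤ
kap true  𝐛 = 1ℤ
kap false 𝐚 = 1ℤ
kap false 𝐛 = -1ℤ

letterPoly : Bool → ABPoly
letterPoly b = if b then bPoly else a-b

coeff-letter : ∀ b q l w → coeffAB (letterPoly b ⊗ q) (l ∷ w) ≡ kap b l * coeffAB q w
coeff-letter true q 𝐚 w = trans (coeff-∷⊗ 1ℤ (𝐛 ∷ []) [] q (𝐚 ∷ w)) refl
coeff-letter true q 𝐛 w = trans (coeff-∷⊗ 1ℤ (𝐛 ∷ []) [] q (𝐛 ∷ w)) (ℤₚ.+-identityʳ _)
coeff-letter false q 𝐚 w = trans (coeff-∷⊗ 1ℤ (𝐚 ∷ []) ((-1ℤ , 𝐛 ∷ []) ∷ []) q (𝐚 ∷ w)) (trans (cong (1ℤ * coeffAB q w +_) (coeff-∷⊗ -1ℤ (𝐛 ∷ []) [] q (𝐚 ∷ w))) (ℤₚ.+-identityʳ _))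
coeff-letter false q 𝐛 w = trans (coeff-∷⊗ 1ℤ (𝐚 ∷ []) ((-1ℤ , 𝐛 ∷ []) ∷ []) q (𝐛 ∷ w)) (trans (ℤₚ.+-identityˡ _) (trans (coeff-∷⊗ -1ℤ (𝐛 ∷ []) [] q (𝐛 ∷ w)) (ℤₚ.+-identityʳ _)))

coeff-letter-[] : ∀ b q → coeffAB (letterPoly b ⊗ q) [] ≡ 0ℤ
coeff-letter-[] true  q = coeff-∷⊗ 1ℤ (𝐛 ∷ []) [] q []
coeff-letter-[] false q = trans (coeff-∷⊗ 1ℤ (𝐚 ∷ []) ((-1ℤ , 𝐛 ∷ []) ∷ []) q []) (trans (ℤₚ.+-identityˡ _) (coeff-∷⊗ -1ℤ (𝐛 ∷ []) [] q []))

private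
  -- The product loop inside prodPos, recovered by unification.
  mutual
    loop : (ℕ → ABPoly) → ℕ → ℕ → ABPoly
    loop = _

    prodPos-loop : ∀ m g i → 1 ≡ i → prodPos m g ≡ loop g i m
    prodPos-loop m g i e rewrite e = refl

  loop-suc : ∀ g i k → loop g i (suc k) ≡ g i ⊗ loop g (suc i) k
  loop-suc g i k = refl

  cl : (ℕ → Bool) → ℕ → ℕ → List AB → ℤ
  cl r i zero    []      = 1ℤ
  cl r i zero    (_ ∷ _) = 0ℤ
  cl r i (suc k) []      = 0ℤ
  cl r i (suc k) (l ∷ w) = kap (r i) l * cl r (suc i) k w

  coeff-loop : ∀ r i k w → coeffAB (loop (λ j → letterPoly (r j)) i k) w ≡ cl r i k w
  coeff-loop r i zero    []      = refl
  coeff-loop r i zero    (l ∷ w) = refl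
  coeff-loop r i (suc k) []      = trans (cong (λ p → coeffAB p []) (loop-suc (λ j → letterPoly (r j)) i k)) (coeff-letter-[] (r i) _)
  coeff-loop r i (suc k) (l ∷ w) = trans (cong (λ p → coeffAB p (l ∷ w)) (loop-suc (λ j → letterPoly (r j)) i k)) (trans (coeff-letter (r i) _ l w) (cong (kap (r i) l *_) (coeff-loop r (suc i) k w)))

  cl-0-snoc : ∀ r i w l → cl r i 0 (w ++ l ∷ []) ≡ 0ℤ
  cl-0-snoc r i []      l = refl
  cl-0-snoc r i (_ ∷ _) l = refl

  cl-snoc : ∀ r i k w l → cl r i (suc k) (w ++ l ∷ []) ≡ kap (r (i ℕ.+ k)) l * cl r i k w
  cl-snoc r i zero    []      l = cong (λ j → kap (r j) l * 1ℤ) (sym (ℕₚ.+-identityʳ i))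
  cl-snoc r i zero    (x ∷ w) l = trans (cong (kap (r i) x *_) (cl-0-snoc r (suc i) w l)) (trans (ℤₚ.*-zeroʳ (kap (r i) x)) (sym (ℤₚ.*-zeroʳ (kap (r (i ℕ.+ 0)) l))))
  cl-snoc r i (suc k) []      l = trans (ℤₚ.*-zeroʳ (kap (r i) l)) (sym (ℤₚ.*-zeroʳ (kap (r (i ℕ.+ suc k)) l)))
  cl-snoc r i (suc k) (x ∷ w) l = trans (cong (kap (r i) x *_) (trans (cl-snoc r (suc i) k w l) (cong (λ j → kap (r j) l * cl r (suc i) k w) (sym (ℕₚ.+-suc i k))))) (comm (kap (r i) x) (kap (r (i ℕ.+ suc k)) l) _)
    where
    comm : ∀ a b c → a * (b * c) ≡ b * (a * c)
    comm = solve-∀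

-- The coefficient, at the word u read from right to left, of a product of m factors b or a − b.
kr : (ℕ → Bool) → ℕ → List AB → ℤ
kr r zero    []      = 1ℤ
kr r zero    (_ ∷ _) = 0ℤ
kr r (suc m) []      = 0ℤ
kr r (suc m) (l ∷ u) = kap (r (suc m)) l * kr r m u

-- The flag recursion removes the top rank, which is the last letter of a word, whereas lists are
-- taken apart at the front. Words are therefore reversed here once, and all later recursions see
-- the top rank first.
coeff-prodPos : ∀ r m u → coeffAB (prodPos m (λ j → letterPoly (r j))) (reverse u) ≡ kr r m u
coeff-prodPos r m u = trans (cong (λ p → coeffAB p (reverse u)) (prodPos-loop m (λ j → letterPoly (r j)) 1 refl)) (trans (coeff-loop r 1 m (reverse u)) (go m u))
  where
  go : ∀ m u → cl r 1 m (reverse u) ≡ kr r m u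
  go zero    []      = refl
  go zero    (l ∷ u) = trans (cong (cl r 1 0) (Listₚ.unfold-reverse l u)) (cl-0-snoc r 1 (reverse u) l)
  go (suc m) []      = refl
  go (suc m) (l ∷ u) = trans (cong (cl r 1 (suc m)) (Listₚ.unfold-reverse l u)) (trans (cl-snoc r 1 m (reverse u) l) (cong (kap (r (suc m)) l *_) (go m u)))

private
  eqWord-snoc : ∀ v w x y → eqWord eqAB (v ++ x ∷ []) (w ++ y ∷ []) ≡ eqWord eqAB v w ∧ eqAB x y
  eqWord-snoc []      []           x y = Boolₚ.∧-identityʳ _
  eqWord-snoc []      (_ ∷ [])     x y = Boolₚ.∧-zeroʳ _
  eqWord-snoc []      (_ ∷ _ ∷ _)  x y = Boolₚ.∧-zeroʳ _
  eqWord-snoc (_ ∷ [])    []       x y = Boolₚ.∧-zeroʳ _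
  eqWord-snoc (_ ∷ _ ∷ _) []       x y = Boolₚ.∧-zeroʳ _
  eqWord-snoc (a ∷ v) (b ∷ w)      x y = trans (cong (eqAB a b ∧_) (eqWord-snoc v w x y)) (sym (Boolₚ.∧-assoc (eqAB a b) _ _))

  eqWord-snoc-[] : ∀ v x → eqWord eqAB (v ++ x ∷ []) [] ≡ false
  eqWord-snoc-[] []      x = refl
  eqWord-snoc-[] (_ ∷ _) x = refl

coeff-⊗a : ∀ p w l → coeffAB (p ⊗ aPoly) (w ++ l ∷ []) ≡ (if eqAB 𝐚 l then coeffAB p w else 0ℤ)
coeff-⊗a [] w 𝐚 = refl
coeff-⊗a [] w 𝐛 = refl
coeff-⊗a ((c , v) ∷ p) w l = trans (cong₂ _+_ (cong (λ b → if b then c * 1ℤ else 0ℤ) (eqWord-snoc v w 𝐚 l)) (coeff-⊗a p w l)) (go l)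
  where
  go : ∀ l → (if eqWord eqAB v w ∧ eqAB 𝐚 l then c * 1ℤ else 0ℤ) + (if eqAB 𝐚 l then coeffAB p w else 0ℤ) ≡ (if eqAB 𝐚 l then coeffAB ((c , v) ∷ p) w else 0ℤ)
  go 𝐚 = cong (_+ coeffAB p w) (trans (cong (λ b → if b then c * 1ℤ else 0ℤ) (Boolₚ.∧-identityʳ (eqWord eqAB v w))) (cong (λ z → if eqWord eqAB v w then z else 0ℤ) (ℤₚ.*-identityʳ c)))
  go 𝐛 = cong (_+ 0ℤ) (cong (λ b → if b then c * 1ℤ else 0ℤ) (Boolₚ.∧-zeroʳ (eqWord eqAB v w)))

coeff-⊗a-[] : ∀ p → coeffAB (p ⊗ aPoly) [] ≡ 0ℤ
coeff-⊗a-[] []            = refl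
coeff-⊗a-[] ((c , v) ∷ p) = trans (cong₂ _+_ (cong (λ b → if b then c * 1ℤ else 0ℤ) (eqWord-snoc-[] v 𝐚)) (coeff-⊗a-[] p)) refl

-- The coefficient of an ab-word in the expansion of a cd-word.
X : List CD → List AB → ℤ
X []      []              = 1ℤ
X []      (_ ∷ _)         = 0ℤ
X (𝐜 ∷ v) []              = 0ℤ
X (𝐜 ∷ v) (_ ∷ w)         = X v w
X (𝐝 ∷ v) []              = 0ℤ
X (𝐝 ∷ v) (_ ∷ [])        = 0ℤ
X (𝐝 ∷ v) (𝐚 ∷ 𝐚 ∷ w)     = 0ℤ
X (𝐝 ∷ v) (𝐚 ∷ 𝐛 ∷ w)     = X v w
X (𝐝 ∷ v) (𝐛 ∷ 𝐚 ∷ w)     = X v w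
X (𝐝 ∷ v) (𝐛 ∷ 𝐛 ∷ w)     = 0ℤ

private
  coeff-c⊗ : ∀ q w → coeffAB (cPoly ⊗ q) w ≡ 1ℤ * coeffM q (rest (𝐚 ∷ []) w) + (1ℤ * coeffM q (rest (𝐛 ∷ []) w) + 0ℤ)
  coeff-c⊗ q w = trans (coeff-∷⊗ 1ℤ (𝐚 ∷ []) ((1ℤ , 𝐛 ∷ []) ∷ []) q w) (cong (1ℤ * coeffM q (rest (𝐚 ∷ []) w) +_) (coeff-∷⊗ 1ℤ (𝐛 ∷ []) [] q w))

  coeff-d⊗ : ∀ q w → coeffAB (dPoly ⊗ q) w ≡ 1ℤ * coeffM q (rest (𝐚 ∷ 𝐛 ∷ []) w) + (1ℤ * coeffM q (rest (𝐛 ∷ 𝐚 ∷ []) w) + 0ℤ)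
  coeff-d⊗ q w = trans (coeff-∷⊗ 1ℤ (𝐚 ∷ 𝐛 ∷ []) ((1ℤ , 𝐛 ∷ 𝐚 ∷ []) ∷ []) q w) (cong (1ℤ * coeffM q (rest (𝐚 ∷ 𝐛 ∷ []) w) +_) (coeff-∷⊗ 1ℤ (𝐛 ∷ 𝐚 ∷ []) [] q w))

  keep-first : ∀ z → 1ℤ * z + (1ℤ * 0ℤ + 0ℤ) ≡ z
  keep-first = solve-∀

  keep-second : ∀ z → 1ℤ * 0ℤ + (1ℤ * z + 0ℤ) ≡ z
  keep-second = solve-∀

  coeff-word : (st : CD → ABPoly → ABPoly) → (∀ q → st 𝐜 q ≡ cPoly ⊗ q) → (∀ q → st 𝐝 q ≡ dPoly ⊗ q) → ∀ v w → coeffAB (foldr st onePoly v) w ≡ X v w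
  coeff-word st lc ld [] []      = refl
  coeff-word st lc ld [] (_ ∷ _) = refl
  coeff-word st lc ld (𝐜 ∷ v) w = trans (cong (λ p → coeffAB p w) (lc (foldr st onePoly v))) (trans (coeff-c⊗ (foldr st onePoly v) w) (go w))
    where
    go : ∀ w → 1ℤ * coeffM (foldr st onePoly v) (rest (𝐚 ∷ []) w) + (1ℤ * coeffM (foldr st onePoly v) (rest (𝐛 ∷ []) w) + 0ℤ) ≡ X (𝐜 ∷ v) w
    go []      = refl
    go (𝐚 ∷ w) = trans (keep-first _) (coeff-word st lc ld v w)
    go (𝐛 ∷ w) = trans (keep-second _) (coeff-word st lc ld v w)
  coeff-word st lc ld (𝐝 ∷ v) w = trans (cong (λ p → coeffAB p w) (ld (foldr st onePoly v))) (trans (coeff-d⊗ (foldr st onePoly v) w) (go w))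
    where
    go : ∀ w → 1ℤ * coeffM (foldr st onePoly v) (rest (𝐚 ∷ 𝐛 ∷ []) w) + (1ℤ * coeffM (foldr st onePoly v) (rest (𝐛 ∷ 𝐚 ∷ []) w) + 0ℤ) ≡ X (𝐝 ∷ v) w
    go []          = refl
    go (𝐚 ∷ [])    = refl
    go (𝐛 ∷ [])    = refl
    go (𝐚 ∷ 𝐚 ∷ w) = refl
    go (𝐚 ∷ 𝐛 ∷ w) = trans (keep-first _) (coeff-word st lc ld v w)
    go (𝐛 ∷ 𝐚 ∷ w) = trans (keep-second _) (coeff-word st lc ld v w)
    go (𝐛 ∷ 𝐛 ∷ w) = refl

  coeff-scaled : (st : CD → ABPoly → ABPoly) → (∀ q → st 𝐜 q ≡ cPoly ⊗ q) → (∀ q → st 𝐝 q ≡ dPoly ⊗ q) → ∀ k v w → coeffAB (((k , []) ∷ []) ⊗ foldr st onePoly v) w ≡ k * X v w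
  coeff-scaled st lc ld k v w = trans (coeff-single k [] (foldr st onePoly v) w) (cong (k *_) (coeff-word st lc ld v w))

evalCD : CDPoly → List AB → ℤ
evalCD []            w = 0ℤ
evalCD ((k , v) ∷ f) w = k * X v w + evalCD f w

private
  coeff-concatMap : (G : ℤ × List CD → ABPoly) → (∀ k v w → coeffAB (G (k , v)) w ≡ k * X v w) → ∀ f w → coeffAB (concatMap G f) w ≡ evalCD f w
  coeff-concatMap G h []            w = refl
  coeff-concatMap G h ((k , v) ∷ f) w = trans (coeff-++ (G (k , v)) (concatMap G f) w) (cong₂ _+_ (h k v w) (coeff-concatMap G h f w))

coeff-expandCD : ∀ f w → coeffAB (expandCD f) w ≡ evalCD f w
coeff-expandCD f w = coeff-concatMap _ (coeff-scaled _ (λ _ → refl) (λ _ → refl)) f w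

private
  ne : AB → AB → ℤ
  ne 𝐚 𝐚 = 0ℤ
  ne 𝐚 𝐛 = 1ℤ
  ne 𝐛 𝐚 = 1ℤ
  ne 𝐛 𝐛 = 0ℤ

  degree : List CD → ℕ
  degree []      = 0
  degree (𝐜 ∷ v) = suc (degree v)
  degree (𝐝 ∷ v) = suc (suc (degree v))

  X-degree : ∀ v w → length w ≢ degree v → X v w ≡ 0ℤ
  X-degree []      []          n = ⊥-elim (n refl)
  X-degree []      (_ ∷ _)     n = refl
  X-degree (𝐜 ∷ v) []          n = refl
  X-degree (𝐜 ∷ v) (_ ∷ w)     n = X-degree v w (λ e → n (cong suc e))
  X-degree (𝐝 ∷ v) []          n = refl
  X-degree (𝐝 ∷ v) (_ ∷ [])    n = refl
  X-degree (𝐝 ∷ v) (𝐚 ∷ 𝐚 ∷ w) n = refl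
  X-degree (𝐝 ∷ v) (𝐚 ∷ 𝐛 ∷ w) n = X-degree v w (λ e → n (cong (λ k → suc (suc k)) e))
  X-degree (𝐝 ∷ v) (𝐛 ∷ 𝐚 ∷ w) n = X-degree v w (λ e → n (cong (λ k → suc (suc k)) e))
  X-degree (𝐝 ∷ v) (𝐛 ∷ 𝐛 ∷ w) n = refl

  degree-++ : ∀ v v' → degree (v ++ v') ≡ degree v ℕ.+ degree v'
  degree-++ []      v' = refl
  degree-++ (𝐜 ∷ v) v' = cong suc (degree-++ v v')
  degree-++ (𝐝 ∷ v) v' = cong (λ k → suc (suc k)) (degree-++ v v')

  degree-reverse : ∀ v → degree (reverse v) ≡ degree v
  degree-reverse []      = refl
  degree-reverse (x ∷ v) = trans (cong degree (Listₚ.unfold-reverse x v)) (trans (degree-++ (reverse v) (x ∷ [])) (trans (cong (ℕ._+ degree (x ∷ [])) (degree-reverse v)) (lem x)))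
    where
    lem : ∀ x → degree v ℕ.+ degree (x ∷ []) ≡ degree (x ∷ v)
    lem 𝐜 = ℕₚ.+-comm (degree v) 1
    lem 𝐝 = ℕₚ.+-comm (degree v) 2

  X-++ : ∀ v w v' w' → length w ≡ degree v → X (v ++ v') (w ++ w') ≡ X v w * X v' w'
  X-++ []      []          v' w' e = sym (ℤₚ.*-identityˡ _)
  X-++ (𝐜 ∷ v) (_ ∷ w)     v' w' e = X-++ v w v' w' (ℕₚ.suc-injective e)
  X-++ (𝐝 ∷ v) (𝐚 ∷ 𝐚 ∷ w) v' w' e = refl
  X-++ (𝐝 ∷ v) (𝐚 ∷ 𝐛 ∷ w) v' w' e = X-++ v w v' w' (ℕₚ.suc-injective (ℕₚ.suc-injective e))
  X-++ (𝐝 ∷ v) (𝐛 ∷ 𝐚 ∷ w) v' w' e = X-++ v w v' w' (ℕₚ.suc-injective (ℕₚ.suc-injective e))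
  X-++ (𝐝 ∷ v) (𝐛 ∷ 𝐛 ∷ w) v' w' e = refl

-- Both a + b and ab + ba are invariant under reversal of words, so reversing a cd-word reverses its
-- expansion.
X-reverse : ∀ v u → X (reverse v) (reverse u) ≡ X v u
X-reverse v u with length u ℕₚ.≟ degree v
... | no n = trans (X-degree (reverse v) (reverse u) (λ e → n (trans (sym (Listₚ.length-reverse u)) (trans e (degree-reverse v))))) (sym (X-degree v u n))
... | yes e = go v u e
  where
  len : ∀ v u → length u ≡ degree v → length (reverse u) ≡ degree (reverse v)
  len v u e = trans (Listₚ.length-reverse u) (trans e (sym (degree-reverse v)))
  rev2 : ∀ (x y : AB) u → reverse (x ∷ y ∷ u) ≡ reverse u ++ y ∷ x ∷ []
  rev2 x y u = trans (Listₚ.unfold-reverse x (y ∷ u)) (trans (cong (_++ x ∷ []) (Listₚ.unfold-reverse y u)) (Listₚ.++-assoc (reverse u) (y ∷ []) (x ∷ [])))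
  go : ∀ v u → length u ≡ degree v → X (reverse v) (reverse u) ≡ X v u
  two : ∀ v x y u → length u ≡ degree v → X (𝐝 ∷ []) (y ∷ x ∷ []) ≡ ne x y → X (reverse (𝐝 ∷ v)) (reverse (x ∷ y ∷ u)) ≡ X v u * ne x y
  two v x y u e q = trans (cong₂ X (Listₚ.unfold-reverse 𝐝 v) (rev2 x y u)) (trans (X-++ (reverse v) (reverse u) (𝐝 ∷ []) (y ∷ x ∷ []) (len v u e)) (cong₂ _*_ (go v u e) q))
  go []      []      e = refl
  go (𝐜 ∷ v) (l ∷ u) e = trans (cong₂ X (Listₚ.unfold-reverse 𝐜 v) (Listₚ.unfold-reverse l u)) (trans (X-++ (reverse v) (reverse u) (𝐜 ∷ []) (l ∷ []) (len v u (ℕₚ.suc-injective e))) (trans (ℤₚ.*-identityʳ _) (go v u (ℕₚ.suc-injective e))))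
  go (𝐝 ∷ v) (𝐚 ∷ 𝐚 ∷ u) e = trans (two v 𝐚 𝐚 u (ℕₚ.suc-injective (ℕₚ.suc-injective e)) refl) (ℤₚ.*-zeroʳ (X v u))
  go (𝐝 ∷ v) (𝐚 ∷ 𝐛 ∷ u) e = trans (two v 𝐚 𝐛 u (ℕₚ.suc-injective (ℕₚ.suc-injective e)) refl) (ℤₚ.*-identityʳ (X v u))
  go (𝐝 ∷ v) (𝐛 ∷ 𝐚 ∷ u) e = trans (two v 𝐛 𝐚 u (ℕₚ.suc-injective (ℕₚ.suc-injective e)) refl) (ℤₚ.*-identityʳ (X v u))
  go (𝐝 ∷ v) (𝐛 ∷ 𝐛 ∷ u) e = trans (two v 𝐛 𝐛 u (ℕₚ.suc-injective (ℕₚ.suc-injective e)) refl) (ℤₚ.*-zeroʳ (X v u))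

mirror : CDPoly → CDPoly
mirror = map (λ p → proj₁ p , reverse (proj₂ p))

evalCD-mirror : ∀ f u → evalCD (mirror f) (reverse u) ≡ evalCD f u
evalCD-mirror []            u = refl
evalCD-mirror ((k , v) ∷ f) u = cong₂ _+_ (cong (k *_) (X-reverse v u)) (evalCD-mirror f u)

evalCD-++ : ∀ f g u → evalCD (f ++ g) u ≡ evalCD f u + evalCD g u
evalCD-++ []            g u = sym (ℤₚ.+-identityˡ _)
evalCD-++ ((k , v) ∷ f) g u = trans (cong (k * X v u +_) (evalCD-++ f g u)) (sym (ℤₚ.+-assoc (k * X v u) _ _))

-- Flag enumeration

open Sums ℤring using ([_]; []-∧; ∑; ∑-cong; ∑-0; ∑-+; ∑-*ˡ; ∑-*ʳ; ∑-sub; ∑-neg; ∑-δ; ∑-one; ∑-swap; δ; sumL; sumL-concatMap; sumL-cong; Finite; finFin)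
open SumVSet ℤring

anyFin⇒ : ∀ {n} {p : Fin n → Bool} → anyFin p ≡ true → Σ (Fin n) λ i → p i ≡ true
anyFin⇒ {suc n} {p} e with p zero in eq
... | true  = zero , eq
... | false = let q = anyFin⇒ e in suc (proj₁ q) , proj₂ q

⇒anyFin : ∀ {n} {p : Fin n → Bool} i → p i ≡ true → anyFin p ≡ true
⇒anyFin {suc n} {p} zero    e = ⇒∨ (inj₁ e)
⇒anyFin {suc n} {p} (suc i) e = ⇒∨ {p zero} (inj₂ (⇒anyFin i e))

kr-cong : ∀ {r r'} m u → (∀ j → j ≤ m → r j ≡ r' j) → kr r m u ≡ kr r' m u
kr-cong zero    []      e = refl
kr-cong zero    (_ ∷ _) e = refl
kr-cong (suc m) []      e = refl
kr-cong (suc m) (l ∷ u) e = cong₂ (λ b z → kap b l * z) (e (suc m) ℕₚ.≤-refl) (kr-cong m u (λ j le → e j (ℕₚ.m≤n⇒m≤1+n le)))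

∑-toggle : ∀ {N} (y : Fin N) (G : VSet N → ℤ) → (∑[ S ] [ lookup S y ] * G S) ≡ (∑[ S ] [ not (lookup S y) ] * G (S [ y ]≔ true))
∑-toggle {suc N} zero G = trans (∑VSet-∷ (λ S → [ lookup S zero ] * G S)) (trans (cong ((∑[ S ] 1ℤ * G (true ∷ S)) +_) (∑-0 (λ S → ℤₚ.*-zeroˡ (G (false ∷ S)))))
  (trans (ℤₚ.+-comm (∑[ S ] 1ℤ * G (true ∷ S)) 0ℤ) (sym (trans (∑VSet-∷ (λ S → [ not (lookup S zero) ] * G (S [ zero ]≔ true))) (cong (_+ (∑[ S ] 1ℤ * G (true ∷ S))) (∑-0 (λ S → ℤₚ.*-zeroˡ (G (true ∷ S)))))))))
∑-toggle {suc N} (suc y) G = trans (∑VSet-∷ _) (trans (cong₂ _+_ (∑-toggle y (λ S → G (true ∷ S))) (∑-toggle y (λ S → G (false ∷ S)))) (sym (∑VSet-∷ _)))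

sgn-sq : ∀ a → sgn a * sgn a ≡ 1ℤ
sgn-sq zero    = refl
sgn-sq (suc a) = trans (lem (sgn a)) (sgn-sq a)
  where
  lem : ∀ x → (- x) * (- x) ≡ x * x
  lem = solve-∀

lookup-ext : ∀ {N} {S T : VSet N} → (∀ u → lookup S u ≡ lookup T u) → S ≡ T
lookup-ext {S = []}    {[]}    e = refl
lookup-ext {S = _ ∷ _} {_ ∷ _} e = cong₂ _∷_ (e zero) (lookup-ext (λ u → e (suc u)))

module Flags {N : ℕ} (P : PosetData N) (n : ℕ) (graded : IsGradedPoset P n) where
  open GradedPoset P n graded

  low : ℕ → Fin N → Bool
  low m u = does (ρ u ≤? m)

  has : VSet N → ℕ → Bool
  has S j = anyFin (λ u → lookup S u ∧ (ρ u ≡ᵇ j))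

  has⇒ : ∀ S j → has S j ≡ true → Σ (Fin N) λ u → u ∈ˢ S × ρ u ≡ j
  has⇒ S j e = let q = anyFin⇒ e ; r = ∧-true {lookup S (proj₁ q)} (proj₂ q) in proj₁ q , proj₁ r , ≡ᵇ⇒≡ _ j (proj₂ r)

  ⇒has : ∀ S j u → u ∈ˢ S → ρ u ≡ j → has S j ≡ true
  ⇒has S j u m e = ⇒anyFin u (cong₂ _∧_ m (trans (cong (_≡ᵇ j) e) (≡ᵇ-refl j)))

  has-insert : ∀ S y j → j < ρ y → has (S [ y ]≔ true) j ≡ has S j
  has-insert S y j lt = ≡-true-iff
    (λ e → let q = has⇒ (S [ y ]≔ true) j e in case₁ (proj₁ q) (proj₁ (proj₂ q)) (proj₂ (proj₂ q)))
    (λ e → let q = has⇒ S j e in ⇒has (S [ y ]≔ true) j (proj₁ q) (insert-∈ S y (proj₁ q) (proj₁ (proj₂ q))) (proj₂ (proj₂ q)))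
    where
    case₁ : ∀ u → u ∈ˢ (S [ y ]≔ true) → ρ u ≡ j → has S j ≡ true
    case₁ u m e with ∈-insert S y u m
    ... | inj₁ refl = ⊥-elim (ℕₚ.<-irrefl (sym e) lt)
    ... | inj₂ m'   = ⇒has S j u m' e

  K : ℕ → VSet N → Bool
  K m S = OC (low m) S

  K⇒ : ∀ m S → K m S ≡ true → IsChainIn (low m) S
  K⇒ m S = OC⇒ {low m} {S}

  ⇒K : ∀ m S → IsChainIn (low m) S → K m S ≡ true
  ⇒K m S = ⇒OC {low m} {S}

  K⇒low : ∀ {m S u} → K m S ≡ true → u ∈ˢ S → ρ u ≤ m
  K⇒low {m} {S} {u} e m∈ = witness (ρ u ≤? m) (inside (K⇒ m S e) m∈)

  K-suc : ∀ m S → K (suc m) S ∧ not (has S (suc m)) ≡ K m S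
  K-suc m S = ≡-true-iff
    (λ e → let q = ∧-true {K (suc m) S} e in ⇒K m S (chain-sub (K⇒ (suc m) S (proj₁ q)) (λ i → i) (λ {u} i → dec-true (ρ u ≤? m) (ℕ.s≤s⁻¹ (ℕₚ.≤∧≢⇒< (K⇒low {suc m} {S} (proj₁ q) i)
       (λ e' → true≢false (trans (sym (⇒has S (suc m) u i e')) (not-true (proj₂ q)))))))))
    (λ e → cong₂ _∧_ (⇒K (suc m) S (chain-sub (K⇒ m S e) (λ i → i) (λ {u} i → dec-true (ρ u ≤? suc m) (ℕₚ.m≤n⇒m≤1+n (K⇒low {m} {S} e i))))) (cong not (none e (has S (suc m)) refl)))
    where
    none : K m S ≡ true → ∀ b → has S (suc m) ≡ b → b ≡ false
    none e false _ = refl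
    none e true  h = let q = has⇒ S (suc m) h in ⊥-elim (ℕₚ.1+n≰n (subst (_≤ m) (proj₂ (proj₂ q)) (K⇒low {m} {S} e (proj₁ (proj₂ q)))))

  strictly : Fin N → Fin N → Bool
  strictly y x = _<ᵇ'_ P x y

  K-insert : ∀ m y → ρ y ≡ suc m → ∀ S → not (lookup S y) ∧ K (suc m) (S [ y ]≔ true) ≡ K m S ∧ OC (strictly y) S
  K-insert m y ry S = ≡-true-iff
    (λ e → let q = ∧-true {not (lookup S y)} e ; out = not-true (proj₁ q) ; ch = OC⇒ {low (suc m)} {S [ y ]≔ true} (proj₂ q)
               lt = λ {v} i → below-y out ch v i in
           cong₂ _∧_ (⇒K m S (chain-sub ch (λ {v} → insert-∈ S y v) (λ {v} i → dec-true (ρ v ≤? m) (ℕ.s≤s⁻¹ (subst (ρ v <_) ry (ρ-mono (lt {v} i)))))))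
                     (⇒OC {strictly y} {S} (chain-sub ch (λ {v} → insert-∈ S y v) (λ {v} i → ≺⇒<b (lt {v} i)))))
    (λ e → let q = ∧-true {K m S} e ; ch = K⇒ m S (proj₁ q) ; ch' = OC⇒ {strictly y} {S} (proj₂ q) in
           cong₂ _∧_ (cong not (out' ch' (lookup S y) refl))
             (⇒K (suc m) (S [ y ]≔ true) (chain-insert (chain-sub ch (λ i → i) (λ {v} i → dec-true (ρ v ≤? suc m) (ℕₚ.m≤n⇒m≤1+n (K⇒low {m} {S} (proj₁ q) i)))) y≢𝟎 (dec-true (ρ y ≤? suc m) (ℕₚ.≤-reflexive ry)) (λ i → inj₂ (proj₁ (<b⇒≺ (inside ch' i)))))))
    where
    y≢𝟎 : y ≢ 𝟎
    y≢𝟎 e = ℕₚ.1+n≢0 (trans (sym ry) (trans (cong ρ e) ρ𝟎))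
    out' : IsChainIn (strictly y) S → ∀ b → lookup S y ≡ b → b ≡ false
    out' ch false _ = refl
    out' ch true  i = ⊥-elim (proj₂ (<b⇒≺ (inside ch i)) refl)
    below-y : lookup S y ≡ false → IsChainIn (low (suc m)) (S [ y ]≔ true) → ∀ v → v ∈ˢ S → v ≺ y
    below-y out ch v i with comparable ch (insert-∈ S y v i) (insert-here {S} y)
    ... | inj₁ le = le , λ { refl → true≢false (trans (sym i) out) }
    ... | inj₂ le = ⊥-elim (true≢false (trans (sym i) (trans (cong (lookup S) (sym (≼-same-rank le (ℕₚ.≤-antisym (ρ-mono-≼ le) (subst (ρ v ≤_) (sym ry) (witness (ρ v ≤? suc m) (inside ch (insert-∈ S y v i)))))))) out)))

  -- φ at the largest element of the chain S, where S has ranks ≤ m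
  top : ℕ → (Fin N → ℤ) → VSet N → ℤ
  top zero    φ S = φ 𝟎
  top (suc m) φ S = (∑[ y ] [ lookup S y ∧ (ρ y ≡ᵇ suc m) ] * φ y) + [ not (has S (suc m)) ] * top m φ S

  top-∑ : ∀ m (a : Fin N → ℤ) (ψ : Fin N → Fin N → ℤ) S → top m (λ x → ∑[ y ] a y * ψ y x) S ≡ (∑[ y ] a y * top m (ψ y) S)
  top-∑ zero    a ψ S = refl
  top-∑ (suc m) a ψ S = begin
    (∑[ x ] h x * (∑[ y ] a y * ψ y x)) + g * top m (λ x → ∑[ y ] a y * ψ y x) S
      ≡⟨ cong₂ _+_ (trans (∑-cong (λ x → sym (∑-*ˡ (h x) _))) (∑-swap _)) (trans (cong (g *_) (top-∑ m a ψ S)) (sym (∑-*ˡ g _))) ⟩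
    (∑[ y ] ∑[ x ] h x * (a y * ψ y x)) + (∑[ y ] g * (a y * top m (ψ y) S))   ≡⟨ sym (∑-+ _ _) ⟩
    (∑[ y ] (∑[ x ] h x * (a y * ψ y x)) + g * (a y * top m (ψ y) S))
      ≡⟨ ∑-cong (λ y → trans (cong (_+ g * (a y * top m (ψ y) S)) (trans (∑-cong (λ x → swap₃ (h x) (a y) (ψ y x))) (∑-*ˡ (a y) _))) (factor (a y) (∑[ x ] h x * ψ y x) g (top m (ψ y) S))) ⟩
    (∑[ y ] a y * ((∑[ x ] h x * ψ y x) + g * top m (ψ y) S)) ∎
    where
    open ≡-Reasoning
    h : Fin N → ℤ
    h x = [ lookup S x ∧ (ρ x ≡ᵇ suc m) ]
    g : ℤ
    g = [ not (has S (suc m)) ]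
    swap₃ : ∀ a b c → a * (b * c) ≡ b * (a * c)
    swap₃ = solve-∀
    factor : ∀ a s g t → a * s + g * (a * t) ≡ a * (s + g * t)
    factor = solve-∀

  top-sub : ∀ m φ ψ S → top m (λ x → φ x - ψ x) S ≡ top m φ S - top m ψ S
  top-sub zero    φ ψ S = refl
  top-sub (suc m) φ ψ S = trans (cong₂ _+_ (trans (∑-cong (λ y → dist [ lookup S y ∧ (ρ y ≡ᵇ suc m) ] (φ y) (ψ y))) (∑-sub _ _)) (cong ([ not (has S (suc m)) ] *_) (top-sub m φ ψ S)))
      (regroup (∑[ y ] [ lookup S y ∧ (ρ y ≡ᵇ suc m) ] * φ y) (∑[ y ] [ lookup S y ∧ (ρ y ≡ᵇ suc m) ] * ψ y) [ not (has S (suc m)) ] (top m φ S) (top m ψ S))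
    where
    dist : ∀ a b c → a * (b - c) ≡ a * b - a * c
    dist = solve-∀
    regroup : ∀ p q g s t → (p - q) + g * (s - t) ≡ (p + g * s) - (q + g * t)
    regroup = solve-∀

  -- For down-closed B, a chain lies in B iff its largest element does.
  top-down : ∀ (B : Fin N → Bool) → B 𝟎 ≡ true → (∀ {x y} → x ≼ y → B y ≡ true → B x ≡ true) →
    ∀ m S → K m S ≡ true → [ OC B S ] ≡ top m (λ x → [ B x ]) S
  top-down B B𝟎 down zero S k = trans (cong [_] (⇒OC {B} {S} (chain-sub (K⇒ 0 S k) (λ i → i) (λ {u} i → subst (λ v → B v ≡ true) (sym (rank0 (ℕₚ.n≤0⇒n≡0 (K⇒low {0} {S} k i)))) B𝟎)))) (cong [_] (sym B𝟎))
  top-down B B𝟎 down (suc m) S k = go (has S (suc m)) refl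
    where
    A : Fin N → ℤ
    A y = [ lookup S y ∧ (ρ y ≡ᵇ suc m) ] * [ B y ]
    go : ∀ b → has S (suc m) ≡ b → [ OC B S ] ≡ (∑[ y ] A y) + [ not b ] * top m (λ x → [ B x ]) S
    go false h = trans (top-down B B𝟎 down m S (trans (sym (K-suc m S)) (cong₂ _∧_ k (cong not h)))) (sym (trans (cong₂ _+_ (∑-0 zero-term) (ℤₚ.*-identityˡ _)) (ℤₚ.+-identityˡ _)))
      where
      zero-term : ∀ y → A y ≡ 0ℤ
      zero-term y = trans (cong (λ b → [ b ] * [ B y ]) (off (lookup S y ∧ (ρ y ≡ᵇ suc m)) refl)) (ℤₚ.*-zeroˡ [ B y ])
        where
        off : ∀ b → lookup S y ∧ (ρ y ≡ᵇ suc m) ≡ b → b ≡ false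
        off false _ = refl
        off true  e = ⊥-elim (true≢false (trans (sym (⇒anyFin y e)) h))
    go true h = trans (cong [_] (≡-true-iff (λ e → inside (OC⇒ {B} {S} e) y∈) (λ e → ⇒OC {B} {S} (chain-sub ch (λ i → i) (λ {v} i → down (le v i) e)))))
        (sym (trans (ℤₚ.+-identityʳ _) (trans (∑-one y A other) (trans (cong (λ b → [ b ] * [ B y ]) (cong₂ _∧_ y∈ (trans (cong (_≡ᵇ suc m) ry) (≡ᵇ-refl (suc m))))) (ℤₚ.*-identityˡ _)))))
      where
      ch = K⇒ (suc m) S k
      y = proj₁ (has⇒ S (suc m) h)
      y∈ = proj₁ (proj₂ (has⇒ S (suc m) h))
      ry = proj₂ (proj₂ (has⇒ S (suc m) h))
      le : ∀ v → v ∈ˢ S → v ≼ y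
      le v i with comparable ch i y∈
      ... | inj₁ q = q
      ... | inj₂ q = subst (_≼ y) (≼-same-rank q (ℕₚ.≤-antisym (ρ-mono-≼ q) (subst (ρ v ≤_) (sym ry) (K⇒low {suc m} {S} k i)))) ≼-refl
      other : ∀ z → z ≢ y → A z ≡ 0ℤ
      other z ne = trans (cong (λ b → [ b ] * [ B z ]) (off (lookup S z ∧ (ρ z ≡ᵇ suc m)) refl)) (ℤₚ.*-zeroˡ [ B z ])
        where
        off : ∀ b → lookup S z ∧ (ρ z ≡ᵇ suc m) ≡ b → b ≡ false
        off false _ = refl
        off true  e = ⊥-elim (ne (let q = ∧-true {lookup S z} e in comparable-rank (comparable ch (proj₁ q) y∈) (trans (≡ᵇ⇒≡ _ (suc m) (proj₂ q)) (sym ry))))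

  -- The ab-index in rank m with every chain weighted by the value of φ at its largest element. For
  -- the indicator of a down-closed set this is the ab-index of that set, and arbitrary φ are what
  -- makes the recursion close up.
  flagSum : ℕ → (Fin N → ℤ) → List AB → ℤ
  flagSum m φ u = ∑[ S ] [ K m S ] * (top m φ S * kr (has S) m u)

  π : ℕ → (Fin N → ℤ) → Fin N → ℤ
  π j φ x = ∑[ y ] [ ρ y ≡ᵇ j ] * φ y * [ strictly y x ]

  -- `flagSum` computed letter by letter from the top rank. The letter a occurs only in a factor a -
  -- b, so the chain avoids this rank. The letter b has coefficient 1 for the chains through this
  -- rank, which push φ down to `π`, and -1 for the chains that avoid it.
  Ψ : ℕ → (Fin N → ℤ) → List AB → ℤ
  Ψ zero    φ []      = φ 𝟎
  Ψ zero    φ (_ ∷ _) = 0ℤ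
  Ψ (suc m) φ []      = 0ℤ
  Ψ (suc m) φ (𝐚 ∷ u) = Ψ m φ u
  Ψ (suc m) φ (𝐛 ∷ u) = Ψ m (λ x → π (suc m) φ x - φ x) u

  flagSum-sub : ∀ m φ ψ u → flagSum m (λ x → φ x - ψ x) u ≡ flagSum m φ u - flagSum m ψ u
  flagSum-sub m φ ψ u = trans (∑-cong (λ S → trans (cong (λ t → [ K m S ] * (t * kr (has S) m u)) (top-sub m φ ψ S)) (dist [ K m S ] (top m φ S) (top m ψ S) (kr (has S) m u)))) (∑-sub _ _)
    where
    dist : ∀ a b c d → a * ((b - c) * d) ≡ a * (b * d) - a * (c * d)
    dist = solve-∀

  -- The chains are divided according to whether they contain an element y of rank m + 1. Those that
  -- do arise by inserting y into a chain strictly below y. The set below y is down-closed, so its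
  -- indicator on chains is its indicator at the largest element, and the sum over y becomes `π`.
  flagSum-∷ : ∀ m φ l u → flagSum (suc m) φ (l ∷ u) ≡ kap false l * flagSum m φ u + kap true l * flagSum m (π (suc m) φ) u
  flagSum-∷ m φ l u = begin
    (∑[ S ] [ K (suc m) S ] * (top (suc m) φ S * (kap (has S (suc m)) l * kr (has S) m u)))
      ≡⟨ ∑-cong (λ S → point S (has S (suc m)) refl) ⟩
    (∑[ S ] kap false l * ([ K m S ] * (top m φ S * kr (has S) m u)) + kap true l * ([ K (suc m) S ] * (A S * kr (has S) m u)))
      ≡⟨ trans (∑-+ _ _) (cong₂ _+_ (∑-*ˡ (kap false l) _) (∑-*ˡ (kap true l) _)) ⟩
    kap false l * flagSum m φ u + kap true l * (∑[ S ] [ K (suc m) S ] * (A S * kr (has S) m u))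
      ≡⟨ cong (λ z → kap false l * flagSum m φ u + kap true l * z) second ⟩
    kap false l * flagSum m φ u + kap true l * flagSum m (π (suc m) φ) u ∎
    where
    open ≡-Reasoning
    A : VSet N → ℤ
    A S = ∑[ y ] [ lookup S y ∧ (ρ y ≡ᵇ suc m) ] * φ y
    point : ∀ S b → has S (suc m) ≡ b → [ K (suc m) S ] * ((A S + [ not b ] * top m φ S) * (kap b l * kr (has S) m u))
      ≡ kap false l * ([ K m S ] * (top m φ S * kr (has S) m u)) + kap true l * ([ K (suc m) S ] * (A S * kr (has S) m u))
    point S true h = trans (lem [ K (suc m) S ] (A S) (top m φ S) (kap true l) (kr (has S) m u) (kap false l))
        (cong (λ z → kap false l * (z * (top m φ S * kr (has S) m u)) + kap true l * ([ K (suc m) S ] * (A S * kr (has S) m u))) (cong [_] (sym K≡)))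
      where
      K≡ : K m S ≡ false
      K≡ = trans (sym (K-suc m S)) (trans (cong (λ b → K (suc m) S ∧ not b) h) (Boolₚ.∧-zeroʳ _))
      lem : ∀ k a t p r q → k * ((a + 0ℤ * t) * (p * r)) ≡ q * (0ℤ * (t * r)) + p * (k * (a * r))
      lem = solve-∀
    point S false h = trans (cong (λ z → [ K (suc m) S ] * ((z + 1ℤ * top m φ S) * (kap false l * kr (has S) m u))) A≡0)
        (trans (lem [ K (suc m) S ] (top m φ S) (kap false l) (kr (has S) m u) (kap true l))
          (cong₂ (λ z a → kap false l * (z * (top m φ S * kr (has S) m u)) + kap true l * ([ K (suc m) S ] * (a * kr (has S) m u))) (cong [_] K≡) (sym A≡0)))
      where
      K≡ : K (suc m) S ≡ K m S
      K≡ = trans (sym (Boolₚ.∧-identityʳ _)) (trans (cong (λ b → K (suc m) S ∧ not b) (sym h)) (K-suc m S))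
      A≡0 : A S ≡ 0ℤ
      A≡0 = ∑-0 (λ y → trans (cong (λ b → [ b ] * φ y) (off y (lookup S y ∧ (ρ y ≡ᵇ suc m)) refl)) (ℤₚ.*-zeroˡ (φ y)))
        where
        off : ∀ y b → lookup S y ∧ (ρ y ≡ᵇ suc m) ≡ b → b ≡ false
        off y false _ = refl
        off y true  e = ⊥-elim (true≢false (trans (sym (⇒anyFin y e)) h))
      lem : ∀ k t p r q → k * ((0ℤ + 1ℤ * t) * (p * r)) ≡ p * (k * (t * r)) + q * (k * (0ℤ * r))
      lem = solve-∀
    flags : Fin N → VSet N → ℤ
    flags y S = [ not (lookup S y) ] * ([ K (suc m) (S [ y ]≔ true) ] * kr (has (S [ y ]≔ true)) m u)
    kr' : VSet N → ℤ
    kr' S = kr (has S) m u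
    toggled : ∀ y → ρ y ≡ suc m → ∀ S → flags y S ≡ [ K m S ] * (top m (λ x → [ strictly y x ]) S * kr' S)
    toggled y ry S = begin
      flags y S                                                     ≡⟨ cong (λ z → [ not (lookup S y) ] * ([ K (suc m) (S [ y ]≔ true) ] * z)) (kr-cong m u (λ j le → has-insert S y j (subst (j <_) (sym ry) (s≤s le)))) ⟩
      [ not (lookup S y) ] * ([ K (suc m) (S [ y ]≔ true) ] * kr' S)  ≡⟨ trans (sym (ℤₚ.*-assoc [ not (lookup S y) ] _ _)) (cong (_* kr' S) (trans (sym ([]-∧ (not (lookup S y)) _)) (trans (cong [_] (K-insert m y ry S)) ([]-∧ (K m S) _)))) ⟩
      [ K m S ] * [ OC (strictly y) S ] * kr' S                      ≡⟨ go (K m S) refl ⟩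
      [ K m S ] * (top m (λ x → [ strictly y x ]) S * kr' S) ∎
      where
      𝟎<y : strictly y 𝟎 ≡ true
      𝟎<y = ≺⇒<b (𝟎≼ y , λ e → ℕₚ.1+n≢0 (trans (sym ry) (trans (cong ρ (sym e)) ρ𝟎)))
      go : ∀ b → K m S ≡ b → [ b ] * [ OC (strictly y) S ] * kr' S ≡ [ b ] * (top m (λ x → [ strictly y x ]) S * kr' S)
      go false k = trans (cong (_* kr' S) (ℤₚ.*-zeroˡ [ OC (strictly y) S ])) (trans (ℤₚ.*-zeroˡ (kr' S)) (sym (ℤₚ.*-zeroˡ (top m (λ x → [ strictly y x ]) S * kr' S))))
      go true  k = trans (ℤₚ.*-assoc 1ℤ [ OC (strictly y) S ] (kr' S)) (cong (λ z → 1ℤ * (z * kr' S)) (top-down (strictly y) 𝟎<y (λ xy yz → ≺⇒<b (≼≺-trans xy (<b⇒≺ yz))) m S k))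
    second : (∑[ S ] [ K (suc m) S ] * (A S * kr' S)) ≡ flagSum m (π (suc m) φ) u
    second = begin
      (∑[ S ] [ K (suc m) S ] * (A S * kr' S))
        ≡⟨ ∑-cong (λ S → trans (rearr [ K (suc m) S ] (A S) (kr' S)) (sym (∑-*ʳ ([ K (suc m) S ] * kr' S) _))) ⟩
      (∑[ S ] ∑[ y ] [ lookup S y ∧ (ρ y ≡ᵇ suc m) ] * φ y * ([ K (suc m) S ] * kr' S))
        ≡⟨ ∑-swap _ ⟩
      (∑[ y ] ∑[ S ] [ lookup S y ∧ (ρ y ≡ᵇ suc m) ] * φ y * ([ K (suc m) S ] * kr' S))
        ≡⟨ ∑-cong (λ y → trans (∑-cong (λ S → trans (cong (λ z → z * φ y * ([ K (suc m) S ] * kr' S)) ([]-∧ (lookup S y) (ρ y ≡ᵇ suc m))) (rearr₂ [ lookup S y ] [ ρ y ≡ᵇ suc m ] (φ y) ([ K (suc m) S ] * kr' S)))) (trans (∑-*ˡ ([ ρ y ≡ᵇ suc m ] * φ y) _) (cong ([ ρ y ≡ᵇ suc m ] * φ y *_) (∑-toggle y (λ S → [ K (suc m) S ] * kr' S))))) ⟩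
      (∑[ y ] [ ρ y ≡ᵇ suc m ] * φ y * (∑[ S ] flags y S))
        ≡⟨ ∑-cong (λ y → step y (ρ y ≡ᵇ suc m) refl) ⟩
      (∑[ y ] [ ρ y ≡ᵇ suc m ] * φ y * (∑[ S ] [ K m S ] * (top m (λ x → [ strictly y x ]) S * kr' S)))
        ≡⟨ trans (∑-cong (λ y → sym (∑-*ˡ ([ ρ y ≡ᵇ suc m ] * φ y) _))) (∑-swap _) ⟩
      (∑[ S ] ∑[ y ] [ ρ y ≡ᵇ suc m ] * φ y * ([ K m S ] * (top m (λ x → [ strictly y x ]) S * kr' S)))
        ≡⟨ ∑-cong (λ S → trans (∑-cong (λ y → rearr₃ ([ ρ y ≡ᵇ suc m ] * φ y) [ K m S ] (top m (λ x → [ strictly y x ]) S) (kr' S))) (trans (∑-*ˡ [ K m S ] _) (cong ([ K m S ] *_) (trans (∑-*ʳ (kr' S) _) (cong (_* kr' S) (sym (top-∑ m (λ y → [ ρ y ≡ᵇ suc m ] * φ y) (λ y x → [ strictly y x ]) S))))))) ⟩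
      flagSum m (π (suc m) φ) u ∎
      where
      rearr : ∀ k a r → k * (a * r) ≡ a * (k * r)
      rearr = solve-∀
      rearr₂ : ∀ s b p k → s * b * p * k ≡ b * p * (s * k)
      rearr₂ = solve-∀
      rearr₃ : ∀ a k t r → a * (k * (t * r)) ≡ k * (a * t * r)
      rearr₃ = solve-∀
      step : ∀ y b → (ρ y ≡ᵇ suc m) ≡ b → [ b ] * φ y * (∑[ S ] flags y S) ≡ [ b ] * φ y * (∑[ S ] [ K m S ] * (top m (λ x → [ strictly y x ]) S * kr' S))
      step y true  e = cong (1ℤ * φ y *_) (∑-cong (toggled y (≡ᵇ⇒≡ (ρ y) (suc m) e)))
      step y false e = trans (cong (_* (∑[ S ] flags y S)) (ℤₚ.*-zeroˡ (φ y))) (trans (ℤₚ.*-zeroˡ (∑[ S ] flags y S)) (sym (trans (cong (_* (∑[ S ] [ K m S ] * (top m (λ x → [ strictly y x ]) S * kr' S))) (ℤₚ.*-zeroˡ (φ y))) (ℤₚ.*-zeroˡ (∑[ S ] [ K m S ] * (top m (λ x → [ strictly y x ]) S * kr' S))))))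

  flagSum≡Ψ : ∀ m φ u → flagSum m φ u ≡ Ψ m φ u
  flagSum≡Ψ zero φ [] = trans (∑-one ∅ _ other) (trans (cong (λ b → [ b ] * (φ 𝟎 * 1ℤ)) (⇒OC {low 0} empty)) (trans (ℤₚ.*-identityˡ _) (ℤₚ.*-identityʳ _)))
    where
    ∅ : VSet N
    ∅ = replicate N false
    ∉∅ : ∀ u → lookup ∅ u ≡ false
    ∉∅ u = Vecₚ.lookup-replicate u false
    empty : IsChainIn (low 0) ∅
    empty = mkChain (∉∅ 𝟎) (λ {v} i → ⊥-elim (true≢false (trans (sym i) (∉∅ v)))) (λ {v} i → ⊥-elim (true≢false (trans (sym i) (∉∅ v))))
    other : ∀ S → S ≢ ∅ → [ K 0 S ] * (φ 𝟎 * 1ℤ) ≡ 0ℤ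
    other S ne = trans (cong (λ b → [ b ] * (φ 𝟎 * 1ℤ)) (off (K 0 S) refl)) (ℤₚ.*-zeroˡ (φ 𝟎 * 1ℤ))
      where
      off : ∀ b → K 0 S ≡ b → b ≡ false
      off false _ = refl
      off true  k = ⊥-elim (ne (lookup-ext (λ u → trans (out u (lookup S u) refl) (sym (∉∅ u)))))
        where
        out : ∀ u b → lookup S u ≡ b → b ≡ false
        out u false _ = refl
        out u true  i = ⊥-elim (true≢false (trans (sym i) (trans (cong (lookup S) (rank0 (ℕₚ.n≤0⇒n≡0 (K⇒low {0} {S} k i)))) (no𝟎 (K⇒ 0 S k)))))
  flagSum≡Ψ zero φ (_ ∷ _) = ∑-0 (λ S → trans (cong ([ K 0 S ] *_) (ℤₚ.*-zeroʳ (φ 𝟎))) (ℤₚ.*-zeroʳ [ K 0 S ]))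
  flagSum≡Ψ (suc m) φ [] = ∑-0 (λ S → trans (cong ([ K (suc m) S ] *_) (ℤₚ.*-zeroʳ (top (suc m) φ S))) (ℤₚ.*-zeroʳ [ K (suc m) S ]))
  flagSum≡Ψ (suc m) φ (𝐚 ∷ u) = trans (flagSum-∷ m φ 𝐚 u) (trans (ℤₚ.+-identityʳ _) (trans (ℤₚ.*-identityˡ _) (flagSum≡Ψ m φ u)))
  flagSum≡Ψ (suc m) φ (𝐛 ∷ u) = trans (flagSum-∷ m φ 𝐛 u) (trans (lem (flagSum m φ u) (flagSum m (π (suc m) φ) u)) (trans (sym (flagSum-sub m (π (suc m) φ) φ u)) (flagSum≡Ψ m (λ x → π (suc m) φ x - φ x) u)))
    where
    lem : ∀ a b → -1ℤ * a + 1ℤ * b ≡ b - a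
    lem = solve-∀

  abIndex-Ψ : ∀ (B : Fin N → Bool) m → B 𝟎 ≡ true → (∀ {x y} → x ≼ y → B y ≡ true → B x ≡ true) → (∀ {x} → B x ≡ true → ρ x ≤ m) →
    ∀ u → coeffAB (abIndex P B m) (reverse u) ≡ Ψ m (λ x → [ B x ]) u
  abIndex-Ψ B m B𝟎 down ranks u = begin
    coeffAB (concatMap (wt P m) (filterᵇ (OC B) (allSubsets N))) (reverse u)            ≡⟨ coeff-sum (filterᵇ (OC B) (allSubsets N)) ⟩
    sumL (filterᵇ (OC B) (allSubsets N)) (λ S → coeffAB (wt P m S) (reverse u))         ≡⟨ ∑VSet-filter (OC B) _ ⟩
    (∑[ S ] [ OC B S ] * coeffAB (wt P m S) (reverse u))                                ≡⟨ ∑-cong (λ S → trans (cong ([ OC B S ] *_) (coeff-prodPos (has S) m u)) (go S (K m S) refl)) ⟩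
    flagSum m (λ x → [ B x ]) u                                                         ≡⟨ flagSum≡Ψ m (λ x → [ B x ]) u ⟩
    Ψ m (λ x → [ B x ]) u ∎
    where
    open ≡-Reasoning
    coeff-sum : ∀ xs → coeffAB (concatMap (wt P m) xs) (reverse u) ≡ sumL xs (λ S → coeffAB (wt P m S) (reverse u))
    coeff-sum []       = refl
    coeff-sum (S ∷ xs) = trans (coeff-++ (wt P m S) (concatMap (wt P m) xs) (reverse u)) (cong (coeffAB (wt P m S) (reverse u) +_) (coeff-sum xs))
    go : ∀ S b → K m S ≡ b → [ OC B S ] * kr (has S) m u ≡ [ b ] * (top m (λ x → [ B x ]) S * kr (has S) m u)
    go S true  k = trans (cong (_* kr (has S) m u) (top-down B B𝟎 down m S k)) (sym (ℤₚ.*-identityˡ _))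
    go S false k = trans (cong (λ b → [ b ] * kr (has S) m u) (off (OC B S) refl)) (trans (ℤₚ.*-zeroˡ (kr (has S) m u)) (sym (ℤₚ.*-zeroˡ (top m (λ x → [ B x ]) S * kr (has S) m u))))
      where
      off : ∀ b → OC B S ≡ b → b ≡ false
      off false _ = refl
      off true  e = ⊥-elim (true≢false (trans (sym (⇒K m S (chain-sub (OC⇒ {B} {S} e) (λ i → i) (λ {v} i → dec-true (ρ v ≤? m) (ranks (inside (OC⇒ {B} {S} e) i)))))) k))

-- The recursion for the cd-index

evalCD-𝐜 : ∀ f l u → evalCD (map (λ p → proj₁ p , 𝐜 ∷ proj₂ p) f) (l ∷ u) ≡ evalCD f u
evalCD-𝐜 []            l u = refl
evalCD-𝐜 ((k , v) ∷ f) l u = cong (k * X v u +_) (evalCD-𝐜 f l u)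

evalCD-𝐜-[] : ∀ f → evalCD (map (λ p → proj₁ p , 𝐜 ∷ proj₂ p) f) [] ≡ 0ℤ
evalCD-𝐜-[] []            = refl
evalCD-𝐜-[] ((k , v) ∷ f) = cong₂ _+_ (ℤₚ.*-zeroʳ k) (evalCD-𝐜-[] f)

-- Right multiplication by a and by b on coefficient functions: the last letter of a word is the
-- head of the reversed list.
apart bpart : (List AB → ℤ) → List AB → ℤ
apart g []      = 0ℤ
apart g (𝐚 ∷ u) = g u
apart g (𝐛 ∷ u) = 0ℤ
bpart g []      = 0ℤ
bpart g (𝐚 ∷ u) = 0ℤ
bpart g (𝐛 ∷ u) = g u

prefix𝐝 : CDPoly → CDPoly
prefix𝐝 = map (λ p → proj₁ p , 𝐝 ∷ proj₂ p)

private
  evalCD-0 : ∀ f u → (∀ v → X (𝐝 ∷ v) u ≡ 0ℤ) → evalCD (prefix𝐝 f) u ≡ 0ℤ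
  evalCD-0 []            u e = refl
  evalCD-0 ((k , v) ∷ f) u e = cong₂ _+_ (trans (cong (k *_) (e v)) (ℤₚ.*-zeroʳ k)) (evalCD-0 f u e)

  evalCD-d : ∀ f u u' → (∀ v → X (𝐝 ∷ v) u ≡ X v u') → evalCD (prefix𝐝 f) u ≡ evalCD f u'
  evalCD-d []            u u' e = refl
  evalCD-d ((k , v) ∷ f) u u' e = cong₂ _+_ (cong (k *_) (e v)) (evalCD-d f u u' e)

evalCD-𝐝-𝐚 : ∀ f u → evalCD (prefix𝐝 f) (𝐚 ∷ u) ≡ bpart (evalCD f) u
evalCD-𝐝-𝐚 f []      = evalCD-0 f (𝐚 ∷ []) (λ v → refl)
evalCD-𝐝-𝐚 f (𝐚 ∷ u) = evalCD-0 f (𝐚 ∷ 𝐚 ∷ u) (λ v → refl)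
evalCD-𝐝-𝐚 f (𝐛 ∷ u) = evalCD-d f (𝐚 ∷ 𝐛 ∷ u) u (λ v → refl)

evalCD-𝐝-𝐛 : ∀ f u → evalCD (prefix𝐝 f) (𝐛 ∷ u) ≡ apart (evalCD f) u
evalCD-𝐝-𝐛 f []      = evalCD-0 f (𝐛 ∷ []) (λ v → refl)
evalCD-𝐝-𝐛 f (𝐚 ∷ u) = evalCD-d f (𝐛 ∷ 𝐚 ∷ u) u (λ v → refl)
evalCD-𝐝-𝐛 f (𝐛 ∷ u) = evalCD-0 f (𝐛 ∷ 𝐛 ∷ u) (λ v → refl)

apart-cong : ∀ {g h} → (∀ u → g u ≡ h u) → ∀ u → apart g u ≡ apart h u
apart-cong e []      = refl
apart-cong e (𝐚 ∷ u) = e u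
apart-cong e (𝐛 ∷ u) = refl

bpart-cong : ∀ {g h} → (∀ u → g u ≡ h u) → ∀ u → bpart g u ≡ bpart h u
bpart-cong e []      = refl
bpart-cong e (𝐚 ∷ u) = refl
bpart-cong e (𝐛 ∷ u) = e u

bpart-0 : ∀ u → bpart (λ _ → 0ℤ) u ≡ 0ℤ
bpart-0 []      = refl
bpart-0 (𝐚 ∷ u) = refl
bpart-0 (𝐛 ∷ u) = refl

module CDIndices {N : ℕ} (P : PosetData N) (n : ℕ) (graded : IsGradedPoset P n) where
  open GradedPoset P n graded
  open Flags P n graded
  open Omega ℤring P

  𝔻 : ℕ → (Fin N → ℤ) → Fin N → ℤ
  𝔻 k φ x = ω k φ x - φ x

  π-cong : ∀ j {φ ψ} → (∀ x → ρ x ≡ j → φ x ≡ ψ x) → ∀ x → π j φ x ≡ π j ψ x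
  π-cong j {φ} {ψ} e x = ∑-cong (λ y → cong (_* [ strictly y x ]) (go y (ρ y ≡ᵇ j) refl))
    where
    go : ∀ y b → (ρ y ≡ᵇ j) ≡ b → [ b ] * φ y ≡ [ b ] * ψ y
    go y true  q = cong (1ℤ *_) (e y (≡ᵇ⇒≡ (ρ y) j q))
    go y false q = trans (ℤₚ.*-zeroˡ (φ y)) (sym (ℤₚ.*-zeroˡ (ψ y)))

  Ψ-cong : ∀ m {φ ψ} → (∀ x → ρ x ≤ m → φ x ≡ ψ x) → ∀ u → Ψ m φ u ≡ Ψ m ψ u
  Ψ-cong zero    e []      = e 𝟎 (ℕₚ.≤-reflexive ρ𝟎)
  Ψ-cong zero    e (_ ∷ _) = refl
  Ψ-cong (suc m) e []      = refl
  Ψ-cong (suc m) e (𝐚 ∷ u) = Ψ-cong m (λ x le → e x (ℕₚ.m≤n⇒m≤1+n le)) u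
  Ψ-cong (suc m) e (𝐛 ∷ u) = Ψ-cong m (λ x le → cong₂ _-_ (π-cong (suc m) (λ y q → e y (ℕₚ.≤-reflexive q)) x) (e x (ℕₚ.m≤n⇒m≤1+n le))) u

  Ψ-sub : ∀ m φ ψ u → Ψ m (λ x → φ x - ψ x) u ≡ Ψ m φ u - Ψ m ψ u
  Ψ-sub m φ ψ u = trans (sym (flagSum≡Ψ m (λ x → φ x - ψ x) u)) (trans (flagSum-sub m φ ψ u) (cong₂ _-_ (flagSum≡Ψ m φ u) (flagSum≡Ψ m ψ u)))

  Ψ-0 : ∀ m {φ} → (∀ x → ρ x ≤ m → φ x ≡ 0ℤ) → ∀ u → Ψ m φ u ≡ 0ℤ
  Ψ-0 m {φ} e u = trans (Ψ-cong m {φ} {λ _ → 0ℤ} e u) (trans (Ψ-sub m (λ _ → 0ℤ) (λ _ → 0ℤ) u) (ℤₚ.+-inverseʳ (Ψ m (λ _ → 0ℤ) u)))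

  π≡rankSum : ∀ j φ x → ρ x < j → π j φ x ≡ rankSum j φ x
  π≡rankSum j φ x lt = ∑-cong (λ y → go y (ρ y ≡ᵇ j) refl)
    where
    go : ∀ y b → (ρ y ≡ᵇ j) ≡ b → [ b ] * φ y * [ strictly y x ] ≡ [ (x ≤ᵇ y) ∧ b ] * φ y
    go y false q = trans (cong (_* [ strictly y x ]) (ℤₚ.*-zeroˡ (φ y))) (trans (ℤₚ.*-zeroˡ [ strictly y x ]) (sym (trans (cong (λ b → [ b ] * φ y) (Boolₚ.∧-zeroʳ (x ≤ᵇ y))) (ℤₚ.*-zeroˡ (φ y)))))
    go y true  q = trans (cong₂ _*_ (ℤₚ.*-identityˡ (φ y)) (cong [_] {strictly y x} {(x ≤ᵇ y) ∧ true} (≡-true-iff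
        (λ e → cong (_∧ true) (proj₁ (<b⇒≺ {x} {y} e))) (λ e → ≺⇒<b {x} {y} (proj₁ (∧-true {x ≤ᵇ y} e) , λ x≡y → ℕₚ.<-irrefl (trans (cong ρ x≡y) (≡ᵇ⇒≡ (ρ y) j q)) lt))))) (ℤₚ.*-comm (φ y) [ (x ≤ᵇ y) ∧ true ])

  rankSum-0 : ∀ j {φ} → (∀ x → ρ x ≡ j → φ x ≡ 0ℤ) → ∀ x → rankSum j φ x ≡ 0ℤ
  rankSum-0 j {φ} e x = ∑-0 (λ y → go y (ρ y ≡ᵇ j) refl)
    where
    go : ∀ y b → (ρ y ≡ᵇ j) ≡ b → [ (x ≤ᵇ y) ∧ b ] * φ y ≡ 0ℤ
    go y true  q = trans (cong ([ (x ≤ᵇ y) ∧ true ] *_) (e y (≡ᵇ⇒≡ (ρ y) j q))) (ℤₚ.*-zeroʳ [ (x ≤ᵇ y) ∧ true ])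
    go y false q = trans (cong (λ b → [ b ] * φ y) (Boolₚ.∧-zeroʳ (x ≤ᵇ y))) (ℤₚ.*-zeroˡ (φ y))

  -- The coefficient of φ y in `ω j φ`: the sign (-1)^(j - ρ y) for ρ y ≤ j, and 0 above rank j.
  alt : ℕ → Fin N → ℤ
  alt zero    y = [ ρ y ≡ᵇ 0 ]
  alt (suc j) y = [ ρ y ≡ᵇ suc j ] - alt j y

  alt-above : ∀ j y → j < ρ y → alt j y ≡ 0ℤ
  alt-above zero    y lt = cong [_] (≡ᵇ-false (λ e → ℕₚ.<-irrefl (sym e) lt))
  alt-above (suc j) y lt = cong₂ _-_ (cong [_] (≡ᵇ-false (λ e → ℕₚ.<-irrefl (sym e) lt))) (alt-above j y (ℕₚ.<-trans (ℕₚ.n<1+n j) lt))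

  alt-below : ∀ j y → ρ y ≤ j → alt j y ≡ sgn j * sgn (ρ y)
  alt-below zero    y le = trans (cong (λ r → [ r ≡ᵇ 0 ]) e) (sym (cong (λ r → 1ℤ * sgn r) e))
    where e = ℕₚ.n≤0⇒n≡0 le
  alt-below (suc j) y le = go (ρ y ℕ.≟ suc j)
    where
    neg : ∀ a b → 0ℤ - a * b ≡ - a * b
    neg = solve-∀
    go : Dec (ρ y ≡ suc j) → alt (suc j) y ≡ sgn (suc j) * sgn (ρ y)
    go (yes e) = trans (cong₂ _-_ (cong [_] (trans (cong (_≡ᵇ suc j) e) (≡ᵇ-refl (suc j)))) (alt-above j y (ℕₚ.≤-reflexive (sym e)))) (sym (trans (cong (λ r → sgn (suc j) * sgn r) e) (sgn-sq (suc j))))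
    go (no ne) = trans (cong₂ _-_ (cong [_] (≡ᵇ-false ne)) (alt-below j y (ℕ.s≤s⁻¹ (ℕₚ.≤∧≢⇒< le ne)))) (neg (sgn j) (sgn (ρ y)))

  ω-alt : ∀ j φ x → ω j φ x ≡ (∑[ y ] [ x ≤ᵇ y ] * (alt j y * φ y))
  ω-alt zero φ x = ∑-cong (λ y → trans (cong (_* φ y) ([]-∧ (x ≤ᵇ y) (ρ y ≡ᵇ 0))) (ℤₚ.*-assoc [ x ≤ᵇ y ] [ ρ y ≡ᵇ 0 ] (φ y)))
  ω-alt (suc j) φ x = trans (cong (λ z → rankSum (suc j) φ x - z) (ω-alt j φ x)) (trans (sym (∑-sub _ _)) (∑-cong (λ y → trans (cong (λ z → z * φ y - [ x ≤ᵇ y ] * (alt j y * φ y)) ([]-∧ (x ≤ᵇ y) (ρ y ≡ᵇ suc j))) (lem [ x ≤ᵇ y ] [ ρ y ≡ᵇ suc j ] (φ y) (alt j y)))))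
    where
    lem : ∀ a b p t → a * b * p - a * (t * p) ≡ a * ((b - t) * p)
    lem = solve-∀

  ω-cong : ∀ j {φ ψ} → (∀ x → ρ x ≤ j → φ x ≡ ψ x) → ∀ x → ω j φ x ≡ ω j ψ x
  ω-cong j {φ} {ψ} e x = trans (ω-alt j φ x) (trans (∑-cong (λ y → cong ([ x ≤ᵇ y ] *_) (go y (ρ y ≤? j)))) (sym (ω-alt j ψ x)))
    where
    go : ∀ y → Dec (ρ y ≤ j) → alt j y * φ y ≡ alt j y * ψ y
    go y (yes le) = cong (alt j y *_) (e y le)
    go y (no nle) = trans (cong (_* φ y) z) (trans (ℤₚ.*-zeroˡ (φ y)) (sym (trans (cong (_* ψ y) z) (ℤₚ.*-zeroˡ (ψ y)))))
      where z = alt-above j y (ℕₚ.≰⇒> nle)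

  ω-sub : ∀ j φ ψ x → ω j (λ y → φ y - ψ y) x ≡ ω j φ x - ω j ψ x
  ω-sub j φ ψ x = trans (ω-alt j _ x) (trans (∑-cong (λ y → lem [ x ≤ᵇ y ] (alt j y) (φ y) (ψ y))) (trans (∑-sub _ _) (sym (cong₂ _-_ (ω-alt j φ x) (ω-alt j ψ x)))))
    where
    lem : ∀ a b c d → a * (b * (c - d)) ≡ a * (b * c) - a * (b * d)
    lem = solve-∀

  ω-top : ∀ j φ x → ρ x ≡ j → ω j φ x ≡ φ x
  ω-top j φ x e = trans (ω-alt j φ x) (trans (∑-one x _ other) (trans (cong₂ (λ b z → [ b ] * (z * φ x)) ≼-refl (trans (alt-below j x (ℕₚ.≤-reflexive e)) (trans (cong (λ r → sgn j * sgn r) e) (sgn-sq j)))) (trans (ℤₚ.*-identityˡ _) (ℤₚ.*-identityˡ _))))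
    where
    other : ∀ y → y ≢ x → [ x ≤ᵇ y ] * (alt j y * φ y) ≡ 0ℤ
    other y ne = go (x ≤ᵇ y) refl
      where
      go : ∀ b → (x ≤ᵇ y) ≡ b → [ b ] * (alt j y * φ y) ≡ 0ℤ
      go false _ = ℤₚ.*-zeroˡ (alt j y * φ y)
      go true  q = trans (cong (λ z → 1ℤ * (z * φ y)) (alt-above j y (subst (_< ρ y) e (ρ-mono (q , λ p → ne (sym p)))))) (trans (ℤₚ.*-identityˡ (0ℤ * φ y)) (ℤₚ.*-zeroˡ (φ y)))

  -- Chains that reach the top rank have weight zero, so the last factor of every remaining weight
  -- is a - b.
  Ψ-top : ∀ k ψ → (∀ x → ρ x ≡ suc k → ψ x ≡ 0ℤ) → ∀ u → Ψ (suc k) ψ u ≡ apart (Ψ k ψ) u - bpart (Ψ k ψ) u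
  Ψ-top k ψ e []      = refl
  Ψ-top k ψ e (𝐚 ∷ u) = sym (ℤₚ.+-identityʳ _)
  Ψ-top k ψ e (𝐛 ∷ u) = trans (Ψ-sub k (π (suc k) ψ) ψ u) (cong (_- Ψ k ψ u) (Ψ-0 k (λ x le → trans (π≡rankSum (suc k) ψ x (s≤s le)) (rankSum-0 (suc k) e x)) u))

  -- All words are read from right to left.
  cd : ℕ → (Fin N → ℤ) → CDPoly
  cd zero          φ = (φ 𝟎 , []) ∷ []
  cd (suc zero)    φ = (φ 𝟎 , 𝐜 ∷ []) ∷ []
  cd (suc (suc k)) φ = map (λ p → proj₁ p , 𝐜 ∷ proj₂ p) (cd (suc k) φ) ++ prefix𝐝 (cd k (𝔻 (suc k) φ))

  module _ (euler : ∀ x z → x ≺ z → (∑[ y ] [ (x ≤ᵇ y) ∧ (y ≤ᵇ z) ] * sgn (ρ y)) ≡ 0ℤ) where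

    interval-sum : ∀ j x z → ρ z ≤ j → (∑[ y ] [ (x ≤ᵇ y) ∧ (y ≤ᵇ z) ] * alt j y) ≡ δ x z * alt j x
    interval-sum j x z le = trans (∑-cong (λ y → trans (cong ([ (x ≤ᵇ y) ∧ (y ≤ᵇ z) ] *_) refl) (go y ((x ≤ᵇ y) ∧ (y ≤ᵇ z)) refl))) (trans (∑-*ˡ (sgn j) _) (cases (x Finₚ.≟ z) (x ≤ᵇ z) refl))
      where
      swap₃ : ∀ a b c → a * (b * c) ≡ b * (a * c)
      swap₃ = solve-∀
      go : ∀ y b → (x ≤ᵇ y) ∧ (y ≤ᵇ z) ≡ b → [ b ] * alt j y ≡ sgn j * ([ b ] * sgn (ρ y))
      go y false q = trans (ℤₚ.*-zeroˡ (alt j y)) (sym (trans (cong (sgn j *_) (ℤₚ.*-zeroˡ (sgn (ρ y)))) (ℤₚ.*-zeroʳ (sgn j))))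
      go y true  q = trans (cong (1ℤ *_) (alt-below j y (ℕₚ.≤-trans (ρ-mono-≼ (proj₂ (∧-true {x ≤ᵇ y} q))) le))) (swap₃ 1ℤ (sgn j) (sgn (ρ y)))
      s : ℤ
      s = ∑[ y ] [ (x ≤ᵇ y) ∧ (y ≤ᵇ z) ] * sgn (ρ y)
      zero-sum : (d : Dec (x ≡ z)) → ¬ (x ≡ z) → s ≡ 0ℤ → sgn j * s ≡ [ does d ] * alt j x
      zero-sum (yes e) ne q = ⊥-elim (ne e)
      zero-sum (no _)  ne q = trans (cong (sgn j *_) q) (trans (ℤₚ.*-zeroʳ (sgn j)) (sym (ℤₚ.*-zeroˡ (alt j x))))
      cases : (d : Dec (x ≡ z)) → ∀ b → (x ≤ᵇ z) ≡ b → sgn j * s ≡ [ does d ] * alt j x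
      cases (yes refl) _ _ = trans (cong (sgn j *_) (trans (∑-one x _ other) (trans (cong (λ b → [ b ∧ b ] * sgn (ρ x)) ≼-refl) (ℤₚ.*-identityˡ _)))) (trans (sym (alt-below j x le)) (sym (ℤₚ.*-identityˡ _)))
        where
        other : ∀ y → y ≢ x → [ (x ≤ᵇ y) ∧ (y ≤ᵇ x) ] * sgn (ρ y) ≡ 0ℤ
        other y ne = out ((x ≤ᵇ y) ∧ (y ≤ᵇ x)) refl
          where
          out : ∀ b → (x ≤ᵇ y) ∧ (y ≤ᵇ x) ≡ b → [ b ] * sgn (ρ y) ≡ 0ℤ
          out false _ = ℤₚ.*-zeroˡ (sgn (ρ y))
          out true  q = ⊥-elim (ne (≼-antisym (proj₂ (∧-true {x ≤ᵇ y} q)) (proj₁ (∧-true {x ≤ᵇ y} q))))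
      cases (no ne) true  q = zero-sum (no ne) ne (euler x z (q , ne))
      cases (no ne) false q = zero-sum (no ne) ne (∑-0 (λ y → out y ((x ≤ᵇ y) ∧ (y ≤ᵇ z)) refl))
        where
        out : ∀ y b → (x ≤ᵇ y) ∧ (y ≤ᵇ z) ≡ b → [ b ] * sgn (ρ y) ≡ 0ℤ
        out y false _ = ℤₚ.*-zeroˡ (sgn (ρ y))
        out y true  p = ⊥-elim (true≢false (trans (sym (≼-trans (proj₁ (∧-true {x ≤ᵇ y} p)) (proj₂ (∧-true {x ≤ᵇ y} p)))) q))

    -- The square of the signed zeta matrix of P has alternating interval sums as entries, and the
    -- Euler relation makes them vanish off the diagonal.
    ω-involutive : ∀ j φ x → ρ x ≤ j → ω j (ω j φ) x ≡ φ x
    ω-involutive j φ x le = begin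
      ω j (ω j φ) x                                                                  ≡⟨ ω-alt j (ω j φ) x ⟩
      (∑[ y ] [ x ≤ᵇ y ] * (alt j y * ω j φ y))                                      ≡⟨ ∑-cong (λ y → trans (cong (λ z → [ x ≤ᵇ y ] * (alt j y * z)) (ω-alt j φ y)) (trans (sym (ℤₚ.*-assoc [ x ≤ᵇ y ] (alt j y) _)) (sym (∑-*ˡ ([ x ≤ᵇ y ] * alt j y) _)))) ⟩
      (∑[ y ] ∑[ z ] [ x ≤ᵇ y ] * alt j y * ([ y ≤ᵇ z ] * (alt j z * φ z)))          ≡⟨ ∑-swap _ ⟩
      (∑[ z ] ∑[ y ] [ x ≤ᵇ y ] * alt j y * ([ y ≤ᵇ z ] * (alt j z * φ z)))          ≡⟨ ∑-cong (λ z → trans (∑-cong (λ y → trans (rearr [ x ≤ᵇ y ] (alt j y) [ y ≤ᵇ z ] (alt j z * φ z)) (cong (λ b → b * alt j y * (alt j z * φ z)) (sym ([]-∧ (x ≤ᵇ y) (y ≤ᵇ z)))))) (∑-*ʳ (alt j z * φ z) _)) ⟩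
      (∑[ z ] (∑[ y ] [ (x ≤ᵇ y) ∧ (y ≤ᵇ z) ] * alt j y) * (alt j z * φ z))          ≡⟨ ∑-cong (λ z → inner z (ρ z ≤? j)) ⟩
      (∑[ z ] δ x z * (alt j x * (alt j z * φ z)))                                   ≡⟨ ∑-δ x (λ z → alt j x * (alt j z * φ z)) ⟩
      alt j x * (alt j x * φ x)                                                      ≡⟨ trans (sym (ℤₚ.*-assoc (alt j x) (alt j x) (φ x))) (trans (cong (_* φ x) square) (ℤₚ.*-identityˡ (φ x))) ⟩
      φ x ∎
      where
      open ≡-Reasoning
      rearr : ∀ a b c d → a * b * (c * d) ≡ a * c * b * d
      rearr = solve-∀
      four : ∀ a b → a * b * (a * b) ≡ a * a * (b * b)
      four = solve-∀
      square : alt j x * alt j x ≡ 1ℤ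
      square = trans (cong (λ t → t * t) (alt-below j x le)) (trans (four (sgn j) (sgn (ρ x))) (cong₂ _*_ (sgn-sq j) (sgn-sq (ρ x))))
      inner : ∀ z → Dec (ρ z ≤ j) → (∑[ y ] [ (x ≤ᵇ y) ∧ (y ≤ᵇ z) ] * alt j y) * (alt j z * φ z) ≡ δ x z * (alt j x * (alt j z * φ z))
      inner z (yes l) = trans (cong (_* (alt j z * φ z)) (interval-sum j x z l)) (ℤₚ.*-assoc (δ x z) (alt j x) _)
      inner z (no nl) = trans (cong (s *_) az) (trans (ℤₚ.*-zeroʳ s) (sym (trans (cong (λ w → δ x z * (alt j x * w)) az) (trans (cong (δ x z *_) (ℤₚ.*-zeroʳ (alt j x))) (ℤₚ.*-zeroʳ (δ x z))))))
        where
        s : ℤ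
        s = ∑[ y ] [ (x ≤ᵇ y) ∧ (y ≤ᵇ z) ] * alt j y
        az : alt j z * φ z ≡ 0ℤ
        az = trans (cong (_* φ z) (alt-above j z (ℕₚ.≰⇒> nl))) (ℤₚ.*-zeroˡ (φ z))

    𝔻-top : ∀ k φ x → ρ x ≡ k → 𝔻 k φ x ≡ 0ℤ
    𝔻-top k φ x e = trans (cong (_- φ x) (ω-top k φ x e)) (ℤₚ.+-inverseʳ (φ x))

    -- Put ψ = 𝔻 (k + 1) φ = ω φ - φ. Involutivity gives ω (k + 1) ψ = - ψ. Since ψ vanishes in rank
    -- k + 1, the defining recursion of ω gives ω k ψ = - ω (k + 1) ψ = ψ.
    𝔻𝔻 : ∀ k φ x → ρ x ≤ k → 𝔻 k (𝔻 (suc k) φ) x ≡ 0ℤ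
    𝔻𝔻 k φ x le = trans (lem (ω k ψ x) (rankSum (suc k) ψ x) (ψ x)) (trans (cong₂ (λ a b → a - (b + ψ x)) (rankSum-0 (suc k) (𝔻-top (suc k) φ) x) neg) (lem₂ (ψ x)))
      where
      ψ = 𝔻 (suc k) φ
      lem : ∀ w r p → w - p ≡ r - ((r - w) + p)
      lem = solve-∀
      lem₂ : ∀ p → 0ℤ - (- p + p) ≡ 0ℤ
      lem₂ = solve-∀
      lem₃ : ∀ a b → a - b ≡ - (b - a)
      lem₃ = solve-∀
      neg : ω (suc k) ψ x ≡ - ψ x
      neg = trans (ω-sub (suc k) (ω (suc k) φ) φ x) (trans (cong (_- ω (suc k) φ x) (ω-involutive (suc k) φ x (ℕₚ.m≤n⇒m≤1+n le))) (lem₃ (φ x) (ω (suc k) φ x)))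

    -- The flag polynomial fails to be a cd-polynomial by a term ending in b. With ψ = 𝔻 (k + 1) φ,
    -- the part of the next flag polynomial that ends in b comes from π φ - φ = 𝔻 (k + 2) φ + φ + ψ
    -- below the top rank. The induction hypothesis for φ contributes Ψ(ψ) b, and since ψ vanishes
    -- in rank k + 1 its own flag polynomial is Ψ(ψ)(a - b). Together with the part ending in a this
    -- leaves Ψ(ψ)(ab + ba) and the correction with 𝔻 (k + 2) φ.
    Ψ-cd : ∀ k φ u → Ψ (suc k) φ u ≡ evalCD (cd (suc k) φ) u + bpart (Ψ k (𝔻 (suc k) φ)) u
    -- The correction term vanishes with 𝔻 k ψ. By `𝔻𝔻` this applies to the functions that accompany
    -- the letter d.
    evalCD-cd : ∀ k ψ → (∀ x → ρ x ≤ k → 𝔻 k ψ x ≡ 0ℤ) → ∀ u → evalCD (cd k ψ) u ≡ Ψ k ψ u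

    Ψ-cd zero φ [] = lem (φ 𝟎)
      where
      lem : ∀ a → 0ℤ ≡ a * 0ℤ + 0ℤ + 0ℤ
      lem = solve-∀
    Ψ-cd zero φ (l ∷ []) = go l
      where
      lemA : ∀ a → a ≡ a * 1ℤ + 0ℤ + 0ℤ
      lemA = solve-∀
      lemB : ∀ p a → p - a ≡ a * 1ℤ + 0ℤ + (p - a - a)
      lemB = solve-∀
      go : ∀ l → Ψ 1 φ (l ∷ []) ≡ φ 𝟎 * 1ℤ + 0ℤ + bpart (Ψ 0 (𝔻 1 φ)) (l ∷ [])
      go 𝐚 = lemA (φ 𝟎)
      go 𝐛 = trans (lemB (π 1 φ 𝟎) (φ 𝟎)) (cong₂ (λ p w → φ 𝟎 * 1ℤ + 0ℤ + (p - w - φ 𝟎)) (π≡rankSum 1 φ 𝟎 (s≤s (ℕₚ.≤-reflexive ρ𝟎))) (sym (ω-top 0 φ 𝟎 ρ𝟎)))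
    Ψ-cd zero φ (𝐚 ∷ _ ∷ u) = sym (trans (ℤₚ.+-identityʳ _) (trans (ℤₚ.+-identityʳ _) (ℤₚ.*-zeroʳ (φ 𝟎))))
    Ψ-cd zero φ (𝐛 ∷ _ ∷ u) = sym (trans (ℤₚ.+-identityʳ _) (trans (ℤₚ.+-identityʳ _) (ℤₚ.*-zeroʳ (φ 𝟎))))
    Ψ-cd (suc k) φ u = trans (go u) (cong (_+ bpart (Ψ (suc k) (𝔻 (suc (suc k)) φ)) u) (sym (evalCD-++ (map (λ p → proj₁ p , 𝐜 ∷ proj₂ p) (cd (suc k) φ)) (prefix𝐝 (cd k ψ)) u)))
      where
      open ≡-Reasoning
      ψ = 𝔻 (suc k) φ
      c-part d-part : List AB → ℤ
      c-part = evalCD (map (λ p → proj₁ p , 𝐜 ∷ proj₂ p) (cd (suc k) φ))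
      d-part = evalCD (prefix𝐝 (cd k ψ))
      cdψ : ∀ u → evalCD (cd k ψ) u ≡ Ψ k ψ u
      cdψ = evalCD-cd k ψ (𝔻𝔻 k φ)
      go : ∀ u → Ψ (suc (suc k)) φ u ≡ c-part u + d-part u + bpart (Ψ (suc k) (𝔻 (suc (suc k)) φ)) u
      go [] = sym (trans (ℤₚ.+-identityʳ _) (cong₂ _+_ (evalCD-𝐜-[] (cd (suc k) φ)) (evalCD-0 (cd k ψ) [] (λ v → refl))))
      go (𝐚 ∷ u) = begin
        Ψ (suc k) φ u                                                  ≡⟨ Ψ-cd k φ u ⟩
        evalCD (cd (suc k) φ) u + bpart (Ψ k ψ) u                      ≡⟨ cong₂ _+_ (sym (evalCD-𝐜 (cd (suc k) φ) 𝐚 u)) (sym (trans (evalCD-𝐝-𝐚 (cd k ψ) u) (bpart-cong cdψ u))) ⟩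
        c-part (𝐚 ∷ u) + d-part (𝐚 ∷ u)                                ≡⟨ sym (ℤₚ.+-identityʳ _) ⟩
        c-part (𝐚 ∷ u) + d-part (𝐚 ∷ u) + 0ℤ ∎
      go (𝐛 ∷ u) = begin
        Ψ (suc k) (λ x → π (suc (suc k)) φ x - φ x) u
          ≡⟨ Ψ-cong (suc k) (λ x le → trans (cong (_- φ x) (π≡rankSum (suc (suc k)) φ x (s≤s le))) (split (rankSum (suc (suc k)) φ x) (ω (suc k) φ x) (φ x))) u ⟩
        Ψ (suc k) (λ x → (𝔻 (suc (suc k)) φ x - (0ℤ - φ x)) - (0ℤ - ψ x)) u
          ≡⟨ trans (Ψ-sub (suc k) _ _ u) (cong₂ _-_ (trans (Ψ-sub (suc k) _ _ u) (cong (λ z → Ψ (suc k) (𝔻 (suc (suc k)) φ) u - z) (trans (Ψ-sub (suc k) _ _ u) (cong (_- Ψ (suc k) φ u) (Ψ-0 (suc k) (λ _ _ → refl) u))))) (trans (Ψ-sub (suc k) _ _ u) (cong (_- Ψ (suc k) ψ u) (Ψ-0 (suc k) (λ _ _ → refl) u)))) ⟩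
        Ψ (suc k) (𝔻 (suc (suc k)) φ) u - (0ℤ - Ψ (suc k) φ u) - (0ℤ - Ψ (suc k) ψ u)
          ≡⟨ cong₂ (λ a b → Ψ (suc k) (𝔻 (suc (suc k)) φ) u - (0ℤ - a) - (0ℤ - b)) (Ψ-cd k φ u) (Ψ-top k ψ (𝔻-top (suc k) φ) u) ⟩
        Ψ (suc k) (𝔻 (suc (suc k)) φ) u - (0ℤ - (evalCD (cd (suc k) φ) u + bpart (Ψ k ψ) u)) - (0ℤ - (apart (Ψ k ψ) u - bpart (Ψ k ψ) u))
          ≡⟨ regroup (Ψ (suc k) (𝔻 (suc (suc k)) φ) u) (evalCD (cd (suc k) φ) u) (bpart (Ψ k ψ) u) (apart (Ψ k ψ) u) ⟩
        evalCD (cd (suc k) φ) u + apart (Ψ k ψ) u + Ψ (suc k) (𝔻 (suc (suc k)) φ) u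
          ≡⟨ cong₂ (λ a b → a + b + Ψ (suc k) (𝔻 (suc (suc k)) φ) u) (sym (evalCD-𝐜 (cd (suc k) φ) 𝐛 u)) (sym (trans (evalCD-𝐝-𝐛 (cd k ψ) u) (apart-cong cdψ u))) ⟩
        c-part (𝐛 ∷ u) + d-part (𝐛 ∷ u) + Ψ (suc k) (𝔻 (suc (suc k)) φ) u ∎
        where
        split : ∀ r w p → r - p ≡ ((r - w - p) - (0ℤ - p)) - (0ℤ - (w - p))
        split = solve-∀
        regroup : ∀ d e b a → d - (0ℤ - (e + b)) - (0ℤ - (a - b)) ≡ e + a + d
        regroup = solve-∀

    evalCD-cd zero ψ e []      = trans (ℤₚ.+-identityʳ _) (ℤₚ.*-identityʳ (ψ 𝟎))
    evalCD-cd zero ψ e (_ ∷ _) = trans (ℤₚ.+-identityʳ _) (ℤₚ.*-zeroʳ (ψ 𝟎))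
    evalCD-cd (suc k) ψ e u = sym (trans (Ψ-cd k ψ u) (trans (cong (evalCD (cd (suc k) ψ) u +_) (trans (bpart-cong (Ψ-0 k (λ x le → e x (ℕₚ.m≤n⇒m≤1+n le))) u) (bpart-0 u))) (ℤₚ.+-identityʳ _)))

-- Nonnegativity

Nonneg : CDPoly → Set
Nonneg = All (λ p → 0ℤ ≤ℤ proj₁ p)

coeff-nonneg : ∀ {p} → Nonneg p → ∀ w → 0ℤ ≤ℤ coeffCD p w
coeff-nonneg []                  w = ℤₚ.≤-refl
coeff-nonneg (_∷_ {c , v} h hs) w = ℤₚ.+-mono-≤ (pos (eqWord eqCD v w)) (coeff-nonneg hs w)
  where
  pos : ∀ b → 0ℤ ≤ℤ (if b then c else 0ℤ)
  pos true  = h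
  pos false = ℤₚ.≤-refl

module Positivity (F : OrderedField) {N : ℕ} (P : PosetData N) (n : ℕ) (graded : IsGradedPoset P n)
  (C : CellStructures.CellStructure F P n graded) where
  open OrderedField F using (fromℤ; fromℤ-inj)
  open LinAlg F using (fromℕ)
  open GradedPoset P n graded
  open Sheaves F P n graded C
  open Derive F P n graded C
  open CDIndices P n graded
  open Transfer F P

  -- Agreement with a dimension function is asked for only up to rank k, because the dimensions of a
  -- derived sheaf are known only in a bounded range of ranks.
  Represented : ℕ → (Fin N → ℤ) → Set
  Represented k φ = Σ Sheaf λ S → Sheaf.CM S k × (∀ x → ρ x ≤ k → fromℤ (φ x) ≡ fromℕ (Sheaf.f S x))

  cd-nonneg : ∀ k φ → Represented k φ → Nonneg (cd k φ)
  cd-nonneg zero φ (S , _ , e) = subst (0ℤ ≤ℤ_) (sym (fromℤ-inj (e 𝟎 (ℕₚ.≤-reflexive ρ𝟎)))) (ℤ.+≤+ z≤n) ∷ []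
  cd-nonneg (suc zero) φ (S , _ , e) = subst (0ℤ ≤ℤ_) (sym (fromℤ-inj (e 𝟎 (subst (_≤ 1) (sym ρ𝟎) z≤n)))) (ℤ.+≤+ z≤n) ∷ []
  cd-nonneg (suc (suc k)) φ (S , cm , e) = Allₚ.++⁺
      (Allₚ.map⁺ (cd-nonneg (suc k) φ (S , (λ x j lt → cm x j (ℕₚ.m<n⇒m<1+n lt)) , λ x le → e x (ℕₚ.m≤n⇒m≤1+n le))))
      (Allₚ.map⁺ (cd-nonneg k (𝔻 (suc k) φ) (proj₁ E , proj₁ (proj₂ E) , λ x le → trans (fromℤ-sub (Omega.ω ℤring P (suc k) φ x) (φ x)) (trans (cong₂ (OrderedField._-_ F)
        (fromℤ-ω (suc k) (λ y le' → e y (ℕₚ.m≤n⇒m≤1+n le')) x) (e x (ℕₚ.≤-trans le (ℕₚ.m≤n+m k 2))))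
        (sym (proj₂ (proj₂ E) x (ℕₚ.m≤n⇒m≤1+n le)))))))
    where
    E = derive S cm k (ℕₚ.n<1+n (suc k))

-- The two summands of the cd-index

module Indices (F : OrderedField) {N : ℕ} (P : PosetData N) (m : ℕ) (B : Fin N → Bool)
  (graded : IsGradedPoset P (suc m)) (boundary : IsDownClosedOfRank P B m)
  (near : IsNearGorenstein (OrderComplex P (fullSet P)) (OrderComplex P B) (suc m)) where
  open OrderedField F using (fromℤ; fromℤ-inj; 0-homo)
  open GradedPoset P (suc m) graded
  open NearGorenstein F P m B graded boundary near
  open Flags P (suc m) graded
  open CDIndices P (suc m) graded
  open Transfer F P
  open Positivity F P (suc m) graded cells
  open Omega ℤring P

  indicator : (Fin N → Bool) → Fin N → ℤ
  indicator Q x = [ Q x ]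

  fromℤ-⟦⟧ : ∀ b → fromℤ [ b ] ≡ fromℤ (ℤ.+ ⟦ b ⟧)
  fromℤ-⟦⟧ true  = refl
  fromℤ-⟦⟧ false = refl

  euler : ∀ x z → x ≺ z → (∑[ y ] [ (x ≤ᵇ y) ∧ (y ≤ᵇ z) ] * sgn (ρ y)) ≡ 0ℤ
  euler x z l = trans (∑-cong (λ y → term y (y ≤ᵇ z) refl)) (trans (∑-*ˡ (sgn (ρ z)) _) (trans (cong (sgn (ρ z) *_) (trans (sym (ω-alt (ρ z) φ x)) ω≡0)) (ℤₚ.*-zeroʳ (sgn (ρ z)))))
    where
    φ : Fin N → ℤ
    φ y = [ y ≤ᵇ z ]
    ω≡0 : ω (ρ z) φ x ≡ 0ℤ
    ω≡0 = fromℤ-inj (trans (fromℤ-ω (ρ z) (λ y _ → fromℤ-⟦⟧ (y ≤ᵇ z)) x) (trans (ω-interval x z l) (sym 0-homo)))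
    term : ∀ y b → (y ≤ᵇ z) ≡ b → [ (x ≤ᵇ y) ∧ b ] * sgn (ρ y) ≡ sgn (ρ z) * ([ x ≤ᵇ y ] * (alt (ρ z) y * [ b ]))
    term y false q = trans (cong (λ b → [ b ] * sgn (ρ y)) (Boolₚ.∧-zeroʳ (x ≤ᵇ y))) (zeros (sgn (ρ y)) (sgn (ρ z)) [ x ≤ᵇ y ] (alt (ρ z) y))
      where
      zeros : ∀ s t a b → 0ℤ * s ≡ t * (a * (b * 0ℤ))
      zeros = solve-∀
    term y true  q = trans (cong (λ b → [ b ] * sgn (ρ y)) (Boolₚ.∧-identityʳ (x ≤ᵇ y))) (sym (trans (cong (λ a → sgn (ρ z) * ([ x ≤ᵇ y ] * (a * 1ℤ))) (alt-below (ρ z) y (ρ-mono-≼ q)))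
        (trans (ones (sgn (ρ z)) [ x ≤ᵇ y ] (sgn (ρ y))) (trans (cong (_* ([ x ≤ᵇ y ] * sgn (ρ y))) (sgn-sq (ρ z))) (ℤₚ.*-identityˡ ([ x ≤ᵇ y ] * sgn (ρ y)))))))
      where
      ones : ∀ t a s → t * (a * (t * s * 1ℤ)) ≡ t * t * (a * s)
      ones = solve-∀

  ωB : ∀ x → ω m (indicator B) x ≡ [ B x ]
  ωB x = fromℤ-inj (trans (fromℤ-ω m (λ y _ → fromℤ-⟦⟧ (B y)) x) (trans (ω-B x) (sym (fromℤ-[] (B x)))))

  ωfull : ∀ x → ω (suc m) (indicator full) x ≡ [ interiorᵇ x ]
  ωfull x = fromℤ-inj (trans (fromℤ-ω (suc m) (λ y _ → fromℤ-⟦⟧ (full y)) x) (trans (ω-full x) (sym (fromℤ-[] (interiorᵇ x)))))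

  no-top-B : ∀ x → ρ x ≡ suc m → indicator B x ≡ 0ℤ
  no-top-B x e = go (B x) refl
    where
    go : ∀ b → B x ≡ b → [ b ] ≡ 0ℤ
    go true  bx = ⊥-elim (ℕₚ.1+n≰n (subst (_≤ m) e (B-rank bx)))
    go false _  = refl

  interior≡ : ∀ x → indicator interiorᵇ x ≡ indicator full x - indicator B x
  interior≡ x = go (B x)
    where
    go : ∀ b → [ not b ] ≡ 1ℤ - [ b ]
    go true  = refl
    go false = refl

  𝔻B : ∀ x → 𝔻 m (indicator B) x ≡ 0ℤ
  𝔻B x = trans (cong (_- [ B x ]) (ωB x)) (ℤₚ.+-inverseʳ [ B x ])

  -- The interior indicator is 1 minus that of ∂P. Here ω (m + 1) sends 1 to the interior indicator,
  -- and it sends the indicator of ∂P to minus that indicator, because ∂P has no elements of rank m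
  -- + 1 and ω m fixes it. The sum is 1, and subtracting the interior indicator leaves that of ∂P.
  𝔻interior : ∀ x → 𝔻 (suc m) (indicator interiorᵇ) x ≡ indicator B x
  𝔻interior x = trans (cong (_- [ interiorᵇ x ]) (trans (ω-cong (suc m) (λ y _ → interior≡ y) x) (trans (ω-sub (suc m) (indicator full) (indicator B) x)
      (cong₂ _-_ (ωfull x) (cong₂ _-_ (rankSum-0 (suc m) no-top-B x) (ωB x)))))) (lem [ interiorᵇ x ] [ B x ])
    where
    lem : ∀ i b → i - (0ℤ - b) - i ≡ b
    lem = solve-∀

  Φ g : CDPoly
  Φ = cd (suc m) (indicator interiorᵇ)
  g = cd m (indicator B)

  evalCD-g : ∀ u → evalCD g u ≡ Ψ m (indicator B) u
  evalCD-g = evalCD-cd euler m (indicator B) (λ x _ → 𝔻B x)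

  -- For the interior indicator `Ψ-cd` has the correction Ψ(∂P) b. On the other side the flag
  -- polynomial of the interior is that of P minus that of the indicator of ∂P in rank m + 1, which
  -- is Ψ(∂P)(a - b). The terms ending in b cancel and Ψ(∂P) a remains.
  evalCD-Φ : ∀ u → evalCD Φ u ≡ Ψ (suc m) (indicator full) u - apart (Ψ m (indicator B)) u
  evalCD-Φ u = begin
    evalCD Φ u                                                  ≡⟨ add (evalCD Φ u) (apart ΨB u) (bpart ΨB u) ⟩
    evalCD Φ u + bpart ΨB u + (apart ΨB u - bpart ΨB u) - apart ΨB u
      ≡⟨ cong₂ (λ a b → a + b - apart ΨB u) (trans (cong (evalCD Φ u +_) (sym (bpart-cong (Ψ-cong m (λ x _ → 𝔻interior x)) u))) (sym (Ψ-cd euler m (indicator interiorᵇ) u))) (sym (Ψ-top m (indicator B) no-top-B u)) ⟩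
    Ψ (suc m) (indicator interiorᵇ) u + Ψ (suc m) (indicator B) u - apart ΨB u
      ≡⟨ cong (λ a → a + Ψ (suc m) (indicator B) u - apart ΨB u) (trans (Ψ-cong (suc m) (λ x _ → interior≡ x) u) (Ψ-sub (suc m) (indicator full) (indicator B) u)) ⟩
    Ψ (suc m) (indicator full) u - Ψ (suc m) (indicator B) u + Ψ (suc m) (indicator B) u - apart ΨB u
      ≡⟨ cancel (Ψ (suc m) (indicator full) u) (Ψ (suc m) (indicator B) u) (apart ΨB u) ⟩
    Ψ (suc m) (indicator full) u - apart ΨB u ∎
    where
    open ≡-Reasoning
    ΨB : List AB → ℤ
    ΨB = Ψ m (indicator B)
    add : ∀ e a b → e ≡ e + b + (a - b) - a
    add = solve-∀
    cancel : ∀ p q a → p - q + q - a ≡ p - a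
    cancel = solve-∀

  coeff-B : ∀ u → coeffAB (abIndex P B m) (reverse u) ≡ Ψ m (indicator B) u
  coeff-B = abIndex-Ψ B m B𝟎 downB B-rank

  coeff-Ba : ∀ u → coeffAB (abIndex P B m ⊗ aPoly) (reverse u) ≡ apart (Ψ m (indicator B)) u
  coeff-Ba []      = coeff-⊗a-[] (abIndex P B m)
  coeff-Ba (l ∷ u) = trans (cong (coeffAB (abIndex P B m ⊗ aPoly)) (Listₚ.unfold-reverse l u)) (trans (coeff-⊗a (abIndex P B m) (reverse u) l) (go l))
    where
    go : ∀ l → (if eqAB 𝐚 l then coeffAB (abIndex P B m) (reverse u) else 0ℤ) ≡ apart (Ψ m (indicator B)) (l ∷ u)
    go 𝐚 = coeff-B u
    go 𝐛 = refl

  expand-mirror : ∀ f p → (∀ u → evalCD f u ≡ coeffAB p (reverse u)) → expandCD (mirror f) ≈ₚ p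
  expand-mirror f p e w = begin
    coeffAB (expandCD (mirror f)) w                ≡⟨ coeff-expandCD (mirror f) w ⟩
    evalCD (mirror f) w                            ≡⟨ cong (evalCD (mirror f)) (sym (Listₚ.reverse-involutive w)) ⟩
    evalCD (mirror f) (reverse (reverse w))        ≡⟨ evalCD-mirror f (reverse w) ⟩
    evalCD f (reverse w)                           ≡⟨ e (reverse w) ⟩
    coeffAB p (reverse (reverse w))                ≡⟨ cong (coeffAB p) (Listₚ.reverse-involutive w) ⟩
    coeffAB p w ∎
    where open ≡-Reasoning

  expand-g : expandCD (mirror g) ≈ₚ abIndex P B m
  expand-g = expand-mirror g (abIndex P B m) (λ u → trans (evalCD-g u) (sym (coeff-B u)))

  expand-Φ : expandCD (mirror Φ) ≈ₚ (abIndex P full (suc m) ⊕ (⊖ (abIndex P B m ⊗ aPoly)))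
  expand-Φ = expand-mirror Φ (abIndex P full (suc m) ⊕ (⊖ (abIndex P B m ⊗ aPoly))) (λ u → trans (evalCD-Φ u) (sym (trans (coeff-++ (abIndex P full (suc m)) (⊖ (abIndex P B m ⊗ aPoly)) (reverse u))
    (cong₂ _+_ (abIndex-Ψ full (suc m) refl (λ _ _ → refl) (λ {x} _ → ρ≤n x) u) (trans (coeff-⊖ (abIndex P B m ⊗ aPoly) (reverse u)) (cong -_ (coeff-Ba u)))))))

  nonneg : Nonneg (mirror Φ ++ mirror g)
  nonneg = Allₚ.++⁺
    (Allₚ.map⁺ (cd-nonneg (suc m) (indicator interiorᵇ) (InteriorSheaf.constant , interior-CM , λ x _ → fromℤ-⟦⟧ (interiorᵇ x))))
    (Allₚ.map⁺ (cd-nonneg m (indicator B) (BoundarySheaf.constant , boundary-CM , λ x _ → fromℤ-⟦⟧ (B x))))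

-- The ordered field of rational numbers

private
  fromℤ : ℤ → ℚ.ℚ
  fromℤ i = ℚ.mkℚ i 0 (Coprime.sym (Coprime.1-coprimeTo ℤ.∣ i ∣))

  fromℤ-+ : ∀ i j → fromℤ (i ℤ.+ j) ≡ fromℤ i ℚ.+ fromℤ j
  fromℤ-+ i j = ℚₚ.toℚᵘ-injective (ℚᵘₚ.≃-trans (ℚᵘ.*≡* (cong (ℤ._* 1ℤ) (sym (cong₂ ℤ._+_ (ℤₚ.*-identityʳ i) (ℤₚ.*-identityʳ j))))) (ℚᵘₚ.≃-sym (ℚₚ.toℚᵘ-homo-+ (fromℤ i) (fromℤ j))))

  fromℤ-* : ∀ i j → fromℤ (i ℤ.* j) ≡ fromℤ i ℚ.* fromℤ j
  fromℤ-* i j = ℚₚ.toℚᵘ-injective (ℚᵘₚ.≃-sym (ℚₚ.toℚᵘ-homo-* (fromℤ i) (fromℤ j)))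

  fromℤ-neg : ∀ i → fromℤ (ℤ.- i) ≡ ℚ.- fromℤ i
  fromℤ-neg i = ℚₚ.toℚᵘ-injective (ℚᵘₚ.≃-sym (ℚₚ.toℚᵘ-homo‿- (fromℤ i)))

  reciprocal : ℚ.ℚ → ℚ.ℚ
  reciprocal p = go (p ℚₚ.≟ ℚ.0ℚ)
    where
    go : Dec (p ≡ ℚ.0ℚ) → ℚ.ℚ
    -- A total inverse is wanted, so 0 is sent to 0; the inverse law speaks only of non-zero
    -- elements.
    go (yes _) = ℚ.0ℚ
    go (no ne) = ℚ.1/_ p {{ℚ.≢-nonZero ne}}

  reciprocal-inverse : ∀ p → p ≢ ℚ.0ℚ → p ℚ.* reciprocal p ≡ ℚ.1ℚ
  reciprocal-inverse p ne with p ℚₚ.≟ ℚ.0ℚ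
  ... | yes e  = ⊥-elim (ne e)
  ... | no ne' = ℚₚ.*-inverseʳ p {{ℚ.≢-nonZero ne'}}

  *-nonneg : ∀ {p q} → ℚ.0ℚ ℚ.≤ p → ℚ.0ℚ ℚ.≤ q → ℚ.0ℚ ℚ.≤ p ℚ.* q
  *-nonneg {p} {q} hp hq = subst (ℚ._≤ p ℚ.* q) (ℚₚ.*-zeroʳ p) (ℚₚ.*-monoˡ-≤-nonNeg p {{ℚ.nonNegative hp}} hq)

  total : ∀ p → (ℚ.0ℚ ℚ.≤ p) ⊎ (ℚ.0ℚ ℚ.≤ ℚ.- p)
  total p with ℚₚ.≤-total ℚ.0ℚ p
  ... | inj₁ h = inj₁ h
  ... | inj₂ h = inj₂ (ℚₚ.neg-antimono-≤ h)

  square-nonneg : ∀ p → ℚ.0ℚ ℚ.≤ p ℚ.* p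
  square-nonneg p with total p
  ... | inj₁ h = *-nonneg h h
  ... | inj₂ h = subst (ℚ.0ℚ ℚ.≤_) (trans (sym (ℚₚ.neg-distribˡ-* p (ℚ.- p))) (trans (cong ℚ.-_ (sym (ℚₚ.neg-distribʳ-* p p))) (Algebra.Properties.Group.⁻¹-involutive ℚₚ.+-0-group _))) (*-nonneg h h)

rationals : OrderedField
rationals = record
  { ring = record
    { K = ℚ.ℚ ; _+_ = ℚ._+_ ; _*_ = ℚ._*_ ; -_ = ℚ.-_ ; 0# = ℚ.0ℚ ; 1# = ℚ.1ℚ
    ; isCommutativeRing = ℚₚ.+-*-isCommutativeRing
    ; fromℤ = fromℤ ; +-homo = fromℤ-+ ; *-homo = fromℤ-* ; -‿homo = fromℤ-neg ; 0-homo = refl ; 1-homo = refl }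
  ; _≟K_ = ℚₚ._≟_
  ; inv = reciprocal
  ; inverse = reciprocal-inverse
  ; fromℤ-inj = cong ℚ.ℚ.numerator
  ; NN = ℚ.0ℚ ℚ.≤_
  ; NN-sq = square-nonneg
  ; NN-+ = ℚₚ.+-mono-≤
  ; NN-* = *-nonneg
  ; NN-total = total
  ; NN-anti = λ {x} h h' → ℚₚ.≤-antisym (subst (ℚ._≤ ℚ.0ℚ) (Algebra.Properties.Group.⁻¹-involutive ℚₚ.+-0-group x) (ℚₚ.neg-antimono-≤ h')) h
  }

theorem2p5 : {N : ℕ} (P : PosetData N) (m : ℕ) (B : Fin N → Bool) →
  IsGradedPoset P (suc m) →
  IsDownClosedOfRank P B m →
  IsNearGorenstein (OrderComplex P (fullSet P)) (OrderComplex P B) (suc m) →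
  Σ CDPoly λ f → Σ CDPoly λ g →
    (expandCD f ≈ₚ (abIndex P (fullSet P) (suc m) ⊕ (⊖ (abIndex P B m ⊗ aPoly)))) ×
    (expandCD g ≈ₚ abIndex P B m) ×
    ((w : List CD) → 0ℤ ≤ℤ coeffCD (f ++ g) w)
theorem2p5 P m B graded boundary near = mirror Φ , mirror g , expand-Φ , expand-g , coeff-nonneg nonneg
  where open Indices rationals P m B graded boundary near
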